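{- Let $p$ be a prime, let $F$ be an algebraic field extension of $\mathbb{F}_p$, let $S=\{s_1,\dots,s_\nu\}$ be a finite set of irreducible elements of $\mathbb{F}_p[z]$ which remain irreducible in $F[z]$, and let $R=F[z,s_1^{ -1},\dots,s_\nu^{ -1}]\subseteq F(z)$. Assume that the $\mathcal{L}_p$-theory of the field $F$ is decidable. Then the $\mathcal{L}_p(z)^e$-theory of $R$ is decidable.
   Context: $\mathcal{L}_p=\{+,\ x\mapsto x^p,\ =,\ 0,\ 1\}$, with $+$ interpreted as addition, $x\mapsto x^p$ as the Frobenius map, and constants $0,1$; the field $F$ is regarded as an $\mathcal{L}_p$-structure in the obvious way. $\mathcal{L}_p(z)=\mathcal{L}_p\cup\{\,\in F,\ x\mapsto zx\}$, where $x\mapsto zx$ is a unary function symbol interpreted as multiplication by $z$ and $\in F$ is a unary predicate interpreted as membership in $F$. $\mathcal{L}_p(z)^e$ is the extension of $\mathcal{L}_p(z)$ by predicate symbols $P_\sigma$, one for each $\mathcal{L}_p$-formula $\sigma(a_1,\dots,a_n)$ (all free variables of $\sigma$ being among $a_1,\dots,a_n$); $P_\sigma$ is interpreted in $R$ as the $n$-ary relation "$a_1,\dots,a_n\in F$ and $\sigma(a_1,\dots,a_n)$ is true in the $\mathcal{L}_p$-structure $F$". The ring $R$ is regarded as an $\mathcal{L}_p(z)^e$-structure with these interpretations. -}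

module Defs where

open import Algebra.Apartness.Bundles using (HeytingField; HeytingCommutativeRing)
open import Algebra.Bundles using (CommutativeRing)
open import Algebra.Bundles.Raw using (RawRing; RawSemiring)
import Algebra.Definitions.RawSemiring as RawSemiringDefs
open import Algebra.Morphism.Structures using (module RingMorphisms)
import Algebra.Properties.Ring as RingProperties
open import Data.Empty.Polymorphic using (⊥)
open import Data.Fin.Base using (Fin)
import Data.Integer.Base as ℤ
import Data.Integer.Divisibility as ℤ
open import Data.List.Base as List using (List; []; _∷_)
open import Data.List.Membership.Propositional using (_∈_)
open import Data.Nat.Base using (ℕ; zero; suc)
open import Data.Product.Base using (Σ; _×_; _,_; proj₁; proj₂; ∃-syntax)
open import Data.Vec.Base as Vec using (Vec; []; _∷_)
open import Data.Vec.Relation.Binary.Pointwise.Inductive using (Pointwise)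
open import Level using (Level; Lift; _⊔_; 0ℓ) renaming (suc to lsuc)
open import Relation.Binary.Core using (Rel)
open import Relation.Nullary.Decidable.Core using (Dec)
open import Relation.Nullary.Negation.Core using (¬_; contradiction)

private variable
  n : ℕ

------------------------------------------------------------------------
-- First-order logic

record Language : Set₁ where
  field
    Fun : ℕ → Set
    Pred : ℕ → Set

-- `var i` is the i-th of the n available variables.
data Term (L : Language) (n : ℕ) : Set where
  var : Fin n → Term L n
  app : ∀ {k} → Language.Fun L k → Vec (Term L n) k → Term L n

-- Formulas with all free variables among the first n.  In `all` the bound
-- variable has index zero.  The calculus is classical, so ⊥, → and ∀ form
-- a complete set of connectives; the remaining ones are the abbreviations
-- below.
data Formula (L : Language) (n : ℕ) : Set where
  bot  : Formula L n
  _≐_  : Term L n → Term L n → Formula L n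
  pred : ∀ {k} → Language.Pred L k → Vec (Term L n) k → Formula L n
  _⇒_  : Formula L n → Formula L n → Formula L n
  all  : Formula L (suc n) → Formula L n

infix  6 _≐_
infixr 4 _⇒_

not : ∀ {L} → Formula L n → Formula L n
not φ = φ ⇒ bot

_and_ : ∀ {L} → Formula L n → Formula L n → Formula L n
φ and ψ = not (φ ⇒ not ψ)

_or_ : ∀ {L} → Formula L n → Formula L n → Formula L n
φ or ψ = not φ ⇒ ψ

ex : ∀ {L} → Formula L (suc n) → Formula L n
ex φ = not (all (not φ))

Sentence : Language → Set
Sentence L = Formula L 0

-- The underlying set is a setoid; _≈_ interprets the symbol =.
record Structure (L : Language) c ℓ r : Set (lsuc (c ⊔ ℓ ⊔ r)) where
  open Language L
  field
    Carrier : Set c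
    _≈_     : Rel Carrier ℓ
    ⟦_⟧ᶠ    : ∀ {k} → Fun k → Vec Carrier k → Carrier
    ⟦_⟧ᵖ    : ∀ {k} → Pred k → Vec Carrier k → Set r

module _ {L : Language} {c ℓ r : Level} (M : Structure L c ℓ r) where
  open Structure M

  mutual
    evalTerm : Vec Carrier n → Term L n → Carrier
    evalTerm ρ (var i)    = Vec.lookup ρ i
    evalTerm ρ (app f ts) = ⟦ f ⟧ᶠ (evalTerms ρ ts)

    evalTerms : ∀ {k} → Vec Carrier n → Vec (Term L n) k → Vec Carrier k
    evalTerms ρ []       = []
    evalTerms ρ (t ∷ ts) = evalTerm ρ t ∷ evalTerms ρ ts

  Satisfies : Formula L n → Vec Carrier n → Set (c ⊔ ℓ ⊔ r)
  Satisfies bot         ρ = ⊥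
  Satisfies (s ≐ t)     ρ = Lift (c ⊔ r) (evalTerm ρ s ≈ evalTerm ρ t)
  Satisfies (pred P ts) ρ = Lift (c ⊔ ℓ) (⟦ P ⟧ᵖ (evalTerms ρ ts))
  Satisfies (φ ⇒ ψ)     ρ = Satisfies φ ρ → Satisfies ψ ρ
  Satisfies (all φ)     ρ = ∀ a → Satisfies φ (a ∷ ρ)

  _⊨_ : Sentence L → Set (c ⊔ ℓ ⊔ r)
  _⊨_ σ = Satisfies σ []

  -- Decidability in the sense of type theory: a function that computes, from
  -- each sentence, whether it is true in M.
  DecidableTheory : Set (c ⊔ ℓ ⊔ r)
  DecidableTheory = ∀ σ → Dec (_⊨_ σ)

------------------------------------------------------------------------
-- The languages.  Equality is a logical symbol.

data Funₚ : ℕ → Set where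
  zeroₚ oneₚ : Funₚ 0
  plusₚ      : Funₚ 2
  frobₚ      : Funₚ 1

data NoPred : ℕ → Set where

ℒₚ : Language
ℒₚ = record { Fun = Funₚ ; Pred = NoPred }

data Funz : ℕ → Set where
  base   : ∀ {k} → Funₚ k → Funz k
  timesz : Funz 1

data Predz : ℕ → Set where
  inF : Predz 1

ℒₚz : Language
ℒₚz = record { Fun = Funz ; Pred = Predz }

data Predzᵉ : ℕ → Set where
  base : ∀ {k} → Predz k → Predzᵉ k
  P    : ∀ {k} → Formula ℒₚ k → Predzᵉ k

ℒₚzᵉ : Language
ℒₚzᵉ = record { Fun = Funz ; Pred = Predzᵉ }

------------------------------------------------------------------------
-- Polynomials in one variable

-- A polynomial is its list of coefficients, constant term first, up to
-- trailing zeros.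
module Polynomial {c ℓ} (A : RawSemiring c ℓ) where
  private module A = RawSemiring A

  Poly : Set c
  Poly = List A.Carrier

  coeff : Poly → ℕ → A.Carrier
  coeff []      _       = A.0#
  coeff (a ∷ f) zero    = a
  coeff (a ∷ f) (suc n) = coeff f n

  infix  4 _≈_
  infixl 6 _+_
  infixl 7 _*_

  _≈_ : Rel Poly ℓ
  f ≈ g = ∀ n → coeff f n A.≈ coeff g n

  _+_ : Poly → Poly → Poly
  []      + g       = g
  (a ∷ f) + []      = a ∷ f
  (a ∷ f) + (b ∷ g) = (a A.+ b) ∷ (f + g)

  scale : A.Carrier → Poly → Poly
  scale a = List.map (a A.*_)

  _*_ : Poly → Poly → Poly
  []      * g = []
  (a ∷ f) * g = scale a g + (A.0# ∷ f * g)

  const : A.Carrier → Poly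
  const a = a ∷ []

  X : Poly
  X = A.0# ∷ A.1# ∷ []

  rawSemiring : RawSemiring c ℓ
  rawSemiring = record
    { Carrier = Poly ; _≈_ = _≈_ ; _+_ = _+_ ; _*_ = _*_
    ; 0# = [] ; 1# = const A.1# }

  open RawSemiringDefs rawSemiring public using (Irreducible)

  eval : Poly → A.Carrier → A.Carrier
  eval []      x = A.0#
  eval (a ∷ f) x = a A.+ x A.* eval f x

------------------------------------------------------------------------
-- The prime field

-- ℤ with congruence modulo p as its equality.
𝔽 : ℕ → RawRing 0ℓ 0ℓ
𝔽 p = record
  { Carrier = ℤ.ℤ
  ; _≈_ = λ i j → ℤ.+ p ℤ.∣ (i ℤ.- j)
  ; _+_ = ℤ._+_ ; _*_ = ℤ._*_ ; -_ = ℤ.-_ ; 0# = ℤ.0ℤ ; 1# = ℤ.1ℤ }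

module 𝔽[z] (p : ℕ) = Polynomial (RawRing.rawSemiring (𝔽 p))

------------------------------------------------------------------------
-- F as an extension of 𝔽 p, and the ring R

-- A Heyting field that is algebraic over 𝔽 p has decidable equality: if a is a
-- root of z ^ k * g with g(0) ≠ 0, then either g(a) or a is invertible.  Hence
-- the atomic formulas below are stable under double negation, and Satisfies
-- agrees with classical truth.
module _ {c ℓ₁ ℓ₂} (F : HeytingField c ℓ₁ ℓ₂) where

  fieldRing : CommutativeRing c ℓ₁
  fieldRing = HeytingCommutativeRing.commutativeRing (HeytingField.heytingCommutativeRing F)

  fieldRawRing : RawRing c ℓ₁
  fieldRawRing = CommutativeRing.rawRing fieldRing

  module F[z] = Polynomial (RawRing.rawSemiring fieldRawRing)

  IsExtension : (p : ℕ) → (ℤ.ℤ → HeytingField.Carrier F) → Set ℓ₁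
  IsExtension p ι = RingMorphisms.IsRingHomomorphism (𝔽 p) fieldRawRing ι

  module _ (p : ℕ) (ι : ℤ.ℤ → HeytingField.Carrier F) where

    -- The map 𝔽_p[z] → F[z] induced by ι.
    extend : 𝔽[z].Poly p → F[z].Poly
    extend = List.map ι

    IsAlgebraic : Set (c ⊔ ℓ₁)
    IsAlgebraic = ∀ a → ∃[ f ] ¬ 𝔽[z]._≈_ p f [] × F[z].eval (extend f) a F.≈ F.0#
      where module F = HeytingField F

  -- Products of nonzero polynomials over a field are nonzero.
  module _ where
    private
      module F = HeytingField F
      module R = CommutativeRing fieldRing
    open F[z]
    open import Relation.Binary.Reasoning.Setoid R.setoid
    open RingProperties R.ring using (-0#≈0#)

    coeff-+ : ∀ f g n → coeff (f + g) n F.≈ coeff f n F.+ coeff g n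
    coeff-+ []      g       n       = F.sym (R.+-identityˡ _)
    coeff-+ (a ∷ f) []      n       = F.sym (R.+-identityʳ _)
    coeff-+ (a ∷ f) (b ∷ g) zero    = F.refl
    coeff-+ (a ∷ f) (b ∷ g) (suc n) = coeff-+ f g n

    coeff-scale : ∀ a g n → coeff (scale a g) n F.≈ a F.* coeff g n
    coeff-scale a []      n       = F.sym (R.zeroʳ a)
    coeff-scale a (b ∷ g) zero    = F.refl
    coeff-scale a (b ∷ g) (suc n) = coeff-scale a g n

    coeff-∷* : ∀ a f g n →
      coeff ((a ∷ f) * g) n F.≈ a F.* coeff g n F.+ coeff (F.0# ∷ f * g) n
    coeff-∷* a f g n = F.trans (coeff-+ (scale a g) (F.0# ∷ f * g) n)
                               (F.+-congʳ (coeff-scale a g n))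

    coeff-*0∷ : ∀ f {b} g n → b F.≈ F.0# →
      coeff (f * (b ∷ g)) n F.≈ coeff (F.0# ∷ f * g) n
    coeff-*0∷ [] g zero    b≈0 = F.refl
    coeff-*0∷ [] g (suc n) b≈0 = F.refl
    coeff-*0∷ (a ∷ f) {b} g zero b≈0 = begin
      coeff ((a ∷ f) * (b ∷ g)) 0 ≈⟨ coeff-∷* a f (b ∷ g) 0 ⟩
      a F.* b F.+ F.0#            ≈⟨ R.+-identityʳ _ ⟩
      a F.* b                     ≈⟨ F.*-congˡ b≈0 ⟩
      a F.* F.0#                  ≈⟨ R.zeroʳ a ⟩
      F.0#                        ∎
    coeff-*0∷ (a ∷ f) {b} g (suc n) b≈0 = begin
      coeff ((a ∷ f) * (b ∷ g)) (suc n)             ≈⟨ coeff-∷* a f (b ∷ g) (suc n) ⟩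
      a F.* coeff g n F.+ coeff (f * (b ∷ g)) n     ≈⟨ F.+-congˡ (coeff-*0∷ f g n b≈0) ⟩
      a F.* coeff g n F.+ coeff (F.0# ∷ f * g) n    ≈⟨ coeff-∷* a f g n ⟨
      coeff ((a ∷ f) * g) n                         ∎

    ≉-* : ∀ {a b} → ¬ a F.≈ F.0# → ¬ b F.≈ F.0# → ¬ a F.* b F.≈ F.0#
    ≉-* {a} {b} a≉0 b≉0 ab≈0 = a≉0 (proj₁ (F.tight a F.0#) λ a#0 →
      let u , ua≈1 , _ = F.#⇒invertible a#0
          a-0≈a = F.trans (F.+-congˡ -0#≈0#) (R.+-identityʳ a)
      in b≉0 (begin
        b                             ≈⟨ R.*-identityˡ b ⟨
        F.1# F.* b                    ≈⟨ F.*-congʳ ua≈1 ⟨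
        u F.* (a F.+ F.- F.0#) F.* b  ≈⟨ F.*-congʳ (F.*-congˡ a-0≈a) ⟩
        u F.* a F.* b                 ≈⟨ R.*-assoc u a b ⟩
        u F.* (a F.* b)               ≈⟨ F.*-congˡ ab≈0 ⟩
        u F.* F.0#                    ≈⟨ R.zeroʳ u ⟩
        F.0#                          ∎))

    cancel-zˡ : ∀ {a} f g → a F.≈ F.0# → (a ∷ f) * g ≈ [] → f * g ≈ []
    cancel-zˡ {a} f g a≈0 fg≈0 n = begin
      coeff (f * g) n                               ≈⟨ R.+-identityˡ _ ⟨
      F.0# F.+ coeff (f * g) n                      ≈⟨ F.+-congʳ (R.zeroˡ _) ⟨
      F.0# F.* coeff g (suc n) F.+ coeff (f * g) n  ≈⟨ F.+-congʳ (F.*-congʳ a≈0) ⟨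
      a F.* coeff g (suc n) F.+ coeff (f * g) n     ≈⟨ coeff-∷* a f g (suc n) ⟨
      coeff ((a ∷ f) * g) (suc n)                   ≈⟨ fg≈0 (suc n) ⟩
      F.0#                                          ∎

    cancel-zʳ : ∀ {b} f g → b F.≈ F.0# → f * (b ∷ g) ≈ [] → f * g ≈ []
    cancel-zʳ f g b≈0 fg≈0 n =
      F.trans (F.sym (coeff-*0∷ f g (suc n) b≈0)) (fg≈0 (suc n))

    ∷-zero : ∀ {a f} → a F.≈ F.0# → f ≈ [] → a ∷ f ≈ []
    ∷-zero a≈0 f≈0 zero    = a≈0
    ∷-zero a≈0 f≈0 (suc n) = f≈0 n

    *-nonzero : ∀ f g → ¬ f ≈ [] → ¬ g ≈ [] → ¬ f * g ≈ []
    *-nonzero []      g       f≉0 g≉0 fg≈0 = f≉0 λ _ → F.refl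
    *-nonzero (a ∷ f) []      f≉0 g≉0 fg≈0 = g≉0 λ _ → F.refl
    *-nonzero (a ∷ f) (b ∷ g) f≉0 g≉0 fg≈0 = ≉-*
      (λ a≈0 → *-nonzero f (b ∷ g) (λ f≈0 → f≉0 (∷-zero a≈0 f≈0)) g≉0
                 (cancel-zˡ f (b ∷ g) a≈0 fg≈0))
      (λ b≈0 → *-nonzero (a ∷ f) g f≉0 (λ g≈0 → g≉0 (∷-zero b≈0 g≈0))
                 (cancel-zʳ (a ∷ f) g b≈0 fg≈0))
      (F.trans (F.sym (R.+-identityʳ _))
               (F.trans (F.sym (coeff-∷* a f (b ∷ g) 0)) (fg≈0 0)))

    1≉0 : ¬ const F.1# ≈ []
    1≉0 1≈0 = F.#-irrefl F.refl (F.invertible⇒# {F.0#} {F.0#}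
      (F.0# , F.trans (R.zeroˡ _) (F.sym (1≈0 0)) , F.trans (R.zeroʳ _) (F.sym (1≈0 0))))

  module F⟨z⟩ where
    private module F = HeytingField F

    -- The rational function field F(z).
    record Frac : Set (c ⊔ ℓ₁) where
      constructor frac
      field
        num   : F[z].Poly
        den   : F[z].Poly
        den≉0 : ¬ den F[z].≈ []
    open Frac public

    infix  4 _≈_
    infixl 6 _+_
    infixl 7 _*_

    _≈_ : Rel Frac ℓ₁
    x ≈ y = num x F[z].* den y F[z].≈ num y F[z].* den x

    _+_ : Frac → Frac → Frac
    x + y = frac (num x F[z].* den y F[z].+ num y F[z].* den x) (den x F[z].* den y)
                 (*-nonzero (den x) (den y) (den≉0 x) (den≉0 y))

    _*_ : Frac → Frac → Frac
    x * y = frac (num x F[z].* num y) (den x F[z].* den y)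
                 (*-nonzero (den x) (den y) (den≉0 x) (den≉0 y))

    poly : F[z].Poly → Frac
    poly f = frac f (F[z].const F.1#) 1≉0

    const : F.Carrier → Frac
    const a = poly (F[z].const a)

    z : Frac
    z = poly F[z].X

    rawSemiring : RawSemiring (c ⊔ ℓ₁) ℓ₁
    rawSemiring = record
      { Carrier = Frac ; _≈_ = _≈_ ; _+_ = _+_ ; _*_ = _*_
      ; 0# = const F.0# ; 1# = const F.1# }

    open RawSemiringDefs rawSemiring public using (_^_)

  Fₚ-structure : ℕ → Structure ℒₚ c ℓ₁ 0ℓ
  Fₚ-structure p = record
    { Carrier = Carrier ; _≈_ = _≈_ ; ⟦_⟧ᶠ = fun ; ⟦_⟧ᵖ = λ () }
    where
    open HeytingField F
    open RawSemiringDefs (RawRing.rawSemiring fieldRawRing) using (_^_)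

    fun : ∀ {k} → Funₚ k → Vec Carrier k → Carrier
    fun zeroₚ []           = 0#
    fun oneₚ  []           = 1#
    fun plusₚ (x ∷ y ∷ []) = x + y
    fun frobₚ (x ∷ [])     = x ^ p

  module _ (p : ℕ) (ι : ℤ.ℤ → HeytingField.Carrier F) (S : List (𝔽[z].Poly p)) where
    open F⟨z⟩

    -- x ∈R says that x lies in F[z, s₁⁻¹, …, s_ν⁻¹], the F-subalgebra of F(z)
    -- generated by z and the inverses of the elements of S.
    data _∈R : Frac → Set (c ⊔ ℓ₁) where
      const∈ : ∀ a → const a ∈R
      z∈     : z ∈R
      inv∈   : ∀ {s x} → s ∈ S → poly (extend p ι s) * x ≈ const (HeytingField.1# F) → x ∈R
      +∈     : ∀ {x y} → x ∈R → y ∈R → (x + y) ∈R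
      *∈     : ∀ {x y} → x ∈R → y ∈R → (x * y) ∈R
      resp∈  : ∀ {x y} → x ≈ y → x ∈R → y ∈R

    ^∈ : ∀ {x} n → x ∈R → (x ^ n) ∈R
    ^∈ zero    x∈ = const∈ _
    ^∈ (suc n) x∈ = *∈ x∈ (^∈ n x∈)

    R-structure : Structure ℒₚzᵉ (c ⊔ ℓ₁) ℓ₁ (c ⊔ ℓ₁)
    R-structure = record
      { Carrier = Σ Frac _∈R ; _≈_ = λ x y → proj₁ x ≈ proj₁ y
      ; ⟦_⟧ᶠ = fun ; ⟦_⟧ᵖ = rel }
      where
      fun : ∀ {k} → Funz k → Vec (Σ Frac _∈R) k → Σ Frac _∈R
      fun (base zeroₚ) []                       = const _ , const∈ (HeytingField.0# F)
      fun (base oneₚ)  []                       = const _ , const∈ (HeytingField.1# F)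
      fun (base plusₚ) ((x , x∈) ∷ (y , y∈) ∷ []) = x + y , +∈ x∈ y∈
      fun (base frobₚ) ((x , x∈) ∷ [])          = x ^ p , ^∈ p x∈
      fun timesz       ((x , x∈) ∷ [])          = z * x , *∈ z∈ x∈

      rel : ∀ {k} → Predzᵉ k → Vec (Σ Frac _∈R) k → Set (c ⊔ ℓ₁)
      rel (base inF) (x ∷ []) = ∃[ a ] proj₁ x ≈ const a
      rel (P σ)      xs       = ∃[ as ] Pointwise (λ x a → proj₁ x ≈ const a) xs as
                                        × Satisfies (Fₚ-structure p) σ as

-- F is perfect, so every x in R is uniquely Σ zⁱ (θᵢ x)ᵖ, summed over i < p,
-- with θᵢ x in R.  With f the product of the elements of S, R is the union of
-- the finite-dimensional F-spaces V N = {h / f ^ N : deg h < C N}, and θᵢ maps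
-- V (2N) to V N.  Hence an additive operator built from z, x ↦ xᵖ and the θᵢ
-- is, once θ has been applied often enough, multiplication by a polynomial up
-- to a contraction, and column reduction makes a linear system of such
-- operators invertible up to bounded errors, that is, errors in some V N.
--
-- Call a relation on R basic if it says that a linear system is solvable where some
-- of the unknowns are elements f ^ -e · a with a in F subject to a first-order
-- condition, and some terms avoid V N.  The control over linear systems shows that
-- complements of basic relations are finite unions of basic relations: whether the
-- bounded part of a system is solvable is a first-order condition over F.  So
-- quantifiers can be eliminated, and a sentence about R turns into one about F.

module Submission where

open import Defs
open import Algebra.Apartness.Bundles using (HeytingField)
open import Algebra.Bundles using (AbelianGroup; CommutativeMonoid; CommutativeRing; CommutativeSemiring)
open import Algebra.Bundles.Raw using (RawRing; RawSemiring)
import Algebra.Definitions.RawMagma as RawMagmaDefs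
import Algebra.Definitions.RawSemiring as RawSemiringDefs
open import Algebra.Morphism.Structures using (module RingMorphisms)
import Algebra.Properties.AbelianGroup as AbelianGroupProperties
import Algebra.Properties.CommutativeMonoid.Sum as CommutativeMonoidSum
import Algebra.Properties.CommutativeSemiring.Binomial as Binomial
import Algebra.Properties.CommutativeSemiring.Exp as Exp
import Algebra.Properties.Monoid.Mult as MonoidMult
import Algebra.Properties.Ring as RingProperties
import Algebra.Properties.Semiring.Mult as Mult
import Algebra.Properties.Semiring.Sum as SemiringSum
import Algebra.Solver.CommutativeMonoid as CommutativeMonoidSolver
import Algebra.Solver.Ring.NaturalCoefficients.Default as SemiringSolver
open import Data.Bool.Base using (Bool; true; false; if_then_else_)
open import Data.Empty using (⊥; ⊥-elim)
open import Data.Fin.Base as Fin using (Fin; zero; suc; inject₁; fromℕ; fromℕ<; toℕ; _↑ˡ_; _↑ʳ_; splitAt)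
import Data.Fin.Properties as Fin
open import Data.Integer.Base using (ℤ)
import Data.Integer.Base as ℤ
import Data.Integer.Properties as ℤ
open import Data.List.Base as List using (List; []; _∷_; _++_)
open import Data.List.Membership.Propositional using (_∈_)
import Data.List.Properties as List
open import Data.List.Relation.Unary.All as All using (All; []; _∷_)
import Data.List.Relation.Unary.All.Properties as All
open import Data.List.Relation.Unary.Any as Any using (Any; here; there)
import Data.List.Relation.Unary.Any.Properties as Any
open import Data.Maybe.Base using (Maybe; just; nothing)
import Data.Nat.Base as ℕ
open import Data.Nat.Base using (ℕ; zero; suc; _≤_; _<_; z≤n; s≤s)
import Data.Nat.Combinatorics as ℕ
open import Data.Nat.Divisibility using (_∣_; divides; _∣?_; ∣-refl; ∣⇒≤)
import Data.Nat.GCD as ℕ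
open import Data.Nat.Primality using (Prime; euclidsLemma; prime⇒irreducible; prime⇒nonTrivial; ¬prime[0])
import Data.Nat.Properties as ℕ
open import Data.Nat.Tactic.RingSolver using (solve-∀)
open import Data.Product.Base using (Σ; _×_; _,_; proj₁; proj₂; ∃; ∃-syntax)
open import Data.Sum.Base using (_⊎_; inj₁; inj₂; [_,_])
open import Data.Vec.Base as Vec using (Vec; []; _∷_)
import Data.Vec.Properties as Vec
open import Data.Vec.Relation.Binary.Pointwise.Inductive as Pointwise using (Pointwise; []; _∷_)
open import Function.Base using (_∘_; id)
open import Level using (Level; _⊔_; lift; lower) renaming (suc to lsuc)
import Relation.Binary.Reasoning.Setoid as SetoidReasoning
open import Relation.Binary.PropositionalEquality.Core as ≡ using (_≡_; _≢_)
open import Relation.Nullary.Decidable.Core using (Dec; yes; no; map′; True; toWitness)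
open import Relation.Nullary.Negation.Core using (¬_; contradiction)

-- Pole orders are multiplied by p under `τ` and divided by p under `θ`, so linear equations must be
-- freed of `τ`. This loses nothing: the `θ i` are jointly injective, and `θ i ∘ τ` is the identity
-- or zero. Without `τ`, the part of an operator outside every `θ` dominates at large orders, and
-- this is the source of all bounded errors.
--
-- Terms avoiding V N are forced on basic relations by complementation. A value off the image of a
-- system may be recognisable only by large coordinates in the rows without a pivot, and largeness
-- is not an equation. If those coordinates are bounded, the value can be moved into a fixed V N,
-- where solvability concerns finitely many elements of F.
--
-- That S lies over the prime field matters because ℒₚ has no multiplication: clearing denominators
-- multiplies by f, and this stays expressible since integer multiples are repeated sums.
--
-- Truth is classical while the decision must be computed. Equivalences are therefore proved up to
-- double negation, and the stability of formulas recovers the answer.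

-- Linear identities in abelian groups; finite sums

module AbelianGroupSolver {a ℓ} (G : AbelianGroup a ℓ) where
  open AbelianGroup G renaming (_∙_ to _+_; ε to 0#; _⁻¹ to -_; ∙-cong to +-cong;
    ∙-congˡ to +-congˡ; ∙-congʳ to +-congʳ; assoc to +-assoc;
    identityˡ to +-identityˡ; identityʳ to +-identityʳ)
  open AbelianGroupProperties G using (∙-cancelʳ)
  open CommutativeMonoidSum commutativeMonoid using (sum; sum-cong-≋; ∑-distrib-+)
  open MonoidMult monoid using (×-homo-+; ×-homo-1) renaming (_×_ to _·_)
  open SetoidReasoning setoid
  module S = CommutativeMonoidSolver commutativeMonoid

  infixl 6 _⊕_
  infix  7 ⊝_

  data Expr (n : ℕ) : Set where
    atom : Fin n → Expr n
    nil  : Expr n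
    _⊕_  : Expr n → Expr n → Expr n
    ⊝_   : Expr n → Expr n

  module _ {n : ℕ} where
    ⟦_⟧ : Expr n → Vec Carrier n → Carrier
    ⟦ atom i ⟧ ρ = Vec.lookup ρ i
    ⟦ nil ⟧    ρ = 0#
    ⟦ e ⊕ f ⟧  ρ = ⟦ e ⟧ ρ + ⟦ f ⟧ ρ
    ⟦ ⊝ e ⟧    ρ = - ⟦ e ⟧ ρ

    unit : Fin n → Fin n → ℕ
    unit i j = f (i Fin.≟ j)
      where
      f : ∀ {b} {B : Set b} → Dec B → ℕ
      f (yes _) = 1
      f (no _)  = 0

    pos neg : Expr n → Fin n → ℕ
    pos (atom i) = unit i
    pos nil      = λ _ → 0
    pos (e ⊕ f)  = λ j → pos e j ℕ.+ pos f j
    pos (⊝ e)    = neg e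
    neg (atom i) = λ _ → 0
    neg nil      = λ _ → 0
    neg (e ⊕ f)  = λ j → neg e j ℕ.+ neg f j
    neg (⊝ e)    = pos e

  lin : ∀ {n} → (Fin n → ℕ) → Vec Carrier n → Carrier
  lin k ρ = sum (λ i → k i · Vec.lookup ρ i)

  lin-+ : ∀ {n} (k l : Fin n → ℕ) ρ → lin (λ i → k i ℕ.+ l i) ρ ≈ lin k ρ + lin l ρ
  lin-+ k l ρ = trans (sum-cong-≋ (λ i → ×-homo-+ (Vec.lookup ρ i) (k i) (l i))) (∑-distrib-+ (λ i → k i · Vec.lookup ρ i) (λ i → l i · Vec.lookup ρ i))

  lin-0 : ∀ {n} (ρ : Vec Carrier n) → lin (λ _ → 0) ρ ≈ 0#
  lin-0 []      = refl
  lin-0 (x ∷ ρ) = trans (+-identityˡ _) (lin-0 ρ)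

  lin-unit : ∀ {n} (i : Fin n) ρ → lin (unit i) ρ ≈ Vec.lookup ρ i
  lin-unit zero    (x ∷ ρ) = trans (+-cong (×-homo-1 x) (lin-0 ρ)) (+-identityʳ x)
  lin-unit (suc i) (x ∷ ρ) = trans (+-identityˡ _) (trans (sum-cong-≋ λ j → reflexive (≡.cong (_· Vec.lookup ρ j) (eq j))) (lin-unit i ρ))
    where
    eq : ∀ j → unit (suc i) (suc j) ≡ unit i j
    eq j with i Fin.≟ j
    ... | yes _ = ≡.refl
    ... | no  _ = ≡.refl

  -- Negative occurrences move to the other side, so all coefficients stay natural numbers and two
  -- expressions can be compared by counting.
  balance : ∀ {n} (e : Expr n) ρ → ⟦ e ⟧ ρ + lin (neg e) ρ ≈ lin (pos e) ρ
  balance (atom i) ρ = trans (+-congˡ (lin-0 ρ)) (trans (+-identityʳ _) (sym (lin-unit i ρ)))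
  balance nil      ρ = +-identityˡ _
  balance (e ⊕ f)  ρ = begin
    ⟦ e ⟧ ρ + ⟦ f ⟧ ρ + lin (neg (e ⊕ f)) ρ                  ≈⟨ +-congˡ (lin-+ (neg e) (neg f) ρ) ⟩
    ⟦ e ⟧ ρ + ⟦ f ⟧ ρ + (lin (neg e) ρ + lin (neg f) ρ)      ≈⟨ S.solve 4 (λ a b c d → (a S.⊕ b) S.⊕ (c S.⊕ d) S.⊜ (a S.⊕ c) S.⊕ (b S.⊕ d)) refl _ _ _ _ ⟩
    ⟦ e ⟧ ρ + lin (neg e) ρ + (⟦ f ⟧ ρ + lin (neg f) ρ)      ≈⟨ +-cong (balance e ρ) (balance f ρ) ⟩
    lin (pos e) ρ + lin (pos f) ρ                            ≈⟨ lin-+ (pos e) (pos f) ρ ⟨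
    lin (pos (e ⊕ f)) ρ                                      ∎
  balance (⊝ e)    ρ = begin
    - ⟦ e ⟧ ρ + lin (pos e) ρ               ≈⟨ +-congˡ (balance e ρ) ⟨
    - ⟦ e ⟧ ρ + (⟦ e ⟧ ρ + lin (neg e) ρ)   ≈⟨ +-assoc _ _ _ ⟨
    - ⟦ e ⟧ ρ + ⟦ e ⟧ ρ + lin (neg e) ρ     ≈⟨ +-congʳ (inverseˡ _) ⟩
    0# + lin (neg e) ρ                      ≈⟨ +-identityˡ _ ⟩
    lin (neg e) ρ                           ∎

  solve : ∀ {n} (ρ : Vec Carrier n) (e f : Expr n) →
          {True (Fin.all? λ i → pos e i ℕ.+ neg f i ℕ.≟ pos f i ℕ.+ neg e i)} → ⟦ e ⟧ ρ ≈ ⟦ f ⟧ ρ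
  solve ρ e f {eq} = ∙-cancelʳ (lin (neg e) ρ + lin (neg f) ρ) _ _ (begin
    ⟦ e ⟧ ρ + (lin (neg e) ρ + lin (neg f) ρ)  ≈⟨ +-assoc _ _ _ ⟨
    ⟦ e ⟧ ρ + lin (neg e) ρ + lin (neg f) ρ    ≈⟨ +-congʳ (balance e ρ) ⟩
    lin (pos e) ρ + lin (neg f) ρ              ≈⟨ lin-+ (pos e) (neg f) ρ ⟨
    lin (λ i → pos e i ℕ.+ neg f i) ρ          ≈⟨ sum-cong-≋ (λ i → reflexive (≡.cong (_· Vec.lookup ρ i) (toWitness eq i))) ⟩
    lin (λ i → pos f i ℕ.+ neg e i) ρ          ≈⟨ lin-+ (pos f) (neg e) ρ ⟩
    lin (pos f) ρ + lin (neg e) ρ              ≈⟨ +-congʳ (balance f ρ) ⟨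
    ⟦ f ⟧ ρ + lin (neg f) ρ + lin (neg e) ρ    ≈⟨ S.solve 3 (λ a b c → (a S.⊕ b) S.⊕ c S.⊜ a S.⊕ (c S.⊕ b)) refl _ _ _ ⟩
    ⟦ f ⟧ ρ + (lin (neg e) ρ + lin (neg f) ρ)  ∎)

  pattern a₀ = atom zero
  pattern a₁ = atom (suc zero)
  pattern a₂ = atom (suc (suc zero))
  pattern a₃ = atom (suc (suc (suc zero)))
  pattern a₄ = atom (suc (suc (suc (suc zero))))
  pattern a₅ = atom (suc (suc (suc (suc (suc zero)))))

module FiniteSums {a ℓ} (G : CommutativeMonoid a ℓ) where
  open CommutativeMonoid G renaming (_∙_ to infixl 6 _+_; ε to 0#; ∙-cong to +-cong;
    ∙-congˡ to +-congˡ; assoc to +-assoc; identityˡ to +-identityˡ)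
  open CommutativeMonoidSum G public using (sum; ∑-distrib-+)
  open CommutativeMonoidSum G using (sum-cong-≋)
  private module S = CommutativeMonoidSolver G

  sum-0 : ∀ {n} {f : Fin n → Carrier} → (∀ i → f i ≈ 0#) → sum f ≈ 0#
  sum-0 {zero}  e = refl
  sum-0 {suc n} e = trans (+-cong (e zero) (sum-0 (e ∘ suc))) (+-identityˡ 0#)

  sum-cong : ∀ {n} {f g : Fin n → Carrier} → (∀ i → f i ≈ g i) → sum f ≈ sum g
  sum-cong = sum-cong-≋

  -- The common remainder `r` lets one summand be exchanged without subtraction, so the lemma also
  -- serves in ℕ, for the costs of column reduction.
  sum-focus : ∀ {n} {f g : Fin n → Carrier} i → (∀ j → j ≢ i → f j ≈ g j) →
    ∃[ r ] sum f ≈ f i + r × sum g ≈ g i + r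
  sum-focus {f = f} zero e = sum (f ∘ suc) , refl , +-congˡ (sum-cong λ j → sym (e (suc j) λ ()))
  sum-focus {f = f} {g} (suc i) e with sum-focus {f = f ∘ suc} {g ∘ suc} i (λ j j≢i → e (suc j) λ { ≡.refl → j≢i ≡.refl })
  ... | r , e₁ , e₂ = f zero + r
      , trans (+-congˡ e₁) (swap (f zero) (f (suc i)) r)
      , trans (+-cong (sym (e zero λ ())) e₂) (swap (f zero) (g (suc i)) r)
    where
    swap : ∀ x y r → x + (y + r) ≈ y + (x + r)
    swap = S.solve 3 (λ x y r → x S.⊕ (y S.⊕ r) S.⊜ y S.⊕ (x S.⊕ r)) refl

  sum-↑ : ∀ m {n} (f : Fin (m ℕ.+ n) → Carrier) →
    sum f ≈ sum (λ i → f (i ↑ˡ n)) + sum (λ j → f (m ↑ʳ j))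
  sum-↑ zero    f = sym (+-identityˡ _)
  sum-↑ (suc m) f = trans (+-congˡ (sum-↑ m (f ∘ suc))) (sym (+-assoc _ _ _))

-- Modules with a Frobenius map and a filtration

-- Expressions for the elements of ℤ[z].
data Scalar : Set where
  𝟘 𝟙 𝕫   : Scalar
  _⊞_ _⊡_ : Scalar → Scalar → Scalar
  ⊟_      : Scalar → Scalar

infixl 6 _⊞_
infixl 7 _⊡_
infix  8 ⊟_

-- The symbol `θᴸ` has no counterpart in ℒₚz; it enters when `τᴸ` is eliminated. Terms are kept as
-- syntax because they are later evaluated generically, with coefficients that are terms over F.
data LinTerm (q : ℕ) {s} (A : Set s) : Set s where
  var   : A → LinTerm q A
  0ᴸ    : LinTerm q A
  _+ᴸ_  : LinTerm q A → LinTerm q A → LinTerm q A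
  -ᴸ_ zᴸ τᴸ : LinTerm q A → LinTerm q A
  θᴸ    : Fin (suc q) → LinTerm q A → LinTerm q A

infixl 6 _+ᴸ_
infix  8 -ᴸ_

module Operators {a ℓ} (group : AbelianGroup a ℓ) where
  open AbelianGroup group
    using (Carrier; _≈_) renaming (_∙_ to infixl 6 _+_; ε to 0#; _⁻¹ to -_)

  record Additive (h : Carrier → Carrier) : Set (a ⊔ ℓ) where
    field
      cong : ∀ {x y} → x ≈ y → h x ≈ h y
      homo : ∀ x y → h (x + y) ≈ h x + h y

  module _ (z : Carrier → Carrier) where
    -- The Horner form of Σ zⁱ τ(yᵢ), which recovers x from its coordinates `θ i x`.
    assembleBy : (Carrier → Carrier) → ∀ {n} → (Fin n → Carrier) → Carrier
    assembleBy τ {zero}  y = 0#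
    assembleBy τ {suc n} y = τ (y zero) + z (assembleBy τ (y ∘ suc))

    actBy : Scalar → Carrier → Carrier
    actBy 𝟘       x = 0#
    actBy 𝟙       x = x
    actBy 𝕫       x = z x
    actBy (s ⊞ t) x = actBy s x + actBy t x
    actBy (s ⊡ t) x = actBy s (actBy t x)
    actBy (⊟ s)   x = - actBy s x

-- An abelian group with the additive operators of R: multiplication by z, the
-- Frobenius map τ, and the coordinates θ i with respect to the basis
-- 1, z, …, z^q of R over τ R, where p = 1 + q.  V N plays the role of the
-- functions with all poles of order at most N.
record FilteredModule (q : ℕ) (a ℓ v : Level) : Set (lsuc (a ⊔ ℓ ⊔ v)) where
  field
    group : AbelianGroup a ℓ

  open AbelianGroup group public
    using (Carrier; _≈_; refl; sym; trans; setoid; reflexive; inverseˡ; inverseʳ)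
    renaming (_∙_ to infixl 6 _+_; ε to 0#; _⁻¹ to -_; ∙-cong to +-cong;
      ∙-congˡ to +-congˡ; ∙-congʳ to +-congʳ; assoc to +-assoc; comm to +-comm;
      identityˡ to +-identityˡ; identityʳ to +-identityʳ; ⁻¹-cong to -‿cong;
      commutativeMonoid to +-commutativeMonoid)
  open Operators group public using (Additive; module Additive; assembleBy; actBy)

  field
    z τ     : Carrier → Carrier
    θ       : Fin (suc q) → Carrier → Carrier
    z-add   : Additive z
    τ-add   : Additive τ
    θ-add   : ∀ i → Additive (θ i)

  assemble : ∀ {n} → (Fin n → Carrier) → Carrier
  assemble = assembleBy z τ

  act : Scalar → Carrier → Carrier
  act = actBy z

  field
    θ-assemble : ∀ (y : Fin (suc q) → Carrier) i → θ i (assemble y) ≈ y i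
    assemble-θ : ∀ x → assemble (λ i → θ i x) ≈ x
    θ-z-zero   : ∀ x → θ zero (z x) ≈ z (θ (fromℕ q) x)
    θ-z-suc    : ∀ i x → θ (suc i) (z x) ≈ θ (inject₁ i) x

    V       : ℕ → Carrier → Set v
    V-resp  : ∀ {N x y} → x ≈ y → V N x → V N y
    V-0     : ∀ {N} → V N 0#
    V-+     : ∀ {N x y} → V N x → V N y → V N (x + y)
    V-neg   : ∀ {N x} → V N x → V N (- x)
    V-mono  : ∀ {N N′ x} → N ≤ N′ → V N x → V N′ x
    V-all   : ∀ x → ∃[ N ] V N x
    V-z     : ∀ {N x} → V N x → V (suc N) (z x)
    V-τ     : ∀ {N x} → V N x → V (suc q ℕ.* N) (τ x)
    V-θ     : ∀ {N x} i → V (N ℕ.+ N) x → V N (θ i x)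
    V-large : ∀ N → ∃[ x ] ¬ V N x

  -- Division with remainder in abstract form: multiplication by `s` is invertible up to bounded
  -- errors. It lowers orders by at most C, and every element is a multiple of `s` up to V C.
  Divisor : Scalar → Set (a ⊔ v)
  Divisor s = ∃[ C ] (∀ {N x} → V N (act s x) → V (N ℕ.+ C) x)
                   × (∀ x → ∃[ y ] V C (x + - act s y))

  field
    divisor? : ∀ s → (∀ x → act s x ≈ 0#) ⊎ Divisor s

module Additivity {a ℓ} (G : AbelianGroup a ℓ) where
  open AbelianGroup G renaming (_∙_ to infixl 6 _+_; ε to 0#; _⁻¹ to -_)
  open AbelianGroupProperties G using (identityʳ-unique; inverseˡ-unique)

  module _ {h : Carrier → Carrier}
           (cong : ∀ {x y} → x ≈ y → h x ≈ h y) (homo : ∀ x y → h (x + y) ≈ h x + h y) where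
    h-0 : h 0# ≈ 0#
    h-0 = identityʳ-unique (h 0#) (h 0#) (trans (sym (homo 0# 0#)) (cong (identityˡ 0#)))

    h-neg : ∀ x → h (- x) ≈ - h x
    h-neg x = inverseˡ-unique (h (- x)) (h x) (trans (sym (homo (- x) x)) (trans (cong (inverseˡ x)) h-0))

-- Operators without Frobenius: a scalar plus a contraction

module Forms {q a ℓ v} (M : FilteredModule q a ℓ v) where
  open FilteredModule M public
  open AbelianGroupSolver group public using (solve; _⊕_; ⊝_; nil; a₀; a₁; a₂; a₃; a₄; a₅)
  open FiniteSums +-commutativeMonoid public
  open SetoidReasoning setoid
  open AbelianGroupProperties group public using () renaming (ε⁻¹≈ε to -0≈0)

  add-0 : ∀ {h} → Additive h → h 0# ≈ 0#
  add-0 A = Additivity.h-0 group (Additive.cong A) (Additive.homo A)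

  add-neg : ∀ {h} → Additive h → ∀ x → h (- x) ≈ - h x
  add-neg A = Additivity.h-neg group (Additive.cong A) (Additive.homo A)

  id-additive : Additive id
  id-additive = record { cong = id ; homo = λ _ _ → refl }

  0-additive : Additive (λ _ → 0#)
  0-additive = record { cong = λ _ → refl ; homo = λ _ _ → sym (+-identityˡ 0#) }

  ∘-additive : ∀ {g h} → Additive g → Additive h → Additive (g ∘ h)
  ∘-additive G H = record
    { cong = Additive.cong G ∘ Additive.cong H
    ; homo = λ x y → trans (Additive.cong G (Additive.homo H x y)) (Additive.homo G _ _) }

  +-additive : ∀ {g h} → Additive g → Additive h → Additive (λ x → g x + h x)
  +-additive G H = record
    { cong = λ e → +-cong (Additive.cong G e) (Additive.cong H e)
    ; homo = λ x y → trans (+-cong (Additive.homo G x y) (Additive.homo H x y))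
        (solve (_ ∷ _ ∷ _ ∷ _ ∷ []) (a₀ ⊕ a₁ ⊕ (a₂ ⊕ a₃)) (a₀ ⊕ a₂ ⊕ (a₁ ⊕ a₃))) }

  neg-additive : ∀ {g} → Additive g → Additive (λ x → - g x)
  neg-additive G = record
    { cong = λ e → -‿cong (Additive.cong G e)
    ; homo = λ x y → trans (-‿cong (Additive.homo G x y))
        (solve (_ ∷ _ ∷ []) (⊝ (a₀ ⊕ a₁)) (⊝ a₀ ⊕ ⊝ a₁)) }

  sum-additive : ∀ {n} {h : Fin n → Carrier → Carrier} →
    (∀ i → Additive (h i)) → Additive (λ x → sum (λ i → h i x))
  sum-additive {zero}  H = 0-additive
  sum-additive {suc n} H = +-additive (H zero) (sum-additive (H ∘ suc))

  resp-additive : ∀ {g h : Carrier → Carrier} → (∀ x → g x ≈ h x) → Additive g → Additive h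
  resp-additive e G = record
    { cong = λ {x} {y} eq → trans (sym (e x)) (trans (Additive.cong G eq) (e y))
    ; homo = λ x y → trans (sym (e _)) (trans (Additive.homo G x y) (+-cong (e x) (e y))) }

  single : ∀ {n} → Fin n → Carrier → Fin n → Carrier
  single i x j with i Fin.≟ j
  ... | yes _ = x
  ... | no  _ = 0#

  single-same : ∀ {n} (i : Fin n) x → single i x i ≡ x
  single-same i x with i Fin.≟ i
  ... | yes _  = ≡.refl
  ... | no i≢i = contradiction ≡.refl i≢i

  single-other : ∀ {n} (i : Fin n) x {j} → j ≢ i → single i x j ≡ 0#
  single-other i x {j} j≢i with i Fin.≟ j
  ... | yes i≡j = contradiction (≡.sym i≡j) j≢i
  ... | no  _   = ≡.refl

  act-additive : ∀ s → Additive (act s)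
  act-additive 𝟘       = 0-additive
  act-additive 𝟙       = id-additive
  act-additive 𝕫       = z-add
  act-additive (s ⊞ t) = +-additive (act-additive s) (act-additive t)
  act-additive (s ⊡ t) = ∘-additive (act-additive s) (act-additive t)
  act-additive (⊟ s)   = neg-additive (act-additive s)

  act-cong : ∀ s {x y} → x ≈ y → act s x ≈ act s y
  act-cong s = Additive.cong (act-additive s)

  z-act : ∀ s x → z (act s x) ≈ act s (z x)
  z-act 𝟘       x = add-0 z-add
  z-act 𝟙       x = refl
  z-act 𝕫       x = refl
  z-act (s ⊞ t) x = trans (Additive.homo z-add _ _) (+-cong (z-act s x) (z-act t x))
  z-act (s ⊡ t) x = trans (z-act s _) (act-cong s (z-act t x))
  z-act (⊟ s)   x = trans (add-neg z-add _) (-‿cong (z-act s x))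

  act-comm : ∀ s t x → act s (act t x) ≈ act t (act s x)
  act-comm 𝟘       t x = sym (add-0 (act-additive t))
  act-comm 𝟙       t x = refl
  act-comm 𝕫       t x = z-act t x
  act-comm (s ⊞ s′) t x = trans (+-cong (act-comm s t x) (act-comm s′ t x)) (sym (Additive.homo (act-additive t) _ _))
  act-comm (s ⊡ s′) t x = trans (act-cong s (act-comm s′ t x)) (act-comm s t _)
  act-comm (⊟ s)   t x = trans (-‿cong (act-comm s t x)) (sym (add-neg (act-additive t) _))

  τ-assemble : ∀ {n} (y : Fin (suc n) → Carrier) → (∀ i → y (suc i) ≈ 0#) → assemble y ≈ τ (y zero)
  τ-assemble y y≈0 = trans (+-congˡ (trans (Additive.cong z-add (zeros _ y≈0)) (add-0 z-add))) (+-identityʳ _)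
    where
    zeros : ∀ {n} (y : Fin n → Carrier) → (∀ i → y i ≈ 0#) → assemble y ≈ 0#
    zeros {zero}  y y≈0 = refl
    zeros {suc n} y y≈0 = trans (+-cong (trans (Additive.cong τ-add (y≈0 zero)) (add-0 τ-add))
      (trans (Additive.cong z-add (zeros (y ∘ suc) (y≈0 ∘ suc))) (add-0 z-add))) (+-identityˡ 0#)

  module _ (x : Carrier) where
    private
      y : Fin (suc q) → Carrier
      y zero    = x
      y (suc i) = 0#

    θ-τ-zero : θ zero (τ x) ≈ x
    θ-τ-zero = trans (Additive.cong (θ-add zero) (sym (τ-assemble y λ _ → refl))) (θ-assemble y zero)

    θ-τ-suc : ∀ i → θ (suc i) (τ x) ≈ 0#
    θ-τ-suc i = trans (Additive.cong (θ-add (suc i)) (sym (τ-assemble y λ _ → refl))) (θ-assemble y (suc i))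

  assemble-cong : ∀ {n} {x y : Fin n → Carrier} → (∀ i → x i ≈ y i) → assemble x ≈ assemble y
  assemble-cong {zero}  e = refl
  assemble-cong {suc n} e = +-cong (Additive.cong τ-add (e zero)) (Additive.cong z-add (assemble-cong (e ∘ suc)))

  θ-injective : ∀ {x y} → (∀ i → θ i x ≈ θ i y) → x ≈ y
  θ-injective {x} {y} e = trans (sym (assemble-θ x)) (trans (assemble-cong e) (assemble-θ y))

  θ-0 : ∀ {x} → x ≈ 0# → ∀ i → θ i x ≈ 0#
  θ-0 e i = trans (Additive.cong (θ-add i) e) (add-0 (θ-add i))

  θ-zero : ∀ {x} → (∀ i → θ i x ≈ 0#) → x ≈ 0#
  θ-zero e = θ-injective λ i → trans (e i) (sym (add-0 (θ-add i)))

  V-θ′ : ∀ {N x} i → V N x → V N (θ i x)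
  V-θ′ {N} i Vx = V-θ i (V-mono (ℕ.m≤m+n N N) Vx)

  V-sum : ∀ {n N} {f : Fin n → Carrier} → (∀ i → V N (f i)) → V N (sum f)
  V-sum {zero}  Vf = V-0
  V-sum {suc n} Vf = V-+ (Vf zero) (V-sum (Vf ∘ suc))

  V-sub : ∀ {N x y} → V N x → V N y → V N (x + - y)
  V-sub Vx Vy = V-+ Vx (V-neg Vy)

  V-act : ∀ s → ∃[ E ] ∀ {N x} → V N x → V (N ℕ.+ E) (act s x)
  V-act 𝟘       = 0 , λ _ → V-0
  V-act 𝟙       = 0 , λ {N} → V-mono (ℕ.m≤m+n N 0)
  V-act 𝕫       = 1 , λ {N} {x} Vx → ≡.subst (λ k → V k (z x)) (ℕ.+-comm 1 N) (V-z Vx)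
  V-act (s ⊞ t) with V-act s | V-act t
  ... | E , f | E′ , g = E ℕ.+ E′ , λ {N} Vx →
    V-+ (V-mono (ℕ.+-monoʳ-≤ N (ℕ.m≤m+n E E′)) (f Vx)) (V-mono (ℕ.+-monoʳ-≤ N (ℕ.m≤n+m E′ E)) (g Vx))
  V-act (s ⊡ t) with V-act s | V-act t
  ... | E , f | E′ , g = E′ ℕ.+ E , λ {N} {x} Vx → ≡.subst (λ k → V k (act s (act t x))) (ℕ.+-assoc N E′ E) (f (g Vx))
  V-act (⊟ s) with V-act s
  ... | E , f = E , λ Vx → V-neg (f Vx)

  uniform : ∀ {n p} {P : Fin n → ℕ → Set p} → (∀ i {k l} → k ≤ l → P i k → P i l) →
    (∀ i → ∃[ k ] P i k) → ∃[ k ] ∀ i → P i k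
  uniform {zero}  mono f = 0 , λ ()
  uniform {suc n} mono f with f zero | uniform (mono ∘ suc) (f ∘ suc)
  ... | k , Pk | l , Pl = k ℕ.+ l , λ
    { zero → mono zero (ℕ.m≤m+n k l) Pk ; (suc i) → mono (suc i) (ℕ.m≤n+m l k) (Pl i) }

  V-vec : ∀ {n} (y : Fin n → Carrier) → ∃[ N ] ∀ i → V N (y i)
  V-vec y = uniform (λ i → V-mono) (λ i → V-all (y i))

  -- The operators y ↦ Σ T_w θ_w y, where w ranges over words of length at most d.
  data Form : ℕ → (Carrier → Carrier) → Set (a ⊔ ℓ) where
    leaf : ∀ {g} T → (∀ y → g y ≈ act T y) → Form zero g
    node : ∀ {d g} T (B : Fin (suc q) → Carrier → Carrier) → (∀ i → Form d (B i)) →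
           (∀ y → g y ≈ act T y + sum (λ i → B i (θ i y))) → Form (suc d) g

  top : ∀ {d g} → Form d g → Scalar
  top (leaf T _) = T
  top (node T _ _ _) = T

  rest : ∀ {d g} → Form d g → Carrier → Carrier
  rest (leaf _ _)             y = 0#
  rest (node T B _ _) y = sum (λ i → B i (θ i y))

  Form-split : ∀ {d g} (F : Form d g) y → g y ≈ act (top F) y + rest F y
  Form-split (leaf T e)         y = trans (e y) (sym (+-identityʳ _))
  Form-split (node T B _ e) y = e y

  Form-additive : ∀ {d g} → Form d g → Additive g
  Form-additive (leaf T e)         = resp-additive (sym ∘ e) (act-additive T)
  Form-additive (node T B F e) = resp-additive (sym ∘ e)
    (+-additive (act-additive T) (sum-additive λ i → ∘-additive (Form-additive (F i)) (θ-add i)))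

  Form-resp : ∀ {d} {g h : Carrier → Carrier} → (∀ y → g y ≈ h y) → Form d g → Form d h
  Form-resp {zero}  e (leaf T eT)         = leaf T λ y → trans (sym (e y)) (eT y)
  Form-resp {suc d} e (node T B F eT) = node T B F λ y → trans (sym (e y)) (eT y)

  top-resp : ∀ {d} {g h : Carrier → Carrier} (e : ∀ y → g y ≈ h y) (F : Form d g) → ∀ x →
    act (top (Form-resp e F)) x ≈ act (top F) x
  top-resp e (leaf _ _) x = refl
  top-resp e (node _ _ _ _) x = refl

  Form-0 : ∀ d → Form d (λ _ → 0#)
  Form-0 zero    = leaf 𝟘 λ _ → refl
  Form-0 (suc d) = node 𝟘 (λ _ _ → 0#) (λ _ → Form-0 d) λ y → sym (trans (+-identityˡ _) (sum-0 {suc q} λ _ → refl))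

  top-0 : ∀ d → ∀ x →
    act (top (Form-0 d)) x ≈ 0#
  top-0 zero    x = refl
  top-0 (suc d) x = refl

  Form-lift : ∀ {d g} → Form d g → Form (suc d) g
  Form-lift (leaf T e)         = node T (λ _ _ → 0#) (λ _ → Form-0 0)
    λ y → trans (e y) (sym (trans (+-congˡ (sum-0 {suc q} λ _ → refl)) (+-identityʳ _)))
  Form-lift (node T B F e) = node T B (λ i → Form-lift (F i)) e

  top-lift : ∀ {d g} (F : Form d g) → ∀ x →
    act (top (Form-lift F)) x ≈ act (top F) x
  top-lift (leaf _ _) x = refl
  top-lift (node _ _ _ _) x = refl

  Form-lift+ : ∀ k {d g} → Form d g → Form (k ℕ.+ d) g
  Form-lift+ zero    F = F
  Form-lift+ (suc k) F = Form-lift (Form-lift+ k F)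

  top-lift+ : ∀ k {d g} (F : Form d g) → ∀ x →
    act (top (Form-lift+ k F)) x ≈ act (top F) x
  top-lift+ zero    F x = refl
  top-lift+ (suc k) F x = trans (top-lift (Form-lift+ k F) x) (top-lift+ k F x)

  Form-+ : ∀ {d g h} → Form d g → Form d h → Form d (λ y → g y + h y)
  Form-+ (leaf T e)         (leaf T′ e′)           = leaf (T ⊞ T′) λ y → +-cong (e y) (e′ y)
  Form-+ (node T B F e) (node T′ B′ F′ e′) =
    node (T ⊞ T′) (λ i y → B i y + B′ i y) (λ i → Form-+ (F i) (F′ i)) λ y →
      trans (+-cong (e y) (e′ y)) (trans
        (solve (act T y ∷ sum (λ i → B i (θ i y)) ∷ act T′ y ∷ sum (λ i → B′ i (θ i y)) ∷ [])
          (a₀ ⊕ a₁ ⊕ (a₂ ⊕ a₃)) (a₀ ⊕ a₂ ⊕ (a₁ ⊕ a₃)))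
        (+-congˡ (sym (∑-distrib-+ (λ i → B i (θ i y)) (λ i → B′ i (θ i y))))))

  top-+ : ∀ {d g h} (F : Form d g) (F′ : Form d h) → ∀ x →
    act (top (Form-+ F F′)) x ≈ act (top F) x + act (top F′) x
  top-+ (leaf _ _) (leaf _ _) x = refl
  top-+ (node _ _ _ _) (node _ _ _ _) x = refl

  sum-neg : ∀ {n} (f : Fin n → Carrier) → - sum f ≈ sum (λ i → - f i)
  sum-neg {zero}  f = -0≈0
  sum-neg {suc n} f = trans (solve (_ ∷ _ ∷ []) (⊝ (a₀ ⊕ a₁)) (⊝ a₀ ⊕ ⊝ a₁)) (+-congˡ (sum-neg (f ∘ suc)))

  Form-neg : ∀ {d g} → Form d g → Form d (λ y → - g y)
  Form-neg (leaf T e)         = leaf (⊟ T) λ y → -‿cong (e y)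
  Form-neg (node T B F e) = node (⊟ T) (λ i y → - B i y) (λ i → Form-neg (F i)) λ y →
    trans (-‿cong (e y)) (trans (solve (_ ∷ _ ∷ []) (⊝ (a₀ ⊕ a₁)) (⊝ a₀ ⊕ ⊝ a₁)) (+-congˡ (sum-neg (λ i → B i (θ i y)))))

  top-neg : ∀ {d g} (F : Form d g) → ∀ x →
    act (top (Form-neg F)) x ≈ - act (top F) x
  top-neg (leaf _ _) x = refl
  top-neg (node _ _ _ _) x = refl

  snoc : ∀ {s} {S : Set s} {n} → (Fin n → S) → S → Fin (suc n) → S
  snoc {n = zero}  f b _       = b
  snoc {n = suc n} f b zero    = f zero
  snoc {n = suc n} f b (suc i) = snoc (f ∘ suc) b i

  snoc-all : ∀ {s t} {S : Set s} (Q : S → Set t) {n} {f : Fin n → S} {b} →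
    (∀ i → Q (f i)) → Q b → ∀ i → Q (snoc f b i)
  snoc-all Q {zero}  Qf Qb i       = Qb
  snoc-all Q {suc n} Qf Qb zero    = Qf zero
  snoc-all Q {suc n} Qf Qb (suc i) = snoc-all Q (Qf ∘ suc) Qb i

  sum-snoc : ∀ {n} (f : Fin n → Carrier → Carrier) b (x : Fin (suc n) → Carrier) →
    sum (λ i → snoc f b i (x i)) ≈ b (x (fromℕ n)) + sum (λ i → f i (x (inject₁ i)))
  sum-snoc {zero}  f b x = refl
  sum-snoc {suc n} f b x = trans (+-congˡ (sum-snoc (f ∘ suc) b (x ∘ suc)))
    (solve (_ ∷ _ ∷ _ ∷ []) (a₀ ⊕ (a₁ ⊕ a₂)) (a₁ ⊕ (a₀ ⊕ a₂)))

  -- Precomposition with z rotates the branches: θ at i + 1 becomes θ at i, and θ at 0 wraps around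
  -- to θ at q, handing z on to its branch.
  Form-z : ∀ {d g} → Form d g → Form d (g ∘ z)
  Form-z (leaf T e)         = leaf (T ⊡ 𝕫) λ y → e (z y)
  Form-z {g = g} (node T B F e) = node (T ⊡ 𝕫) (snoc (B ∘ suc) (B zero ∘ z))
    (snoc-all (Form _) (F ∘ suc) (Form-z (F zero))) λ y → begin
      g (z y)                                              ≈⟨ e (z y) ⟩
      act T (z y) + (B zero (θ zero (z y)) + sum (λ i → B (suc i) (θ (suc i) (z y))))
        ≈⟨ +-congˡ (+-cong (Additive.cong (Form-additive (F zero)) (θ-z-zero y))
                           (sum-cong λ i → Additive.cong (Form-additive (F (suc i))) (θ-z-suc i y))) ⟩
      act T (z y) + (B zero (z (θ (fromℕ q) y)) + sum (λ i → B (suc i) (θ (inject₁ i) y)))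
        ≈⟨ +-congˡ (sum-snoc (B ∘ suc) (B zero ∘ z) (λ i → θ i y)) ⟨
      act T (z y) + sum (λ i → snoc (B ∘ suc) (B zero ∘ z) i (θ i y))  ∎

  top-z : ∀ {d g} (F : Form d g) → ∀ x →
    act (top (Form-z F)) x ≈ act (top F) (z x)
  top-z (leaf _ _) x = refl
  top-z (node _ _ _ _) x = refl

  Form-act : ∀ s {d g} → Form d g → Form d (g ∘ act s)
  Form-act 𝟘       {d} F = Form-resp (λ y → sym (add-0 (Form-additive F))) (Form-0 d)
  Form-act 𝟙       F = F
  Form-act 𝕫       F = Form-z F
  Form-act (s ⊞ t) F = Form-resp (λ y → sym (Additive.homo (Form-additive F) _ _)) (Form-+ (Form-act s F) (Form-act t F))
  Form-act (s ⊡ t) F = Form-act t (Form-act s F)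
  Form-act (⊟ s)   F = Form-resp (λ y → sym (add-neg (Form-additive F) _)) (Form-neg (Form-act s F))

  -- Tops compose like scalars, so the effect of a column operation can be followed on the matrix of
  -- tops alone.
  top-act : ∀ s {d g} (F : Form d g) y → act (top (Form-act s F)) y ≈ act (top F) (act s y)
  top-act 𝟘       {d} F y = trans (top-resp _ (Form-0 d) y) (trans (top-0 d y) (sym (add-0 (act-additive (top F)))))
  top-act 𝟙       F y = refl
  top-act 𝕫       F y = top-z F y
  top-act (s ⊞ t) F y = trans (top-resp _ (Form-+ (Form-act s F) (Form-act t F)) y)
    (trans (top-+ (Form-act s F) (Form-act t F) y)
      (trans (+-cong (top-act s F y) (top-act t F y)) (sym (Additive.homo (act-additive (top F)) _ _))))
  top-act (s ⊡ t) F y = trans (top-act t (Form-act s F) y) (top-act s F _)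
  top-act (⊟ s)   F y = trans (top-resp _ (Form-neg (Form-act s F)) y)
    (trans (top-neg (Form-act s F) y)
      (trans (-‿cong (top-act s F y)) (sym (add-neg (act-additive (top F)) _))))

  mutual
    V-Form : ∀ {d g} → Form d g → ∃[ E ] ∀ {N x} → V N x → V (N ℕ.+ E) (g x)
    V-Form F with V-act (top F) | V-rest F
    ... | E , f | E′ , h = E ℕ.+ E′ , λ {N} {x} Vx → V-resp (sym (Form-split F x))
      (V-+ (V-mono (ℕ.+-monoʳ-≤ N (ℕ.m≤m+n E E′)) (f Vx))
           (V-mono (ℕ.+-monoʳ-≤ N (ℕ.m≤n+m E′ E)) (h (V-mono (ℕ.m≤m+n N N) Vx))))

    -- θ contracts, hence so does everything in a form but its top.
    V-rest : ∀ {d g} (F : Form d g) → ∃[ E ] ∀ {N x} → V (N ℕ.+ N) x → V (N ℕ.+ E) (rest F x)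
    V-rest (leaf _ _)               = 0 , λ _ → V-0
    V-rest (node T B F e)
      with uniform {P = λ i E → ∀ {N x} → V N x → V (N ℕ.+ E) (B i x)}
             (λ i k≤l f {N} Vx → V-mono (ℕ.+-monoʳ-≤ N k≤l) (f Vx)) (λ i → V-Form (F i))
    ... | E , f = E , λ Vx → V-sum λ i → f i (V-θ i Vx)

  module _ {s} {A : Set s} where
    eval : (A → Carrier) → LinTerm q A → Carrier
    eval ρ (var x)  = ρ x
    eval ρ 0ᴸ       = 0#
    eval ρ (t +ᴸ u) = eval ρ t + eval ρ u
    eval ρ (-ᴸ t)   = - eval ρ t
    eval ρ (zᴸ t)   = z (eval ρ t)
    eval ρ (τᴸ t)   = τ (eval ρ t)
    eval ρ (θᴸ i t) = θ i (eval ρ t)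

    eval-cong : ∀ {ρ ρ′ : A → Carrier} → (∀ x → ρ x ≈ ρ′ x) → ∀ t → eval ρ t ≈ eval ρ′ t
    eval-cong e (var x)  = e x
    eval-cong e 0ᴸ       = refl
    eval-cong e (t +ᴸ u) = +-cong (eval-cong e t) (eval-cong e u)
    eval-cong e (-ᴸ t)   = -‿cong (eval-cong e t)
    eval-cong e (zᴸ t)   = Additive.cong z-add (eval-cong e t)
    eval-cong e (τᴸ t)   = Additive.cong τ-add (eval-cong e t)
    eval-cong e (θᴸ i t) = Additive.cong (θ-add i) (eval-cong e t)

    eval-+ : ∀ (ρ ρ′ : A → Carrier) t → eval (λ x → ρ x + ρ′ x) t ≈ eval ρ t + eval ρ′ t
    eval-+ ρ ρ′ (var x)  = refl
    eval-+ ρ ρ′ 0ᴸ       = sym (+-identityˡ 0#)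
    eval-+ ρ ρ′ (t +ᴸ u) = trans (+-cong (eval-+ ρ ρ′ t) (eval-+ ρ ρ′ u))
      (solve (_ ∷ _ ∷ _ ∷ _ ∷ []) (a₀ ⊕ a₁ ⊕ (a₂ ⊕ a₃)) (a₀ ⊕ a₂ ⊕ (a₁ ⊕ a₃)))
    eval-+ ρ ρ′ (-ᴸ t)   = trans (-‿cong (eval-+ ρ ρ′ t)) (solve (_ ∷ _ ∷ []) (⊝ (a₀ ⊕ a₁)) (⊝ a₀ ⊕ ⊝ a₁))
    eval-+ ρ ρ′ (zᴸ t)   = trans (Additive.cong z-add (eval-+ ρ ρ′ t)) (Additive.homo z-add _ _)
    eval-+ ρ ρ′ (τᴸ t)   = trans (Additive.cong τ-add (eval-+ ρ ρ′ t)) (Additive.homo τ-add _ _)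
    eval-+ ρ ρ′ (θᴸ i t) = trans (Additive.cong (θ-add i) (eval-+ ρ ρ′ t)) (Additive.homo (θ-add i) _ _)

    eval-0 : ∀ t → eval (λ _ → 0#) t ≈ 0#
    eval-0 (var x)  = refl
    eval-0 0ᴸ       = refl
    eval-0 (t +ᴸ u) = trans (+-cong (eval-0 t) (eval-0 u)) (+-identityˡ 0#)
    eval-0 (-ᴸ t)   = trans (-‿cong (eval-0 t)) -0≈0
    eval-0 (zᴸ t)   = trans (Additive.cong z-add (eval-0 t)) (add-0 z-add)
    eval-0 (τᴸ t)   = trans (Additive.cong τ-add (eval-0 t)) (add-0 τ-add)
    eval-0 (θᴸ i t) = θ-0 (eval-0 t) i

    eval-neg : ∀ (ρ : A → Carrier) t → eval (λ x → - ρ x) t ≈ - eval ρ t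
    eval-neg ρ t = AbelianGroupProperties.inverseˡ-unique group _ _
      (trans (sym (eval-+ (λ x → - ρ x) ρ t)) (trans (eval-cong (λ x → inverseˡ (ρ x)) t) (eval-0 t)))

    eval-sub : ∀ (ρ ρ′ : A → Carrier) t → eval (λ x → ρ x + - ρ′ x) t ≈ eval ρ t + - eval ρ′ t
    eval-sub ρ ρ′ t = trans (eval-+ ρ (λ x → - ρ′ x) t) (+-congˡ (eval-neg ρ′ t))

    V-eval : (β : A → ℕ) → ∀ t → ∃[ N ] ∀ ρ → (∀ x → V (β x) (ρ x)) → V N (eval ρ t)
    V-eval β (var x)  = β x , λ ρ f → f x
    V-eval β 0ᴸ       = 0 , λ _ _ → V-0
    V-eval β (t +ᴸ u) with V-eval β t | V-eval β u
    ... | E , f | E′ , g = E ℕ.+ E′ , λ ρ h → V-+ (V-mono (ℕ.m≤m+n E E′) (f ρ h)) (V-mono (ℕ.m≤n+m E′ E) (g ρ h))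
    V-eval β (-ᴸ t)   with V-eval β t
    ... | E , f = E , λ ρ h → V-neg (f ρ h)
    V-eval β (zᴸ t)   with V-eval β t
    ... | E , f = suc E , λ ρ h → V-z (f ρ h)
    V-eval β (τᴸ t)   with V-eval β t
    ... | E , f = suc q ℕ.* E , λ ρ h → V-τ (f ρ h)
    V-eval β (θᴸ i t) with V-eval β t
    ... | E , f = E , λ ρ h → V-θ′ i (f ρ h)

  infix 9 _⟪_⟫
  _⟪_⟫ : ∀ {s t} {A : Set s} {B : Set t} → LinTerm q A → (A → LinTerm q B) → LinTerm q B
  var x    ⟪ σ ⟫ = σ x
  0ᴸ       ⟪ σ ⟫ = 0ᴸ
  (t +ᴸ u) ⟪ σ ⟫ = t ⟪ σ ⟫ +ᴸ u ⟪ σ ⟫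
  (-ᴸ t)   ⟪ σ ⟫ = -ᴸ t ⟪ σ ⟫
  zᴸ t     ⟪ σ ⟫ = zᴸ (t ⟪ σ ⟫)
  τᴸ t     ⟪ σ ⟫ = τᴸ (t ⟪ σ ⟫)
  θᴸ i t   ⟪ σ ⟫ = θᴸ i (t ⟪ σ ⟫)

  eval-⟪⟫ : ∀ {s t} {A : Set s} {B : Set t} (ρ : B → Carrier) (σ : A → LinTerm q B) t →
    eval ρ (t ⟪ σ ⟫) ≡ eval (λ x → eval ρ (σ x)) t
  eval-⟪⟫ ρ σ (var x)  = ≡.refl
  eval-⟪⟫ ρ σ 0ᴸ       = ≡.refl
  eval-⟪⟫ ρ σ (t +ᴸ u) = ≡.cong₂ _+_ (eval-⟪⟫ ρ σ t) (eval-⟪⟫ ρ σ u)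
  eval-⟪⟫ ρ σ (-ᴸ t)   = ≡.cong -_ (eval-⟪⟫ ρ σ t)
  eval-⟪⟫ ρ σ (zᴸ t)   = ≡.cong z (eval-⟪⟫ ρ σ t)
  eval-⟪⟫ ρ σ (τᴸ t)   = ≡.cong τ (eval-⟪⟫ ρ σ t)
  eval-⟪⟫ ρ σ (θᴸ i t) = ≡.cong (θ i) (eval-⟪⟫ ρ σ t)

  infixr 7 _·ᴸ_
  _·ᴸ_ : ∀ {s} {A : Set s} → Scalar → LinTerm q A → LinTerm q A
  𝟘       ·ᴸ t = 0ᴸ
  𝟙       ·ᴸ t = t
  𝕫       ·ᴸ t = zᴸ t
  (s ⊞ u) ·ᴸ t = s ·ᴸ t +ᴸ u ·ᴸ t
  (s ⊡ u) ·ᴸ t = s ·ᴸ (u ·ᴸ t)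
  (⊟ s)   ·ᴸ t = -ᴸ (s ·ᴸ t)

  eval-· : ∀ {s} {A : Set s} (ρ : A → Carrier) s t → eval ρ (s ·ᴸ t) ≡ act s (eval ρ t)
  eval-· ρ 𝟘       t = ≡.refl
  eval-· ρ 𝟙       t = ≡.refl
  eval-· ρ 𝕫       t = ≡.refl
  eval-· ρ (s ⊞ u) t = ≡.cong₂ _+_ (eval-· ρ s t) (eval-· ρ u t)
  eval-· ρ (s ⊡ u) t = ≡.trans (eval-· ρ s (u ·ᴸ t)) (≡.cong (act s) (eval-· ρ u t))
  eval-· ρ (⊟ s)   t = ≡.cong -_ (eval-· ρ s t)

  assembleᴸ : ∀ {s} {A : Set s} {n} → (Fin n → LinTerm q A) → LinTerm q A
  assembleᴸ {n = zero}  t = 0ᴸ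
  assembleᴸ {n = suc n} t = τᴸ (t zero) +ᴸ zᴸ (assembleᴸ (t ∘ suc))

  eval-assemble : ∀ {s} {A : Set s} {n} (ρ : A → Carrier) (t : Fin n → LinTerm q A) →
    eval ρ (assembleᴸ t) ≡ assemble (λ i → eval ρ (t i))
  eval-assemble {n = zero}  ρ t = ≡.refl
  eval-assemble {n = suc n} ρ t = ≡.cong (λ u → τ (eval ρ (t zero)) + z u) (eval-assemble ρ (t ∘ suc))

-- Linear systems over filtered modules

≤-by : ∀ {m n} d → m ℕ.+ d ≡ n → m ≤ n
≤-by d ≡.refl = ℕ.m≤m+n _ d

decideAll : ∀ {n p r} {P : Fin n → Set p} {Q : Fin n → Set r} →
  (∀ i → P i ⊎ Q i) → (∀ i → P i) ⊎ ∃ Q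
decideAll {zero}  f = inj₁ λ ()
decideAll {suc n} f with f zero | decideAll (f ∘ suc)
... | inj₂ q | _              = inj₂ (zero , q)
... | inj₁ p | inj₂ (i , q)   = inj₂ (suc i , q)
... | inj₁ p | inj₁ ps        = inj₁ λ { zero → p ; (suc i) → ps i }

module AlmostInverse {q a ℓ v} (M : FilteredModule q a ℓ v) where
  open Forms M
  open SetoidReasoning setoid

  Vector : ℕ → Set a
  Vector m = Fin m → Carrier

  -- Injective and surjective up to bounded errors.
  record AlmostIso {m} (B : Vector m → Vector m) : Set (a ⊔ v) where
    field
      bounded : ∀ K → ∃[ K′ ] ∀ (y : Vector m) → (∀ r → V K (B y r)) → ∀ i → V K′ (y i)
      onto    : ∃[ C ] ∀ (u : Vector m) → ∃[ y ] ∀ (r : Fin m) → V C (u r + - B y r)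

  cons : ∀ {m} → Carrier → Vector m → Vector (suc m)
  cons x y zero    = x
  cons x y (suc i) = y i

  triangular : ∀ {m} → (Fin m → Fin m → Scalar) → Vector m → Vector m
  triangular T y r = sum (λ i → act (T r i) (y i))

  Lower : ∀ {m} → (Fin m → Fin m → Scalar) → Set (a ⊔ ℓ)
  Lower T = ∀ r i → toℕ r < toℕ i → ∀ x → act (T r i) x ≈ 0#

  module _ {m} (T : Fin (suc m) → Fin (suc m) → Scalar) (low : Lower T) where
    T′ : Fin m → Fin m → Scalar
    T′ r i = T (suc r) (suc i)

    low′ : Lower T′
    low′ r i r<i = low (suc r) (suc i) (s≤s r<i)

    triangular-zero : ∀ y → triangular T y zero ≈ act (T zero zero) (y zero)
    triangular-zero y = trans (+-congˡ (sum-0 λ i → low zero (suc i) (s≤s z≤n) (y (suc i)))) (+-identityʳ _)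

  -- Forward substitution: row zero bounds `y zero`, and removing its contribution leaves a smaller
  -- triangular system with bounded values.
  triangular-bounded : ∀ {m} (T : Fin m → Fin m → Scalar) → Lower T → (∀ i → Divisor (T i i)) →
    ∃[ C ] ∀ {N} (y : Vector m) → (∀ r → V N (triangular T y r)) → ∀ i → V (N ℕ.+ C) (y i)
  triangular-bounded {zero}  T low D = 0 , λ _ _ ()
  triangular-bounded {suc m} T low D
    with D zero | triangular-bounded (T′ T low) (low′ T low) (D ∘ suc)
       | uniform {P = λ r E → ∀ {N x} → V N x → V (N ℕ.+ E) (act (T (suc r) zero) x)}
           (λ r k≤l f {N} Vx → V-mono (ℕ.+-monoʳ-≤ N k≤l) (f Vx)) (λ r → V-act (T (suc r) zero))
  ... | C₀ , d₀ , _ | C , ih | E , e = C₀ ℕ.+ E ℕ.+ C , bnd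
    where
    bnd : ∀ {N} (y : Vector (suc m)) → (∀ r → V N (triangular T y r)) → ∀ i → V (N ℕ.+ (C₀ ℕ.+ E ℕ.+ C)) (y i)
    bnd {N} y Vy zero    = V-mono (≤-by (E ℕ.+ C) (eq N C₀ E C)) (d₀ (V-resp (triangular-zero T low y) (Vy zero)))
      where
      eq : ∀ N a b c → N ℕ.+ a ℕ.+ (b ℕ.+ c) ≡ N ℕ.+ (a ℕ.+ b ℕ.+ c)
      eq = solve-∀
    bnd {N} y Vy (suc i) = V-mono (ℕ.≤-reflexive (eq N C₀ E C)) (ih (y ∘ suc) below i)
      where
      eq : ∀ N a b c → N ℕ.+ a ℕ.+ b ℕ.+ c ≡ N ℕ.+ (a ℕ.+ b ℕ.+ c)
      eq = solve-∀
      below : ∀ r → V (N ℕ.+ C₀ ℕ.+ E) (triangular (T′ T low) (y ∘ suc) r)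
      below r = V-resp
        (solve (act (T (suc r) zero) (y zero) ∷ triangular (T′ T low) (y ∘ suc) r ∷ []) (a₀ ⊕ a₁ ⊕ ⊝ a₀) a₁)
        (V-sub (V-mono (≤-by (C₀ ℕ.+ E) (≡.sym (ℕ.+-assoc N C₀ E))) (Vy (suc r)))
               (e r (d₀ (V-resp (triangular-zero T low y) (Vy zero)))))

  triangular-onto : ∀ {m} (T : Fin m → Fin m → Scalar) → Lower T → (∀ i → Divisor (T i i)) →
    ∃[ C ] ∀ (u : Vector m) → ∃[ y ] ∀ (r : Fin m) → V C (u r + - triangular T y r)
  triangular-onto {zero}  T low D = 0 , λ u → u , λ ()
  triangular-onto {suc m} T low D with D zero | triangular-onto (T′ T low) (low′ T low) (D ∘ suc)
  ... | C₀ , _ , d₀ | C , ih = C₀ ℕ.+ C , λ u →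
    let y₀ , V₀ = d₀ (u zero)
        y , Vy  = ih (λ r → u (suc r) + - act (T (suc r) zero) y₀)
    in cons y₀ y , λ
      { zero    → V-mono (ℕ.m≤m+n C₀ C) (V-resp (+-congˡ (-‿cong (sym (triangular-zero T low (cons y₀ y))))) V₀)
      ; (suc r) → V-mono (ℕ.m≤n+m C C₀) (V-resp
          (solve (u (suc r) ∷ act (T (suc r) zero) y₀ ∷ triangular (T′ T low) y r ∷ [])
            (a₀ ⊕ ⊝ a₁ ⊕ ⊝ a₂) (a₀ ⊕ ⊝ (a₁ ⊕ a₂))) (Vy r)) }

  -- Inverting `T` costs a constant in order while `ε` halves orders, so `T` dominates above some
  -- threshold. Both parts of `AlmostIso` descend to a threshold one unit at a time: the order of y
  -- if `B y` is bounded, and the order of the residue if `B y = u` is solved by successive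
  -- approximation.
  module Contraction {m} (B T ε : Vector m → Vector m)
    (split : ∀ y r → B y r ≈ T y r + ε y r)
    (B-+ : ∀ x y r → B (λ i → x i + y i) r ≈ B x r + B y r)
    (B-0 : ∀ r → B (λ _ → 0#) r ≈ 0#)
    (T-bounded : ∃[ C ] ∀ {N} (y : Vector m) → (∀ r → V N (T y r)) → ∀ i → V (N ℕ.+ C) (y i))
    (T-onto : ∃[ C ] ∀ (u : Vector m) → ∃[ y ] ∀ (r : Fin m) → V C (u r + - T y r))
    (ε-contracts : ∃[ E ] ∀ {N} (y : Vector m) → (∀ i → V (N ℕ.+ N) (y i)) → ∀ r → V (N ℕ.+ E) (ε y r)) where

    private
      C₁ = proj₁ T-bounded
      C₂ = proj₁ T-onto
      E  = proj₁ ε-contracts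

    module Bounded (K : ℕ) where
      -- Above 2c + 1 the halving outweighs the three constants: an order of 2c + 2 + j is at most 2
      -- (c + 1 + j), and after `ε` and the inversion of `T` it has become c + (c + 1 + j).
      c = K ℕ.+ E ℕ.+ C₁

      go : ∀ j (y : Vector m) → (∀ r → V K (B y r)) → (∀ i → V (c ℕ.+ c ℕ.+ suc j) (y i)) → ∀ i → V (c ℕ.+ c ℕ.+ 1) (y i)
      go zero    y VB Vy = Vy
      go (suc j) y VB Vy = go j y VB λ i →
        V-mono (ℕ.≤-reflexive (eq₂ (suc j) K E C₁)) (proj₂ T-bounded y VT i)
        where
        eq₁ : ∀ c j → c ℕ.+ c ℕ.+ (2 ℕ.+ j) ℕ.+ j ≡ (c ℕ.+ (1 ℕ.+ j)) ℕ.+ (c ℕ.+ (1 ℕ.+ j))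
        eq₁ = solve-∀
        eq₂ : ∀ j k e d → (k ℕ.+ ((k ℕ.+ e ℕ.+ d) ℕ.+ j ℕ.+ e)) ℕ.+ d ≡ (k ℕ.+ e ℕ.+ d) ℕ.+ (k ℕ.+ e ℕ.+ d) ℕ.+ j
        eq₂ = solve-∀
        Vε : ∀ r → V (c ℕ.+ suc j ℕ.+ E) (ε y r)
        Vε = proj₂ ε-contracts y λ i → V-mono (≤-by j (eq₁ c j)) (Vy i)
        VT : ∀ r → V (K ℕ.+ (c ℕ.+ suc j ℕ.+ E)) (T y r)
        VT r = V-resp
          (trans (+-congʳ (split y r)) (solve (T y r ∷ ε y r ∷ []) (a₀ ⊕ a₁ ⊕ ⊝ a₁) a₀))
          (V-sub (V-mono (ℕ.m≤m+n K _) (VB r)) (V-mono (ℕ.m≤n+m _ K) (Vε r)))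

    -- For u of order 3k + 2 + j, a solution of `T y = u` up to V C₂ has order at most 4k + 2 + 2j.
    -- Halving it makes the residue `u - B y` of order at most 3k + 1 + j.
    k = C₂ ℕ.+ C₁ ℕ.+ E

    solveUpTo : ∀ j (u : Vector m) → (∀ r → V (k ℕ.+ k ℕ.+ k ℕ.+ suc j) (u r)) →
      ∃[ y ] ∀ (r : Fin m) → V (k ℕ.+ k ℕ.+ k ℕ.+ 1) (u r + - B y r)
    solveUpTo zero    u Vu = (λ _ → 0#) , λ r → V-resp
      (trans (solve (u r ∷ []) a₀ (a₀ ⊕ ⊝ nil)) (+-congˡ (-‿cong (sym (B-0 r))))) (Vu r)
    solveUpTo (suc j) u Vu =
      let y , Vy = proj₂ T-onto u
          n = k ℕ.+ k ℕ.+ k ℕ.+ (2 ℕ.+ j)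
          VT : ∀ r → V (n ℕ.+ C₂) (T y r)
          VT r = V-resp (solve (u r ∷ T y r ∷ []) (a₀ ⊕ ⊝ (a₀ ⊕ ⊝ a₁)) a₁)
            (V-sub (V-mono (ℕ.m≤m+n n C₂) (Vu r)) (V-mono (ℕ.m≤n+m C₂ n) (Vy r)))
          Vε : ∀ r → V (k ℕ.+ k ℕ.+ suc j ℕ.+ E) (ε y r)
          Vε = proj₂ ε-contracts y λ i → V-mono (≤-by (E ℕ.+ j) (eq₁ C₁ C₂ E j)) (proj₂ T-bounded y VT i)
          u′ = λ r → u r + - B y r
          Vu′ : ∀ r → V (k ℕ.+ k ℕ.+ k ℕ.+ suc j) (u′ r)
          Vu′ r = V-mono (≤-by C₁ (eq₂ C₁ C₂ E j)) (V-resp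
            (trans (solve (u r ∷ T y r ∷ ε y r ∷ []) (a₀ ⊕ ⊝ a₁ ⊕ ⊝ a₂) (a₀ ⊕ ⊝ (a₁ ⊕ a₂)))
                   (+-congˡ (-‿cong (sym (split y r)))))
            (V-sub (V-mono (ℕ.m≤n+m C₂ (k ℕ.+ k ℕ.+ suc j ℕ.+ E)) (Vy r)) (V-mono (ℕ.m≤m+n _ C₂) (Vε r))))
          y′ , Vy′ = solveUpTo j u′ Vu′
      in (λ i → y i + y′ i) , λ r → V-resp
           (trans (solve (u r ∷ B y r ∷ B y′ r ∷ []) (a₀ ⊕ ⊝ a₁ ⊕ ⊝ a₂) (a₀ ⊕ ⊝ (a₁ ⊕ a₂)))
                  (+-congˡ (-‿cong (sym (B-+ y y′ r))))) (Vy′ r)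
      where
      eq₁ : ∀ c₁ c₂ e j → let k = c₂ ℕ.+ c₁ ℕ.+ e in
        (k ℕ.+ k ℕ.+ k ℕ.+ (2 ℕ.+ j) ℕ.+ c₂ ℕ.+ c₁) ℕ.+ (e ℕ.+ j) ≡ (k ℕ.+ k ℕ.+ (1 ℕ.+ j)) ℕ.+ (k ℕ.+ k ℕ.+ (1 ℕ.+ j))
      eq₁ = solve-∀
      eq₂ : ∀ c₁ c₂ e j → let k = c₂ ℕ.+ c₁ ℕ.+ e in
        k ℕ.+ k ℕ.+ (1 ℕ.+ j) ℕ.+ e ℕ.+ c₂ ℕ.+ c₁ ≡ k ℕ.+ k ℕ.+ k ℕ.+ (1 ℕ.+ j)
      eq₂ = solve-∀

    almostIso : AlmostIso B
    almostIso = record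
      { bounded = λ K → let open Bounded K in c ℕ.+ c ℕ.+ 1 , λ y VB →
          let N , Vy = V-vec y
          in go N y VB λ i → V-mono (ℕ.≤-trans (ℕ.n≤1+n N) (ℕ.m≤n+m (suc N) (c ℕ.+ c))) (Vy i)
      ; onto = k ℕ.+ k ℕ.+ k ℕ.+ 1 , λ u →
          let N , Vu = V-vec u
          in solveUpTo N u λ r → V-mono (ℕ.≤-trans (ℕ.n≤1+n N) (ℕ.m≤n+m (suc N) (k ℕ.+ k ℕ.+ k))) (Vu r) }

  -- A square system of forms whose tops form a nondegenerate triangular matrix.
  module _ {m} (col : Fin m → Carrier → Vector m) (d : Fin m → ℕ)
    (F : ∀ i r → Form (d i) (λ y → col i y r))
    (low : Lower (λ r i → top (F i r))) (D : ∀ i → Divisor (top (F i i))) where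

    columns : Vector m → Vector m
    columns y r = sum (λ i → col i (y i) r)

    columns-iso : AlmostIso columns
    columns-iso = Contraction.almostIso columns (triangular (λ r i → top (F i r)))
      (λ y r → sum (λ i → rest (F i r) (y i)))
      (λ y r → trans (sum-cong λ i → Form-split (F i r) (y i))
        (∑-distrib-+ (λ i → act (top (F i r)) (y i)) (λ i → rest (F i r) (y i))))
      (λ x y r → trans (sum-cong λ i → Additive.homo (Form-additive (F i r)) (x i) (y i))
        (∑-distrib-+ (λ i → col i (x i) r) (λ i → col i (y i) r)))
      (λ r → sum-0 λ i → add-0 (Form-additive (F i r)))
      (triangular-bounded (λ r i → top (F i r)) low D)
      (triangular-onto (λ r i → top (F i r)) low D)
      (let E , e = uniform {P = λ i E → ∀ r {N x} → V (N ℕ.+ N) x → V (N ℕ.+ E) (rest (F i r) x)}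
                     (λ i k≤l f r {N} Vx → V-mono (ℕ.+-monoʳ-≤ N k≤l) (f r Vx))
                     (λ i → uniform {P = λ r E → ∀ {N x} → V (N ℕ.+ N) x → V (N ℕ.+ E) (rest (F i r) x)}
                       (λ r k≤l f {N} Vx → V-mono (ℕ.+-monoʳ-≤ N k≤l) (f Vx)) (λ r → V-rest (F i r)))
       in E , λ y Vy r → V-sum λ i → e i r (Vy i))

  sum-single : ∀ {n} (i : Fin n) x → sum (single i x) ≈ x
  sum-single {suc n} zero x = trans (+-congˡ (sum-0 {n} λ j → reflexive (single-other zero x {suc j} λ ()))) (+-identityʳ x)
  sum-single (suc i) x = trans (+-identityˡ _) (trans (sum-cong λ j → reflexive (shift j)) (sum-single i x))
    where
    shift : ∀ j → single (suc i) x (suc j) ≡ single i x j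
    shift j with i Fin.≟ j
    ... | yes _ = ≡.refl
    ... | no  _ = ≡.refl

  Dichotomy : (Carrier → Carrier) → Set (a ⊔ ℓ ⊔ v)
  Dichotomy h = (∀ x → h x ≈ 0#) ⊎ (∀ N → ∃[ x ] ¬ V N (h x))

  -- With a nonzero top the form is an almost injective system of size one, so arguments of large
  -- order have values of large order. With a zero top, `assemble` produces arguments with a single
  -- nonzero coordinate, and these isolate a branch that is not zero.
  Form-dichotomy : ∀ {d g} → Form d g → Dichotomy g
  Form-dichotomy {g = g} F with divisor? (top F)
  ... | inj₂ D = inj₂ λ N →
    let K , b = AlmostIso.bounded (columns-iso {1} (λ _ x _ → g x) (λ _ → _) (λ _ _ → F)
                  (λ { zero zero () }) (λ { zero → D })) N
        x , x∉ = V-large K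
    in x , λ Vg → x∉ (b (λ _ → x) (λ _ → V-resp (sym (+-identityʳ _)) Vg) zero)
  Form-dichotomy {g = g} (leaf T e) | inj₁ T≈0 = inj₁ λ x → trans (e x) (T≈0 x)
  Form-dichotomy {g = g} (node T B F e) | inj₁ T≈0 with decideAll (λ i → Form-dichotomy (F i))
  ... | inj₁ B≈0 = inj₁ λ x → trans (e x) (trans (+-cong (T≈0 x) (sum-0 λ i → B≈0 i (θ i x))) (+-identityʳ _))
  ... | inj₂ (i , large) = inj₂ λ N →
    let x , x∉ = large N
        y = assemble (single i x)
        others : ∀ j → j ≢ i → B j (θ j y) ≈ 0#
        others j j≢i = trans (Additive.cong (Form-additive (F j))
          (trans (θ-assemble (single i x) j) (reflexive (single-other i x j≢i)))) (add-0 (Form-additive (F j)))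
        r , e₁ , e₂ = sum-focus {f = λ j → B j (θ j y)} {g = single i (B i (θ i y))} i
          (λ j j≢i → trans (others j j≢i) (reflexive (≡.sym (single-other i _ j≢i))))
        total : g y ≈ B i x
        total = begin
          g y                                    ≈⟨ e y ⟩
          act T y + sum (λ j → B j (θ j y))      ≈⟨ +-cong (T≈0 y) e₁ ⟩
          0# + (B i (θ i y) + r)                 ≈⟨ +-identityˡ _ ⟩
          B i (θ i y) + r                        ≈⟨ +-congʳ (reflexive (single-same i (B i (θ i y)))) ⟨
          single i (B i (θ i y)) i + r           ≈⟨ e₂ ⟨
          sum (single i (B i (θ i y)))           ≈⟨ sum-single i (B i (θ i y)) ⟩
          B i (θ i y)                            ≈⟨ Additive.cong (Form-additive (F i))
                                                      (trans (θ-assemble (single i x) i) (reflexive (single-same i x))) ⟩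
          B i x                                  ∎
    in y , λ Vy → x∉ (V-resp total Vy)

-- Removing the Frobenius map from linear terms

module Splitting {q a ℓ v} (M : FilteredModule q a ℓ v) where
  open Forms M
  open AlmostInverse M

  Form-≡ : ∀ {d e g} → d ≡ e → Form d g → Form e g
  Form-≡ ≡.refl F = F

  Form-≤ : ∀ {d e g} → d ≤ e → Form d g → Form e g
  Form-≤ {d} {e} d≤e F = Form-≡ (ℕ.m∸n+n≡m d≤e) (Form-lift+ (e ℕ.∸ d) F)

  top-≤ : ∀ {d e g} (d≤e : d ≤ e) (F : Form d g) x → act (top (Form-≤ d≤e F)) x ≈ act (top F) x
  top-≤ {d} {e} d≤e F x = trans (top-≡ (ℕ.m∸n+n≡m d≤e) (Form-lift+ (e ℕ.∸ d) F) x) (top-lift+ (e ℕ.∸ d) F x)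
    where
    top-≡ : ∀ {d e g} (eq : d ≡ e) (F : Form d g) x → act (top (Form-≡ eq F)) x ≈ act (top F) x
    top-≡ ≡.refl F x = refl

  θ-form : ∀ i → Form 1 (θ i)
  θ-form i = node 𝟘 (pick i) (pick-form i) λ y → trans (sum-pick i (λ j → θ j y)) (sym (+-identityˡ _))
    where
    pick : ∀ {n} → Fin n → Fin n → Carrier → Carrier
    pick zero    zero    y = y
    pick zero    (suc j) y = 0#
    pick (suc i) zero    y = 0#
    pick (suc i) (suc j) y = pick i j y
    pick-form : ∀ {n} (i j : Fin n) → Form 0 (pick i j)
    pick-form zero    zero    = leaf 𝟙 λ _ → refl
    pick-form zero    (suc j) = leaf 𝟘 λ _ → refl
    pick-form (suc i) zero    = leaf 𝟘 λ _ → refl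
    pick-form (suc i) (suc j) = pick-form i j
    sum-pick : ∀ {n} (i : Fin n) (x : Fin n → Carrier) → x i ≈ sum (λ j → pick i j (x j))
    sum-pick {suc n} zero x = sym (trans (+-congˡ (sum-0 {n} λ j → refl)) (+-identityʳ _))
    sum-pick (suc i) x = trans (sum-pick i (x ∘ suc)) (sym (+-identityˡ _))

  add-sum : ∀ {h} → Additive h → ∀ {n} (f : Fin n → Carrier) → h (sum f) ≈ sum (λ i → h (f i))
  add-sum H {zero}  f = add-0 H
  add-sum H {suc n} f = trans (Additive.homo H _ _) (+-congˡ (add-sum H (f ∘ suc)))

  -- The scalar `T` stands under `θ i` here; since `θ i` is itself a form and forms admit
  -- precomposition with scalars, `θ i ∘ act T` is a form again, at the price of depth.
  Form-θ : ∀ i {d g} → Form d g → ∃[ d′ ] Form d′ (θ i ∘ g)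
  Form-θ i (leaf T e) = 1 , Form-resp (λ y → Additive.cong (θ-add i) (sym (e y))) (Form-act T (θ-form i))
  Form-θ i {suc d} (node T B F e)
    with uniform {P = λ k j → Form j (θ i ∘ B k)} (λ k → Form-≤) (λ k → Form-θ i (F k))
  ... | d′ , G = suc (suc d′) , Form-resp (λ y → sym (trans (Additive.cong (θ-add i) (e y))
        (trans (Additive.homo (θ-add i) _ _) (+-congˡ (trans (add-sum (θ-add i) (λ k → B k (θ k y))) (sym (+-identityˡ _)))))))
      (Form-+ (Form-≤ (s≤s z≤n) (Form-act T (θ-form i)))
              (Form-lift (node 𝟘 (λ k → θ i ∘ B k) G (λ y → refl))))

  -- One application of all `θ i` undoes one `τ`, because `θ zero ∘ τ` is the identity and the other
  -- composites vanish. The index counts these applications, and it grows only at `τ`.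
  data EventualForm : ℕ → (Carrier → Carrier) → Set (a ⊔ ℓ) where
    now   : ∀ {d g} → Form d g → EventualForm zero g
    later : ∀ {e g} → (∀ i → EventualForm e (θ i ∘ g)) → EventualForm (suc e) g

  EF-resp : ∀ {e} {g h : Carrier → Carrier} → (∀ x → g x ≈ h x) → EventualForm e g → EventualForm e h
  EF-resp eq (now F)   = now (Form-resp eq F)
  EF-resp eq (later F) = later λ i → EF-resp (λ x → Additive.cong (θ-add i) (eq x)) (F i)

  EF-θ : ∀ {e g} i → EventualForm e g → EventualForm e (θ i ∘ g)
  EF-θ i (now F)   = now (proj₂ (Form-θ i F))
  EF-θ i (later F) = later λ j → EF-θ j (F i)

  EF-lift : ∀ k {e g} → EventualForm e g → EventualForm (k ℕ.+ e) g
  EF-lift zero    F = F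
  EF-lift (suc k) F = later λ i → EF-θ i (EF-lift k F)

  EF-≡ : ∀ {d e g} → d ≡ e → EventualForm d g → EventualForm e g
  EF-≡ ≡.refl F = F

  EF-0 : ∀ e → EventualForm e (λ _ → 0#)
  EF-0 zero    = now (Form-0 0)
  EF-0 (suc e) = later λ i → EF-resp (λ _ → sym (add-0 (θ-add i))) (EF-0 e)

  EF-+ : ∀ {e g h} → EventualForm e g → EventualForm e h → EventualForm e (λ x → g x + h x)
  EF-+ (now {d} F) (now {d′} G) = now (Form-+ (Form-≤ (ℕ.m≤m+n d d′) F) (Form-≤ (ℕ.m≤n+m d′ d) G))
  EF-+ (later F) (later G) = later λ i → EF-resp (λ x → sym (Additive.homo (θ-add i) _ _)) (EF-+ (F i) (G i))

  EF-neg : ∀ {e g} → EventualForm e g → EventualForm e (λ x → - g x)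
  EF-neg (now F)   = now (Form-neg F)
  EF-neg (later F) = later λ i → EF-resp (λ x → sym (add-neg (θ-add i) _)) (EF-neg (F i))

  z-form : ∀ {d g} → Form d g → Form d (z ∘ g)
  z-form (leaf T e)     = leaf (𝕫 ⊡ T) λ y → Additive.cong z-add (e y)
  z-form (node T B F e) = node (𝕫 ⊡ T) (λ i → z ∘ B i) (λ i → z-form (F i)) λ y →
    trans (Additive.cong z-add (e y)) (trans (Additive.homo z-add _ _) (+-congˡ (add-sum z-add (λ i → B i (θ i y)))))

  EF-z : ∀ {e g} → EventualForm e g → EventualForm e (z ∘ g)
  EF-z (now F)   = now (z-form F)
  EF-z (later F) = later λ
    { zero    → EF-resp (λ x → sym (θ-z-zero _)) (EF-z (F (fromℕ q)))
    ; (suc i) → EF-resp (λ x → sym (θ-z-suc i _)) (F (inject₁ i)) }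

  EF-τ : ∀ {e g} → EventualForm e g → EventualForm (suc e) (τ ∘ g)
  EF-τ {e} F = later λ
    { zero    → EF-resp (λ x → sym (θ-τ-zero _)) F
    ; (suc i) → EF-resp (λ x → sym (θ-τ-suc _ i)) (EF-0 e) }

  EF-dichotomy : ∀ {e g} → EventualForm e g → Dichotomy g
  EF-dichotomy (now F)   = Form-dichotomy F
  EF-dichotomy (later F) with decideAll (λ i → EF-dichotomy (F i))
  ... | inj₁ zeros       = inj₁ λ x → θ-zero λ i → zeros i x
  ... | inj₂ (i , large) = inj₂ λ N → let x , x∉ = large N in x , λ Vx → x∉ (V-θ′ i Vx)

  module _ {s} {A : Set s} where
    τ-depth : LinTerm q A → ℕ
    τ-depth (var x)  = 0
    τ-depth 0ᴸ       = 0
    τ-depth (t +ᴸ u) = τ-depth t ℕ.+ τ-depth u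
    τ-depth (-ᴸ t)   = τ-depth t
    τ-depth (zᴸ t)   = τ-depth t
    τ-depth (τᴸ t)   = suc (τ-depth t)
    τ-depth (θᴸ i t) = τ-depth t

    -- One-parameter families of assignments, each variable being 0 or the parameter.
    Simple : (Carrier → A → Carrier) → Set (a ⊔ ℓ ⊔ s)
    Simple σ = ∀ x → Form 0 (λ y → σ y x)

    eval-EF : ∀ {σ} → Simple σ → ∀ t → EventualForm (τ-depth t) (λ y → eval (σ y) t)
    eval-EF S (var x)  = now (S x)
    eval-EF S 0ᴸ       = EF-0 0
    eval-EF S (t +ᴸ u) = EF-+
      (EF-≡ (ℕ.+-comm (τ-depth u) (τ-depth t)) (EF-lift (τ-depth u) (eval-EF S t)))
      (EF-lift (τ-depth t) (eval-EF S u))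
    eval-EF S (-ᴸ t)   = EF-neg (eval-EF S t)
    eval-EF S (zᴸ t)   = EF-z (eval-EF S t)
    eval-EF S (τᴸ t)   = EF-τ (eval-EF S t)
    eval-EF S (θᴸ i t) = EF-θ i (eval-EF S t)

    FormTerm : LinTerm q A → Set (a ⊔ ℓ ⊔ s)
    FormTerm t = ∀ {σ} → Simple σ → ∃[ d ] Form d (λ y → eval (σ y) t)

    splits : ℕ → LinTerm q A → List (LinTerm q A)
    splits zero    t = t ∷ []
    splits (suc e) t = List.concat (List.tabulate λ i → splits e (θᴸ i t))

    splits-form : ∀ e t → (∀ {σ} → Simple σ → EventualForm e (λ y → eval (σ y) t)) → All FormTerm (splits e t)
    splits-form zero    t F = (λ S → EF-now (F S)) ∷ []
      where
      EF-now : ∀ {g} → EventualForm 0 g → ∃[ d ] Form d g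
      EF-now (now F) = _ , F
    splits-form (suc e) t F = All.concat⁺ (All.tabulate⁺ λ i → splits-form e (θᴸ i t) λ S → EF-later (F S) i)
      where
      EF-later : ∀ {e g} → EventualForm (suc e) g → ∀ i → EventualForm e (θ i ∘ g)
      EF-later (later F) = F

    normalise : LinTerm q A → List (LinTerm q A)
    normalise t = splits (τ-depth t) t

    normalise-form : ∀ t → All FormTerm (normalise t)
    normalise-form t = splits-form (τ-depth t) t λ S → eval-EF S t

    splits-zero⁺ : ∀ e {ρ} t → eval ρ t ≈ 0# → All (λ u → eval ρ u ≈ 0#) (splits e t)
    splits-zero⁺ zero    t eq = eq ∷ []
    splits-zero⁺ (suc e) t eq = All.concat⁺ (All.tabulate⁺ λ i → splits-zero⁺ e (θᴸ i t) (θ-0 eq i))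

    splits-zero⁻ : ∀ e {ρ} t → All (λ u → eval ρ u ≈ 0#) (splits e t) → eval ρ t ≈ 0#
    splits-zero⁻ zero    t (eq ∷ []) = eq
    splits-zero⁻ (suc e) t zeros = θ-zero λ i → splits-zero⁻ e (θᴸ i t) (All.tabulate⁻ {f = λ j → splits e (θᴸ j t)} (All.concat⁻ zeros) i)

    splits-V : ∀ e {ρ N} t → V N (eval ρ t) → All (λ u → V N (eval ρ u)) (splits e t)
    splits-V zero    t Vt = Vt ∷ []
    splits-V (suc e) t Vt = All.concat⁺ (All.tabulate⁺ λ i → splits-V e (θᴸ i t) (V-θ′ i Vt))

-- Column reduction of a system of forms: a column whose top has been cleared
-- by the pivots contracts, so that it splits into columns for the coordinates
-- of its variable, all of smaller depth.
module Reduction {q a ℓ v} (M : FilteredModule q a ℓ v)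
  {m k : ℕ} (E : Fin m → LinTerm q (Fin k)) where
  open Forms M
  open AlmostInverse M
  open Splitting M
  open SetoidReasoning setoid

  record Column : Set (a ⊔ ℓ) where
    field
      depth : ℕ
      fun   : Carrier → Vector m
      form  : ∀ i → Form depth (λ x → fun x i)

    tops : Fin m → Scalar
    tops i = top (form i)

    additive : ∀ i → Additive (λ x → fun x i)
    additive i = Form-additive (form i)

  open Column

  -- The condition `above` makes the tops of the filled slots lower triangular, with the pivots on
  -- the diagonal.
  record Slot (i : Fin m) : Set (a ⊔ ℓ ⊔ v) where
    field
      column : Column
      above  : ∀ j → toℕ j < toℕ i → ∀ x → act (tops column j) x ≈ 0#
      pivot  : Divisor (tops column i)

  open Slot

  Slots : Set (a ⊔ ℓ ⊔ v)
  Slots = ∀ i → Maybe (Slot i)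

  slotFun : ∀ {i} → Maybe (Slot i) → Carrier → Vector m
  slotFun nothing  x r = 0#
  slotFun (just s) x r = fun (column s) x r

  slot-additive : ∀ {i} (s : Maybe (Slot i)) r → Additive (λ x → slotFun s x r)
  slot-additive nothing  r = 0-additive
  slot-additive (just s) r = additive (column s) r

  data Var (n r : ℕ) : Set where
    slotV : Fin m → Var n r
    workV : Fin n → Var n r
    freeV : Fin r → Var n r

  total : ∀ {n r} → Slots → Vec Column n → (Var n r → Carrier) → Vector m
  total slots work ρ i = sum (λ j → slotFun (slots j) (ρ (slotV j)) i)
                       + sum (λ j → fun (Vec.lookup work j) (ρ (workV j)) i)

  Env : ∀ {s t} {A : Set s} {B : Set t} → (A → Carrier) → (B → Carrier) → A ⊎ B → Carrier
  Env ρ u (inj₁ x) = ρ x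
  Env ρ u (inj₂ x) = u x

  none : ∀ {t} {B : Set t} → B → Carrier
  none _ = 0#

  -- `U` expresses the original unknowns through the variables of the current columns. The bounded
  -- parameters `Bd` are remainders of divisions by pivots: a substitution by a multiple of a pivot
  -- is onto only up to V C. They vanish in `lin`; by additivity they contribute just a bounded
  -- error.
  record State {n} (slots : Slots) (work : Vec Column n) : Set (lsuc Level.zero ⊔ a ⊔ ℓ ⊔ v) where
    field
      r    : ℕ
      Bd   : Set
      β    : Bd → ℕ
      U    : Fin k → LinTerm q (Var n r ⊎ Bd)
      surj : ∀ (w : Fin k → Carrier) → ∃[ ρ ] ∃[ u ] (∀ b → V (β b) (u b)) × (∀ j → w j ≈ eval (Env ρ u) (U j))
      lin  : ∀ ρ i → eval (λ j → eval (Env ρ none) (U j)) (E i) ≈ total slots work ρ i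

  record Step {n n′} (slots : Slots) (work : Vec Column n) (slots′ : Slots) (work′ : Vec Column n′) (r : ℕ)
      : Set (lsuc Level.zero ⊔ a ⊔ ℓ ⊔ v) where
    field
      r′   : ℕ
      Bd   : Set
      β    : Bd → ℕ
      Φ    : Var n r → LinTerm q (Var n′ r′ ⊎ Bd)
      surj : ∀ (ρ : Var n r → Carrier) → ∃[ ρ′ ] ∃[ u ] (∀ b → V (β b) (u b)) × (∀ x → ρ x ≈ eval (Env ρ′ u) (Φ x))
      lin  : ∀ ρ′ i → total slots work (λ x → eval (Env ρ′ none) (Φ x)) i ≈ total slots′ work′ ρ′ i

  advance : ∀ {n n′ slots slots′} {work : Vec Column n} {work′ : Vec Column n′} →
    (st : State slots work) → Step slots work slots′ work′ (State.r st) → State slots′ work′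
  advance {n′ = n′} st step = record
    { r    = Step.r′ step
    ; Bd   = State.Bd st ⊎ Step.Bd step
    ; β    = [ State.β st , Step.β step ]
    ; U    = λ j → State.U st j ⟪ σ ⟫
    ; surj = λ w →
        let ρ , u , Vu , w≈   = State.surj st w
            ρ′ , u′ , Vu′ , ρ≈ = Step.surj step ρ
        in ρ′ , [ u , u′ ] , (λ { (inj₁ b) → Vu b ; (inj₂ b) → Vu′ b }) , λ j → trans (w≈ j)
             (trans (eval-cong (λ { (inj₁ x) → trans (ρ≈ x) (σ-eval ρ′ u u′ (λ _ → refl) x) ; (inj₂ b) → refl }) (State.U st j))
                    (reflexive (≡.sym (eval-⟪⟫ _ σ (State.U st j)))))
    ; lin  = λ ρ′ i → trans
        (eval-cong (λ j → trans (reflexive (eval-⟪⟫ (Env ρ′ none) σ (State.U st j)))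
           (eval-cong (λ { (inj₁ x) → sym (σ-eval ρ′ none none (λ { (inj₁ _) → refl ; (inj₂ _) → refl }) x) ; (inj₂ b) → refl }) (State.U st j))) (E i))
        (trans (State.lin st (λ x → eval (Env ρ′ none) (Step.Φ step x)) i) (Step.lin step ρ′ i)) }
    where
    ren : Var n′ (Step.r′ step) ⊎ Step.Bd step → LinTerm q (Var n′ (Step.r′ step) ⊎ (State.Bd st ⊎ Step.Bd step))
    ren (inj₁ x) = var (inj₁ x)
    ren (inj₂ b) = var (inj₂ (inj₂ b))
    σ : Var _ (State.r st) ⊎ State.Bd st → LinTerm q (Var n′ (Step.r′ step) ⊎ (State.Bd st ⊎ Step.Bd step))
    σ (inj₁ x) = Step.Φ step x ⟪ ren ⟫
    σ (inj₂ b) = var (inj₂ (inj₁ b))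
    σ-eval : ∀ ρ′ u u′ {u″} → (∀ b → u″ b ≈ [ u , u′ ] b) → ∀ x → eval (Env ρ′ u′) (Step.Φ step x) ≈ eval (Env ρ′ u″) (σ (inj₁ x))
    σ-eval ρ′ u u′ eq x = sym (trans (reflexive (eval-⟪⟫ (Env ρ′ _) ren (Step.Φ step x)))
      (eval-cong (λ { (inj₁ y) → refl ; (inj₂ b) → eq (inj₂ b) }) (Step.Φ step x)))

  private variable
    n r : ℕ
    slots : Slots
    h : Column
    work : Vec Column n

  drop : (∀ x i → fun h x i ≈ 0#) → Step slots (h ∷ work) slots work r
  drop {h = h} {r = r} zeros = record
    { r′ = suc r ; Bd = ⊥ ; β = λ ()
    ; Φ = λ { (slotV j) → var (inj₁ (slotV j)) ; (workV zero) → var (inj₁ (freeV zero))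
            ; (workV (suc j)) → var (inj₁ (workV j)) ; (freeV j) → var (inj₁ (freeV (suc j))) }
    ; surj = λ ρ → (λ { (slotV j) → ρ (slotV j) ; (workV j) → ρ (workV (suc j))
                      ; (freeV zero) → ρ (workV zero) ; (freeV (suc j)) → ρ (freeV j) }) , (λ ()) , (λ ())
        , λ { (slotV j) → refl ; (workV zero) → refl ; (workV (suc j)) → refl ; (freeV j) → refl }
    ; lin = λ ρ′ i → +-congˡ (trans (+-congʳ (zeros _ i)) (+-identityˡ _)) }

  update : (i : Fin m) → Slot i → Slots → Slots
  update i s slots j with j Fin.≟ i
  ... | yes ≡.refl = just s
  ... | no _       = slots j

  update-same : ∀ i s slots → update i s slots i ≡ just s
  update-same i s slots with i Fin.≟ i
  ... | yes ≡.refl = ≡.refl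
  ... | no i≢i     = contradiction ≡.refl i≢i

  update-other : ∀ {i j} s slots → j ≢ i → update i s slots j ≡ slots j
  update-other {i} {j} s slots j≢i with j Fin.≟ i
  ... | yes j≡i = contradiction j≡i j≢i
  ... | no _    = ≡.refl

  data Two : Set where
    x₀ x₁ : Two

  two : Carrier → Carrier → Two → Carrier
  two y x x₀ = y
  two y x x₁ = x

  -- A column operation involves only the variable of one slot and that of the first waiting column.
  -- It is verified on these two variables and then transported to a full state.
  record PairStep {i} (s : Maybe (Slot i)) (h : Column) (s′ : Slot i) (h′ : Column) : Set (lsuc Level.zero ⊔ a ⊔ ℓ ⊔ v) where
    field
      Bd  : Set
      β   : Bd → ℕ
      φ   : Two → LinTerm q (Two ⊎ Bd)
      surj : ∀ (ρ : Two → Carrier) → ∃[ ρ′ ] ∃[ u ] (∀ b → V (β b) (u b)) × (∀ x → ρ x ≈ eval (Env ρ′ u) (φ x))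
      lin : ∀ y x r → slotFun s (eval (Env (two y x) none) (φ x₀)) r + fun h (eval (Env (two y x) none) (φ x₁)) r
                    ≈ fun (column s′) y r + fun h′ x r

  pairStep : ∀ i {s′ h′} → PairStep (slots i) h s′ h′ → Step slots (h ∷ work) (update i s′ slots) (h′ ∷ work) r
  pairStep {slots} {h} {n} {work} {r} i {s′} {h′} pair = record
    { r′ = r ; Bd = PS.Bd ; β = PS.β ; Φ = Φ ; surj = surj ; lin = lin }
    where
    module PS = PairStep pair
    emb : Two ⊎ PS.Bd → Var (suc n) r ⊎ PS.Bd
    emb (inj₁ x₀) = inj₁ (slotV i)
    emb (inj₁ x₁) = inj₁ (workV zero)
    emb (inj₂ b)  = inj₂ b
    Φ : Var (suc n) r → LinTerm q (Var (suc n) r ⊎ PS.Bd)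
    Φ (slotV j) with j Fin.≟ i
    ... | yes _ = PS.φ x₀ ⟪ var ∘ emb ⟫
    ... | no _  = var (inj₁ (slotV j))
    Φ (workV zero)    = PS.φ x₁ ⟪ var ∘ emb ⟫
    Φ (workV (suc j)) = var (inj₁ (workV (suc j)))
    Φ (freeV j)       = var (inj₁ (freeV j))
    Φ-eval : ∀ (ρ′ : Var (suc n) r → Carrier) {y} u x → ρ′ (slotV i) ≈ y →
      eval (Env ρ′ u) (PS.φ x ⟪ var ∘ emb ⟫) ≈ eval (Env (two y (ρ′ (workV zero))) u) (PS.φ x)
    Φ-eval ρ′ u x eq = trans (reflexive (eval-⟪⟫ (Env ρ′ u) (var ∘ emb) (PS.φ x)))
      (eval-cong (λ { (inj₁ x₀) → eq ; (inj₁ x₁) → refl ; (inj₂ b) → refl }) (PS.φ x))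
    Φ-slot : ∀ ρ′ u j → j ≢ i → eval (Env ρ′ u) (Φ (slotV j)) ≈ ρ′ (slotV j)
    Φ-slot ρ′ u j j≢i with j Fin.≟ i
    ... | yes j≡i = contradiction j≡i j≢i
    ... | no _    = refl
    Φ-same : ∀ ρ′ u → eval (Env ρ′ u) (Φ (slotV i)) ≈ eval (Env (two (ρ′ (slotV i)) (ρ′ (workV zero))) u) (PS.φ x₀)
    Φ-same ρ′ u with i Fin.≟ i
    ... | yes _  = Φ-eval ρ′ u x₀ refl
    ... | no i≢i = contradiction ≡.refl i≢i
    surj : ∀ (ρ : Var (suc n) r → Carrier) → ∃[ ρ′ ] ∃[ u ] (∀ b → V (PS.β b) (u b)) × (∀ x → ρ x ≈ eval (Env ρ′ u) (Φ x))
    surj ρ with PS.surj (two (ρ (slotV i)) (ρ (workV zero)))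
    ... | ρ₂ , u , Vu , ρ≈ = ρ′ , u , Vu , agree
      where
      at : ∀ j → Dec (j ≡ i) → Carrier
      at j (yes _) = ρ₂ x₀
      at j (no _)  = ρ (slotV j)
      ρ′ : Var (suc n) r → Carrier
      ρ′ (slotV j)       = at j (j Fin.≟ i)
      ρ′ (workV zero)    = ρ₂ x₁
      ρ′ (workV (suc j)) = ρ (workV (suc j))
      ρ′ (freeV j)       = ρ (freeV j)
      at-i : ρ′ (slotV i) ≈ ρ₂ x₀
      at-i with i Fin.≟ i
      ... | yes _  = refl
      ... | no i≢i = contradiction ≡.refl i≢i
      back : ∀ x → eval (Env ρ₂ u) (PS.φ x) ≈ eval (Env ρ′ u) (PS.φ x ⟪ var ∘ emb ⟫)
      back x = sym (trans (Φ-eval ρ′ u x at-i)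
        (eval-cong (λ { (inj₁ x₀) → refl ; (inj₁ x₁) → refl ; (inj₂ b) → refl }) (PS.φ x)))
      agree : ∀ x → ρ x ≈ eval (Env ρ′ u) (Φ x)
      agree (slotV j) with j Fin.≟ i in eq
      ... | yes ≡.refl = trans (ρ≈ x₀) (back x₀)
      ... | no _       = reflexive (≡.sym (≡.cong (at j) eq))
      agree (workV zero)    = trans (ρ≈ x₁) (back x₁)
      agree (workV (suc j)) = refl
      agree (freeV j)       = refl
    lin : ∀ ρ′ l → total slots (h ∷ work) (λ x → eval (Env ρ′ none) (Φ x)) l ≈ total (update i s′ slots) (h′ ∷ work) ρ′ l
    lin ρ′ l with sum-focus {f = λ j → slotFun (slots j) (eval (Env ρ′ none) (Φ (slotV j))) l}
                            {g = λ j → slotFun (update i s′ slots j) (ρ′ (slotV j)) l} i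
                    (λ j j≢i → trans (Additive.cong (slot-additive (slots j) l) (Φ-slot ρ′ none j j≢i))
                       (reflexive (≡.cong (λ s → slotFun s (ρ′ (slotV j)) l) (≡.sym (update-other s′ slots j≢i)))))
    ... | c , e₁ , e₂ = begin
      sum (λ j → slotFun (slots j) (eval (Env ρ′ none) (Φ (slotV j))) l) + (fun h hd l + W)
        ≈⟨ +-congʳ e₁ ⟩
      slotFun (slots i) (eval (Env ρ′ none) (Φ (slotV i))) l + c + (fun h hd l + W)
        ≈⟨ +-cong (+-congʳ (Additive.cong (slot-additive (slots i) l) (Φ-same ρ′ none)))
                  (+-congʳ (Additive.cong (additive h l) (Φ-eval ρ′ none x₁ refl))) ⟩
      A + c + (B + W)
        ≈⟨ solve (A ∷ B ∷ c ∷ W ∷ []) (a₀ ⊕ a₂ ⊕ (a₁ ⊕ a₃)) (a₀ ⊕ a₁ ⊕ (a₂ ⊕ a₃)) ⟩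
      A + B + (c + W)
        ≈⟨ +-congʳ (PS.lin (ρ′ (slotV i)) (ρ′ (workV zero)) l) ⟩
      A′ + B′ + (c + W)
        ≈⟨ solve (A′ ∷ B′ ∷ c ∷ W ∷ []) (a₀ ⊕ a₁ ⊕ (a₂ ⊕ a₃)) (a₀ ⊕ a₂ ⊕ (a₁ ⊕ a₃)) ⟩
      A′ + c + (B′ + W)
        ≈⟨ +-congʳ (+-congʳ (reflexive (≡.cong (λ s → slotFun s (ρ′ (slotV i)) l) (≡.sym (update-same i s′ slots))))) ⟩
      slotFun (update i s′ slots i) (ρ′ (slotV i)) l + c + (B′ + W)
        ≈⟨ +-congʳ e₂ ⟨
      sum (λ j → slotFun (update i s′ slots j) (ρ′ (slotV j)) l) + (B′ + W)  ∎
      where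
      hd = eval (Env ρ′ none) (Φ (workV zero))
      W  = sum (λ j → fun (Vec.lookup work j) (ρ′ (workV (suc j))) l)
      A  = slotFun (slots i) (eval (Env (two (ρ′ (slotV i)) (ρ′ (workV zero))) none) (PS.φ x₀)) l
      B  = fun h (eval (Env (two (ρ′ (slotV i)) (ρ′ (workV zero))) none) (PS.φ x₁)) l
      A′ = fun (column s′) (ρ′ (slotV i)) l
      B′ = fun h′ (ρ′ (workV zero)) l

  branch : ∀ {d g} → Form (suc d) g → Fin (suc q) → Carrier → Carrier
  branch (node T B F e) = B

  branch-form : ∀ {d g} (F : Form (suc d) g) i → Form d (branch F i)
  branch-form (node T B F e) = F

  branch-sum : ∀ {d g} (F : Form (suc d) g) y → rest F y ≈ sum (λ i → branch F i (θ i y))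
  branch-sum (node T B F e) y = refl

  module Expand (d : ℕ) (f : Carrier → Vector m) (F : ∀ i → Form (suc d) (λ x → f x i)) where
    child : Fin (suc q) → Column
    child j = record { depth = d ; fun = λ x i → branch (F i) j x ; form = λ i → branch-form (F i) j }

    children : Vec Column (suc q)
    children = Vec.tabulate child

    -- Replacing a variable by its coordinates is bijective, with `assemble` as inverse, so no
    -- bounded parameter arises here.
    expand : ∀ {n} {work : Vec Column n} → (∀ i x → act (top (F i)) x ≈ 0#) →
      Step slots (record { depth = suc d ; fun = f ; form = F } ∷ work) slots (children Vec.++ work) r
    expand {r = r} {n} {work} T≈0 = record
      { r′ = r ; Bd = ⊥ ; β = λ () ; Φ = Φ
      ; surj = λ ρ → ρ″ ρ , (λ ()) , (λ ()) , λ
          { (slotV j) → refl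
          ; (workV zero) → sym (trans (reflexive (eval-assemble (Env (ρ″ ρ) (λ ())) parts))
              (trans (assemble-cong λ i → reflexive (≡.cong (both ρ) (Fin.splitAt-↑ˡ (suc q) i n))) (assemble-θ _)))
          ; (workV (suc j)) → reflexive (≡.sym (≡.cong (both ρ) (Fin.splitAt-↑ʳ (suc q) n j)))
          ; (freeV j) → refl }
      ; lin = λ ρ′ i → +-congˡ (begin
          f (eval (Env ρ′ none) (assembleᴸ parts)) i + _
            ≈⟨ +-congʳ (trans (Form-split (F i) _) (trans (+-congʳ (T≈0 i _)) (+-identityˡ _))) ⟩
          rest (F i) (eval (Env ρ′ none) (assembleᴸ parts)) + _
            ≈⟨ +-congʳ (trans (branch-sum (F i) _) (sum-cong λ j → Additive.cong (Form-additive (branch-form (F i) j))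
                 (trans (Additive.cong (θ-add j) (reflexive (eval-assemble (Env ρ′ none) parts))) (θ-assemble (λ i → ρ′ (workV (i ↑ˡ n))) j)))) ⟩
          sum (λ j → branch (F i) j (ρ′ (workV (j ↑ˡ n)))) + sum (λ j → fun (Vec.lookup work j) (ρ′ (workV (suc q ↑ʳ j))) i)
            ≈⟨ +-cong (sum-cong λ j → reflexive (≡.cong (λ c → fun c (ρ′ (workV (j ↑ˡ n))) i)
                         (≡.sym (≡.trans (Vec.lookup-++ˡ children work j) (Vec.lookup∘tabulate child j)))))
                      (sum-cong λ j → reflexive (≡.cong (λ c → fun c (ρ′ (workV (suc q ↑ʳ j))) i)
                         (≡.sym (Vec.lookup-++ʳ children work j)))) ⟩
          sum (λ j → fun (Vec.lookup (children Vec.++ work) (j ↑ˡ n)) (ρ′ (workV (j ↑ˡ n))) i)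
            + sum (λ j → fun (Vec.lookup (children Vec.++ work) (suc q ↑ʳ j)) (ρ′ (workV (suc q ↑ʳ j))) i)
            ≈⟨ sum-↑ (suc q) (λ j → fun (Vec.lookup (children Vec.++ work) j) (ρ′ (workV j)) i) ⟨
          sum (λ j → fun (Vec.lookup (children Vec.++ work) j) (ρ′ (workV j)) i)  ∎) }
      where
      parts : Fin (suc q) → LinTerm q (Var (suc q ℕ.+ n) r ⊎ ⊥)
      parts i = var (inj₁ (workV (i ↑ˡ n)))
      Φ : Var (suc n) r → LinTerm q (Var (suc q ℕ.+ n) r ⊎ ⊥)
      Φ (slotV j)       = var (inj₁ (slotV j))
      Φ (workV zero)    = assembleᴸ parts
      Φ (workV (suc j)) = var (inj₁ (workV (suc q ↑ʳ j)))
      Φ (freeV j)       = var (inj₁ (freeV j))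
      both : (Var (suc n) r → Carrier) → Fin (suc q) ⊎ Fin n → Carrier
      both ρ (inj₁ i) = θ i (ρ (workV zero))
      both ρ (inj₂ j) = ρ (workV (suc j))
      ρ″ : (Var (suc n) r → Carrier) → Var (suc q ℕ.+ n) r → Carrier
      ρ″ ρ (slotV j) = ρ (slotV j)
      ρ″ ρ (workV j) = both ρ (splitAt (suc q) j)
      ρ″ ρ (freeV j) = ρ (freeV j)

  record IsSlot (i : Fin m) (c : Column) : Set (a ⊔ ℓ ⊔ v) where
    constructor isSlot
    field
      above : ∀ j → toℕ j < toℕ i → ∀ x → act (tops c j) x ≈ 0#
      pivot : Divisor (tops c i)

  toSlot : ∀ {i} c → IsSlot i c → Slot i
  toSlot c (isSlot ab pv) = record { column = c ; above = ab ; pivot = pv }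

  -- Clears the entry of h in row i by means of the pivot of c.
  module Combine (i : Fin m) (c h : Column) (c≤h : depth c ≤ depth h) where
    t u : Scalar
    t = tops c i
    u = tops h i

    combined : Column
    combined = record
      { depth = depth h
      ; fun   = λ x r → fun h (act t x) r + - fun c (act u x) r
      ; form  = λ r → Form-+ (Form-act t (form h r)) (Form-neg (Form-act u (Form-≤ c≤h (form c r)))) }

    combined-tops : ∀ r x → act (tops combined r) x ≈ act (tops h r) (act t x) + - act (tops c r) (act u x)
    combined-tops r x = begin
      act (tops combined r) x
        ≈⟨ top-+ (Form-act t (form h r)) (Form-neg (Form-act u (Form-≤ c≤h (form c r)))) x ⟩
      act (top (Form-act t (form h r))) x + act (top (Form-neg (Form-act u (Form-≤ c≤h (form c r))))) x
        ≈⟨ +-cong (top-act t (form h r) x) (trans (top-neg (Form-act u (Form-≤ c≤h (form c r))) x)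
             (-‿cong (trans (top-act u (Form-≤ c≤h (form c r)) x) (top-≤ c≤h (form c r) (act u x))))) ⟩
      act (tops h r) (act t x) + - act (tops c r) (act u x)  ∎

    cleared : ∀ x → act (tops combined i) x ≈ 0#
    cleared x = trans (combined-tops i x) (trans (+-congʳ (act-comm u t x)) (inverseʳ _))

    stillZero : ∀ r → (∀ x → act (tops h r) x ≈ 0#) → (∀ x → act (tops c r) x ≈ 0#) → ∀ x → act (tops combined r) x ≈ 0#
    stillZero r h≈0 c≈0 x = trans (combined-tops r x)
      (trans (+-cong (h≈0 _) (-‿cong (c≈0 _))) (inverseʳ 0#))

    module _ (C : ℕ) (divide : ∀ x → ∃[ y ] V C (x + - act t y)) where
      private
        divided : ∀ x y → x ≈ act t y + (x + - act t y)
        divided x y = solve (x ∷ act t y ∷ []) a₀ (a₁ ⊕ (a₀ ⊕ ⊝ a₁))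
        restored : ∀ y x → y ≈ y + act u x + - act u x
        restored y x = solve (y ∷ act u x ∷ []) a₀ (a₀ ⊕ a₁ ⊕ ⊝ a₁)
        linear : ∀ r y x → fun c (y + - act u x) r + fun h (act t x + 0#) r ≈ fun c y r + (fun h (act t x) r + - fun c (act u x) r)
        linear r y x = trans
          (+-cong (trans (Additive.homo (additive c r) _ _) (+-congˡ (add-neg (additive c r) _)))
                  (Additive.cong (additive h r) (+-identityʳ _)))
          (solve (fun c y r ∷ fun c (act u x) r ∷ fun h (act t x) r ∷ []) (a₀ ⊕ ⊝ a₁ ⊕ a₂) (a₀ ⊕ (a₂ ⊕ ⊝ a₁)))

      -- Dividing the variable of `h` by the pivot `t` makes it t x + b with b in V C. The
      -- substitution y - u x for the variable of `c` then gives c (y - u x) + h (t x) = c y + (h t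
      -- - c u) x.
      keep : (s : IsSlot i c) → PairStep (just (toSlot c s)) h (toSlot c s) combined
      keep s = record
        { Bd = Fin 1 ; β = λ _ → C
        ; φ = λ { x₀ → var (inj₁ x₀) +ᴸ -ᴸ (u ·ᴸ var (inj₁ x₁)) ; x₁ → t ·ᴸ var (inj₁ x₁) +ᴸ var (inj₂ zero) }
        ; surj = λ ρ → let x , Vx = divide (ρ x₁) in two (ρ x₀ + act u x) x , (λ _ → ρ x₁ + - act t x) , (λ _ → Vx) , λ
            { x₀ → trans (restored (ρ x₀) x) (+-congˡ (-‿cong (reflexive (≡.sym (eval-· _ u (var (inj₁ x₁)))))))
            ; x₁ → trans (divided (ρ x₁) x) (+-congʳ (reflexive (≡.sym (eval-· _ t (var (inj₁ x₁)))))) }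
        ; lin = λ y x r → trans
            (+-cong (Additive.cong (additive c r) (+-congˡ (-‿cong (reflexive (eval-· _ u (var (inj₁ x₁)))))))
                    (Additive.cong (additive h r) (+-congʳ (reflexive (eval-· _ t (var (inj₁ x₁)))))))
            (linear r y x) }

      -- The shallower of two competing columns must hold the slot, because `combined` has the depth
      -- of the column that is reduced. When the newcomer is the shallower one, the occupant moves
      -- to the queue and the measure is preserved.
      exchange : (s : IsSlot i c) (s′ : IsSlot i h) → PairStep (just (toSlot h s′)) c (toSlot c s) combined
      exchange s s′ = record
        { Bd = Fin 1 ; β = λ _ → C
        ; φ = λ { x₁ → var (inj₁ x₀) +ᴸ -ᴸ (u ·ᴸ var (inj₁ x₁)) ; x₀ → t ·ᴸ var (inj₁ x₁) +ᴸ var (inj₂ zero) }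
        ; surj = λ ρ → let x , Vx = divide (ρ x₀) in two (ρ x₁ + act u x) x , (λ _ → ρ x₀ + - act t x) , (λ _ → Vx) , λ
            { x₁ → trans (restored (ρ x₁) x) (+-congˡ (-‿cong (reflexive (≡.sym (eval-· _ u (var (inj₁ x₁)))))))
            ; x₀ → trans (divided (ρ x₀) x) (+-congʳ (reflexive (≡.sym (eval-· _ t (var (inj₁ x₁)))))) }
        ; lin = λ y x r → trans (+-comm _ _) (trans
            (+-cong (Additive.cong (additive c r) (+-congˡ (-‿cong (reflexive (eval-· _ u (var (inj₁ x₁)))))))
                    (Additive.cong (additive h r) (+-congʳ (reflexive (eval-· _ t (var (inj₁ x₁)))))))
            (linear r y x)) }

  zeroColumn : Column
  zeroColumn = record { depth = 0 ; fun = λ _ _ → 0# ; form = λ _ → Form-0 0 }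

  accept : ∀ i (s : Slot i) → PairStep nothing (column s) s zeroColumn
  accept i s = record
    { Bd = ⊥ ; β = λ ()
    ; φ = λ { x₀ → var (inj₁ x₁) ; x₁ → var (inj₁ x₀) }
    ; surj = λ ρ → two (ρ x₁) (ρ x₀) , (λ ()) , (λ ()) , λ { x₀ → refl ; x₁ → refl }
    ; lin = λ y x r → +-comm _ _ }

  module ℕ-Sums = FiniteSums ℕ.+-0-commutativeMonoid
  open ℕ-Sums using () renaming (sum to sumℕ)

  -- A column of depth d outweighs its 1 + q children; moving a column into a
  -- slot makes it lighter by one.
  cost : ℕ → ℕ
  cost zero    = 0
  cost (suc d) = suc q ℕ.* suc (cost d)

  slotCost : ∀ {i} → Maybe (Slot i) → ℕ
  slotCost nothing  = 0
  slotCost (just s) = cost (depth (column s))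

  workCost : ∀ {n} → Vec Column n → ℕ
  workCost []       = 0
  workCost (c ∷ cs) = suc (cost (depth c)) ℕ.+ workCost cs

  measure : ∀ {n} → Slots → Vec Column n → ℕ
  measure slots work = workCost work ℕ.+ sumℕ (λ i → slotCost (slots i))

  update-cost : ∀ i s slots → sumℕ (λ j → slotCost (update i s slots j)) ℕ.+ slotCost (slots i)
                            ≡ sumℕ (λ j → slotCost (slots j)) ℕ.+ cost (depth (column s))
  update-cost i s slots with ℕ-Sums.sum-focus {f = λ j → slotCost (slots j)} {g = λ j → slotCost (update i s slots j)} i
                               (λ j j≢i → ≡.cong slotCost (≡.sym (update-other s slots j≢i)))
  ... | c , e₁ , e₂ rewrite e₁ | e₂ | update-same i s slots = rearrange (cost (depth (column s))) c (slotCost (slots i))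
    where
    rearrange : ∀ x c y → x ℕ.+ c ℕ.+ y ≡ y ℕ.+ c ℕ.+ x
    rearrange = solve-∀

  workCost-++ : ∀ {n n′} (w : Vec Column n) (w′ : Vec Column n′) → workCost (w Vec.++ w′) ≡ workCost w ℕ.+ workCost w′
  workCost-++ []      w′ = ≡.refl
  workCost-++ (c ∷ w) w′ = ≡.cong suc (≡.trans (≡.cong (cost (depth c) ℕ.+_) (workCost-++ w w′)) (≡.sym (ℕ.+-assoc (cost (depth c)) _ _)))

  workCost-children : ∀ d {n} (f : Fin n → Column) → (∀ j → depth (f j) ≡ d) → workCost (Vec.tabulate f) ≡ n ℕ.* suc (cost d)
  workCost-children d {zero}  f e = ≡.refl
  workCost-children d {suc n} f e = ≡.cong₂ (λ x y → suc (cost x) ℕ.+ y) (e zero) (workCost-children d (f ∘ suc) (e ∘ suc))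

  Reduced : Set (lsuc Level.zero ⊔ a ⊔ ℓ ⊔ v)
  Reduced = Σ Slots λ slots → State slots []

  row : ∀ {g i} → suc g ℕ.+ i ≡ m → Fin m
  row {g} {i} e = fromℕ< {i} (≡.subst (i <_) e (s≤s (ℕ.m≤n+m i g)))

  toℕ-row : ∀ {g i} (e : suc g ℕ.+ i ≡ m) → toℕ (row e) ≡ i
  toℕ-row {g} {i} e = Fin.toℕ-fromℕ< (≡.subst (i <_) e (s≤s (ℕ.m≤n+m i g)))

  mutual
    -- Fuel pays for filling an empty slot, for discarding a column and for expanding one. Meeting
    -- an occupied slot leaves the measure unchanged, but moves one row down.
    reduce : ∀ fuel {n} slots (work : Vec Column n) → measure slots work ≤ fuel → State slots work → Reduced
    reduce fuel       slots []         μ≤ st = slots , st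
    reduce (suc fuel) slots (h ∷ work) μ≤ st = insert fuel m 0 (ℕ.+-identityʳ m) slots h work μ≤ st λ _ ()

    insert : ∀ fuel g i → g ℕ.+ i ≡ m → ∀ slots h {n} (work : Vec Column n) → measure slots (h ∷ work) ≤ suc fuel →
      State slots (h ∷ work) → (∀ j → toℕ j < i → ∀ x → act (tops h j) x ≈ 0#) → Reduced
    insert fuel zero    i g+i≡m slots h work μ≤ st zeros =
      finish fuel slots h work μ≤ st λ j → zeros j (≡.subst (toℕ j <_) (≡.sym g+i≡m) (Fin.toℕ<n j))
    insert fuel (suc g) i g+i≡m slots h work μ≤ st zeros with divisor? (tops h (row {g} {i} g+i≡m))
    ... | inj₁ T≈0 = insert fuel g (suc i) (≡.trans (ℕ.+-suc g i) g+i≡m) slots h work μ≤ st (clear-row {g} {i} g+i≡m h zeros T≈0)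
    ... | inj₂ D   = place fuel g i g+i≡m slots h work μ≤ st zeros D (slots (row {g} {i} g+i≡m)) ≡.refl

    clear-row : ∀ {g i} (e : suc g ℕ.+ i ≡ m) h → (∀ j → toℕ j < i → ∀ x → act (tops h j) x ≈ 0#) →
      (∀ x → act (tops h (row {g} {i} e)) x ≈ 0#) → ∀ j → toℕ j < suc i → ∀ x → act (tops h j) x ≈ 0#
    clear-row {g} {i} e h zeros T≈0 j (s≤s j≤i) with ℕ.m≤n⇒m<n∨m≡n j≤i
    ... | inj₁ j<i = zeros j j<i
    ... | inj₂ j≡i rewrite Fin.toℕ-injective {i = j} {j = row {g} {i} e} (≡.trans j≡i (≡.sym (toℕ-row {g} {i} e))) = T≈0

    place : ∀ fuel g i (e : suc g ℕ.+ i ≡ m) slots h {n} (work : Vec Column n) → measure slots (h ∷ work) ≤ suc fuel →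
      State slots (h ∷ work) → (∀ j → toℕ j < i → ∀ x → act (tops h j) x ≈ 0#) → Divisor (tops h (row {g} {i} e)) →
      (s : Maybe (Slot (row {g} {i} e))) → slots (row {g} {i} e) ≡ s → Reduced
    place fuel g i e slots h work (s≤s μ≤) st zeros D nothing eq =
      reduce fuel (update ι new slots) work (ℕ.≤-trans (ℕ.≤-reflexive μ-eq) μ≤)
        -- An empty slot stands for a zero column; `accept` swaps it with the new column, and `drop`
        -- turns its variable into a free one.
        (advance (advance st (pairStep ι (≡.subst (λ s → PairStep s h new zeroColumn) (≡.sym eq) (accept ι new)))) (drop λ _ _ → refl))
      where
      ι   = row {g} {i} e
      new = toSlot h (isSlot (λ j j<ι → zeros j (≡.subst (toℕ j <_) (toℕ-row {g} {i} e) j<ι)) D)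
      μ-eq : workCost work ℕ.+ sumℕ (λ j → slotCost (update ι new slots j)) ≡ cost (depth h) ℕ.+ workCost work ℕ.+ sumℕ (λ j → slotCost (slots j))
      μ-eq = ≡.trans (≡.cong (workCost work ℕ.+_)
        (≡.trans (≡.sym (ℕ.+-identityʳ _)) (≡.trans (≡.cong (sumℕ (λ j → slotCost (update ι new slots j)) ℕ.+_) (≡.cong slotCost (≡.sym eq)))
          (update-cost ι new slots)))) (rearrange (cost (depth h)) (workCost work) (sumℕ (λ j → slotCost (slots j))))
        where
        rearrange : ∀ c w s → w ℕ.+ (s ℕ.+ c) ≡ c ℕ.+ w ℕ.+ s
        rearrange = solve-∀
    place fuel g i e slots h work μ≤ st zeros D (just s) eq with ℕ.≤-total (depth (column s)) (depth h)
    ... | inj₁ s≤h = insert fuel g (suc i) (≡.trans (ℕ.+-suc g i) e) (update ι s slots) combined work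
            (ℕ.≤-trans (ℕ.≤-reflexive μ-eq) μ≤)
            (advance st (pairStep ι (≡.subst (λ s′ → PairStep s′ h s combined) (≡.sym eq)
              (keep (proj₁ (pivot s)) (proj₂ (proj₂ (pivot s))) (isSlot (above s) (pivot s))))))
            (clear-row {g} {i} e combined (λ j j<i → stillZero j (zeros j j<i) (above s j (≡.subst (toℕ j <_) (≡.sym (toℕ-row {g} {i} e)) j<i))) cleared)
      where
      ι = row {g} {i} e
      open Combine ι (column s) h s≤h
      μ-eq : measure (update ι s slots) (combined ∷ work) ≡ measure slots (h ∷ work)
      μ-eq = ≡.cong (λ x → suc (cost (depth h)) ℕ.+ workCost work ℕ.+ x) (ℕ.+-cancelʳ-≡ (cost (depth (column s))) _ _
        (≡.trans (≡.cong (λ s′ → sumℕ (λ j → slotCost (update ι s slots j)) ℕ.+ slotCost s′) (≡.sym eq)) (update-cost ι s slots)))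
    ... | inj₂ h≤s = insert fuel g (suc i) (≡.trans (ℕ.+-suc g i) e) (update ι new slots) combined work
            (ℕ.≤-trans (ℕ.≤-reflexive μ-eq) μ≤)
            (advance st (pairStep ι (≡.subst (λ s′ → PairStep s′ h new combined) (≡.sym eq)
              (exchange (proj₁ D) (proj₂ (proj₂ D)) (isSlot new-above D) (isSlot (above s) (pivot s))))))
            (clear-row {g} {i} e combined (λ j j<i → stillZero j (above s j (≡.subst (toℕ j <_) (≡.sym (toℕ-row {g} {i} e)) j<i)) (zeros j j<i)) cleared)
      where
      ι = row {g} {i} e
      new-above : ∀ j → toℕ j < toℕ ι → ∀ x → act (tops h j) x ≈ 0#
      new-above j j<ι = zeros j (≡.subst (toℕ j <_) (toℕ-row {g} {i} e) j<ι)
      new = toSlot h (isSlot new-above D)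
      open Combine ι h (column s) h≤s
      μ-eq : measure (update ι new slots) (combined ∷ work) ≡ measure slots (h ∷ work)
      μ-eq = ≡.cong suc (≡.trans (r₁ (cost (depth (column s))) (workCost work) (sumℕ (λ j → slotCost (update ι new slots j))))
        (≡.trans (≡.cong (workCost work ℕ.+_)
          (≡.trans (≡.cong (λ s′ → sumℕ (λ j → slotCost (update ι new slots j)) ℕ.+ slotCost s′) (≡.sym eq)) (update-cost ι new slots)))
          (r₂ (cost (depth h)) (workCost work) (sumℕ (λ j → slotCost (slots j))))))
        where
        r₁ : ∀ c w s → c ℕ.+ w ℕ.+ s ≡ w ℕ.+ (s ℕ.+ c)
        r₁ = solve-∀
        r₂ : ∀ c w s → w ℕ.+ (s ℕ.+ c) ≡ c ℕ.+ w ℕ.+ s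
        r₂ = solve-∀

    finish : ∀ fuel slots h {n} (work : Vec Column n) → measure slots (h ∷ work) ≤ suc fuel →
      State slots (h ∷ work) → (∀ j x → act (tops h j) x ≈ 0#) → Reduced
    finish fuel slots record { depth = zero ; fun = f ; form = F } work (s≤s μ≤) st zeros =
      reduce fuel slots work μ≤ (advance st (drop λ x i → trans (Form-split (F i) x)
        (trans (+-cong (zeros i x) (rest-leaf (F i) x)) (+-identityˡ _))))
      where
      rest-leaf : ∀ {g} (F : Form 0 g) x → rest F x ≈ 0#
      rest-leaf (leaf _ _) x = refl
    finish fuel slots record { depth = suc d ; fun = f ; form = F } work (s≤s μ≤) st zeros =
      reduce fuel slots (children Vec.++ work) (ℕ.≤-trans (ℕ.≤-reflexive (≡.cong (ℕ._+ sumℕ (λ j → slotCost (slots j)))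
          (≡.trans (workCost-++ children work) (≡.cong (ℕ._+ workCost work) (workCost-children d child λ _ → ≡.refl))))) μ≤)
        (advance st (expand zeros))
      where open Expand d f F

-- Images, kernels and bounded solutions of linear systems

module Systems {q a ℓ v} (M : FilteredModule q a ℓ v) where
  open Forms M
  open AlmostInverse M
  open Splitting M

  -- What is needed to know about a linear system E for the elimination of
  -- quantifiers: E is completed to an almost surjective system by new
  -- variables in the absent rows; bounded values of E have bounded solutions;
  -- and a linear term is either determined by E up to bounded errors or
  -- takes large values on solutions of E = 0.
  record Analysis {m k} (E : Fin m → LinTerm q (Fin k)) : Set (lsuc Level.zero ⊔ lsuc (a ⊔ ℓ ⊔ v)) where
    field
      absent  : Fin m → Bool

    extra : Vector m → Vector m
    extra x i = if absent i then x i else 0#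

    field
      C₀       : ℕ
      complete : ∀ (t : Vector m) → ∃[ w ] ∃[ x ] ∀ i → V C₀ (t i + - (eval w (E i) + extra x i))
      complement-bounded : ∀ K → ∃[ K′ ] ∀ w x → (∀ i → V K (eval w (E i) + extra x i)) →
        ∀ i → absent i ≡ true → V K′ (x i)
      bounded-solution : ∀ K → ∃[ K′ ] ∀ w → (∀ i → V K (eval w (E i))) →
        ∃[ w′ ] (∀ j → V K′ (w′ j)) × (∀ i → eval w′ (E i) ≈ eval w (E i))
      Kernel   : Vector k → Set (a ⊔ ℓ ⊔ v)
      kernel-0 : Kernel (λ _ → 0#)
      kernel-+ : ∀ {w w′} → Kernel w → Kernel w′ → Kernel (λ j → w j + w′ j)
      kernel-E : ∀ {w} → Kernel w → ∀ i → eval w (E i) ≈ 0#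
      classify : ∀ t →
        ((∀ {w} → Kernel w → eval w t ≈ 0#) × (∀ K → ∃[ K′ ] ∀ w → (∀ i → V K (eval w (E i))) → V K′ (eval w t)))
        ⊎ (∀ N → ∃[ w ] Kernel w × ¬ V N (eval w t))

  vanish : ∀ {n} (h : Vector n → Carrier) → (∀ {x y} → (∀ i → x i ≈ y i) → h x ≈ h y) →
    (∀ x y → h (λ i → x i + y i) ≈ h x + h y) → (∀ i x → h (single i x) ≈ 0#) → ∀ y → h y ≈ 0#
  vanish {zero}  h cong homo zeros y = trans (cong λ ()) (AbelianGroup-0 h cong homo)
    where
    AbelianGroup-0 : ∀ (h : Vector 0 → Carrier) → (∀ {x y} → (∀ i → x i ≈ y i) → h x ≈ h y) →
      (∀ x y → h (λ i → x i + y i) ≈ h x + h y) → h (λ ()) ≈ 0#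
    AbelianGroup-0 h cong homo = trans (solve (h (λ ()) ∷ []) a₀ (a₀ ⊕ a₀ ⊕ ⊝ a₀))
      (trans (+-congʳ (trans (sym (homo (λ ()) (λ ()))) (cong λ ()))) (inverseʳ _))
  vanish {suc n} h cong homo zeros y = trans (cong split) (trans (homo (single zero (y zero)) (cons 0# (y ∘ suc)))
      (trans (+-cong (zeros zero (y zero)) (vanish (h ∘ cons 0#) (λ e → cong λ { zero → refl ; (suc i) → e i })
        (λ x x′ → trans (cong λ { zero → sym (+-identityˡ 0#) ; (suc i) → refl }) (homo (cons 0# x) (cons 0# x′)))
        (λ i x → trans (cong (shift i x)) (zeros (suc i) x)) (y ∘ suc))) (+-identityˡ 0#)))
    where
    split : ∀ i → y i ≈ single zero (y zero) i + cons 0# (y ∘ suc) i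
    split zero    = trans (sym (+-identityʳ _)) (+-congʳ (reflexive (≡.sym (single-same (zero {n}) (y zero)))))
    split (suc i) = trans (sym (+-identityˡ _)) (+-congʳ (reflexive (≡.sym (single-other zero (y zero) {suc i} λ ()))))
    shift : ∀ i x j → cons 0# (single i x) j ≈ single (suc i) x j
    shift i x zero    = refl
    shift i x (suc j) with i Fin.≟ j
    ... | yes _ = refl
    ... | no  _ = refl

  single-form : ∀ {n} (i j : Fin n) → Form 0 (λ x → single i x j)
  single-form i j with i Fin.≟ j
  ... | yes _ = leaf 𝟙 λ _ → refl
  ... | no  _ = leaf 𝟘 λ _ → refl

  sum-singles : ∀ {k} (x : Vector k) i → x i ≈ sum (λ j → single j (x j) i)
  sum-singles {suc k} x zero = trans (sym (+-identityʳ _)) (+-cong (reflexive (≡.sym (single-same (zero {k}) (x zero))))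
    (sym (sum-0 λ j → reflexive (single-other (suc j) (x (suc j)) {zero} λ ()))))
  sum-singles {suc k} x (suc i) = trans (sum-singles (x ∘ suc) i) (trans (sum-cong λ j → reflexive (shift j)) (sym (trans
    (+-congʳ (reflexive (single-other zero (x zero) {suc i} λ ()))) (+-identityˡ _))))
    where
    shift : ∀ j → single j (x (suc j)) i ≡ single (suc j) (x (suc j)) (suc i)
    shift j with j Fin.≟ i
    ... | yes _ = ≡.refl
    ... | no  _ = ≡.refl

  eval-sum : ∀ {s} {A : Set s} {k} (ρ : Fin k → A → Carrier) t →
    eval (λ x → sum (λ j → ρ j x)) t ≈ sum (λ j → eval (ρ j) t)
  eval-sum {k = zero}  ρ t = eval-0 t
  eval-sum {k = suc k} ρ t = trans (eval-+ (ρ zero) (λ x → sum (λ j → ρ (suc j) x)) t) (+-congˡ (eval-sum (ρ ∘ suc) t))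

  module _ {m k} (E : Fin m → LinTerm q (Fin k)) (forms : ∀ i → FormTerm (E i)) where
    open Reduction M E
    open Column
    open Slot

    private
      single-simple : ∀ {n} (j : Fin n) → Simple (single j)
      single-simple j i = single-form j i

      columnOf : Fin k → Column
      columnOf j = record
        { depth = proj₁ common
        ; fun = λ x i → eval (single j x) (E i)
        ; form = proj₂ common }
        where
        common = uniform {P = λ i d → Form d (λ x → eval (single j x) (E i))} (λ i → Form-≤) (λ i → forms i (single-simple j))

      initial : State (λ _ → nothing) (Vec.tabulate columnOf)
      initial = record
        { r = 0 ; Bd = ⊥ ; β = λ () ; U = λ j → var (inj₁ (workV j))
        ; surj = λ w → (λ { (slotV i) → 0# ; (workV j) → w j ; (freeV ()) }) , (λ ()) , (λ ()) , λ j → refl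
        ; lin = λ ρ i → trans (eval-cong (sum-singles (λ j → ρ (workV j))) (E i))
            (trans (eval-sum (λ j → single j (ρ (workV j))) (E i))
              (trans (sum-cong λ j → reflexive (≡.cong (λ c → fun c (ρ (workV j)) i) (≡.sym (Vec.lookup∘tabulate columnOf j))))
                (sym (trans (+-congʳ (sum-0 {m} λ _ → refl)) (+-identityˡ _))))) }

      reduced : Reduced
      reduced = reduce _ _ _ ℕ.≤-refl initial

      slots : Slots
      slots = proj₁ reduced
      open State (proj₂ reduced)

      unitColumn : Fin m → Column
      unitColumn i = record { depth = 0 ; fun = single i ; form = single-form i }

      -- Unit columns in the empty slots make the reduced system square with nonzero pivots. Their
      -- variables become the new variables in the absent rows.
      unitSlot : ∀ i → Slot i
      unitSlot i = record { column = unitColumn i ; above = above₀ ; pivot = 0 , pivot₁ , pivot₂ }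
        where
        top-unit : ∀ j x → act (top (single-form i j)) x ≈ single i x j
        top-unit j x with i Fin.≟ j
        ... | yes _ = refl
        ... | no  _ = refl
        top-same : ∀ x → act (top (single-form i i)) x ≈ x
        top-same x = trans (top-unit i x) (reflexive (single-same i x))
        above₀ : ∀ j → toℕ j < toℕ i → ∀ x → act (top (single-form i j)) x ≈ 0#
        above₀ j j<i x = trans (top-unit j x) (reflexive (single-other i x λ { ≡.refl → ℕ.<-irrefl ≡.refl j<i }))
        pivot₁ : ∀ {N x} → V N (act (top (single-form i i)) x) → V (N ℕ.+ 0) x
        pivot₁ {N} {x} Vx = V-mono (ℕ.m≤m+n N 0) (V-resp (top-same x) Vx)
        pivot₂ : ∀ x → ∃[ y ] V 0 (x + - act (top (single-form i i)) y)
        pivot₂ x = x , V-resp (sym (trans (+-congˡ (-‿cong (top-same x))) (inverseʳ x))) V-0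

      fill : ∀ {i} → Maybe (Slot i) → Slot i
      fill {i} nothing = unitSlot i
      fill (just s)    = s

      col : Fin m → Carrier → Vector m
      col i = fun (column (fill (slots i)))

      iso : AlmostIso (λ y r → sum (λ i → col i (y i) r))
      iso = columns-iso col (λ i → depth (column (fill (slots i)))) (λ i → form (column (fill (slots i))))
        (λ r i → above (fill (slots i)) r) (λ i → pivot (fill (slots i)))

      mix : ∀ {i} → Maybe (Slot i) → Carrier → Carrier → Carrier
      mix (just _) y x = y
      mix nothing  y x = x

      isAbsent : ∀ {i} → Maybe (Slot i) → Bool
      isAbsent nothing  = true
      isAbsent (just _) = false

      abs : Fin m → Bool
      abs i = isAbsent (slots i)

      B : Vector m → Vector m
      B y r = sum (λ i → slotFun (slots i) (y i) r)

      complete-col : ∀ (y x : Vector m) r → sum (λ i → col i (mix (slots i) (y i) (x i)) r)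
                   ≈ B y r + (if abs r then x r else 0#)
      complete-col y x r = trans (sum-cong split) (trans (∑-distrib-+ (λ i → slotFun (slots i) (y i) r) (λ i → single i (if abs i then x i else 0#) r))
        (+-congˡ (sym (sum-singles (λ i → if abs i then x i else 0#) r))))
        where
        split′ : ∀ i (s : Maybe (Slot i)) → fun (column (fill s)) (mix s (y i) (x i)) r
               ≈ slotFun s (y i) r + single i (if isAbsent s then x i else 0#) r
        split′ i nothing  = sym (+-identityˡ _)
        split′ i (just s) = sym (trans (+-congˡ (add-0 (Form-additive (single-form i r)))) (+-identityʳ _))
        split : ∀ i → col i (mix (slots i) (y i) (x i)) r ≈ slotFun (slots i) (y i) r + single i (if abs i then x i else 0#) r
        split i = split′ i (slots i)

      env : Vector m → (Fin r → Carrier) → Var 0 r → Carrier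
      env y s (slotV i) = y i
      env y s (freeV j) = s j

      lin′ : ∀ y s i → eval (λ j → eval (Env (env y s) none) (U j)) (E i) ≈ B y i
      lin′ y s i = trans (lin (env y s) i) (+-identityʳ _)

      present : Vector m → Vector m
      present y i = mix (slots i) (y i) 0#

      missing : Vector m → Vector m
      missing y i = mix (slots i) 0# (y i)

      slotFun-present : ∀ y i r → slotFun (slots i) (present y i) r ≈ slotFun (slots i) (y i) r
      slotFun-present y i r with slots i
      ... | nothing = refl
      ... | just s  = refl

      slotFun-missing : ∀ y i r → slotFun (slots i) (missing y i) r ≈ 0#
      slotFun-missing y i r with slots i
      ... | nothing = refl
      ... | just s  = add-0 (additive (column s) r)

      Uᵇ : (Bd → Carrier) → Vector k
      Uᵇ u j = eval (Env (λ _ → 0#) u) (U j)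

      U-split : ∀ ρ u j → eval (Env ρ u) (U j) ≈ eval (Env ρ none) (U j) + Uᵇ u j
      U-split ρ u j = trans
        (eval-cong (λ { (inj₁ x) → sym (+-identityʳ _) ; (inj₂ b) → sym (+-identityˡ _) }) (U j))
        (eval-+ (Env ρ none) (Env (λ _ → 0#) u) (U j))

      Uᵇ-bounded : ∃[ N ] ∀ u → (∀ b → V (β b) (u b)) → ∀ j → V N (Uᵇ u j)
      Uᵇ-bounded = let N , f = uniform {P = λ j N → ∀ ρ → (∀ x → V ([ (λ _ → 0) , β ] x) (ρ x)) → V N (eval ρ (U j))}
                                 (λ j k≤l f ρ h → V-mono k≤l (f ρ h)) (λ j → V-eval [ (λ _ → 0) , β ] (U j))
                   in N , λ u Vu j → f j _ λ { (inj₁ x) → V-0 ; (inj₂ b) → Vu b }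

      term-Uᵇ : ∀ t → ∃[ N ] ∀ u → (∀ b → V (β b) (u b)) → V N (eval (Uᵇ u) t)
      term-Uᵇ t = let N , f = Uᵇ-bounded ; N′ , g = V-eval (λ _ → N) t in N′ , λ u Vu → g (Uᵇ u) (f u Vu)

      E-Uᵇ : ∃[ N ] ∀ u → (∀ b → V (β b) (u b)) → ∀ i → V N (eval (Uᵇ u) (E i))
      E-Uᵇ = let N , f = uniform {P = λ i N → ∀ u → (∀ b → V (β b) (u b)) → V N (eval (Uᵇ u) (E i))}
                           (λ i k≤l f u h → V-mono k≤l (f u h)) (λ i → term-Uᵇ (E i))
             in N , λ u Vu i → f i u Vu

      parametrise : ∀ w → ∃[ y ] ∃[ s ] ∃[ u ] (∀ b → V (β b) (u b)) ×
        (∀ t → eval w t ≈ eval (λ j → eval (Env (env y s) none) (U j)) t + eval (Uᵇ u) t)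
      parametrise w with surj w
      ... | ρ , u , Vu , w≈ = (λ i → ρ (slotV i)) , (λ j → ρ (freeV j)) , u , Vu , λ t →
        trans (eval-cong (λ j → trans (w≈ j) (trans (eval-cong (λ { (inj₁ x) → agree x ; (inj₂ b) → refl }) (U j)) (U-split _ u j))) t)
          (eval-+ (λ j → eval (Env (env (λ i → ρ (slotV i)) (λ j → ρ (freeV j))) none) (U j)) (Uᵇ u) t)
        where
        agree : ∀ x → ρ x ≈ env (λ i → ρ (slotV i)) (λ j → ρ (freeV j)) x
        agree (slotV i) = refl
        agree (freeV j) = refl

      slots-bounded : ∀ K → ∃[ K′ ] ∀ (y x : Vector m) → (∀ r → V K (B y r + (if abs r then x r else 0#))) →
        ∀ i → V K′ (mix (slots i) (y i) (x i))
      slots-bounded K = let K′ , f = AlmostIso.bounded iso K in K′ , λ y x VB →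
        f (λ i → mix (slots i) (y i) (x i)) λ r → V-resp (sym (complete-col y x r)) (VB r)

      if-0 : ∀ (b : Bool) → (if b then 0# else 0#) ≡ 0#
      if-0 true  = ≡.refl
      if-0 false = ≡.refl

      present-bounded : ∀ K → ∃[ K′ ] ∀ w → (∀ i → V K (eval w (E i))) → ∀ i → V K′ (present (proj₁ (parametrise w)) i)
      present-bounded K =
        let N , VN = E-Uᵇ
            K′ , f = slots-bounded (K ℕ.+ N)
        in K′ , λ w Vw → let y , s , u , Vu , eq = parametrise w in f y (λ _ → 0#) λ i →
          V-resp (trans (trans (+-congʳ (trans (eq (E i)) (+-congʳ (lin′ y s i))))
                   (solve (B y i ∷ eval (Uᵇ u) (E i) ∷ []) (a₀ ⊕ a₁ ⊕ ⊝ a₁) (a₀ ⊕ nil))) (+-congˡ (reflexive (≡.sym (if-0 (abs i))))))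
            (V-sub (V-mono (ℕ.m≤m+n K N) (Vw i)) (V-mono (ℕ.m≤n+m N K) (VN u Vu i)))

      -- The vectors given by the free variables and the variables of empty slots, all other
      -- parameters being zero. Every solution of E = 0 differs from one of them by a bounded
      -- vector.
      KernelOf : Vector k → Set (a ⊔ ℓ)
      KernelOf w = ∃[ y ] ∃[ s ] ∀ j → w j ≈ eval (Env (env (missing y) s) none) (U j)

      mix-+ : ∀ {i} (s : Maybe (Slot i)) a b → mix s 0# (a + b) ≈ mix s 0# a + mix s 0# b
      mix-+ nothing  a b = refl
      mix-+ (just _) a b = sym (+-identityˡ 0#)

      mix-split : ∀ {i} (s : Maybe (Slot i)) a → a ≈ mix s a 0# + mix s 0# a
      mix-split nothing  a = sym (+-identityˡ a)
      mix-split (just _) a = sym (+-identityʳ a)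

      mix-0 : ∀ {i} (s : Maybe (Slot i)) → mix s 0# 0# ≈ 0#
      mix-0 nothing  = refl
      mix-0 (just _) = refl

      mix-form : ∀ {i} (s : Maybe (Slot i)) {g} → Form 0 g → Form 0 (λ x → mix s 0# (g x))
      mix-form nothing  F = F
      mix-form (just _) F = Form-0 0

      onKernel : LinTerm q (Fin k) → Vector m → (Fin r → Carrier) → Carrier
      onKernel t y s = eval (λ j → eval (Env (env (missing y) s) none) (U j)) t

      onKernel-cong : ∀ t {y y′ s s′} → (∀ i → y i ≈ y′ i) → (∀ j → s j ≈ s′ j) → onKernel t y s ≈ onKernel t y′ s′
      onKernel-cong t {y} {y′} ey es = eval-cong (λ j → eval-cong (λ
          { (inj₁ (slotV i)) → mix-cong (slots i) (ey i) ; (inj₁ (freeV l)) → es l ; (inj₂ b) → refl }) (U j)) t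
        where
        mix-cong : ∀ {i} (s : Maybe (Slot i)) {a b} → a ≈ b → mix s 0# a ≈ mix s 0# b
        mix-cong nothing  e = e
        mix-cong (just _) e = refl

      onKernel-+ : ∀ t y y′ s s′ → onKernel t (λ i → y i + y′ i) (λ j → s j + s′ j) ≈ onKernel t y s + onKernel t y′ s′
      onKernel-+ t y y′ s s′ = trans (eval-cong (λ j → trans
          (eval-cong (λ { (inj₁ (slotV i)) → mix-+ (slots i) (y i) (y′ i) ; (inj₁ (freeV l)) → refl ; (inj₂ b) → sym (+-identityˡ 0#) }) (U j))
          (eval-+ (Env (env (missing y) s) none) (Env (env (missing y′) s′) none) (U j))) t)
        (eval-+ _ _ t)

      0ᵛ : ∀ {n} → Vector n
      0ᵛ _ = 0#

      unary : LinTerm q (Fin k) → LinTerm q (Var 0 r ⊎ Bd)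
      unary t = t ⟪ U ⟫

      unary-dichotomy : ∀ t (y : Carrier → Vector m) (s : Carrier → Fin r → Carrier) →
        (∀ i → Form 0 (λ x → y x i)) → (∀ j → Form 0 (λ x → s x j)) → Dichotomy (λ x → onKernel t (y x) (s x))
      unary-dichotomy t y s Fy Fs = transport (EF-dichotomy (eval-EF
          {σ = λ x → Env (env (missing (y x)) (s x)) none}
          (λ { (inj₁ (slotV i)) → mix-form (slots i) (Fy i) ; (inj₁ (freeV j)) → Fs j ; (inj₂ b) → Form-0 0 }) (unary t)))
        where
        eq : ∀ x → eval (Env (env (missing (y x)) (s x)) none) (unary t) ≡ onKernel t (y x) (s x)
        eq x = eval-⟪⟫ _ U t
        transport : Dichotomy (λ x → eval (Env (env (missing (y x)) (s x)) none) (unary t)) → Dichotomy (λ x → onKernel t (y x) (s x))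
        transport (inj₁ zeros) = inj₁ λ x → trans (reflexive (≡.sym (eq x))) (zeros x)
        transport (inj₂ large) = inj₂ λ N → let x , x∉ = large N in x , λ Vx → x∉ (V-resp (reflexive (≡.sym (eq x))) Vx)

      -- The value of t is additive in the parameters, so it vanishes if it vanishes along each
      -- axis. On an axis it is an eventual form in one variable, to which the dichotomy applies.
      kernel-dichotomy : ∀ t → (∀ y s → onKernel t y s ≈ 0#) ⊎ (∀ N → ∃[ y ] ∃[ s ] ¬ V N (onKernel t y s))
      kernel-dichotomy t
        with decideAll (λ i → unary-dichotomy t (single i) (λ _ → 0ᵛ) (single-form i) (λ _ → Form-0 0))
           | decideAll (λ j → unary-dichotomy t (λ _ → 0ᵛ) (single j) (λ _ → Form-0 0) (single-form j))
      ... | inj₂ (i , large) | _ = inj₂ λ N → let x , x∉ = large N in single i x , 0ᵛ , x∉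
      ... | inj₁ _ | inj₂ (j , large) = inj₂ λ N → let x , x∉ = large N in 0ᵛ , single j x , x∉
      ... | inj₁ zeros | inj₁ zeros′ = inj₁ λ y s → trans
        (onKernel-cong t (λ i → sym (+-identityʳ (y i))) (λ j → sym (+-identityˡ (s j))))
        (trans (onKernel-+ t y 0ᵛ 0ᵛ s) (trans (+-cong
          (vanish (λ y → onKernel t y 0ᵛ) (λ e → onKernel-cong t e λ _ → refl)
            (λ y y′ → trans (onKernel-cong t (λ _ → refl) (λ _ → sym (+-identityˡ 0#))) (onKernel-+ t y y′ 0ᵛ 0ᵛ)) zeros y)
          (vanish (λ s → onKernel t 0ᵛ s) (λ e → onKernel-cong t (λ _ → refl) e)
            (λ s s′ → trans (onKernel-cong t (λ _ → sym (+-identityˡ 0#)) (λ _ → refl)) (onKernel-+ t 0ᵛ 0ᵛ s s′)) zeros′ s))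
          (+-identityˡ 0#)))

    analysis : Analysis E
    analysis = record
      { absent = abs
      ; C₀ = proj₁ (AlmostIso.onto iso)
      ; complete = λ t → let x , Vx = proj₂ (AlmostIso.onto iso) t in
          (λ j → eval (Env (env x 0ᵛ) none) (U j)) , x , λ i → V-resp (+-congˡ (-‿cong
            (trans (sum-cong λ j → reflexive (≡.cong (λ y → col j y i) (mix-same (slots j) (x j))))
              (trans (complete-col x x i) (+-congʳ (sym (lin′ x 0ᵛ i))))))) (Vx i)
      ; complement-bounded = λ K →
          let N , VN = E-Uᵇ
              K′ , f = slots-bounded (K ℕ.+ N)
          in K′ , λ w x Vw i abs-i → let y , s , u , Vu , eq = parametrise w in
            V-resp (reflexive (mix-absent (slots i) abs-i)) (f y x (λ r → V-resp
              (trans (+-congʳ (+-congʳ (trans (eq (E r)) (+-congʳ (lin′ y s r)))))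
                (solve (B y r ∷ eval (Uᵇ u) (E r) ∷ (if abs r then x r else 0#) ∷ []) (a₀ ⊕ a₁ ⊕ a₂ ⊕ ⊝ a₁) (a₀ ⊕ a₂)))
              (V-sub (V-mono (ℕ.m≤m+n K N) (Vw r)) (V-mono (ℕ.m≤n+m N K) (VN u Vu r)))) i)
      -- Variables of empty slots and free variables do not affect E and are set to zero; the pivot
      -- variables that remain are bounded because E is.
      ; bounded-solution = λ K →
          let K₁ , f = present-bounded K
              K₂ , g = uniform {P = λ j N → ∀ ρ → (∀ x → V ([ (λ _ → K₁) , β ] x) (ρ x)) → V N (eval ρ (U j))}
                         (λ j k≤l f ρ h → V-mono k≤l (f ρ h)) (λ j → V-eval [ (λ _ → K₁) , β ] (U j))
          in K₂ , λ w Vw → let y , s , u , Vu , eq = parametrise w in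
            (λ j → eval (Env (env (present y) 0ᵛ) u) (U j))
            , (λ j → g j _ λ { (inj₁ (slotV i)) → f w Vw i ; (inj₁ (freeV _)) → V-0 ; (inj₂ b) → Vu b })
            , λ i → trans (eval-cong (U-split _ u) (E i)) (trans (eval-+ _ (Uᵇ u) (E i)) (trans
                (+-congʳ (trans (lin′ (present y) 0ᵛ i) (trans (sum-cong λ j → slotFun-present y j i) (sym (lin′ y s i)))))
                (sym (eq (E i)))))
      ; Kernel = λ w → Level.Lift v (KernelOf w)
      ; kernel-0 = Level.lift (0ᵛ , 0ᵛ , λ j → sym (trans (eval-cong (λ
          { (inj₁ (slotV i)) → mix-0 (slots i) ; (inj₁ (freeV _)) → refl ; (inj₂ _) → refl }) (U j)) (eval-0 (U j))))
      ; kernel-+ = λ { (Level.lift (y , s , e)) (Level.lift (y′ , s′ , e′)) → Level.lift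
          ((λ i → y i + y′ i) , (λ j → s j + s′ j) , λ j → trans (+-cong (e j) (e′ j)) (sym (trans
            (eval-cong (λ { (inj₁ (slotV i)) → mix-+ (slots i) (y i) (y′ i) ; (inj₁ (freeV l)) → refl ; (inj₂ b) → sym (+-identityˡ 0#) }) (U j))
            (eval-+ (Env (env (missing y) s) none) (Env (env (missing y′) s′) none) (U j))))) }
      ; kernel-E = λ { (Level.lift (y , s , e)) i → trans (eval-cong e (E i)) (trans (lin′ (missing y) s i)
          (sum-0 λ j → slotFun-missing y j i)) }
      ; classify = classify }
      where
      mix-same : ∀ {i} (s : Maybe (Slot i)) x → x ≡ mix s x x
      mix-same nothing  x = ≡.refl
      mix-same (just _) x = ≡.refl
      mix-absent : ∀ {i} (s : Maybe (Slot i)) {y x} → isAbsent s ≡ true → mix s y x ≡ x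
      mix-absent nothing _ = ≡.refl
      classify : ∀ t → ((∀ {w} → Level.Lift v (KernelOf w) → eval w t ≈ 0#) ×
          (∀ K → ∃[ K′ ] ∀ w → (∀ i → V K (eval w (E i))) → V K′ (eval w t)))
        ⊎ (∀ N → ∃[ w ] Level.Lift v (KernelOf w) × ¬ V N (eval w t))
      classify t with kernel-dichotomy t
      ... | inj₂ large = inj₂ λ N → let y , s , ∉ = large N in _ , Level.lift (y , s , λ j → refl) , ∉
      -- Each slot variable splits into its present and its missing part. The missing part and the
      -- free variables contribute zero to t, and the present part is bounded by the values of E.
      ... | inj₁ zeros = inj₁ ((λ { (Level.lift (y , s , e)) → trans (eval-cong e t) (zeros y s) }) , λ K →
        let K₁ , f  = present-bounded K
            K₂ , g  = V-eval [ (λ _ → K₁) , (λ _ → 0) ] (t ⟪ U ⟫)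
            K₃ , f′ = term-Uᵇ t
        in K₂ ℕ.+ K₃ , λ w Vw → let y , s , u , Vu , eq = parametrise w in
          V-resp (sym (trans (eq t) (+-congʳ (trans
              (eval-cong (λ j → trans (eval-cong (λ { (inj₁ (slotV i)) → mix-split (slots i) (y i)
                                                    ; (inj₁ (freeV l)) → sym (+-identityˡ _) ; (inj₂ _) → sym (+-identityˡ _) }) (U j))
                 (eval-+ (Env (env (present y) 0ᵛ) none) (Env (env (missing y) s) none) (U j))) t)
              (trans (eval-+ _ _ t) (trans (+-congˡ (zeros y s)) (trans (+-identityʳ _)
                (reflexive (≡.sym (eval-⟪⟫ (Env (env (present y) 0ᵛ) none) U t))))))))))
            (V-+ (V-mono (ℕ.m≤m+n K₂ K₃) (g (Env (env (present y) 0ᵛ) none)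
                   λ { (inj₁ (slotV i)) → f w Vw i ; (inj₁ (freeV _)) → V-0 ; (inj₂ _) → V-0 }))
                 (V-mono (ℕ.m≤n+m K₃ K₂) (f′ u Vu))))

-- Quantifier elimination

module Definability {L : Language} {c ℓ r : Level} (M : Structure L c ℓ r) where
  open Structure M using (Carrier)

  private variable
    m n : ℕ

  mutual
    renameTerm : (Fin m → Fin n) → Term L m → Term L n
    renameTerm f (var i)    = var (f i)
    renameTerm f (app g ts) = app g (renameTerms f ts)

    renameTerms : ∀ {k} → (Fin m → Fin n) → Vec (Term L m) k → Vec (Term L n) k
    renameTerms f []       = []
    renameTerms f (t ∷ ts) = renameTerm f t ∷ renameTerms f ts

  under : (Fin m → Fin n) → Fin (suc m) → Fin (suc n)
  under f zero    = zero
  under f (suc i) = suc (f i)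

  rename : (Fin m → Fin n) → Formula L m → Formula L n
  rename f bot         = bot
  rename f (s ≐ t)     = renameTerm f s ≐ renameTerm f t
  rename f (pred R ts) = pred R (renameTerms f ts)
  rename f (φ ⇒ ψ)     = rename f φ ⇒ rename f ψ
  rename f (all φ)     = all (rename (under f) φ)

  module _ {u : Vec Carrier m} {v : Vec Carrier n} (f : Fin m → Fin n)
           (eq : ∀ i → Vec.lookup v (f i) ≡ Vec.lookup u i) where
    mutual
      eval-rename : ∀ t → evalTerm M v (renameTerm f t) ≡ evalTerm M u t
      eval-rename (var i)    = eq i
      eval-rename (app g ts) = ≡.cong (Structure.⟦_⟧ᶠ M g) (evals-rename ts)

      evals-rename : ∀ {k} (ts : Vec (Term L m) k) → evalTerms M v (renameTerms f ts) ≡ evalTerms M u ts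
      evals-rename []       = ≡.refl
      evals-rename (t ∷ ts) = ≡.cong₂ _∷_ (eval-rename t) (evals-rename ts)

  mutual
    rename⁺ : ∀ {m n} {u : Vec Carrier m} {v : Vec Carrier n} {f} → (∀ i → Vec.lookup v (f i) ≡ Vec.lookup u i) →
      ∀ φ → Satisfies M φ u → Satisfies M (rename f φ) v
    rename⁺ eq bot         x = x
    rename⁺ {f = f} eq (s ≐ t) (lift x) = lift (≡.subst₂ (Structure._≈_ M) (≡.sym (eval-rename f eq s)) (≡.sym (eval-rename f eq t)) x)
    rename⁺ {f = f} eq (pred R ts) (lift x) = lift (≡.subst (Structure.⟦_⟧ᵖ M R) (≡.sym (evals-rename f eq ts)) x)
    rename⁺ eq (φ ⇒ ψ)     x y = rename⁺ eq ψ (x (rename⁻ eq φ y))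
    rename⁺ eq (all φ)     x a = rename⁺ (λ { zero → ≡.refl ; (suc i) → eq i }) φ (x a)

    rename⁻ : ∀ {m n} {u : Vec Carrier m} {v : Vec Carrier n} {f} → (∀ i → Vec.lookup v (f i) ≡ Vec.lookup u i) →
      ∀ φ → Satisfies M (rename f φ) v → Satisfies M φ u
    rename⁻ eq bot         x = x
    rename⁻ {f = f} eq (s ≐ t) (lift x) = lift (≡.subst₂ (Structure._≈_ M) (eval-rename f eq s) (eval-rename f eq t) x)
    rename⁻ {f = f} eq (pred R ts) (lift x) = lift (≡.subst (Structure.⟦_⟧ᵖ M R) (evals-rename f eq ts) x)
    rename⁻ eq (φ ⇒ ψ)     x y = rename⁻ eq ψ (x (rename⁺ eq φ y))
    rename⁻ eq (all φ)     x a = rename⁻ (λ { zero → ≡.refl ; (suc i) → eq i }) φ (x a)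

  -- Predicates on families of elements of M indexed by A that are given by a
  -- formula, whatever variables stand for the indices.
  record Definable {A : Set} (Q : (A → Carrier) → Set (c ⊔ ℓ ⊔ r)) : Set (c ⊔ ℓ ⊔ r) where
    field
      form : (A → Fin n) → Formula L n
      to   : ∀ (f : A → Fin n) v → Satisfies M (form f) v → Q (Vec.lookup v ∘ f)
      from : ∀ (f : A → Fin n) v → Q (Vec.lookup v ∘ f) → Satisfies M (form f) v
      resp : ∀ {x y} → (∀ a → x a ≡ y a) → Q x → Q y

  open Definable

  private variable
    A B : Set
    Q Q′ : (A → Carrier) → Set (c ⊔ ℓ ⊔ r)

  def-formula : ∀ {k} (σ : Formula L k) (g : Fin k → A) → Definable (λ x → Satisfies M σ (Vec.tabulate (x ∘ g)))
  def-formula σ g = record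
    { form = λ f → rename (f ∘ g) σ
    ; to   = λ f v → rename⁻ (λ i → ≡.sym (Vec.lookup∘tabulate _ i)) σ
    ; from = λ f v → rename⁺ (λ i → ≡.sym (Vec.lookup∘tabulate _ i)) σ
    ; resp = λ e → ≡.subst (Satisfies M σ) (Vec.tabulate-cong (e ∘ g)) }

  def-⊥ : Definable {A} (λ _ → Level.Lift (c ⊔ ℓ ⊔ r) ⊥)
  def-⊥ = record { form = λ _ → bot ; to = λ _ _ x → lift (lower x) ; from = λ _ _ x → lift (lower x) ; resp = λ _ x → x }

  def-⇒ : Definable Q → Definable Q′ → Definable (λ x → Q x → Q′ x)
  def-⇒ dP dQ = record
    { form = λ f → form dP f ⇒ form dQ f
    ; to   = λ f v h p → to dQ f v (h (from dP f v p))
    ; from = λ f v h p → from dQ f v (h (to dP f v p))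
    ; resp = λ e h p → resp dQ e (h (resp dP (≡.sym ∘ e) p)) }

  def-¬ : Definable Q → Definable (λ x → ¬ Q x)
  def-¬ dP = record
    { form = λ f → form dP f ⇒ bot
    ; to   = λ f v h p → lower (h (from dP f v p))
    ; from = λ f v h p → lift (h (to dP f v p))
    ; resp = λ e h p → h (resp dP (≡.sym ∘ e) p) }

  def-∘ : (g : A → B) → Definable Q → Definable (λ x → Q (x ∘ g))
  def-∘ g dP = record
    { form = λ f → form dP (f ∘ g) ; to = λ f v → to dP (f ∘ g) v ; from = λ f v → from dP (f ∘ g) v
    ; resp = λ e → resp dP (e ∘ g) }

  alls : ∀ k → Formula L (k ℕ.+ n) → Formula L n
  alls zero    φ = φ
  alls (suc k) φ = alls k (all φ)

  alls⁻ : ∀ k (φ : Formula L (k ℕ.+ n)) {v} → Satisfies M (alls k φ) v → ∀ (u : Vec Carrier k) → Satisfies M φ (u Vec.++ v)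
  alls⁻ zero    φ h []      = h
  alls⁻ (suc k) φ h (a ∷ u) = alls⁻ k (all φ) h u a

  alls⁺ : ∀ k (φ : Formula L (k ℕ.+ n)) {v} → (∀ (u : Vec Carrier k) → Satisfies M φ (u Vec.++ v)) → Satisfies M (alls k φ) v
  alls⁺ zero    φ h = h []
  alls⁺ (suc k) φ h = alls⁺ k (all φ) λ u a → h (a ∷ u)

  def-∀ : ∀ k {Q : (A ⊎ Fin k → Carrier) → Set (c ⊔ ℓ ⊔ r)} → Definable Q → Definable {A} (λ x → ∀ (y : Fin k → Carrier) → Q [ x , y ])
  def-∀ {A} k dQ = record
    { form = λ f → alls k (form dQ (ext f))
    ; to   = λ f v h y → resp dQ (λ { (inj₁ a) → Vec.lookup-++ʳ (Vec.tabulate y) v (f a)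
                                    ; (inj₂ i) → ≡.trans (Vec.lookup-++ˡ (Vec.tabulate y) v i) (Vec.lookup∘tabulate y i) })
        (to dQ (ext f) (Vec.tabulate y Vec.++ v) (alls⁻ k (form dQ (ext f)) h (Vec.tabulate y)))
    ; from = λ f v h → alls⁺ k (form dQ (ext f)) λ u → from dQ (ext f) (u Vec.++ v)
        (resp dQ (λ { (inj₁ a) → ≡.sym (Vec.lookup-++ʳ u v (f a)) ; (inj₂ i) → ≡.sym (Vec.lookup-++ˡ u v i) }) (h (Vec.lookup u)))
    ; resp = λ e h y → resp dQ (λ { (inj₁ a) → e a ; (inj₂ i) → ≡.refl }) (h y) }
    where
    ext : (A → Fin n) → A ⊎ Fin k → Fin (k ℕ.+ n)
    ext f (inj₁ a) = k ↑ʳ f a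
    ext {n} f (inj₂ i) = i ↑ˡ n

  -- Conjunction is not primitive in formulas and its abbreviation is only classically a
  -- conjunction, so finitely many hypotheses are curried instead.
  Chain : ∀ {s} {k} → (Fin k → Set s) → Set s → Set s
  Chain {k = zero}  Q R = R
  Chain {k = suc k} Q R = Q zero → Chain (Q ∘ suc) R

  chain⁺ : ∀ {s k} {Q : Fin k → Set s} {R : Set s} → ((∀ i → Q i) → R) → Chain Q R
  chain⁺ {k = zero}  h   = h λ ()
  chain⁺ {k = suc k} h p = chain⁺ λ ps → h λ { zero → p ; (suc i) → ps i }

  chain⁻ : ∀ {s k} {Q : Fin k → Set s} {R : Set s} → Chain Q R → (∀ i → Q i) → R
  chain⁻ {k = zero}  h ps = h
  chain⁻ {k = suc k} h ps = chain⁻ (h (ps zero)) (ps ∘ suc)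

  def-chain : ∀ {k} {Q : Fin k → (A → Carrier) → Set (c ⊔ ℓ ⊔ r)} {R} → (∀ i → Definable (Q i)) → Definable R →
    Definable (λ x → Chain (λ i → Q i x) (R x))
  def-chain {k = zero}  dP dR = dR
  def-chain {k = suc k} dP dR = def-⇒ (dP zero) (def-chain (dP ∘ suc) dR)

  decide : DecidableTheory M → Definable {⊥} Q → ∀ x → Dec (Q x)
  decide dec dQ x = map′ (λ s → resp dQ (λ ()) (to dQ f [] s)) (λ h → from dQ f [] (resp dQ (λ ()) h)) (dec (form dQ f))
    where
    f : ⊥ → Fin 0
    f ()

-- Case distinctions such as whether an element lies in V N have no algorithm here, so the
-- equivalences of quantifier elimination are obtained in this monad.
module DoubleNegation where
  infixl 1 _>>=_
  pure : ∀ {a} {A : Set a} → A → ¬ ¬ A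
  pure x k = k x

  _>>=_ : ∀ {a b} {A : Set a} {B : Set b} → ¬ ¬ A → (A → ¬ ¬ B) → ¬ ¬ B
  (m >>= f) k = m λ x → f x k

  excluded-middle : ∀ {a} (A : Set a) → ¬ ¬ (A ⊎ ¬ A)
  excluded-middle A k = k (inj₂ λ x → k (inj₁ x))

  finite : ∀ {a n} {A : Fin n → Set a} → (∀ i → ¬ ¬ A i) → ¬ ¬ (∀ i → A i)
  finite {n = zero}  f k = k λ ()
  finite {n = suc n} f = f zero >>= λ x → finite (f ∘ suc) >>= λ xs → pure λ { zero → x ; (suc i) → xs i }

module Horner {q a ℓ v} (M : FilteredModule q a ℓ v) where
  open Forms M

  horner : ∀ {n} → (Fin n → Carrier) → Carrier
  horner {zero}  y = 0#
  horner {suc n} y = y zero + z (horner (y ∘ suc))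

  hornerᴸ : ∀ {s} {A : Set s} {n} → (Fin n → LinTerm q A) → LinTerm q A
  hornerᴸ {n = zero}  t = 0ᴸ
  hornerᴸ {n = suc n} t = t zero +ᴸ zᴸ (hornerᴸ (t ∘ suc))

  eval-horner : ∀ {s} {A : Set s} {n} (ρ : A → Carrier) (t : Fin n → LinTerm q A) →
    eval ρ (hornerᴸ t) ≡ horner (λ i → eval ρ (t i))
  eval-horner {n = zero}  ρ t = ≡.refl
  eval-horner {n = suc n} ρ t = ≡.cong (λ u → eval ρ (t zero) + z u) (eval-horner ρ (t ∘ suc))

  horner-cong : ∀ {n} {x y : Fin n → Carrier} → (∀ i → x i ≈ y i) → horner x ≈ horner y
  horner-cong {zero}  e = refl
  horner-cong {suc n} e = +-cong (e zero) (Additive.cong z-add (horner-cong (e ∘ suc)))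

module _ {c ℓ₁ ℓ₂} (F : HeytingField c ℓ₁ ℓ₂) (p : ℕ) where
  open Definability (Fₚ-structure F p)

  -- The coordinates of the elements of V N with respect to a finite basis over
  -- F; bnd N embeds F as the multiples of the N-th power of the common denominator's inverse.
  record Coordinates {q} (M : FilteredModule q (c ⊔ ℓ₁) ℓ₁ (c ⊔ ℓ₁)) : Set (lsuc (c ⊔ ℓ₁)) where
    open Forms M
    open Horner M
    private K = HeytingField.Carrier F
    field
      bnd     : ℕ → K → Carrier
      len     : ℕ → ℕ
      bnd-V   : ∀ N x → V (suc N) (bnd N x)
      bnd-cong : ∀ N {x y} → HeytingField._≈_ F x y → bnd N x ≈ bnd N y

    vec : ∀ N → (Fin (len N) → K) → Carrier
    vec N x = horner (λ i → bnd N (x i))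

    field
      vec-V   : ∀ N x → V N (vec N x)
      V-coord : ∀ {N x} → V N x → ∃[ y ] x ≈ vec N y
      definable-zero : ∀ {A : Set} (e : A → ℕ) (t : LinTerm q A) →
        Definable (λ x → Level.Lift c (eval (λ a → bnd (e a) (x a)) t ≈ 0#))

-- Basic relations: projections, unions and intersections

module Basics {c ℓ₁ ℓ₂} (F : HeytingField c ℓ₁ ℓ₂) (p : ℕ)
  {q} (M : FilteredModule q (c ⊔ ℓ₁) ℓ₁ (c ⊔ ℓ₁)) (C : Coordinates F p M) where
  open Forms M
  open Horner M
  open Coordinates C
  open Definability (Fₚ-structure F p)
  open DoubleNegation

  𝕃 : Level
  𝕃 = c ⊔ ℓ₁

  K : Set c
  K = HeytingField.Carrier F

  data Variable (n m k : ℕ) : Set where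
    xv : Fin n → Variable n m k
    wv : Fin m → Variable n m k
    uv : Fin k → Variable n m k

  private variable
    n m k n′ m′ k′ : ℕ

  assign : (Fin n → Carrier) → (Fin m → Carrier) → (Fin k → Carrier) → Variable n m k → Carrier
  assign x w u (xv i) = x i
  assign x w u (wv i) = w i
  assign x w u (uv i) = u i

  Term′ : ℕ → ℕ → ℕ → Set
  Term′ n m k = LinTerm q (Variable n m k)

  Solves : List (Term′ n m k) → (Variable n m k → Carrier) → Set ℓ₁
  Solves eqs ρ = All (λ t → eval ρ t ≈ 0#) eqs

  Avoids : List (Term′ n m k × ℕ) → (Variable n m k → Carrier) → Set 𝕃
  Avoids negs ρ = All (λ tN → ¬ V (proj₂ tN) (eval ρ (proj₁ tN))) negs

  -- ∃ w ∈ Rᵐ, u₁ ∈ f^{-e₁} F, …, u_k ∈ f^{-e_k} F satisfying the equations, a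
  -- first-order condition over F, and a lower bound for the poles of some terms.
  record Basic (n : ℕ) : Set (lsuc 𝕃) where
    field
      {vars bvars} : ℕ
      exps : Fin bvars → ℕ
      eqs  : List (Term′ n vars bvars)
      cond : (Fin bvars → K) → Set 𝕃
      cond-def : Definable cond
      negs : List (Term′ n vars bvars × ℕ)

    bounded : (Fin bvars → K) → Fin bvars → Carrier
    bounded d i = bnd (exps i) (d i)

    at : Vec Carrier n → (Fin vars → Carrier) → (Fin bvars → K) → Variable n vars bvars → Carrier
    at x w d = assign (Vec.lookup x) w (bounded d)

  open Basic

  Holds : Basic n → Vec Carrier n → Set 𝕃
  Holds D x = ∃[ w ] ∃[ d ] Solves (eqs D) (at D x w d) × cond D d × Avoids (negs D) (at D x w d)

  ren : (Variable n m k → Variable n′ m′ k′) → Term′ n m k → Term′ n′ m′ k′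
  ren f t = t ⟪ var ∘ f ⟫

  module _ {f : Variable n m k → Variable n′ m′ k′} {ρ : Variable n m k → Carrier} {ρ′ : Variable n′ m′ k′ → Carrier}
           (agree : ∀ v → ρ v ≈ ρ′ (f v)) where
    eval-ren : ∀ t → eval ρ′ (ren f t) ≈ eval ρ t
    eval-ren t = trans (reflexive (eval-⟪⟫ ρ′ (var ∘ f) t)) (eval-cong (sym ∘ agree) t)

    solves-ren⁺ : ∀ {eqs} → Solves eqs ρ → Solves (List.map (ren f) eqs) ρ′
    solves-ren⁺ s = All.map⁺ (All.map (λ {t} e → trans (eval-ren t) e) s)

    solves-ren⁻ : ∀ {eqs} → Solves (List.map (ren f) eqs) ρ′ → Solves eqs ρ
    solves-ren⁻ s = All.map (λ {t} e → trans (sym (eval-ren t)) e) (All.map⁻ s)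

    renN : Term′ n m k × ℕ → Term′ n′ m′ k′ × ℕ
    renN (t , N) = ren f t , N

    avoids-ren⁺ : ∀ {negs} → Avoids negs ρ → Avoids (List.map renN negs) ρ′
    avoids-ren⁺ s = All.map⁺ (All.map (λ {tN} h Vt → h (V-resp (eval-ren (proj₁ tN)) Vt)) s)

    avoids-ren⁻ : ∀ {negs} → Avoids (List.map renN negs) ρ′ → Avoids negs ρ
    avoids-ren⁻ s = All.map (λ {tN} h Vt → h (V-resp (sym (eval-ren (proj₁ tN))) Vt)) (All.map⁻ s)

  -- Predicates on R that are finite unions of basic ones, up to double negation.
  record Eliminable {s} {n} (H : Vec Carrier n → Set s) : Set (lsuc 𝕃 ⊔ s) where
    field
      parts    : List (Basic n)
      sound    : ∀ {x} → H x → ¬ ¬ Any (λ D → Holds D x) parts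
      complete : ∀ {x} → Any (λ D → Holds D x) parts → ¬ ¬ H x

  open Eliminable

  private variable
    s t : Level
    H : Vec Carrier n → Set s
    H′ : Vec Carrier n → Set t

  elim-⇔ : (∀ {x} → H x → ¬ ¬ H′ x) → (∀ {x} → H′ x → ¬ ¬ H x) → Eliminable H → Eliminable {n = n} H′
  elim-⇔ f g e = record
    { parts = parts e ; sound = λ Qx → g Qx >>= sound e ; complete = λ h → complete e h >>= f }

  elim-basic : ∀ (D : Basic n) → Eliminable (Holds D)
  elim-basic D = record { parts = D ∷ [] ; sound = λ h → pure (here h) ; complete = λ { (here h) → pure h } }

  elim-⊥ : Eliminable {n = n} (λ _ → Level.Lift 𝕃 ⊥)
  elim-⊥ = record { parts = [] ; sound = λ { (lift ()) } ; complete = λ () }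

  elim-∪ : Eliminable H → Eliminable H′ → Eliminable {n = n} (λ x → H x ⊎ H′ x)
  elim-∪ eP eQ = record
    { parts = parts eP ++ parts eQ
    ; sound = λ { (inj₁ Px) → sound eP Px >>= pure ∘ Any.++⁺ˡ ; (inj₂ Qx) → sound eQ Qx >>= pure ∘ Any.++⁺ʳ (parts eP) }
    ; complete = λ h → [ (λ h′ → complete eP h′ >>= pure ∘ inj₁) , (λ h′ → complete eQ h′ >>= pure ∘ inj₂) ] (Any.++⁻ (parts eP) h) }

  elim-⋃ : ∀ {k} {H : Fin k → Vec Carrier n → Set s} → (∀ i → Eliminable (H i)) → Eliminable (λ x → ∃[ i ] H i x)
  elim-⋃ {k = zero}  e = elim-⇔ (λ { (lift ()) }) (λ { (() , _) }) elim-⊥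
  elim-⋃ {k = suc k} e = elim-⇔ (λ { (inj₁ h) → pure (zero , h) ; (inj₂ (i , h)) → pure (suc i , h) })
    (λ { (zero , h) → pure (inj₁ h) ; (suc i , h) → pure (inj₂ (i , h)) }) (elim-∪ (e zero) (elim-⋃ (e ∘ suc)))

  -- Basic relations are existential already, so a quantified variable simply joins the unknowns
  -- `w`.
  module Bind (D : Basic (suc n)) where
    f : Variable (suc n) (vars D) (bvars D) → Variable n (suc (vars D)) (bvars D)
    f (xv zero)    = wv zero
    f (xv (suc i)) = xv i
    f (wv i)       = wv (suc i)
    f (uv i)       = uv i

    agree : ∀ {a x w d} {w′ : Fin (suc (vars D)) → Carrier} → a ≡ w′ zero → (∀ i → w i ≡ w′ (suc i)) →
      ∀ v → at D (a ∷ x) w d v ≈ assign (Vec.lookup x) w′ (bounded D d) (f v)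
    agree e es (xv zero)    = reflexive e
    agree e es (xv (suc i)) = refl
    agree e es (wv i)       = reflexive (es i)
    agree e es (uv i)       = refl

    bind : Basic n
    bind = record { exps = exps D ; eqs = List.map (ren f) (eqs D) ; cond = cond D ; cond-def = cond-def D
                  ; negs = List.map (λ tN → ren f (proj₁ tN) , proj₂ tN) (negs D) }

    bind⁺ : ∀ {a x} → Holds D (a ∷ x) → Holds bind x
    bind⁺ {a} {x} (w , d , s , h , v) = w′ , d , solves-ren⁺ (agree ≡.refl λ _ → ≡.refl) s , h
      , avoids-ren⁺ (agree ≡.refl λ _ → ≡.refl) v
      where
      w′ : Fin (suc (vars D)) → Carrier
      w′ zero    = a
      w′ (suc i) = w i

    bind⁻ : ∀ {x} → Holds bind x → ∃[ a ] Holds D (a ∷ x)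
    bind⁻ (w , d , s , h , v) = w zero , w ∘ suc , d , solves-ren⁻ (agree ≡.refl λ _ → ≡.refl) s , h
      , avoids-ren⁻ (agree ≡.refl λ _ → ≡.refl) v

  elim-∃ : {H : Vec Carrier (suc n) → Set s} → Eliminable H → Eliminable (λ x → ∃[ a ] H (a ∷ x))
  elim-∃ e = record
    { parts    = List.map Bind.bind (parts e)
    ; sound    = λ { (a , Pa) → sound e Pa >>= λ h → pure (Any.map⁺ (Any.map (λ {D} → Bind.bind⁺ D) h)) }
    ; complete = λ h → let a , h′ = pick (parts e) (Any.map⁻ h) in complete e h′ >>= λ Pa → pure (a , Pa) }
    where
    pick : ∀ Ds {x} → Any (λ D → Holds (Bind.bind D) x) Ds → ∃[ a ] Any (λ D → Holds D (a ∷ x)) Ds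
    pick (D ∷ Ds) (here h)  = let a , h′ = Bind.bind⁻ D h in a , here h′
    pick (D ∷ Ds) (there h) = let a , h′ = pick Ds h in a , there h′

  merge : ∀ {s} {S : Set s} → (Fin m → S) → (Fin n → S) → Fin (m ℕ.+ n) → S
  merge {m} f g = [ f , g ] ∘ splitAt m

  merge-ˡ : ∀ {s} {S : Set s} (f : Fin m → S) (g : Fin n → S) i → merge f g (i ↑ˡ n) ≡ f i
  merge-ˡ {m} {n} f g i = ≡.cong [ f , g ] (Fin.splitAt-↑ˡ m i n)

  merge-ʳ : ∀ {s} {S : Set s} (f : Fin m → S) (g : Fin n → S) i → merge f g (m ↑ʳ i) ≡ g i
  merge-ʳ {m} {n} f g i = ≡.cong [ f , g ] (Fin.splitAt-↑ʳ m n i)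

  module Meet (D D′ : Basic n) where
    g : Variable n (vars D) (bvars D) → Variable n (vars D ℕ.+ vars D′) (bvars D ℕ.+ bvars D′)
    g (xv i) = xv i
    g (wv i) = wv (i ↑ˡ vars D′)
    g (uv i) = uv (i ↑ˡ bvars D′)

    g′ : Variable n (vars D′) (bvars D′) → Variable n (vars D ℕ.+ vars D′) (bvars D ℕ.+ bvars D′)
    g′ (xv i) = xv i
    g′ (wv i) = wv (vars D ↑ʳ i)
    g′ (uv i) = uv (bvars D ↑ʳ i)

    meet : Basic n
    meet = record
      { exps = merge (exps D) (exps D′)
      ; eqs  = List.map (ren g) (eqs D) ++ List.map (ren g′) (eqs D′)
      -- Conjunction has to be written with → and ¬ to remain `Definable`; hence `meet⁻` yields its
      -- conclusion only up to double negation.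
      ; cond = λ d → ¬ (cond D (λ i → d (i ↑ˡ bvars D′)) → ¬ cond D′ (λ i → d (bvars D ↑ʳ i)))
      ; cond-def = def-¬ (def-⇒ (def-∘ (_↑ˡ bvars D′) (cond-def D)) (def-¬ (def-∘ (bvars D ↑ʳ_) (cond-def D′))))
      ; negs = List.map (λ tN → ren g (proj₁ tN) , proj₂ tN) (negs D) ++ List.map (λ tN → ren g′ (proj₁ tN) , proj₂ tN) (negs D′) }

    module _ {x : Vec Carrier n} {w : Fin (vars D ℕ.+ vars D′) → Carrier}
             {w₁ : Fin (vars D) → Carrier} {w₂ : Fin (vars D′) → Carrier}
             {d : Fin (bvars D ℕ.+ bvars D′) → K} {d₁ : Fin (bvars D) → K} {d₂ : Fin (bvars D′) → K}
             (ew₁ : ∀ i → w₁ i ≡ w (i ↑ˡ vars D′)) (ew₂ : ∀ i → w₂ i ≡ w (vars D ↑ʳ i))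
             (ed₁ : ∀ i → d₁ i ≡ d (i ↑ˡ bvars D′)) (ed₂ : ∀ i → d₂ i ≡ d (bvars D ↑ʳ i)) where
      agree : ∀ v → at D x w₁ d₁ v ≈ at meet x w d (g v)
      agree (xv i) = refl
      agree (wv i) = reflexive (ew₁ i)
      agree (uv i) = reflexive (≡.cong₂ bnd (≡.sym (merge-ˡ (exps D) (exps D′) i)) (ed₁ i))

      agree′ : ∀ v → at D′ x w₂ d₂ v ≈ at meet x w d (g′ v)
      agree′ (xv i) = refl
      agree′ (wv i) = reflexive (ew₂ i)
      agree′ (uv i) = reflexive (≡.cong₂ bnd (≡.sym (merge-ʳ (exps D) (exps D′) i)) (ed₂ i))

    meet⁺ : ∀ {x} → Holds D x → Holds D′ x → Holds meet x
    meet⁺ {x} (w , d , s , h , v) (w′ , d′ , s′ , h′ , v′) = merge w w′ , merge d d′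
      , All.++⁺ (solves-ren⁺ a s) (solves-ren⁺ a′ s′)
      , (λ k → k (Definable.resp (cond-def D) (≡.sym ∘ merge-ˡ d d′) h) (Definable.resp (cond-def D′) (≡.sym ∘ merge-ʳ d d′) h′))
      , All.++⁺ (avoids-ren⁺ a v) (avoids-ren⁺ a′ v′)
      where
      a  = agree {x} (≡.sym ∘ merge-ˡ w w′) (≡.sym ∘ merge-ʳ w w′) (≡.sym ∘ merge-ˡ d d′) (≡.sym ∘ merge-ʳ d d′)
      a′ = agree′ {x} (≡.sym ∘ merge-ˡ w w′) (≡.sym ∘ merge-ʳ w w′) (≡.sym ∘ merge-ˡ d d′) (≡.sym ∘ merge-ʳ d d′)

    meet⁻ : ∀ {x} → Holds meet x → ¬ ¬ (Holds D x × Holds D′ x)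
    meet⁻ {x} (w , d , s , h , v) k = h λ h₁ h₂ → k
      ( (_ , _ , solves-ren⁻ a (All.++⁻ˡ (List.map (ren g) (eqs D)) s) , h₁ , avoids-ren⁻ a (All.++⁻ˡ (List.map _ (negs D)) v))
      , (_ , _ , solves-ren⁻ a′ (All.++⁻ʳ (List.map (ren g) (eqs D)) s) , h₂ , avoids-ren⁻ a′ (All.++⁻ʳ (List.map _ (negs D)) v)))
      where
      a  = agree {x} {w} {d = d} (λ _ → ≡.refl) (λ _ → ≡.refl) (λ _ → ≡.refl) (λ _ → ≡.refl)
      a′ = agree′ {x} {w} {d = d} (λ _ → ≡.refl) (λ _ → ≡.refl) (λ _ → ≡.refl) (λ _ → ≡.refl)

  elim-any : ∀ (Ds : List (Basic n)) → (∀ D → Eliminable (λ x → Holds D x × H′ x)) → Eliminable (λ x → Any (λ D → Holds D x) Ds × H′ x)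
  elim-any []       e = elim-⇔ (λ { (lift ()) }) (λ { (() , _) }) elim-⊥
  elim-any (D ∷ Ds) e = elim-⇔
    (λ { (inj₁ (h , q)) → pure (here h , q) ; (inj₂ (h , q)) → pure (there h , q) })
    (λ { (here h , q) → pure (inj₁ (h , q)) ; (there h , q) → pure (inj₂ (h , q)) }) (elim-∪ (e D) (elim-any Ds e))

  elim-∩ : Eliminable H → Eliminable H′ → Eliminable {n = n} (λ x → H x × H′ x)
  elim-∩ {H = H} {H′ = H′} eP eQ = elim-⇔
    (λ { (h , q) → complete eP h >>= λ p → pure (p , q) }) (λ { (p , q) → sound eP p >>= λ h → pure (h , q) })
    (elim-any (parts eP) λ D → elim-⇔
      (λ { (h , h′) → complete eQ h >>= λ q → pure (h′ , q) }) (λ { (h′ , q) → sound eQ q >>= λ h → pure (h , h′) })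
      (elim-any (parts eQ) λ D′ → elim-⇔
        (λ {x} h → Meet.meet⁻ D D′ {x} h >>= λ { (h , h′) → pure (h′ , h) }) (λ { {x} (h′ , h) → pure (Meet.meet⁺ D D′ {x} h h′) })
        (elim-basic (Meet.meet D D′))))

  elim-¬any : (∀ (D : Basic n) → Eliminable (λ x → ¬ Holds D x)) → ∀ (Ds : List (Basic n)) → Eliminable (λ x → ¬ Any (λ D → Holds D x) Ds)
  elim-¬any e []       = record
    { parts = record { exps = λ () ; eqs = [] ; cond = λ _ → ¬ Level.Lift 𝕃 ⊥ ; cond-def = def-¬ def-⊥ ; negs = [] ; vars = 0 ; bvars = 0 } ∷ []
    ; sound = λ _ → pure (here ((λ ()) , (λ ()) , [] , (λ { (lift ()) }) , []))
    ; complete = λ _ → pure λ () }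
  elim-¬any e (D ∷ Ds) = elim-⇔ {H = λ x → (¬ Holds D x) × (¬ Any (λ D → Holds D x) Ds)}
    (λ { (n₁ , n₂) → pure λ { (here h) → n₁ h ; (there h) → n₂ h } }) (λ n₁ → pure ((λ h → n₁ (here h)) , λ h → n₁ (there h)))
    (elim-∩ (e D) (elim-¬any e Ds))

-- Terms that are bounded or unbounded on the solutions

module Elimination {c ℓ₁ ℓ₂} (F : HeytingField c ℓ₁ ℓ₂) (p : ℕ)
  {q} (M : FilteredModule q (c ⊔ ℓ₁) ℓ₁ (c ⊔ ℓ₁)) (C : Coordinates F p M) where
  open Forms M
  open Horner M
  open Coordinates C
  open Definability (Fₚ-structure F p)
  open DoubleNegation
  open Splitting M
  open Systems M
  open Basics F p M C
  open Basic

  private variable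
    n m k n′ m′ k′ : ℕ

  all-lookup : ∀ {a b} {A : Set a} {B : A → Set b} {xs} → All B xs → ∀ i → B (List.lookup xs i)
  all-lookup (x ∷ xs) zero    = x
  all-lookup (x ∷ xs) (suc i) = all-lookup xs i

  all-tabulate : ∀ {a b} {A : Set a} {B : A → Set b} {xs} → (∀ i → B (List.lookup xs i)) → All B xs
  all-tabulate {xs = []}     f = []
  all-tabulate {xs = x ∷ xs} f = f zero ∷ all-tabulate (f ∘ suc)

  0ᶠ : ∀ {k} → Fin k → Carrier
  0ᶠ _ = 0#

  eval-assign-+ : ∀ (x x′ : Fin n → Carrier) (w w′ : Fin m → Carrier) (u u′ : Fin k → Carrier) t →
    eval (assign (λ i → x i + x′ i) (λ i → w i + w′ i) (λ i → u i + u′ i)) t ≈ eval (assign x w u) t + eval (assign x′ w′ u′) t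
  eval-assign-+ x x′ w w′ u u′ t = trans
    (eval-cong (λ { (xv i) → refl ; (wv i) → refl ; (uv i) → refl }) t) (eval-+ (assign x w u) (assign x′ w′ u′) t)

  onW : (Fin m → Carrier) → Variable n m k → Carrier
  onW w = assign 0ᶠ w 0ᶠ

  wPart : Variable n m k → LinTerm q (Fin m)
  wPart (xv i) = 0ᴸ
  wPart (wv i) = var i
  wPart (uv i) = 0ᴸ

  eval-wPart : ∀ (w : Fin m → Carrier) (t : Term′ n m k) → eval w (t ⟪ wPart ⟫) ≈ eval (onW w) t
  eval-wPart w t = trans (reflexive (eval-⟪⟫ w wPart t)) (eval-cong (λ { (xv i) → refl ; (wv i) → refl ; (uv i) → refl }) t)

  eval-shift : ∀ (x : Fin n → Carrier) (w κ : Fin m → Carrier) (u : Fin k → Carrier) t →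
    eval (assign x (λ i → w i + κ i) u) t ≈ eval (assign x w u) t + eval (onW κ) t
  eval-shift x w κ u t = trans
    (eval-cong (λ { (xv i) → sym (+-identityʳ _) ; (wv i) → refl ; (uv i) → sym (+-identityʳ _) }) t)
    (eval-assign-+ x 0ᶠ w κ u 0ᶠ t)

  normaliseAll : List (Term′ n m k) → List (Term′ n m k)
  normaliseAll []         = []
  normaliseAll (t ∷ eqs) = normalise t ++ normaliseAll eqs

  normaliseAll-form : ∀ (eqs : List (Term′ n m k)) → All FormTerm (normaliseAll eqs)
  normaliseAll-form []        = []
  normaliseAll-form (t ∷ eqs) = All.++⁺ (normalise-form t) (normaliseAll-form eqs)

  normalise-solves⁺ : ∀ {ρ} (eqs : List (Term′ n m k)) → Solves eqs ρ → Solves (normaliseAll eqs) ρ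
  normalise-solves⁺ []        []      = []
  normalise-solves⁺ (t ∷ eqs) (e ∷ s) = All.++⁺ (splits-zero⁺ (τ-depth t) t e) (normalise-solves⁺ eqs s)

  normalise-solves⁻ : ∀ {ρ} (eqs : List (Term′ n m k)) → Solves (normaliseAll eqs) ρ → Solves eqs ρ
  normalise-solves⁻ []        s = []
  normalise-solves⁻ (t ∷ eqs) s = splits-zero⁻ (τ-depth t) t (All.++⁻ˡ (normalise t) s) ∷ normalise-solves⁻ eqs (All.++⁻ʳ (normalise t) s)

  normalise-V : ∀ {ρ N} (eqs : List (Term′ n m k)) → All (λ t → V N (eval ρ t)) eqs → All (λ t → V N (eval ρ t)) (normaliseAll eqs)
  normalise-V []        []      = []
  normalise-V (t ∷ eqs) (e ∷ s) = All.++⁺ (splits-V (τ-depth t) t e) (normalise-V eqs s)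

  module System (eqs : List (Term′ n m k)) where
    rows : ℕ
    rows = List.length (normaliseAll eqs)

    equation : Fin rows → Term′ n m k
    equation = List.lookup (normaliseAll eqs)

    E : Fin rows → LinTerm q (Fin m)
    E i = equation i ⟪ wPart ⟫

    E-form : ∀ i → FormTerm (E i)
    E-form i {σ} S = let d , G = all-lookup (normaliseAll-form eqs) i {λ y → onW (σ y)}
                                   (λ { (xv i) → Form-0 0 ; (wv i) → S i ; (uv i) → Form-0 0 })
                     in d , Form-resp (λ y → sym (eval-wPart (σ y) (equation i))) G

    abstract
      system : Analysis E
      system = analysis E E-form

    open Analysis system public

    solves⁺ : ∀ {ρ} → Solves eqs ρ → ∀ i → eval ρ (equation i) ≈ 0#
    solves⁺ s = all-lookup (normalise-solves⁺ eqs s)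

    solves⁻ : ∀ {ρ} → (∀ i → eval ρ (equation i) ≈ 0#) → Solves eqs ρ
    solves⁻ s = normalise-solves⁻ eqs (all-tabulate s)

  -- The equations are assumed bounded rather than zero because the difference of two solutions with
  -- different `u` satisfies them only up to a bounded error.
  BoundedBy : List (Term′ n m k) → Term′ n m k → Set (c ⊔ ℓ₁)
  BoundedBy eqs t = ∀ K → ∃[ K′ ] ∀ w → All (λ e → V K (eval (onW w) e)) eqs → V K′ (eval (onW w) t)

  withNegs : (D : Basic n) → List (Term′ n (vars D) (bvars D) × ℕ) → Basic n
  withNegs D negs = record { exps = exps D ; eqs = eqs D ; cond = cond D ; cond-def = cond-def D ; negs = negs }

  -- A requirement t ∉ V N on a term unbounded on the kernel is always attainable: adding a suitable
  -- kernel element to a solution preserves the equations and every small term, while it moves all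
  -- large terms away at once.
  module DropLarge (D : Basic n) where
    open System (eqs D)

    Term″ = Term′ n (vars D) (bvars D)

    Small Large : Term″ → Set (c ⊔ ℓ₁)
    Small t = (∀ {w} → Kernel w → eval (onW w) t ≈ 0#) × BoundedBy (eqs D) t
    Large t = ∀ N → ∃[ w ] Kernel w × ¬ V N (eval (onW w) t)

    small-or-large : ∀ t → Small t ⊎ Large t
    small-or-large t with classify (t ⟪ wPart ⟫)
    ... | inj₂ large = inj₂ λ N → let w , Kw , ∉ = large N in w , Kw , λ Vt → ∉ (V-resp (sym (eval-wPart w t)) Vt)
    ... | inj₁ (zeros , bdd) = inj₁ ((λ {w} Kw → trans (sym (eval-wPart w t)) (zeros Kw)) , λ K →
      let K′ , f = bdd K in K′ , λ w Vw → V-resp (eval-wPart w t)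
        (f w λ i → V-resp (sym (eval-wPart w (equation i))) (all-lookup (normalise-V (eqs D) Vw) i)))

    record Partition (negs : List (Term″ × ℕ)) : Set (c ⊔ ℓ₁) where
      field
        small large : List (Term″ × ℕ)
        smalls : All (Small ∘ proj₁) small
        larges : All (Large ∘ proj₁) large
        split  : ∀ {ρ} → Avoids negs ρ → Avoids small ρ
        join   : ∀ {ρ} → Avoids small ρ → Avoids large ρ → Avoids negs ρ

    partition : ∀ negs → Partition negs
    partition [] = record { small = [] ; large = [] ; smalls = [] ; larges = [] ; split = id ; join = λ _ _ → [] }
    partition ((t , N) ∷ negs) with small-or-large t | partition negs
    ... | inj₁ s | r = record
      { small = (t , N) ∷ small ; large = large ; smalls = s ∷ smalls ; larges = larges
      ; split = λ { (h ∷ hs) → h ∷ split hs } ; join = λ { (h ∷ hs) ls → h ∷ join hs ls } }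
      where open Partition r
    ... | inj₂ l | r = record
      { small = small ; large = (t , N) ∷ large ; smalls = smalls ; larges = l ∷ larges
      ; split = λ { (h ∷ hs) → split hs } ; join = λ { ss (h ∷ hs) → h ∷ join ss hs } }
      where open Partition r

    -- Given κ large for the other terms and κ′ large for t, one of κ and κ + κ′
    -- is large for all of them, provided that κ was chosen after κ′.
    simultaneous : ∀ {large} → All (Large ∘ proj₁) large → ∀ N →
      ¬ ¬ (∃[ κ ] Kernel κ × All (λ tN → ¬ V N (eval (onW κ) (proj₁ tN))) large)
    simultaneous [] N = pure (0ᶠ , kernel-0 , [])
    simultaneous {(t , _) ∷ ts} (l ∷ ls) N =
      let κ′ , Kκ′ , ∉ = l N
          B , VB = bound ts κ′
      in simultaneous ls (N ℕ.+ B) >>= λ { (κ , Kκ , far) →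
         excluded-middle (V N (eval (onW κ) t)) >>= λ
           { (inj₂ ∉′) → pure (κ , Kκ , ∉′ ∷ All.map (λ h Vt → h (V-mono (ℕ.m≤m+n N B) Vt)) far)
           ; (inj₁ Vκ) → pure ((λ i → κ i + κ′ i) , kernel-+ Kκ Kκ′ ,
               (λ Vt → ∉ (V-resp (trans (+-congʳ (sum-value κ κ′ t)) (solve (eval (onW κ) t ∷ eval (onW κ′) t ∷ []) (a₀ ⊕ a₁ ⊕ ⊝ a₀) a₁)) (V-sub Vt Vκ)))
               ∷ combine ts far VB) } }
      where
      sum-value : ∀ κ κ′ t → eval (onW (λ i → κ i + κ′ i)) t ≈ eval (onW κ) t + eval (onW κ′) t
      sum-value κ κ′ t = trans (eval-shift 0ᶠ κ κ′ 0ᶠ t) refl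
      bound : ∀ (ts : List (Term″ × ℕ)) κ → ∃[ B ] All (λ tN → V B (eval (onW κ) (proj₁ tN))) ts
      bound []             κ = 0 , []
      bound ((t , _) ∷ ts) κ = let B , VB = V-all (eval (onW κ) t) ; B′ , VB′ = bound ts κ
        in B ℕ.+ B′ , V-mono (ℕ.m≤m+n B B′) VB ∷ All.map (V-mono (ℕ.m≤n+m B′ B)) VB′
      combine : ∀ ts {κ κ′ B} → All (λ tN → ¬ V (N ℕ.+ B) (eval (onW κ) (proj₁ tN))) ts → All (λ tN → V B (eval (onW κ′) (proj₁ tN))) ts →
        All (λ tN → ¬ V N (eval (onW (λ i → κ i + κ′ i)) (proj₁ tN))) ts
      combine []             []       []        = []
      combine ((t , _) ∷ ts) {κ} {κ′} {B} (h ∷ hs) (VB ∷ VBs) =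
        (λ Vt → h (V-resp (trans (+-congʳ (sum-value κ κ′ t)) (solve (eval (onW κ) t ∷ eval (onW κ′) t ∷ []) (a₀ ⊕ a₁ ⊕ ⊝ a₁) a₀))
                    (V-sub (V-mono (ℕ.m≤m+n N B) Vt) (V-mono (ℕ.m≤n+m B N) VB)))) ∷ combine ts hs VBs

    open Partition (partition (negs D))

    reduced : Basic n
    reduced = withNegs D small

    reduced-bounded : All (BoundedBy (eqs D) ∘ proj₁) small
    reduced-bounded = All.map proj₂ smalls

    reduced⁺ : ∀ {x} → Holds D x → Holds reduced x
    reduced⁺ (w , d , s , h , v) = w , d , s , h , split v

    reduced⁻ : ∀ {x} → Holds reduced x → ¬ ¬ Holds D x
    reduced⁻ {x} (w , d , s , h , v) =
      -- Each large term has some order B at the given solution, so a kernel element whose value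
      -- avoids V (N + B) moves that term out of V N. The bound chosen here covers all of these
      -- sums.
      let N , avoid = target large
      in simultaneous larges N >>= λ { (κ , Kκ , far) → pure
        ((λ i → w i + κ i) , d
        , solves⁻ (λ i → trans (eval-shift (Vec.lookup x) w κ (bounded D d) (equation i)) (trans
            (+-cong (solves⁺ s i) (trans (sym (eval-wPart κ (equation i))) (kernel-E Kκ i))) (+-identityˡ 0#)))
        , h , join (stay Kκ smalls v) (avoid κ far)) }
      where
      ρ : _
      ρ = at D x w d
      stay : ∀ {κ ts} → Kernel κ → All (Small ∘ proj₁) ts → Avoids ts ρ → Avoids ts (at D x (λ i → w i + κ i) d)
      stay Kκ []       []       = []
      stay {κ} {(t , N) ∷ ts} Kκ (s ∷ ss) (h ∷ hs) = (λ Vt → h (V-resp (trans (eval-shift (Vec.lookup x) w κ (bounded D d) t)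
        (trans (+-congˡ (proj₁ s Kκ)) (+-identityʳ _))) Vt)) ∷ stay Kκ ss hs
      target : ∀ ts → ∃[ N ] ∀ κ → All (λ tN → ¬ V N (eval (onW κ) (proj₁ tN))) ts → Avoids ts (at D x (λ i → w i + κ i) d)
      target []             = 0 , λ _ _ → []
      target ((t , N) ∷ ts) =
        let B , VB = V-all (eval ρ t)
            N′ , f = target ts
            s≤ = ℕ.m≤m+n (N ℕ.+ B) N′
        in N ℕ.+ B ℕ.+ N′ , λ { κ (h ∷ hs) →
             (λ Vt → h (V-resp (trans (+-congʳ (eval-shift (Vec.lookup x) w κ (bounded D d) t)) (solve (eval ρ t ∷ eval (onW κ) t ∷ []) (a₀ ⊕ a₁ ⊕ ⊝ a₀) a₁))
               (V-sub (V-mono (ℕ.≤-trans (ℕ.m≤m+n N B) s≤) Vt) (V-mono (ℕ.≤-trans (ℕ.m≤n+m B N) s≤) VB))))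
             ∷ f κ (All.map (λ h Vt → h (V-mono (ℕ.m≤n+m N′ _) Vt)) hs) }

  module _ (D : Basic n) where
    Bnd : (Fin (bvars D) → Carrier) → Set (c ⊔ ℓ₁)
    Bnd u = ∀ i → V (suc (exps D i)) (u i)

    Bnd-bounded : ∀ d → Bnd (bounded D d)
    Bnd-bounded d i = bnd-V (exps D i) (d i)

    u-bound : ∀ (t : Term′ n (vars D) (bvars D)) → ∃[ K ] ∀ u → Bnd u → V K (eval (assign 0ᶠ 0ᶠ u) t)
    u-bound t = let K , f = V-eval {A = Variable n (vars D) (bvars D)} (λ { (xv _) → 0 ; (wv _) → 0 ; (uv i) → suc (exps D i) }) t
      in K , λ u Bu → f _ λ { (xv _) → V-0 ; (wv _) → V-0 ; (uv i) → Bu i }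

    u-bounds : ∀ (ts : List (Term′ n (vars D) (bvars D))) → ∃[ K ] ∀ u → Bnd u → All (λ t → V K (eval (assign 0ᶠ 0ᶠ u) t)) ts
    u-bounds []       = 0 , λ _ _ → []
    u-bounds (t ∷ ts) = let K , f = u-bound t ; K′ , g = u-bounds ts in K ℕ.+ K′ , λ u Bu →
      V-mono (ℕ.m≤m+n K K′) (f u Bu) ∷ All.map (V-mono (ℕ.m≤n+m K′ K)) (g u Bu)

    difference : ∀ x w u w₁ u₁ (t : Term′ n (vars D) (bvars D)) →
      eval (assign x w u) t + - eval (assign x w₁ u₁) t ≈ eval (onW (λ i → w i + - w₁ i)) t + eval (assign 0ᶠ 0ᶠ (λ i → u i + - u₁ i)) t
    difference x w u w₁ u₁ t = trans (sym (eval-sub (assign x w u) (assign x w₁ u₁) t)) (trans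
      (eval-cong (λ { (xv i) → trans (inverseʳ _) (sym (+-identityˡ 0#)) ; (wv i) → sym (+-identityʳ _) ; (uv i) → sym (+-identityˡ _) }) t)
      (eval-+ (onW (λ i → w i + - w₁ i)) (assign 0ᶠ 0ᶠ (λ i → u i + - u₁ i)) t))

    -- Subtracting two solutions for the same x removes x from the system and leaves only the
    -- bounded contribution of `u` as its right-hand side; boundedness of t is then applied to the
    -- difference.
    spread : ∀ t → BoundedBy (eqs D) t → ∃[ K ] ∀ x w u w₁ u₁ → Bnd u → Bnd u₁ →
      Solves (eqs D) (assign x w u) → Solves (eqs D) (assign x w₁ u₁) →
      V K (eval (assign x w u) t + - eval (assign x w₁ u₁) t)
    spread t bdd =
      let K₀ , f = u-bounds (eqs D)
          K₁ , g = bdd K₀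
          K₂ , h = u-bound t
      in K₁ ℕ.+ K₂ , λ x w u w₁ u₁ Bu Bu₁ s s₁ →
        V-resp (sym (difference x w u w₁ u₁ t))
             (V-+ (V-mono (ℕ.m≤m+n K₁ K₂) (g (λ i → w i + - w₁ i) (errors x w u w₁ u₁ s s₁ (f _ λ i → V-sub (Bu i) (Bu₁ i)))))
                  (V-mono (ℕ.m≤n+m K₂ K₁) (h _ λ i → V-sub (Bu i) (Bu₁ i))))
      where
      balance : ∀ {e} x w u w₁ u₁ → eval (assign x w u) e ≈ 0# → eval (assign x w₁ u₁) e ≈ 0# →
        - eval (assign 0ᶠ 0ᶠ (λ i → u i + - u₁ i)) e ≈ eval (onW (λ i → w i + - w₁ i)) e
      balance {e} x w u w₁ u₁ z₀ z₁ =
        let A = eval (onW (λ i → w i + - w₁ i)) e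
            B = eval (assign 0ᶠ 0ᶠ (λ i → u i + - u₁ i)) e
            total : A + B ≈ 0#
            total = trans (sym (difference x w u w₁ u₁ e)) (trans (+-cong z₀ (-‿cong z₁)) (inverseʳ 0#))
        in trans (solve (A ∷ B ∷ []) (⊝ a₁) (a₀ ⊕ ⊝ (a₀ ⊕ a₁))) (trans (+-congˡ (-‿cong total)) (solve (A ∷ []) (a₀ ⊕ ⊝ nil) a₀))
      errors : ∀ {N eqs} x w u w₁ u₁ → Solves eqs (assign x w u) → Solves eqs (assign x w₁ u₁) →
        All (λ e → V N (eval (assign 0ᶠ 0ᶠ (λ i → u i + - u₁ i)) e)) eqs → All (λ e → V N (eval (onW (λ i → w i + - w₁ i)) e)) eqs
      errors x w u w₁ u₁ []       []         []       = []
      errors {eqs = e ∷ _} x w u w₁ u₁ (z₀ ∷ s) (z₁ ∷ s₁) (v ∷ vs) =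
        V-resp (balance {e} x w u w₁ u₁ z₀ z₁) (V-neg v) ∷ errors x w u w₁ u₁ s s₁ vs

-- Complements of basic relations

module Negation {c ℓ₁ ℓ₂} (F : HeytingField c ℓ₁ ℓ₂) (p : ℕ)
  {q} (M : FilteredModule q (c ⊔ ℓ₁) ℓ₁ (c ⊔ ℓ₁)) (C : Coordinates F p M) where
  open Forms M
  open Horner M
  open Coordinates C
  open Definability (Fₚ-structure F p)
  open DoubleNegation
  open Systems M
  open Basics F p M C
  open Elimination F p M C
  open Basic

  private variable
    n m k : ℕ

  Trivial : ∀ {A : Set} → (A → K) → Set 𝕃
  Trivial _ = ¬ Level.Lift 𝕃 ⊥

  trivial-def : ∀ {A : Set} → Definable (Trivial {A})
  trivial-def = def-¬ def-⊥

  trivial : ¬ Level.Lift 𝕃 ⊥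
  trivial (lift ())

  -- D with the additional requirement that t lies in V N and that its
  -- coordinates satisfy a first-order condition.
  module Pin (D : Basic n) (t : Term′ n (vars D) (bvars D)) (N : ℕ)
             (cond₂ : (Fin (len N) → K) → Set 𝕃) (def₂ : Definable cond₂) where
    ι : Variable n (vars D) (bvars D) → Variable n (vars D) (bvars D ℕ.+ len N)
    ι (xv i) = xv i
    ι (wv i) = wv i
    ι (uv i) = uv (i ↑ˡ len N)

    coordinates : Term′ n (vars D) (bvars D ℕ.+ len N)
    coordinates = hornerᴸ λ l → var (uv (bvars D ↑ʳ l))

    pin : Basic n
    pin = record
      { vars = vars D ; bvars = bvars D ℕ.+ len N
      ; exps = merge (exps D) (λ _ → N)
      ; eqs  = (ren ι t +ᴸ -ᴸ coordinates) ∷ List.map (ren ι) (eqs D)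
      ; cond = λ d → ¬ (cond D (λ i → d (i ↑ˡ len N)) → ¬ cond₂ (λ i → d (bvars D ↑ʳ i)))
      ; cond-def = def-¬ (def-⇒ (def-∘ (_↑ˡ len N) (cond-def D)) (def-¬ (def-∘ (bvars D ↑ʳ_) def₂)))
      ; negs = List.map (λ tN → ren ι (proj₁ tN) , proj₂ tN) (negs D) }

    module _ {x : Vec Carrier n} {w : Fin (vars D) → Carrier} {d : Fin (bvars D) → K} {e : Fin (len N) → K} {d′ : Fin (bvars D ℕ.+ len N) → K}
             (ed : ∀ i → d i ≡ d′ (i ↑ˡ len N)) (ee : ∀ i → e i ≡ d′ (bvars D ↑ʳ i)) where
      agree : ∀ v → at D x w d v ≈ at pin x w d′ (ι v)
      agree (xv i) = refl
      agree (wv i) = refl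
      agree (uv i) = reflexive (≡.cong₂ bnd (≡.sym (merge-ˡ (exps D) (λ _ → N) i)) (ed i))

      coordinates-value : eval (at pin x w d′) coordinates ≈ vec N e
      coordinates-value = trans (reflexive (eval-horner (at pin x w d′) (λ l → var (uv (bvars D ↑ʳ l)))))
        (horner-cong λ l → reflexive (≡.cong₂ bnd (merge-ʳ (exps D) (λ _ → N) l) (≡.sym (ee l))))

    Pinned : Vec Carrier n → Set 𝕃
    Pinned x = ∃[ w ] ∃[ d ] Holds-with w d × (∃[ e ] (eval (at D x w d) t ≈ vec N e) × cond₂ e)
      where
      Holds-with : (Fin (vars D) → Carrier) → (Fin (bvars D) → K) → Set 𝕃
      Holds-with w d = Solves (eqs D) (at D x w d) × cond D d × Avoids (negs D) (at D x w d)

    pin⁺ : ∀ {x} → Pinned x → Holds pin x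
    pin⁺ {x} (w , d , (s , h , v) , e , eq , h₂) = w , merge d e
      , trans (+-cong (eval-ren a t) (-‿cong (coordinates-value {x} {w} {d} {e} ed ee))) (trans (+-congʳ eq) (inverseʳ _)) ∷ solves-ren⁺ a s
      , (λ k → k (Definable.resp (cond-def D) ed h) (Definable.resp def₂ ee h₂))
      , avoids-ren⁺ a v
      where
      ed : ∀ i → d i ≡ merge d e (i ↑ˡ len N)
      ed i = ≡.sym (merge-ˡ d e i)
      ee : ∀ i → e i ≡ merge d e (bvars D ↑ʳ i)
      ee i = ≡.sym (merge-ʳ d e i)
      a = agree {x} {w} {d} {e} {merge d e} ed ee

    pin⁻ : ∀ {x} → Holds pin x → ¬ ¬ Pinned x
    pin⁻ {x} (w , d′ , (eq ∷ s) , h , v) k = h λ h₁ h₂ → k (w , d , (solves-ren⁻ a s , h₁ , avoids-ren⁻ a v) , e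
      , trans (solve (eval (at D x w d) t ∷ vec N e ∷ []) a₀ (a₀ ⊕ ⊝ a₁ ⊕ a₁))
          (trans (+-congʳ (trans (sym (+-cong (eval-ren a t) (-‿cong (coordinates-value {x} {w} {d} {e} (λ _ → ≡.refl) (λ _ → ≡.refl))))) eq))
            (+-identityˡ _)) , h₂)
      where
      d = λ i → d′ (i ↑ˡ len N)
      e = λ i → d′ (bvars D ↑ʳ i)
      a = agree {x} {w} {d} {e} {d′} (λ _ → ≡.refl) (λ _ → ≡.refl)

    onW-ren : ∀ w s → eval (onW w) (ren ι s) ≈ eval (onW w) s
    onW-ren w = eval-ren λ { (xv i) → refl ; (wv i) → refl ; (uv i) → refl }

    bounded-ren : ∀ {s} → BoundedBy (eqs D) s → BoundedBy (eqs pin) (ren ι s)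
    bounded-ren {s} bdd K₀ = let K′ , f = bdd K₀ in K′ , λ { w (_ ∷ Vw) →
      V-resp (sym (onW-ren w s)) (f w (All.map (λ {e} → V-resp (onW-ren w e)) (All.map⁻ Vw))) }

  -- "The system eqn(0 , w , u) + S(d) = 0 has no solution with cond u and w in
  -- V K′" as a condition on d.
  module Unsolvability (D : Basic n) {A : Set} (expA : A → ℕ) (eqn : Fin m → Term′ n (vars D) (bvars D))
                       (S : Fin m → LinTerm q A) (K′ : ℕ) where
    b : ℕ
    b = bvars D ℕ.+ vars D ℕ.* len K′

    expo : A ⊎ Fin b → ℕ
    expo (inj₁ a) = expA a
    expo (inj₂ i) = merge (exps D) (λ _ → K′) i

    σ : Variable n (vars D) (bvars D) → LinTerm q (A ⊎ Fin b)
    -- The parameters x enter only through the bounded value `S`. Unknowns in V K′ are spelled out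
    -- by their coordinates, so that solvability quantifies over F alone.
    σ (xv i) = 0ᴸ
    σ (wv j) = hornerᴸ λ l → var (inj₂ (bvars D ↑ʳ Fin.combine j l))
    σ (uv i) = var (inj₂ (i ↑ˡ (vars D ℕ.* len K′)))

    T : Fin m → LinTerm q (A ⊎ Fin b)
    T i = eqn i ⟪ σ ⟫ +ᴸ S i ⟪ (λ a → var (inj₁ a)) ⟫

    env : (A → K) → (Fin b → K) → A ⊎ Fin b → Carrier
    env d y a = bnd (expo a) ([ d , y ] a)

    value : (A → K) → Fin m → Carrier
    value d i = eval (λ a → bnd (expA a) (d a)) (S i)

    Premise : (A → K) → (Fin b → K) → Fin m → Set 𝕃
    Premise d y i = Level.Lift c (eval (env d y) (T i) ≈ 0#)

    Unsolvable : (A → K) → Set 𝕃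
    Unsolvable d = ∀ (y : Fin b → K) → cond D (λ i → y (i ↑ˡ (vars D ℕ.* len K′))) →
      Chain (Premise d y) (Level.Lift 𝕃 ⊥)

    unsolvable-def : Definable Unsolvable
    unsolvable-def = def-∀ b (def-⇒ (def-∘ (λ i → inj₂ (i ↑ˡ (vars D ℕ.* len K′))) (cond-def D))
      (def-chain (λ i → definable-zero expo (T i)) def-⊥))

    T-value : ∀ d y {g : Fin (bvars D) → K} {e : Fin (vars D) → Fin (len K′) → K} →
      (∀ i → y (i ↑ˡ (vars D ℕ.* len K′)) ≡ g i) → (∀ j l → y (bvars D ↑ʳ Fin.combine j l) ≡ e j l) →
      ∀ i → eval (env d y) (T i) ≈ eval (assign 0ᶠ (λ j → vec K′ (e j)) (bounded D g)) (eqn i) + value d i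
    T-value d y eg ee i = +-cong
      (trans (reflexive (eval-⟪⟫ (env d y) σ (eqn i))) (eval-cong (λ
        { (xv i) → refl
        ; (wv j) → trans (reflexive (eval-horner (env d y) (λ l → var (inj₂ (bvars D ↑ʳ Fin.combine j l)))))
                     (horner-cong λ l → reflexive (≡.cong₂ bnd (merge-ʳ (exps D) (λ _ → K′) (Fin.combine j l)) (ee j l)))
        ; (uv i) → reflexive (≡.cong₂ bnd (merge-ˡ (exps D) (λ _ → K′) i) (eg i)) }) (eqn i)))
      (reflexive (eval-⟪⟫ (env d y) (λ a → var (inj₁ a)) (S i)))

    unsolvable⁻ : ∀ {d} → Unsolvable d → ∀ g (e : Fin (vars D) → Fin (len K′) → K) → cond D g →
      ¬ (∀ i → eval (assign 0ᶠ (λ j → vec K′ (e j)) (bounded D g)) (eqn i) + value d i ≈ 0#)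
    unsolvable⁻ {d} un g e h s = lower (chain⁻ {Q = Premise d y} (un y (Definable.resp (cond-def D) (λ i → ≡.sym (merge-ˡ g e′ i)) h))
      λ i → lift (trans (T-value d y {g} {e} (merge-ˡ g e′) ee i) (s i)))
      where
      e′ : Fin (vars D ℕ.* len K′) → K
      e′ i = let j , l = Fin.remQuot (len K′) i in e j l
      y = merge g e′
      ee : ∀ j l → y (bvars D ↑ʳ Fin.combine j l) ≡ e j l
      ee j l = ≡.trans (merge-ʳ g e′ (Fin.combine j l)) (≡.cong (λ jl → e (proj₁ jl) (proj₂ jl)) (Fin.remQuot-combine j l))

    unsolvable⁺ : ∀ {d} → (∀ g (e : Fin (vars D) → Fin (len K′) → K) → cond D g →
      ¬ (∀ i → eval (assign 0ᶠ (λ j → vec K′ (e j)) (bounded D g)) (eqn i) + value d i ≈ 0#)) → Unsolvable d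
    unsolvable⁺ {d} f y h = chain⁺ {Q = Premise d y} λ s → ⊥-elim (f (λ i → y (i ↑ˡ (vars D ℕ.* len K′))) (λ j l → y (bvars D ↑ʳ Fin.combine j l)) h
      λ i → trans (sym (T-value d y {λ i → y (i ↑ˡ (vars D ℕ.* len K′))} {λ j l → y (bvars D ↑ʳ Fin.combine j l)} (λ _ → ≡.refl) (λ _ _ → ≡.refl) i)) (lower (s i)))

  -- By `complete`, the part of the system depending on x is cancelled, up to V C₀, by some w
  -- together with coordinates v in the absent rows. A true solution would force v into V Na, so a
  -- large v refutes solvability. If v is bounded, w reduces the system to one with right-hand side
  -- in V Nb, whose solvability is a condition over F.
  module NoNegs (D : Basic n) where
    open System (eqs D)

    private
      D₀ = withNegs D []
      mᵛ = vars D

    abstract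
      bound₀ : ∃[ K₀ ] ∀ i u → Bnd D u → V K₀ (eval (assign 0ᶠ 0ᶠ u) (equation i))
      bound₀ = uniform {P = λ i N → ∀ u → Bnd D u → V N (eval (assign 0ᶠ 0ᶠ u) (equation i))}
                 (λ i k≤l f u h → V-mono k≤l (f u h)) (λ i → u-bound D (equation i))

    K₀ : ℕ
    K₀ = proj₁ bound₀

    split-value : ∀ x w u (t : Term′ n (vars D) (bvars D)) → eval (assign x w u) t ≈ eval (assign x w 0ᶠ) t + eval (assign 0ᶠ 0ᶠ u) t
    split-value x w u t = trans (eval-cong (λ { (xv i) → sym (+-identityʳ _) ; (wv i) → sym (+-identityʳ _) ; (uv i) → sym (+-identityˡ _) }) t)
      (eval-assign-+ x 0ᶠ w 0ᶠ 0ᶠ u t)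

    -- A bounded right-hand side and bounded `u` make the values E w bounded. Hence w can be
    -- replaced by a vector with the same values in V K′, which is described by finitely many
    -- elements of F.
    module Witness (N : ℕ) where
      K′ : ℕ
      K′ = proj₁ (bounded-solution (N ℕ.+ K₀))

      module _ (w : Fin mᵛ → Carrier) (d : Fin (bvars D) → K) (y : Fin rows → Carrier) (Vy : ∀ i → V N (y i))
               (s : ∀ i → eval (assign 0ᶠ w (bounded D d)) (equation i) + y i ≈ 0#) where
        private
          u = bounded D d

          W U : Fin rows → Carrier
          W i = eval (onW w) (equation i)
          U i = eval (assign 0ᶠ 0ᶠ u) (equation i)

          total : ∀ i → W i + U i + y i ≈ 0#
          total i = trans (+-congʳ (sym (split-value 0ᶠ w u (equation i)))) (s i)

          image-bounded : ∀ i → V (N ℕ.+ K₀) (eval w (E i))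
          image-bounded i = V-resp
            (trans (solve (y i ∷ U i ∷ W i ∷ []) (⊝ a₀ ⊕ ⊝ a₁) (a₂ ⊕ ⊝ (a₂ ⊕ a₁ ⊕ a₀)))
              (trans (+-congˡ (-‿cong (total i))) (trans (solve (W i ∷ []) (a₀ ⊕ ⊝ nil) a₀) (sym (eval-wPart w (equation i))))))
            (V-+ (V-neg (V-mono (ℕ.m≤m+n N K₀) (Vy i))) (V-neg (V-mono (ℕ.m≤n+m K₀ N) (proj₂ bound₀ i u (Bnd-bounded D d)))))

          solution = proj₂ (bounded-solution (N ℕ.+ K₀)) w image-bounded
          w′ = proj₁ solution
          e : ∀ j → ∃[ y ] w′ j ≈ vec K′ y
          e j = V-coord (proj₁ (proj₂ solution) j)

        witness : Fin mᵛ → Fin (len K′) → K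
        witness j = proj₁ (e j)

        witness-solves : ∀ i → eval (assign 0ᶠ (λ j → vec K′ (witness j)) u) (equation i) + y i ≈ 0#
        witness-solves i = trans (+-congʳ (begin
          eval (assign 0ᶠ (λ j → vec K′ (witness j)) u) (equation i)
            ≈⟨ eval-cong (λ { (xv _) → refl ; (wv j) → sym (proj₂ (e j)) ; (uv _) → refl }) (equation i) ⟩
          eval (assign 0ᶠ w′ u) (equation i)
            ≈⟨ split-value 0ᶠ w′ u (equation i) ⟩
          eval (onW w′) (equation i) + U i
            ≈⟨ +-congʳ (trans (sym (eval-wPart w′ (equation i))) (trans (proj₂ (proj₂ solution) i) (eval-wPart w (equation i)))) ⟩
          W i + U i  ∎)) (total i)
          where open SetoidReasoning setoid

    K₁ Na Nb : ℕ
    -- K₁ collects the contribution of `u` and the residue of `complete`, that is, the error when an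
    -- approximate solution is compared with a true one. Na is the bound this forces on absent
    -- coordinates, and Nb adds the residue to it.
    K₁ = K₀ ℕ.+ C₀
    Na = proj₁ (complement-bounded K₁)
    Nb = Na ℕ.+ C₀

    open Witness Nb

    extraᴸ : Fin rows → Term′ n (mᵛ ℕ.+ rows) (rows ℕ.* len C₀)
    extraᴸ i = if absent i then var (wv (mᵛ ↑ʳ i)) else 0ᴸ

    σ₁ : Variable n mᵛ (bvars D) → Term′ n (mᵛ ℕ.+ rows) (rows ℕ.* len C₀)
    σ₁ (xv i) = var (xv i)
    σ₁ (wv j) = var (wv (j ↑ˡ rows))
    -- The contribution of `u` lies in V K₀ and is left out; it is absorbed by the choice of K₁.
    σ₁ (uv i) = 0ᴸ

    -- x is far from the image of the system.
    far : Fin rows → Basic n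
    far j = record
      { vars = mᵛ ℕ.+ rows ; bvars = rows ℕ.* len C₀
      ; exps = λ _ → C₀
      ; eqs  = List.tabulate λ i → equation i ⟪ σ₁ ⟫ +ᴸ extraᴸ i +ᴸ hornerᴸ (λ l → var (uv (Fin.combine i l)))
      ; cond = Trivial ; cond-def = trivial-def
      ; negs = (var (wv (mᵛ ↑ʳ j)) , Na) ∷ [] }

    far-value : ∀ j (x : Vec Carrier n) (w : Fin mᵛ → Carrier) (v : Fin rows → Carrier) (d : Fin rows → Fin (len C₀) → K) {w′ d′} → (∀ i → w′ (i ↑ˡ rows) ≡ w i) → (∀ i → w′ (mᵛ ↑ʳ i) ≡ v i) →
      (∀ i l → d′ (Fin.combine i l) ≡ d i l) → ∀ i →
      eval (at (far j) x w′ d′) (equation i ⟪ σ₁ ⟫ +ᴸ extraᴸ i +ᴸ hornerᴸ (λ l → var (uv (Fin.combine i l))))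
      ≈ eval (assign (Vec.lookup x) w 0ᶠ) (equation i) + extra v i + vec C₀ (d i)
    far-value j x w v d {w′} {d′} ew ev ed i = +-cong (+-cong
      (trans (reflexive (eval-⟪⟫ (at (far j) x w′ d′) σ₁ (equation i)))
        (eval-cong (λ { (xv _) → refl ; (wv l) → reflexive (ew l) ; (uv _) → refl }) (equation i)))
      (extra-value (absent i)))
      (trans (reflexive (eval-horner (at (far j) x w′ d′) (λ l → var (uv (Fin.combine i l)))))
        (horner-cong λ l → reflexive (≡.cong (bnd C₀) (ed i l))))
      where
      extra-value : ∀ b → eval (at (far j) x w′ d′) (if b then var (wv (mᵛ ↑ʳ i)) else 0ᴸ) ≈ (if b then v i else 0#)
      extra-value true  = reflexive (ev i)
      extra-value false = refl

    σ₂ : Variable n mᵛ (bvars D) → Term′ n mᵛ (rows ℕ.* len Nb)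
    σ₂ (xv i) = var (xv i)
    σ₂ (wv j) = var (wv j)
    σ₂ (uv i) = 0ᴸ

    open Unsolvability D {A = Fin (rows ℕ.* len Nb)} (λ _ → Nb) equation
      (λ i → hornerᴸ λ l → var (Fin.combine i l)) K′

    -- x is near the image of the system, but off it.
    near : Basic n
    near = record
      { vars = mᵛ ; bvars = rows ℕ.* len Nb
      ; exps = λ _ → Nb
      ; eqs  = List.tabulate λ i → equation i ⟪ σ₂ ⟫ +ᴸ -ᴸ hornerᴸ (λ l → var (uv (Fin.combine i l)))
      ; cond = Unsolvable ; cond-def = unsolvable-def
      ; negs = [] }

    horner-value : ∀ {d : Fin rows → Fin (len Nb) → K} {d′ : Fin (rows ℕ.* len Nb) → K} → (∀ i l → d′ (Fin.combine i l) ≡ d i l) → ∀ i → value d′ i ≈ vec Nb (d i)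
    horner-value {d} {d′} ed i = trans (reflexive (eval-horner (λ a → bnd Nb (d′ a)) (λ l → var (Fin.combine i l))))
      (horner-cong λ l → reflexive (≡.cong (bnd Nb) (ed i l)))

    near-value : ∀ (x : Vec Carrier n) w {d : Fin rows → Fin (len Nb) → K} {d′ : Fin (rows ℕ.* len Nb) → K} → (∀ i l → d′ (Fin.combine i l) ≡ d i l) → ∀ i →
      eval (at near x w d′) (equation i ⟪ σ₂ ⟫ +ᴸ -ᴸ hornerᴸ (λ l → var (uv (Fin.combine i l))))
      ≈ eval (assign (Vec.lookup x) w 0ᶠ) (equation i) + - vec Nb (d i)
    near-value x w {d} {d′} ed i = +-cong
      (trans (reflexive (eval-⟪⟫ (at near x w d′) σ₂ (equation i)))
        (eval-cong (λ { (xv _) → refl ; (wv l) → refl ; (uv _) → refl }) (equation i)))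
      (-‿cong (trans (reflexive (eval-horner (at near x w d′) (λ l → var (uv (Fin.combine i l)))))
        (horner-cong λ l → reflexive (≡.cong (bnd Nb) (ed i l)))))

    flat : ∀ {a b} → (Fin a → Fin b → K) → Fin (a ℕ.* b) → K
    flat {b = b} d i = let j , l = Fin.remQuot b i in d j l

    flat-combine : ∀ {a b} (d : Fin a → Fin b → K) i l → flat d (Fin.combine i l) ≡ d i l
    flat-combine d i l = ≡.cong (λ jl → d (proj₁ jl) (proj₂ jl)) (Fin.remQuot-combine i l)

    -- A solution of D₀ minus the w of `near` solves the system with a bounded right-hand side, and
    -- `Witness` turns it into the bounded solution that `Unsolvable` rules out.
    near-excludes : ∀ {x} → Holds near x → ¬ Holds D₀ x
    near-excludes {x} (w , d , s , un , _) (w₁ , g , s₁ , h , _) =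
      unsolvable⁻ {d} un g (witness δ g y Vy sol) h λ i →
        trans (+-congˡ (horner-value {d′} {d} (λ _ _ → ≡.refl) i)) (witness-solves δ g y Vy sol i)
      where
      d′ : Fin rows → Fin (len Nb) → K
      d′ i l = d (Fin.combine i l)
      δ = λ j → w₁ j + - w j
      y = λ i → vec Nb (d′ i)
      Vy : ∀ i → V Nb (y i)
      Vy i = vec-V Nb (d′ i)
      A B G : Fin rows → Carrier
      A i = eval (assign (Vec.lookup x) w 0ᶠ) (equation i)
      B i = eval (onW δ) (equation i)
      G i = eval (assign 0ᶠ 0ᶠ (bounded D g)) (equation i)
      near-eq : ∀ i → A i + - y i ≈ 0#
      near-eq i = trans (sym (near-value x w {d′} {d} (λ _ _ → ≡.refl) i)) (All.tabulate⁻ s i)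
      holds-eq : ∀ i → A i + B i + G i ≈ 0#
      holds-eq i = trans (+-congʳ (sym (eval-shift (Vec.lookup x) w δ 0ᶠ (equation i))))
        (trans (sym (split-value (Vec.lookup x) _ (bounded D g) (equation i)))
          (trans (eval-cong (λ { (xv _) → refl ; (wv j) → solve (w j ∷ w₁ j ∷ []) (a₀ ⊕ (a₁ ⊕ ⊝ a₀)) a₁ ; (uv _) → refl }) (equation i))
            (solves⁺ s₁ i)))
      sol : ∀ i → eval (assign 0ᶠ δ (bounded D g)) (equation i) + y i ≈ 0#
      sol i = trans (+-congʳ (split-value 0ᶠ δ (bounded D g) (equation i)))
        (trans (solve (A i ∷ B i ∷ G i ∷ y i ∷ []) (a₁ ⊕ a₂ ⊕ a₃) (a₀ ⊕ a₁ ⊕ a₂ ⊕ ⊝ (a₀ ⊕ ⊝ a₃)))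
          (trans (+-cong (holds-eq i) (-‿cong (near-eq i))) (inverseʳ 0#)))

    -- Comparing a solution of D₀ with the data of `far` puts `E δ + extra v` into V K₁, so
    -- `complement-bounded` keeps every absent coordinate in V Na.
    far-excludes : ∀ j → absent j ≡ true → ∀ {x} → Holds (far j) x → ¬ Holds D₀ x
    far-excludes j abs-j {x} (w′ , d , s , _ , (∉ ∷ [])) (w₁ , g , s₁ , h , _) =
      ∉ (proj₂ (complement-bounded K₁) δ v image-bounded j abs-j)
      where
      w : Fin mᵛ → Carrier
      w i = w′ (i ↑ˡ rows)
      v : Fin rows → Carrier
      v i = w′ (mᵛ ↑ʳ i)
      d′ : Fin rows → Fin (len C₀) → K
      d′ i l = d (Fin.combine i l)
      δ = λ l → w l + - w₁ l
      A B G R : Fin rows → Carrier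
      A i = eval (assign (Vec.lookup x) w₁ 0ᶠ) (equation i)
      B i = eval (onW δ) (equation i)
      G i = eval (assign 0ᶠ 0ᶠ (bounded D g)) (equation i)
      R i = vec C₀ (d′ i)
      far-eq : ∀ i → A i + B i + extra v i + R i ≈ 0#
      far-eq i = trans (+-congʳ (+-congʳ (trans (sym (eval-shift (Vec.lookup x) w₁ δ 0ᶠ (equation i)))
          (eval-cong (λ { (xv _) → refl ; (wv l) → solve (w l ∷ w₁ l ∷ []) (a₁ ⊕ (a₀ ⊕ ⊝ a₁)) a₀ ; (uv _) → refl }) (equation i)))))
        (trans (sym (far-value j x w v d′ {w′} {d} (λ _ → ≡.refl) (λ _ → ≡.refl) (λ _ _ → ≡.refl) i)) (All.tabulate⁻ s i))
      holds-eq : ∀ i → A i + G i ≈ 0#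
      holds-eq i = trans (sym (split-value (Vec.lookup x) w₁ (bounded D g) (equation i))) (solves⁺ s₁ i)
      image-bounded : ∀ i → V K₁ (eval δ (E i) + extra v i)
      image-bounded i = V-resp
        (trans (solve (A i ∷ B i ∷ extra v i ∷ R i ∷ G i ∷ []) (a₄ ⊕ ⊝ a₃) (a₀ ⊕ a₄ ⊕ ⊝ (a₀ ⊕ a₁ ⊕ a₂ ⊕ a₃) ⊕ (a₁ ⊕ a₂)))
          (trans (+-congʳ (trans (+-cong (holds-eq i) (-‿cong (far-eq i))) (inverseʳ 0#)))
            (trans (+-identityˡ _) (+-congʳ (sym (eval-wPart δ (equation i)))))))
        (V-sub (V-mono (ℕ.m≤m+n K₀ C₀) (proj₂ bound₀ i _ (Bnd-bounded D g))) (V-mono (ℕ.m≤n+m C₀ K₀) (vec-V C₀ (d′ i))))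

    value₀ : Vec Carrier n → (Fin mᵛ → Carrier) → Fin rows → Carrier
    value₀ x w i = eval (assign (Vec.lookup x) w 0ᶠ) (equation i)

    far-holds : ∀ j x w v (r : Fin rows → Fin (len C₀) → K) → (∀ i → value₀ x w i + extra v i + vec C₀ (r i) ≈ 0#) →
      ¬ V Na (v j) → Holds (far j) x
    far-holds j x w v r s ∉ = merge w v , flat r
      , All.tabulate⁺ (λ i → trans (far-value j x w v r {merge w v} {flat r} (merge-ˡ w v) (merge-ʳ w v) (flat-combine r) i) (s i))
      , trivial , (λ Vv → ∉ (V-resp (reflexive (merge-ʳ w v j)) Vv)) ∷ []

    module _ (x : Vec Carrier n) (w : Fin mᵛ → Carrier) (r : Fin rows → Fin (len Nb) → K)
             (A≈ : ∀ i → value₀ x w i ≈ vec Nb (r i)) where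
      near-unsolvable : ¬ Holds D₀ x → ∀ g (e : Fin mᵛ → Fin (len K′) → K) → cond D g →
        ¬ (∀ i → eval (assign 0ᶠ (λ j → vec K′ (e j)) (bounded D g)) (equation i) + value (flat r) i ≈ 0#)
      near-unsolvable none g e h s = none ((λ j → w j + κ j) , g , solves⁻ sum-solves , h , [])
        where
        κ : Fin mᵛ → Carrier
        κ j = vec K′ (e j)
        sum-solves : ∀ i → eval (at D x (λ j → w j + κ j) g) (equation i) ≈ 0#
        sum-solves i = begin
          eval (assign (Vec.lookup x) (λ j → w j + κ j) (bounded D g)) (equation i)
            ≈⟨ split-value (Vec.lookup x) (λ j → w j + κ j) (bounded D g) (equation i) ⟩
          eval (assign (Vec.lookup x) (λ j → w j + κ j) 0ᶠ) (equation i) + eval (assign 0ᶠ 0ᶠ (bounded D g)) (equation i)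
            ≈⟨ +-congʳ (eval-shift (Vec.lookup x) w κ 0ᶠ (equation i)) ⟩
          value₀ x w i + eval (onW κ) (equation i) + eval (assign 0ᶠ 0ᶠ (bounded D g)) (equation i)
            ≈⟨ solve (value₀ x w i ∷ eval (onW κ) (equation i) ∷ eval (assign 0ᶠ 0ᶠ (bounded D g)) (equation i) ∷ []) (a₀ ⊕ a₁ ⊕ a₂) (a₁ ⊕ a₂ ⊕ a₀) ⟩
          eval (onW κ) (equation i) + eval (assign 0ᶠ 0ᶠ (bounded D g)) (equation i) + value₀ x w i
            ≈⟨ +-cong (sym (split-value 0ᶠ κ (bounded D g) (equation i))) (trans (A≈ i) (sym (horner-value {r} {flat r} (flat-combine r) i))) ⟩
          eval (assign 0ᶠ κ (bounded D g)) (equation i) + value (flat r) i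
            ≈⟨ s i ⟩
          0#  ∎
          where open SetoidReasoning setoid

      near-solves : Solves (eqs near) (at near x w (flat r))
      near-solves = All.tabulate⁺ λ i → trans (near-value x w {r} {flat r} (flat-combine r) i) (trans (+-congˡ (-‿cong (sym (A≈ i)))) (inverseʳ _))

      near-cond : ¬ Holds D₀ x → cond near (flat r)
      near-cond none = unsolvable⁺ {flat r} (near-unsolvable none)

      near-holds : ¬ Holds D₀ x → Holds near x
      near-holds none = w , flat r , near-solves , near-cond none , []

    near-bound : ∀ {A X R} → A + X + R ≈ 0# → V Na X → V C₀ R → V Nb A
    near-bound {A} {X} {R} s VX VR = V-resp
      (trans (solve (A ∷ X ∷ R ∷ []) (⊝ a₁ ⊕ ⊝ a₂) (a₀ ⊕ ⊝ (a₀ ⊕ a₁ ⊕ a₂)))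
        (trans (+-congˡ (-‿cong s)) (solve (A ∷ []) (a₀ ⊕ ⊝ nil) a₀)))
      (V-+ (V-neg (V-mono (ℕ.m≤m+n Na C₀) VX)) (V-neg (V-mono (ℕ.m≤n+m C₀ Na) VR)))

    V-extra : ∀ v → (∀ j → absent j ≡ true → V Na (v j)) → ∀ i → V Na (extra v i)
    V-extra v Vv i = go (absent i) ≡.refl
      where
      go : ∀ b → absent i ≡ b → V Na (if b then v i else 0#)
      go true  e = Vv i e
      go false e = V-0

    near-or-far′ : ∀ x w v → (∀ i → ∃[ R ] value₀ x w i + extra v i + R ≈ 0# × V C₀ R) → ¬ Holds D₀ x →
      (∀ j → V Na (v j) ⊎ ¬ V Na (v j)) → (∃[ j ] absent j ≡ true × Holds (far j) x) ⊎ Holds near x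
    near-or-far′ x w v s none em with decideAll {P = λ j → absent j ≡ true → V Na (v j)} {Q = λ j → absent j ≡ true × ¬ V Na (v j)}
                                        (λ j → go j (absent j) ≡.refl (em j))
      where
      go : ∀ j b → absent j ≡ b → V Na (v j) ⊎ ¬ V Na (v j) → (absent j ≡ true → V Na (v j)) ⊎ (absent j ≡ true × ¬ V Na (v j))
      go j b     e (inj₁ Vv) = inj₁ λ _ → Vv
      go j true  e (inj₂ ∉)  = inj₂ (e , ∉)
      go j false e (inj₂ ∉)  = inj₁ λ e′ → contradiction (≡.trans (≡.sym e) e′) λ ()
    ... | inj₁ Vv = inj₂ (near-holds x w (λ i → proj₁ (κ i)) (λ i → proj₂ (κ i)) none)
      where
      κ : ∀ i → ∃[ y ] value₀ x w i ≈ vec Nb y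
      κ i = V-coord (near-bound (proj₁ (proj₂ (s i))) (V-extra v Vv i) (proj₂ (proj₂ (s i))))
    ... | inj₂ (j , e , ∉) = inj₁ (j , e , far-holds j x w v (λ i → proj₁ (κ i))
        (λ i → trans (+-congˡ (sym (proj₂ (κ i)))) (proj₁ (proj₂ (s i)))) ∉)
      where
      κ : ∀ i → ∃[ y ] proj₁ (s i) ≈ vec C₀ y
      κ i = V-coord (proj₂ (proj₂ (s i)))

    near-or-far : ∀ x → ¬ Holds D₀ x → ¬ ¬ ((∃[ j ] absent j ≡ true × Holds (far j) x) ⊎ Holds near x)
    -- Completing the negative of the value at w = 0 yields w and v for which value, extra terms and
    -- residue add up to zero.
    near-or-far x none with complete (λ i → - eval (assign (Vec.lookup x) 0ᶠ 0ᶠ) (equation i))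
    ... | w , v , residue = finite (λ j → excluded-middle (V Na (v j))) >>= λ em →
      pure (near-or-far′ x w v (λ i → _ , completed i , residue i) none em)
      where
      completed : ∀ i → value₀ x w i + extra v i + (- eval (assign (Vec.lookup x) 0ᶠ 0ᶠ) (equation i) + - (eval w (E i) + extra v i)) ≈ 0#
      completed i = trans (+-congʳ (+-congʳ (trans
          (eval-cong (λ { (xv _) → sym (+-identityʳ _) ; (wv _) → sym (+-identityˡ _) ; (uv _) → sym (+-identityˡ _) }) (equation i))
          (trans (eval-assign-+ (Vec.lookup x) 0ᶠ 0ᶠ w 0ᶠ 0ᶠ (equation i)) (+-congˡ (sym (eval-wPart w (equation i))))))))
        (solve (eval (assign (Vec.lookup x) 0ᶠ 0ᶠ) (equation i) ∷ eval w (E i) ∷ extra v i ∷ [])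
          (a₀ ⊕ a₁ ⊕ a₂ ⊕ (⊝ a₀ ⊕ ⊝ (a₁ ⊕ a₂))) nil)

    elim-far : ∀ j → Eliminable (λ x → absent j ≡ true × Holds (far j) x)
    elim-far j = go (absent j)
      where
      go : ∀ b → Eliminable (λ x → b ≡ true × Holds (far j) x)
      go true  = elim-⇔ (λ h → pure (≡.refl , h)) (λ { (_ , h) → pure h }) (elim-basic (far j))
      go false = elim-⇔ (λ { (lift ()) }) (λ { (() , _) }) elim-⊥

    negate₀ : Eliminable (λ x → ¬ Holds D₀ x)
    negate₀ = elim-⇔
      (λ { {x} (inj₁ (j , e , h)) → pure (far-excludes j e {x} h) ; {x} (inj₂ h) → pure (near-excludes {x} h) })
      (λ {x} none → near-or-far x none)
      (elim-∪ (elim-⋃ elim-far) (elim-basic near))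

-- Avoidance conditions and the decision of basic relations

module Decision {c ℓ₁ ℓ₂} (F : HeytingField c ℓ₁ ℓ₂) (p : ℕ)
  {q} (M : FilteredModule q (c ⊔ ℓ₁) ℓ₁ (c ⊔ ℓ₁)) (C : Coordinates F p M) where
  open Forms M
  open Horner M
  open Coordinates C
  open Definability (Fₚ-structure F p)
  open DoubleNegation
  open Basics F p M C
  open Elimination F p M C
  open Negation F p M C
  open Basic
  open Eliminable

  private variable
    n m k : ℕ
    s : Level
    H H′ : Vec Carrier n → Set s

  -- For an element of V N, avoiding V N₀ is a first-order condition on its coordinates: no
  -- coordinates of level N₀ give the same element.
  module Outside (N₀ N : ℕ) where
    level : Fin (len N) ⊎ Fin (len N₀) → ℕ
    level (inj₁ _) = N
    level (inj₂ _) = N₀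

    T : LinTerm q (Fin (len N) ⊎ Fin (len N₀))
    T = hornerᴸ (λ l → var (inj₁ l)) +ᴸ -ᴸ hornerᴸ (λ l → var (inj₂ l))

    Outside : (Fin (len N) → K) → Set 𝕃
    Outside e = ∀ (y : Fin (len N₀) → K) → ¬ Level.Lift c (eval (λ a → bnd (level a) ([ e , y ] a)) T ≈ 0#)

    outside-def : Definable Outside
    outside-def = def-∀ (len N₀) (def-¬ (definable-zero level T))

    T-value : ∀ e y → eval (λ a → bnd (level a) ([ e , y ] a)) T ≈ vec N e + - vec N₀ y
    T-value e y = +-cong (reflexive (eval-horner (λ a → bnd (level a) ([ e , y ] a)) (λ l → var (inj₁ l))))
      (-‿cong (reflexive (eval-horner (λ a → bnd (level a) ([ e , y ] a)) (λ l → var (inj₂ l)))))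

    outside⁺ : ∀ {e} → ¬ V N₀ (vec N e) → Outside e
    outside⁺ {e} ∉ y (lift eq) = ∉ (V-resp (trans (solve (vec N₀ y ∷ vec N e ∷ []) a₀ (a₁ ⊕ ⊝ (a₁ ⊕ ⊝ a₀)))
      (trans (+-congˡ (-‿cong (trans (sym (T-value e y)) eq))) (solve (vec N e ∷ []) (a₀ ⊕ ⊝ nil) a₀))) (vec-V N₀ y))

    outside⁻ : ∀ {e} → Outside e → ¬ V N₀ (vec N e)
    outside⁻ {e} out Ve = let y , eq = V-coord Ve in
      out y (lift (trans (T-value e y) (trans (+-congʳ eq) (inverseʳ _))))

  module PinNeg (D : Basic n) (t : Term′ n (vars D) (bvars D)) (N : ℕ) (bdd : BoundedBy (eqs D) t) where
    Kˢ N′ : ℕ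
    Kˢ = proj₁ (spread D t bdd)
    -- Kˢ bounds the variation of t over the solutions for one x, so a single solution with t in V N
    -- places t in V N′ for all solutions.
    N′ = N ℕ.+ Kˢ

    open Outside N N′

    module _ (negs′ : List (Term′ n (vars D) (bvars D) × ℕ)) where
      full fewer small : Basic n
      full  = withNegs D ((t , N) ∷ negs′)
      fewer  = withNegs D negs′
      small = Pin.pin fewer t N′ Outside outside-def

      small⇒full : ∀ x → Holds small x → ¬ ¬ Holds full x
      small⇒full x h = Pin.pin⁻ fewer t N′ Outside outside-def {x} h >>= λ
        { (w , d , (s , hc , v) , e , eq , out) → pure (w , d , s , hc , (λ Vt → outside⁻ {e} out (V-resp eq Vt)) ∷ v) }

      full⇒small : ∀ x w d → Solves (eqs D) (at D x w d) → cond D d → Avoids ((t , N) ∷ negs′) (at D x w d) →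
        V N′ (eval (at D x w d) t) → Holds small x
      full⇒small x w d s hc (∉ ∷ v) Vt =
        let e , eq = V-coord Vt
        in Pin.pin⁺ fewer t N′ Outside outside-def {x} (w , d , (s , hc , v) , e , eq , outside⁺ {e} (λ Ve → ∉ (V-resp (sym eq) Ve)))

    close-values : ∀ (x : Fin n → Carrier) w u w₁ u₁ → Bnd D u → Bnd D u₁ → Solves (eqs D) (assign x w u) → Solves (eqs D) (assign x w₁ u₁) →
      V N (eval (assign x w₁ u₁) t) → V N′ (eval (assign x w u) t)
    close-values x w u w₁ u₁ Bu Bu₁ s s₁ V₁ = V-resp
      (solve (eval (assign x w u) t ∷ eval (assign x w₁ u₁) t ∷ []) (a₁ ⊕ (a₀ ⊕ ⊝ a₁)) a₀)
      (V-+ (V-mono (ℕ.m≤m+n N Kˢ) V₁) (V-mono (ℕ.m≤n+m Kˢ N) (proj₂ (spread D t bdd) x w u w₁ u₁ Bu Bu₁ s s₁)))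

    unconditional inside : Basic n
    unconditional = record { exps = exps D ; eqs = eqs D ; cond = Trivial ; cond-def = trivial-def ; negs = [] }
    inside = Pin.pin unconditional t N Trivial trivial-def

    inside⁺ : ∀ x w d → Solves (eqs D) (at D x w d) → V N (eval (at D x w d) t) → Holds inside x
    inside⁺ x w d s Vt = let e , eq = V-coord Vt in
      Pin.pin⁺ unconditional t N Trivial trivial-def {x} (w , d , (s , trivial , []) , e , eq , trivial)

    inside⁻ : ∀ x → Holds inside x → ¬ ¬ (∃[ w ] ∃[ d ] Solves (eqs D) (at D x w d) × V N (eval (at D x w d) t))
    inside⁻ x h = Pin.pin⁻ unconditional t N Trivial trivial-def {x} h >>= λ
      { (w , d , (s , _ , _) , e , eq , _) → pure (w , d , s , V-resp (sym eq) (vec-V N e)) }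

  small-bounded : ∀ (D : Basic n) {t N} (bdd : BoundedBy (eqs D) t) {negs′} → All (BoundedBy (eqs D) ∘ proj₁) negs′ →
    All (BoundedBy (eqs (PinNeg.small D t N bdd negs′)) ∘ proj₁) (negs (PinNeg.small D t N bdd negs′))
  small-bounded D {t} {N} bdd {negs′} bs = All.map⁺ (All.map (λ {tN} → Pin.bounded-ren (withNegs D negs′) t N′ Outside outside-def {proj₁ tN}) bs)
    where
    open PinNeg D t N bdd
    open Outside N N′

  small-length : ∀ (D : Basic n) {t N} (bdd : BoundedBy (eqs D) t) negs′ →
    List.length (negs (PinNeg.small D t N bdd negs′)) ≡ List.length negs′
  small-length D bdd negs′ = List.length-map _ negs′

  -- If t is bounded on the solutions then D, with t ∉ V N, fails exactly if D
  -- without that requirement fails or t ∈ V N for some solution, and the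
  -- instances of D with t in a slightly larger V N′ fail.
  negate-bounded : ∀ r (D : Basic n) negs′ → List.length negs′ ≡ r → All (BoundedBy (eqs D) ∘ proj₁) negs′ →
    Eliminable (λ x → ¬ Holds (withNegs D negs′) x)
  negate-bounded zero    D []             _  _          = NoNegs.negate₀ D
  negate-bounded (suc r) D ((t , N) ∷ negs′) eq (bdd ∷ bs) = elim-⇔
    {H = λ x → (¬ Holds (fewer negs′) x ⊎ Holds inside x) × ¬ Holds (small negs′) x}
    (λ {x} h → pure λ { (w , d , s , hc , ∉ ∷ v) → join x h w d s hc (∉ ∷ v) })
    (λ {x} none → excluded-middle (Holds (fewer negs′) x) >>= λ
      { (inj₂ none′)                   → pure (inj₁ none′ , none-small x none)
      ; (inj₁ (w , d , s , hc , v)) → excluded-middle (V N (eval (at D x w d) t)) >>= λ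
          { (inj₁ Vt) → pure (inj₂ (inside⁺ x w d s Vt) , none-small x none)
          ; (inj₂ ∉)  → λ _ → none (w , d , s , hc , ∉ ∷ v) } })
    (elim-∩ (elim-∪ (negate-bounded r D negs′ (ℕ.suc-injective eq) bs) (elim-basic inside))
            (negate-bounded r (small negs′) (negs (small negs′)) (≡.trans (small-length D {t} {N} bdd negs′) (ℕ.suc-injective eq)) (small-bounded D {t} {N} bdd bs)))
    where
    open PinNeg D t N bdd
    none-small : ∀ x → ¬ Holds (full negs′) x → ¬ Holds (small negs′) x
    none-small x none h = small⇒full negs′ x h none
    join : ∀ x → (¬ Holds (fewer negs′) x ⊎ Holds inside x) × ¬ Holds (small negs′) x → ∀ w d →
      Solves (eqs D) (at D x w d) → cond D d → ¬ Avoids ((t , N) ∷ negs′) (at D x w d)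
    join x (inj₁ none′ , _) w d s hc (_ ∷ v) = none′ (w , d , s , hc , v)
    join x (inj₂ h , none′) w d s hc v = inside⁻ x h λ { (w₁ , d₁ , s₁ , V₁) →
      none′ (full⇒small negs′ x w d s hc v (close-values (Vec.lookup x) w (bounded D d) w₁ (bounded D d₁) (Bnd-bounded D d) (Bnd-bounded D d₁) s s₁ V₁)) }

  negate : ∀ (D : Basic n) → Eliminable (λ x → ¬ Holds D x)
  negate D = elim-⇔
    (λ {x} none′ → pure λ h → none′ (DropLarge.reduced⁺ D {x} h))
    (λ {x} none′ → pure λ h → DropLarge.reduced⁻ D {x} h none′)
    (negate-bounded _ D (negs (DropLarge.reduced D)) ≡.refl (DropLarge.reduced-bounded D))

  elim-¬ : Eliminable H → Eliminable {n = n} (λ x → ¬ H x)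
  elim-¬ e = elim-⇔ (λ none′ → pure λ h → sound e h none′) (λ none′ → pure λ h → complete e h none′) (elim-¬any negate (parts e))

  module _ (decidable : DecidableTheory (Fₚ-structure F p)) where
    Decided : Basic 0 → Set 𝕃
    Decided D = (¬ ¬ Holds D []) ⊎ (¬ Holds D [])

    -- Without parameters the right-hand side is zero, so a solution can be sought in V K′, and its
    -- existence is decided by the theory of F.
    decide-no-negs : ∀ D → Decided (withNegs D [])
    decide-no-negs D with decide decidable unsolvable-def (λ ())
      where
      open System (eqs D)
      open NoNegs D using (module Witness)
      open Unsolvability D {A = ⊥} (λ ()) equation (λ _ → 0ᴸ) (Witness.K′ 0)
    ... | yes un = inj₂ λ { (w , d , s , hc , _) →
          let zero-sum = λ i → trans (+-identityʳ _) (trans (eval-cong (λ { (wv _) → refl ; (uv _) → refl }) (equation i)) (solves⁺ s i))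
          in unsolvable⁻ {λ ()} un d (witness w d (λ _ → 0#) (λ _ → V-0) zero-sum) hc (witness-solves w d (λ _ → 0#) (λ _ → V-0) zero-sum) }
      where
      open System (eqs D)
      open NoNegs D using (module Witness)
      open Witness 0
      open Unsolvability D {A = ⊥} (λ ()) equation (λ _ → 0ᴸ) K′
    ... | no solvable = inj₁ λ none → solvable (unsolvable⁺ {λ ()} λ g e hc s → none
          ((λ j → vec K′ (e j)) , g , solves⁻ (λ i → trans (eval-cong (λ { (wv _) → refl ; (uv _) → refl }) (equation i))
            (trans (sym (+-identityʳ _)) (s i))) , hc , []))
      where
      open System (eqs D)
      open NoNegs D using (module Witness)
      open Witness 0
      open Unsolvability D {A = ⊥} (λ ()) equation (λ _ → 0ᴸ) K′

    -- Without parameters the zero assignment solves the equations and gives t = 0, which lies in V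
    -- N. Hence every solution has t in V N′, and the avoidance condition is equivalent to its
    -- version pinned by coordinates.
    decide-bounded : ∀ r (D : Basic 0) negs′ → List.length negs′ ≡ r → All (BoundedBy (eqs D) ∘ proj₁) negs′ →
      Decided (withNegs D negs′)
    decide-bounded zero    D []                _      _          = decide-no-negs D
    decide-bounded (suc r) D ((t , N) ∷ negs′) eq (bdd ∷ bs)
      with decide-bounded r (PinNeg.small D t N bdd negs′) (negs (PinNeg.small D t N bdd negs′)) (≡.trans (small-length D {t} {N} bdd negs′) (ℕ.suc-injective eq)) (small-bounded D {t} {N} bdd bs)
    ... | inj₁ yes′ = inj₁ (yes′ >>= PinNeg.small⇒full D t N bdd negs′ [])
    ... | inj₂ no′  = inj₂ λ { (w , d , s , hc , v) → no′ (full⇒small negs′ [] w d s hc v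
          (close-values (Vec.lookup []) w (bounded D d) 0ᶠ 0ᶠ (Bnd-bounded D d) (λ _ → V-0) s (all-tabulate (λ i → zero-value (List.lookup (eqs D) i)))
            (V-resp (sym (zero-value t)) V-0))) }
      where
      open PinNeg D t N bdd
      zero-value : ∀ t → eval (assign (Vec.lookup []) 0ᶠ 0ᶠ) t ≈ 0#
      zero-value t = trans (eval-cong (λ { (wv _) → refl ; (uv _) → refl }) t) (eval-0 t)

    decide-basic : ∀ D → Decided D
    decide-basic D with decide-bounded _ D (negs (DropLarge.reduced D)) ≡.refl (DropLarge.reduced-bounded D)
    ... | inj₁ yes′ = inj₁ (yes′ >>= DropLarge.reduced⁻ D {[]})
    ... | inj₂ no′  = inj₂ λ h → no′ (DropLarge.reduced⁺ D {[]} h)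

    decide-eliminable : ∀ {H : Vec Carrier 0 → Set s} → Eliminable H → (¬ ¬ H [] → H []) → Dec (H [])
    decide-eliminable e stable with decide-any (parts e)
      where
      decide-any : ∀ Ds → (¬ ¬ Any (λ D → Holds D []) Ds) ⊎ (¬ Any (λ D → Holds D []) Ds)
      decide-any []       = inj₂ λ ()
      decide-any (D ∷ Ds) with decide-basic D | decide-any Ds
      ... | inj₁ y | _      = inj₁ (y >>= λ h → pure (here h))
      ... | inj₂ _ | inj₁ y = inj₁ (y >>= λ h → pure (there h))
      ... | inj₂ f | inj₂ g = inj₂ λ { (here h) → f h ; (there h) → g h }
    ... | inj₁ y = yes (stable (y >>= complete e))
    ... | inj₂ f = no λ h → sound e h f

-- From formulas over R to basic relations

module _ {c ℓ₁ ℓ₂} (F : HeytingField c ℓ₁ ℓ₂) (p : ℕ)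
  {q} (M : FilteredModule q (c ⊔ ℓ₁) ℓ₁ (c ⊔ ℓ₁)) (C : Coordinates F p M) where
  open FilteredModule M
  open Coordinates C
  private
    module F = HeytingField F

  -- These clauses are the link between the symbols of the language and the operators of the
  -- filtered module. The stability clauses let the truth of a formula be recovered from its double
  -- negation.
  record Interpretation : Set (lsuc (c ⊔ ℓ₁)) where
    field
      fun : ∀ {k} → Funz k → Vec Carrier k → Carrier
      rel : ∀ {k} → Predzᵉ k → Vec Carrier k → Set (c ⊔ ℓ₁)
      fun-zero : fun (base zeroₚ) [] ≈ 0#
      fun-one  : fun (base oneₚ) [] ≈ bnd 0 F.1#
      fun-plus : ∀ x y → fun (base plusₚ) (x ∷ y ∷ []) ≈ x + y
      fun-frob : ∀ x → fun (base frobₚ) (x ∷ []) ≈ τ x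
      fun-z    : ∀ x → fun timesz (x ∷ []) ≈ z x
      rel-inF⁺ : ∀ {x} → rel (base inF) (x ∷ []) → ∃[ a ] x ≈ bnd 0 a
      rel-inF⁻ : ∀ {x a} → x ≈ bnd 0 a → rel (base inF) (x ∷ [])
      rel-P⁺   : ∀ {k} {σ : Formula ℒₚ k} {xs} → rel (P σ) xs →
        ∃[ as ] Pointwise (λ x a → x ≈ bnd 0 a) xs as × Satisfies (Fₚ-structure F p) σ as
      rel-P⁻   : ∀ {k} {σ : Formula ℒₚ k} {xs as} → Pointwise (λ x a → x ≈ bnd 0 a) xs as →
        Satisfies (Fₚ-structure F p) σ as → rel (P σ) xs
      ≈-stable : ∀ {x y} → ¬ ¬ x ≈ y → x ≈ y
      F-stable : ∀ {x} → ¬ ¬ (∃[ a ] x ≈ bnd 0 a) → ∃[ a ] x ≈ bnd 0 a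
      bnd-injective : ∀ {a b} → bnd 0 a ≈ bnd 0 b → a F.≈ b
      ≈ᶠ-stable : ∀ {a b} → ¬ ¬ a F.≈ b → a F.≈ b

    structure : Structure ℒₚzᵉ (c ⊔ ℓ₁) ℓ₁ (c ⊔ ℓ₁)
    structure = record { Carrier = Carrier ; _≈_ = _≈_ ; ⟦_⟧ᶠ = fun ; ⟦_⟧ᵖ = rel }

module Translation {c ℓ₁ ℓ₂} (F : HeytingField c ℓ₁ ℓ₂) (p : ℕ)
  {q} (M : FilteredModule q (c ⊔ ℓ₁) ℓ₁ (c ⊔ ℓ₁)) (C : Coordinates F p M) (I : Interpretation F p M C) where
  open Forms M
  open Coordinates C
  open Definability (Fₚ-structure F p)
  open DoubleNegation
  open Basics F p M C
  open Elimination F p M C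
  open Decision F p M C
  open Interpretation I
  private
    module F = HeytingField F
    𝓕 = Fₚ-structure F p

  private variable
    n k : ℕ

  open RawSemiringDefs (RawRing.rawSemiring (fieldRawRing F)) using (_^_)

  ^-cong : ∀ k {a b} → a F.≈ b → (a ^ k) F.≈ (b ^ k)
  ^-cong zero    e = F.refl
  ^-cong (suc k) e = F.*-cong e (^-cong k e)

  module _ {u v : Vec F.Carrier n} (eq : ∀ i → Vec.lookup u i F.≈ Vec.lookup v i) where
    evalTerm-cong : ∀ t → evalTerm 𝓕 u t F.≈ evalTerm 𝓕 v t
    evalTerm-cong (var i)                     = eq i
    evalTerm-cong (app zeroₚ [])              = F.refl
    evalTerm-cong (app oneₚ [])               = F.refl
    evalTerm-cong (app plusₚ (s ∷ t ∷ []))    = F.+-cong (evalTerm-cong s) (evalTerm-cong t)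
    evalTerm-cong (app frobₚ (t ∷ []))        = ^-cong p (evalTerm-cong t)

  satisfies-cong : ∀ {n} {u v : Vec F.Carrier n} → (∀ i → Vec.lookup u i F.≈ Vec.lookup v i) →
    ∀ σ → (Satisfies 𝓕 σ u → Satisfies 𝓕 σ v) × (Satisfies 𝓕 σ v → Satisfies 𝓕 σ u)
  satisfies-cong eq bot     = id , id
  satisfies-cong eq (s ≐ t) =
      (λ { (lift e) → lift (F.trans (F.sym (evalTerm-cong eq s)) (F.trans e (evalTerm-cong eq t))) })
    , (λ { (lift e) → lift (F.trans (evalTerm-cong eq s) (F.trans e (F.sym (evalTerm-cong eq t)))) })
  satisfies-cong eq (σ ⇒ σ′) = let f , g = satisfies-cong eq σ ; f′ , g′ = satisfies-cong eq σ′ in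
    (λ h x → f′ (h (g x))) , (λ h x → g′ (h (f x)))
  satisfies-cong eq (all σ) =
      (λ h a → proj₁ (satisfies-cong (λ { zero → F.refl ; (suc i) → eq i }) σ) (h a))
    , (λ h a → proj₂ (satisfies-cong (λ { zero → F.refl ; (suc i) → eq i }) σ) (h a))

  𝓕-stable : ∀ (σ : Formula ℒₚ n) {v} → ¬ ¬ Satisfies 𝓕 σ v → Satisfies 𝓕 σ v
  𝓕-stable bot      h   = lift (h lower)
  𝓕-stable (s ≐ t)  h   = lift (≈ᶠ-stable λ k → h λ x → k (lower x))
  𝓕-stable (σ ⇒ σ′) h x = 𝓕-stable σ′ λ k → h λ f → k (f x)
  𝓕-stable (all σ)  h a = 𝓕-stable σ λ k → h λ f → k (f a)

  pointwise⁺ : ∀ {xs : Vec Carrier k} {as : Vec F.Carrier k} → (∀ i → Vec.lookup xs i ≈ bnd 0 (Vec.lookup as i)) →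
    Pointwise (λ x a → x ≈ bnd 0 a) xs as
  pointwise⁺ {xs = []}     {[]}     f = []
  pointwise⁺ {xs = x ∷ xs} {a ∷ as} f = f zero ∷ pointwise⁺ (f ∘ suc)

  pointwise-unique : ∀ {xs : Vec Carrier k} {as bs} → Pointwise (λ x a → x ≈ bnd 0 a) xs as → Pointwise (λ x a → x ≈ bnd 0 a) xs bs →
    ∀ i → Vec.lookup as i F.≈ Vec.lookup bs i
  pointwise-unique ps qs i = bnd-injective (trans (sym (Pointwise.lookup ps i)) (Pointwise.lookup qs i))

  Named : Vec Carrier k → Set 𝕃
  Named {k} xs = Σ (Vec F.Carrier k) λ as → Pointwise (λ x a → x ≈ bnd 0 a) xs as

  pointwise-stable : ∀ (xs : Vec Carrier k) → ¬ ¬ Named xs → Named xs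
  pointwise-stable []       h = [] , []
  pointwise-stable (x ∷ xs) h =
    let a , e   = F-stable (h >>= λ { (_ , e ∷ _) → pure (_ , e) })
        as , es = pointwise-stable xs (h >>= λ { (_ , _ ∷ es) → pure (_ , es) })
    in a ∷ as , e ∷ es

  stable : ∀ (φ : Formula ℒₚzᵉ n) {v} → ¬ ¬ Satisfies structure φ v → Satisfies structure φ v
  stable bot      h   = lift (h lower)
  stable (s ≐ t)  h   = lift (≈-stable λ k → h λ x → k (lower x))
  stable (pred (base inF) (t ∷ [])) h = lift (rel-inF⁻ (proj₂ (F-stable (h >>= λ x → pure (rel-inF⁺ (lower x))))))
  stable (pred (P σ) ts) h =
    -- Names in F are unique up to equality, so they can be fixed before σ is known to hold; σ is
    -- then carried over from whatever names the hypothesis supplies.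
    let as , es = pointwise-stable (evalTerms structure _ ts) (h >>= λ x → let as , es , _ = rel-P⁺ (lower x) in pure (as , es))
    in lift (rel-P⁻ es (𝓕-stable σ (h >>= λ x → let _ , es′ , s = rel-P⁺ (lower x) in
         pure (proj₁ (satisfies-cong (pointwise-unique es′ es) σ) s))))
  stable (φ ⇒ ψ)  h x = stable ψ λ k → h λ f → k (f x)
  stable (all φ)  h a = stable φ λ k → h λ f → k (f a)

  -- The variable uv zero stands for 1.
  translate : Term ℒₚzᵉ n → Term′ n 0 (suc k)
  translate (var i)                           = var (xv i)
  translate (app (base zeroₚ) [])             = 0ᴸ
  translate (app (base oneₚ) [])              = var (uv zero)
  translate (app (base plusₚ) (s ∷ t ∷ []))   = translate s +ᴸ translate t
  translate (app (base frobₚ) (t ∷ []))       = τᴸ (translate t)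
  translate (app timesz (t ∷ []))             = zᴸ (translate t)

  translate-value : ∀ (x : Vec Carrier n) w (d : Fin (suc k) → F.Carrier) → d zero F.≈ F.1# → ∀ t →
    eval (assign (Vec.lookup x) w (λ i → bnd 0 (d i))) (translate t) ≈ evalTerm structure x t
  translate-value x w d e (var i)                         = refl
  translate-value x w d e (app (base zeroₚ) [])           = sym fun-zero
  translate-value x w d e (app (base oneₚ) [])            = trans (bnd-cong 0 e) (sym fun-one)
  translate-value x w d e (app (base plusₚ) (s ∷ t ∷ [])) =
    trans (+-cong (translate-value x w d e s) (translate-value x w d e t)) (sym (fun-plus _ _))
  translate-value x w d e (app (base frobₚ) (t ∷ []))     = trans (Additive.cong τ-add (translate-value x w d e t)) (sym (fun-frob _))
  translate-value x w d e (app timesz (t ∷ []))           = trans (Additive.cong z-add (translate-value x w d e t)) (sym (fun-z _))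

  isOne : Formula ℒₚ (suc k)
  isOne = var zero ≐ app oneₚ []

  atom : (eqs : List (Term′ n 0 (suc k))) (σ : Formula ℒₚ (suc k)) → Basic n
  atom {k = k} eqs σ = record
    { vars = 0 ; bvars = suc k ; exps = λ _ → 0 ; eqs = eqs
    ; cond = λ d → Satisfies 𝓕 (isOne and σ) (Vec.tabulate d)
    ; cond-def = def-formula (isOne and σ) id ; negs = [] }

  and⁺ : ∀ (σ σ′ : Formula ℒₚ n) v → Satisfies 𝓕 σ v → Satisfies 𝓕 σ′ v → Satisfies 𝓕 (σ and σ′) v
  and⁺ σ σ′ v x y h = h x y

  and⁻ : ∀ (σ σ′ : Formula ℒₚ n) v → Satisfies 𝓕 (σ and σ′) v → Satisfies 𝓕 σ v × Satisfies 𝓕 σ′ v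
  and⁻ σ σ′ v h = 𝓕-stable σ (λ k → lower (h λ x _ → lift (k x))) , 𝓕-stable σ′ (λ k → lower (h λ _ y → lift (k y)))

  difference-zero : ∀ {a b} → a ≈ b → a + - b ≈ 0#
  difference-zero e = trans (+-congʳ e) (inverseʳ _)

  zero-difference : ∀ {a b} → a + - b ≈ 0# → a ≈ b
  zero-difference {a} {b} e = trans (solve (a ∷ b ∷ []) a₀ (a₀ ⊕ ⊝ a₁ ⊕ a₁)) (trans (+-congʳ e) (+-identityˡ b))

  ∅ : Fin 0 → Carrier
  ∅ ()

  elim-≐ : ∀ (s t : Term ℒₚzᵉ n) → Eliminable (λ x → Satisfies structure (s ≐ t) x)
  elim-≐ {n} s t = elim-⇔
    (λ { {x} (w , d , (e ∷ []) , h , _) → let one , _ = and⁻ isOne isOne (Vec.tabulate d) h in pure (lift (trans (sym (translate-value x w d (lower one) s))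
        (trans (zero-difference e) (translate-value x w d (lower one) t)))) })
    (λ { {x} (lift e) → pure (∅ , (λ _ → F.1#)
       , difference-zero (trans (translate-value x ∅ (λ _ → F.1#) F.refl s) (trans e (sym (translate-value x ∅ (λ _ → F.1#) F.refl t)))) ∷ []
       , and⁺ isOne isOne (F.1# ∷ []) (lift F.refl) (lift F.refl) , []) })
    (elim-basic (atom {k = 0} ((translate s +ᴸ -ᴸ translate t) ∷ []) isOne))

  lookup-evalTerms : ∀ (x : Vec Carrier n) (ts : Vec (Term ℒₚzᵉ n) k) i →
    Vec.lookup (evalTerms structure x ts) i ≡ evalTerm structure x (Vec.lookup ts i)
  lookup-evalTerms x (t ∷ ts) zero    = ≡.refl
  lookup-evalTerms x (t ∷ ts) (suc i) = lookup-evalTerms x ts i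

  -- Each argument of the predicate is named by a variable in F.
  elim-P : ∀ (σ : Formula ℒₚ k) (ts : Vec (Term ℒₚzᵉ n) k) → Eliminable (λ x → Satisfies structure (pred (P σ) ts) x)
  elim-P {k} {n} σ ts = elim-⇔
    (λ { {x} (w , d , s , h , _) →
       let one , sat = and⁻ isOne σ⁺ (Vec.tabulate d) h
       in pure (lift (rel-P⁻ {as = Vec.tabulate (d ∘ suc)} (pointwise⁺ λ i → trans (reflexive (lookup-evalTerms x ts i))
            (trans (sym (translate-value x w d (lower one) (Vec.lookup ts i)))
              (trans (zero-difference (All.tabulate⁻ s i)) (reflexive (≡.cong (bnd 0) (≡.sym (Vec.lookup∘tabulate (d ∘ suc) i)))))))
            (rename⁻ (λ i → ≡.refl) σ sat))) })
    (λ { {x} (lift r) → let as , es , sat = rel-P⁺ r in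
       pure (∅ , d as , All.tabulate⁺ (λ i → difference-zero (trans (translate-value x ∅ (d as) F.refl (Vec.lookup ts i))
                (trans (reflexive (≡.sym (lookup-evalTerms x ts i))) (Pointwise.lookup es i))))
            , and⁺ isOne σ⁺ (Vec.tabulate (d as)) (lift F.refl) (rename⁺ (λ i → Vec.lookup∘tabulate (d as) (suc i)) σ sat) , []) })
    (elim-basic (atom (List.tabulate λ i → translate (Vec.lookup ts i) +ᴸ -ᴸ var (uv (suc i))) σ⁺))
    where
    σ⁺ : Formula ℒₚ (suc k)
    σ⁺ = rename suc σ
    d : Vec F.Carrier k → Fin (suc k) → F.Carrier
    d as zero    = F.1#
    d as (suc i) = Vec.lookup as i

  -- Membership in F is `P` of a tautology in one variable.
  elim-inF : ∀ (t : Term ℒₚzᵉ n) → Eliminable (λ x → Satisfies structure (pred (base inF) (t ∷ [])) x)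
  elim-inF t = elim-⇔
    (λ { (lift r) → pure (lift (rel-inF⁻ (in⁻ (proj₁ (proj₂ (rel-P⁺ r)))))) })
    (λ { (lift r) → let a , e = rel-inF⁺ r in pure (lift (rel-P⁻ {as = a ∷ []} (e ∷ []) (lift F.refl))) })
    (elim-P {k = 1} (var zero ≐ var zero) (t ∷ []))
    where
    in⁻ : ∀ {x as} → Pointwise (λ x a → x ≈ bnd 0 a) (x ∷ []) as → x ≈ bnd 0 (Vec.head as)
    in⁻ (e ∷ []) = e

  eliminate : ∀ (φ : Formula ℒₚzᵉ n) → Eliminable (λ x → Satisfies structure φ x)
  eliminate bot                        = elim-⇔ (λ { (lift ()) }) (λ { (lift ()) }) elim-⊥
  eliminate (s ≐ t)                    = elim-≐ s t
  eliminate (pred (base inF) (t ∷ [])) = elim-inF t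
  eliminate (pred (P σ) ts)            = elim-P σ ts
  eliminate (φ ⇒ ψ)                    = elim-⇔
    (λ { (inj₁ no′) → pure λ h → ⊥-elim (no′ h) ; (inj₂ h) → pure λ _ → h })
    (λ {x} f → excluded-middle (Satisfies structure φ x) >>= λ { (inj₁ h) → pure (inj₂ (f h)) ; (inj₂ no′) → pure (inj₁ no′) })
    (elim-∪ (elim-¬ (eliminate φ)) (eliminate ψ))
  eliminate (all φ)                    = elim-⇔
    (λ none → pure λ a → stable φ λ no′ → none (a , no′)) (λ h → pure λ { (a , no′) → no′ (h a) })
    (elim-¬ (elim-∃ (elim-¬ (eliminate φ))))

  decidable-theory : DecidableTheory 𝓕 → DecidableTheory structure
  decidable-theory decidable φ = decide-eliminable decidable (eliminate φ) (stable φ)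

-- The Frobenius map

absorption : ∀ n k → suc k ℕ.* (suc n ℕ.C suc k) ≡ suc n ℕ.* (n ℕ.C k)
absorption zero    zero    = ≡.refl
absorption zero    (suc k) = ℕ.*-zeroʳ (suc (suc k))
absorption (suc n) zero    = ≡.trans (ℕ.*-identityˡ _) (≡.trans (ℕ.nC1≡n (suc (suc n))) (≡.sym (ℕ.*-identityʳ _)))
absorption (suc n) (suc k) = begin
  suc (suc k) ℕ.* (suc (suc n) ℕ.C suc (suc k))
    ≡⟨ ≡.cong (suc (suc k) ℕ.*_) (ℕ.nCk+nC[k+1]≡[n+1]C[k+1] (suc n) (suc k)) ⟨
  suc (suc k) ℕ.* ((suc n ℕ.C suc k) ℕ.+ (suc n ℕ.C suc (suc k)))
    ≡⟨ distribute k (suc n ℕ.C suc k) (suc n ℕ.C suc (suc k)) ⟩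
  (suc n ℕ.C suc k) ℕ.+ (suc k ℕ.* (suc n ℕ.C suc k) ℕ.+ suc (suc k) ℕ.* (suc n ℕ.C suc (suc k)))
    ≡⟨ ≡.cong₂ (λ x y → (suc n ℕ.C suc k) ℕ.+ (x ℕ.+ y)) (absorption n k) (absorption n (suc k)) ⟩
  (suc n ℕ.C suc k) ℕ.+ (suc n ℕ.* (n ℕ.C k) ℕ.+ suc n ℕ.* (n ℕ.C suc k))
    ≡⟨ ≡.cong ((suc n ℕ.C suc k) ℕ.+_) (ℕ.*-distribˡ-+ (suc n) (n ℕ.C k) (n ℕ.C suc k)) ⟨
  (suc n ℕ.C suc k) ℕ.+ suc n ℕ.* ((n ℕ.C k) ℕ.+ (n ℕ.C suc k))
    ≡⟨ ≡.cong (λ x → (suc n ℕ.C suc k) ℕ.+ suc n ℕ.* x) (ℕ.nCk+nC[k+1]≡[n+1]C[k+1] n k) ⟩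
  suc (suc n) ℕ.* (suc n ℕ.C suc k)  ∎
  where
  open import Relation.Binary.PropositionalEquality.Properties using (module ≡-Reasoning)
  open ≡-Reasoning
  distribute : ∀ k a b → suc (suc k) ℕ.* (a ℕ.+ b) ≡ a ℕ.+ (suc k ℕ.* a ℕ.+ suc (suc k) ℕ.* b)
  distribute = solve-∀

-- By `absorption` p divides the product of k + 1 with the binomial coefficient, but not the smaller
-- number k + 1; Euclid's lemma does the rest.
prime∣binomial : ∀ {q} → Prime (suc q) → ∀ k → suc k < suc q → suc q ∣ suc q ℕ.C suc k
prime∣binomial {q} pr k k<q with euclidsLemma (suc k) (suc q ℕ.C suc k) pr (divides (q ℕ.C k) (≡.trans (absorption q k) (ℕ.*-comm (suc q) (q ℕ.C k))))
... | inj₁ p∣k = contradiction (∣⇒≤ p∣k) (ℕ.<⇒≱ k<q)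
... | inj₂ h   = h

module Frobenius {a ℓ} (R : CommutativeSemiring a ℓ) {q} (pr : Prime (suc q)) where
  open CommutativeSemiring R hiding (zero)
  open Exp R public
  open Mult semiring using (×-assocˡ; ×-assoc-*; ×-congʳ) renaming (_×_ to _·_)
  open SemiringSum semiring using (sum; sum-cong-≋; sum-init-last; sum-replicate-zero)
  open Binomial R using (binomialTerm; theorem)
  open SetoidReasoning setoid

  private
    p = suc q

  module _ (char : p · 1# ≈ 0#) where
    p·x : ∀ x → p · x ≈ 0#
    p·x x = begin
      p · x         ≈⟨ ×-congʳ p (*-identityˡ x) ⟨
      p · (1# * x)  ≈⟨ ×-assoc-* p 1# x ⟨
      (p · 1#) * x  ≈⟨ *-congʳ char ⟩
      0# * x        ≈⟨ zeroˡ x ⟩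
      0#            ∎

    multiple : ∀ {n} → p ∣ n → ∀ x → n · x ≈ 0#
    multiple (divides k ≡.refl) x = trans (reflexive (≡.cong (_· x) (ℕ.*-comm k p)))
      (trans (sym (×-assocˡ x p k)) (p·x (k · x)))

    frobenius-+ : ∀ x y → (x + y) ^ p ≈ x ^ p + y ^ p
    frobenius-+ x y = begin
      (x + y) ^ p                                    ≈⟨ theorem p x y ⟩
      t zero + sum (t ∘ suc)                         ≈⟨ +-congˡ (sum-init-last (t ∘ suc)) ⟩
      t zero + (sum (λ i → t (suc (inject₁ i))) + t (fromℕ p)) ≈⟨ +-congˡ (+-congʳ (sum-zero λ i → middle i)) ⟩
      t zero + (0# + t (fromℕ p))                    ≈⟨ +-congˡ (+-identityˡ _) ⟩
      t zero + t (fromℕ p)                           ≈⟨ +-comm _ _ ⟩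
      t (fromℕ p) + t zero                           ≈⟨ +-cong last first ⟩
      x ^ p + y ^ p                                  ∎
      where
      t = binomialTerm x y p
      sum-zero : ∀ {n} {f : Fin n → Carrier} → (∀ i → f i ≈ 0#) → sum f ≈ 0#
      sum-zero {n} e = trans (sum-cong-≋ e) (sum-replicate-zero n)
      middle : ∀ i → t (suc (inject₁ i)) ≈ 0#
      middle i = multiple (prime∣binomial pr (toℕ (inject₁ i))
        (s≤s (≡.subst (_< q) (≡.sym (Fin.toℕ-inject₁ i)) (Fin.toℕ<n i)))) _
      first : t zero ≈ y ^ p
      first = trans (+-identityʳ _) (*-identityˡ _)
      last : t (fromℕ p) ≈ x ^ p
      last rewrite Fin.toℕ-fromℕ q | ℕ.nCn≡1 p | ℕ.n∸n≡0 q = trans (+-identityʳ _) (*-identityʳ _)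

-- Algebraic extensions of the prime field: equality and p-th roots

module AlgebraicField {c₀ ℓ₁ ℓ₂} (F : HeytingField c₀ ℓ₁ ℓ₂) {q} (pr : Prime (suc q)) (ι : ℤ.ℤ → HeytingField.Carrier F)
  (ext : IsExtension F (suc q) ι) (alg : IsAlgebraic F (suc q) ι) where

  open CommutativeRing (fieldRing F) hiding (zero)
  open RingProperties ring using (-0#≈0#; -‿distribˡ-*)
  open AbelianGroupProperties +-abelianGroup using (x∙y⁻¹≈ε⇒x≈y; inverseˡ-unique)
  open Mult semiring using (×-homo-+; ×1-homo-*) renaming (_×_ to _·_)
  open SetoidReasoning setoid
  private
    module F = HeytingField F
    module ι = RingMorphisms.IsRingHomomorphism ext
    module S = SemiringSolver commutativeSemiring
    p = suc q
  open Frobenius commutativeSemiring pr using (_^_; ^-distrib-*; ^-congˡ; frobenius-+)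

  ι-natural : ∀ n → ι (ℤ.+ n) ≈ n · 1#
  ι-natural zero    = ι.0#-homo
  ι-natural (suc n) = trans (ι.+-homo (ℤ.+ 1) (ℤ.+ n)) (+-cong ι.1#-homo (ι-natural n))

  characteristic : p · 1# ≈ 0#
  characteristic = trans (sym (ι-natural p)) (trans (ι.⟦⟧-cong (≡.subst (p ∣_) (≡.sym (≡.cong ℤ.∣_∣ (ℤ.+-identityʳ (ℤ.+ p)))) ∣-refl)) ι.0#-homo)

  ι-prime : ∀ i → ∃[ n ] ι i ≈ n · 1#
  ι-prime (ℤ.+ n)      = n , ι-natural n
  -- In characteristic 1 + q the element -1 equals q.
  ι-prime (ℤ.-[1+ n ]) = q ℕ.* suc n , (begin
    ι (ℤ.- (ℤ.+ suc n))                                  ≈⟨ ι.-‿homo (ℤ.+ suc n) ⟩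
    - ι (ℤ.+ suc n)                                      ≈⟨ -‿cong (ι-natural (suc n)) ⟩
    - (suc n · 1#)                                       ≈⟨ +-identityʳ _ ⟨
    - (suc n · 1#) + 0#                                  ≈⟨ +-congˡ (trans (×1-homo-* p (suc n)) (trans (*-congʳ characteristic) (zeroˡ _))) ⟨
    - (suc n · 1#) + (p ℕ.* suc n) · 1#                  ≈⟨ +-congˡ (×-homo-+ 1# (suc n) (q ℕ.* suc n)) ⟩
    - (suc n · 1#) + (suc n · 1# + (q ℕ.* suc n) · 1#)   ≈⟨ +-assoc _ _ _ ⟨
    - (suc n · 1#) + suc n · 1# + (q ℕ.* suc n) · 1#     ≈⟨ +-congʳ (-‿inverseˡ _) ⟩
    0# + (q ℕ.* suc n) · 1#                              ≈⟨ +-identityˡ _ ⟩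
    (q ℕ.* suc n) · 1#                                   ∎)

  Unit : Carrier → Set (c₀ ⊔ ℓ₁)
  Unit a = ∃[ b ] b * a ≈ 1#

  natural-unit : ∀ n → ¬ p ∣ n → Unit (n · 1#)
  natural-unit n p∤n with ℕ.Bézout.lemma n p
  ... | ℕ.Bézout.result d g b with prime⇒irreducible pr (proj₂ (ℕ.GCD.commonDivisor g))
  ...   | inj₂ ≡.refl = contradiction (proj₁ (ℕ.GCD.commonDivisor g)) p∤n
  ...   | inj₁ ≡.refl with b
  ...     | ℕ.Bézout.Identity.+- x y eq = x · 1# , (begin
    (x · 1#) * (n · 1#)        ≈⟨ ×1-homo-* x n ⟨
    (x ℕ.* n) · 1#             ≈⟨ reflexive (≡.cong (_· 1#) eq) ⟨
    (1 ℕ.+ y ℕ.* p) · 1#       ≈⟨ +-congˡ (trans (×1-homo-* y p) (trans (*-congˡ characteristic) (zeroʳ _))) ⟩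
    1# + 0#                    ≈⟨ +-identityʳ 1# ⟩
    1#                         ∎)
  ...     | ℕ.Bézout.Identity.-+ x y eq = - (x · 1#) , (begin
    - (x · 1#) * (n · 1#)                            ≈⟨ -‿distribˡ-* _ _ ⟨
    - ((x · 1#) * (n · 1#))                          ≈⟨ -‿cong (×1-homo-* x n) ⟨
    - ((x ℕ.* n) · 1#)                               ≈⟨ +-identityʳ _ ⟨
    - ((x ℕ.* n) · 1#) + 0#                          ≈⟨ +-congˡ (trans (×1-homo-* y p) (trans (*-congˡ characteristic) (zeroʳ _))) ⟨
    - ((x ℕ.* n) · 1#) + (y ℕ.* p) · 1#              ≈⟨ +-congˡ (reflexive (≡.cong (_· 1#) eq)) ⟨
    - ((x ℕ.* n) · 1#) + (1# + (x ℕ.* n) · 1#)       ≈⟨ +-congˡ (+-comm _ _) ⟩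
    - ((x ℕ.* n) · 1#) + ((x ℕ.* n) · 1# + 1#)       ≈⟨ +-assoc _ _ _ ⟨
    - ((x ℕ.* n) · 1#) + (x ℕ.* n) · 1# + 1#         ≈⟨ +-congʳ (-‿inverseˡ _) ⟩
    0# + 1#                                          ≈⟨ +-identityˡ 1# ⟩
    1#                                               ∎)

  unit-cong : ∀ {a b} → a ≈ b → Unit a → Unit b
  unit-cong e (u , eq) = u , trans (*-congˡ (sym e)) eq

  unit-neg : ∀ {a} → Unit (- a) → Unit a
  unit-neg {a} (u , eq) = - u , trans (sym (-‿distribˡ-* u a)) (trans (RingProperties.-‿distribʳ-* ring u a) eq)

  ι-nonzero : ∀ i → ¬ RawRing._≈_ (𝔽 p) i ℤ.0ℤ → Unit (ι i)
  ι-nonzero i i≉0 with p ∣? ℤ.∣ i ∣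
  ... | yes p∣i = contradiction (≡.subst (p ∣_) (≡.sym (≡.cong ℤ.∣_∣ (ℤ.+-identityʳ i))) p∣i) i≉0
  ... | no  p∤i with i
  ...   | ℤ.+ n      = unit-cong (sym (ι-natural n)) (natural-unit n p∤i)
  ...   | ℤ.-[1+ n ] = unit-neg (unit-cong (trans (sym (ι-natural (suc n))) (trans (sym (RingProperties.-‿involutive ring _)) (-‿cong (sym (ι.-‿homo (ℤ.+ suc n))))))
                              (natural-unit (suc n) p∤i))

  1≉0ᶠ : ¬ 1# ≈ 0#
  1≉0ᶠ e = 1≉0 F λ { zero → e ; (suc n) → refl }

  open Polynomial (RawRing.rawSemiring (fieldRawRing F)) using (Poly; eval) renaming (_≈_ to _≋_)

  unit⇒# : ∀ {a} → Unit a → a F.# 0#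
  unit⇒# {a} (u , eq) = F.invertible⇒# (u , trans (*-congˡ (trans (+-congˡ -0#≈0#) (+-identityʳ a))) eq
    , trans (*-comm _ u) (trans (*-congˡ (trans (+-congˡ -0#≈0#) (+-identityʳ a))) eq))

  #⇒unit : ∀ {a b} → a F.# b → Unit (a + - b)
  #⇒unit a#b = let u , eq , _ = F.#⇒invertible a#b in u , eq

  unit-*ˡ : ∀ {a b} → Unit (a * b) → Unit a
  unit-*ˡ {a} {b} (u , eq) = u * b , trans (trans (*-assoc u b a) (*-congˡ (*-comm b a))) eq

  unit-cancel : ∀ {a b} → Unit a → a * b ≈ 0# → b ≈ 0#
  unit-cancel {a} {b} (u , eq) ab≈0 = begin
    b            ≈⟨ *-identityˡ b ⟨
    1# * b       ≈⟨ *-congʳ eq ⟨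
    u * a * b    ≈⟨ *-assoc u a b ⟩
    u * (a * b)  ≈⟨ *-congˡ ab≈0 ⟩
    u * 0#       ≈⟨ zeroʳ u ⟩
    0#           ∎

  unit≉0 : ∀ {a} → Unit a → ¬ a ≈ 0#
  unit≉0 (u , eq) a≈0 = 1≉0ᶠ (trans (sym eq) (trans (*-congˡ a≈0) (zeroʳ u)))

  power-zero : ∀ {a} k → a ^ k ≈ 0# → a ≈ 0#
  power-zero {a} k e = proj₁ (F.tight a 0#) λ a#0 → impossible k e (unit-cong (trans (+-congˡ -0#≈0#) (+-identityʳ a)) (#⇒unit a#0))
    where
    impossible : ∀ k → a ^ k ≈ 0# → ¬ Unit a
    impossible zero    e u = 1≉0ᶠ e
    impossible (suc k) e u = impossible k (unit-cancel u e) u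

  -- If a^k (u + a h) = 0 with u a unit, then u + a h or a h is a unit.
  zero? : ∀ a → a ≈ 0# ⊎ Unit a
  zero? a = let f , f≉0 , fa≈0 = alg a in search f 0 f≉0 (trans (*-identityˡ _) fa≈0)
    where
    search : ∀ (f : List ℤ.ℤ) k → ¬ 𝔽[z]._≈_ p f [] → a ^ k * eval (List.map ι f) a ≈ 0# → a ≈ 0# ⊎ Unit a
    search []      k f≉0 e = contradiction (λ n → divides 0 ≡.refl) f≉0
    search (i ∷ f) k f≉0 e with p ∣? ℤ.∣ i ℤ.- ℤ.0ℤ ∣
    ... | yes p∣i = search f (suc k) (λ f≈0 → f≉0 λ { zero → p∣i ; (suc n) → f≈0 n }) (begin
        a * a ^ k * eval (List.map ι f) a                 ≈⟨ S.solve 3 (λ x y z → (x S.:* y) S.:* z S.:= y S.:* (S.con 0 S.:+ x S.:* z)) refl a (a ^ k) (eval (List.map ι f) a) ⟩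
        a ^ k * (0# + a * eval (List.map ι f) a)          ≈⟨ *-congˡ (+-congʳ (trans (ι.⟦⟧-cong p∣i) ι.0#-homo)) ⟨
        a ^ k * (ι i + a * eval (List.map ι f) a)         ≈⟨ e ⟩
        0#                                                ∎)
    ... | no  p∤i = finish (F.#-cotrans (unit⇒# (ι-nonzero i p∤i)) (ι i + a * h))
      where
      h = eval (List.map ι f) a
      finish : ι i F.# (ι i + a * h) ⊎ (ι i + a * h) F.# 0# → a ≈ 0# ⊎ Unit a
      finish (inj₁ d) = inj₂ (unit-*ˡ (unit-neg (unit-cong (begin
        ι i + - (ι i + a * h)        ≈⟨ +-congˡ (RingProperties.-‿+-comm ring (ι i) (a * h)) ⟨
        ι i + (- ι i + - (a * h))    ≈⟨ +-assoc _ _ _ ⟨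
        ι i + - ι i + - (a * h)      ≈⟨ +-congʳ (-‿inverseʳ _) ⟩
        0# + - (a * h)               ≈⟨ +-identityˡ _ ⟩
        - (a * h)                    ∎) (#⇒unit d))))
      finish (inj₂ d) = inj₁ (power-zero k (unit-cancel (unit-cong (trans (+-congˡ -0#≈0#) (+-identityʳ _)) (#⇒unit d))
        (trans (*-comm _ _) e)))

  ≈-decide : ∀ a b → a ≈ b ⊎ Unit (a + - b)
  ≈-decide a b with zero? (a + - b)
  ... | inj₁ e = inj₁ (x∙y⁻¹≈ε⇒x≈y a b e)
  ... | inj₂ u = inj₂ u

  ≈ᶠ-stable′ : ∀ {a b} → ¬ ¬ a ≈ b → a ≈ b
  ≈ᶠ-stable′ {a} {b} h with ≈-decide a b
  ... | inj₁ e = e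
  ... | inj₂ u = contradiction (λ e → unit≉0 u (trans (+-congʳ e) (-‿inverseʳ b))) h

  φ : Carrier → Carrier
  φ a = a ^ p

  φ-+ : ∀ a b → φ (a + b) ≈ φ a + φ b
  φ-+ = frobenius-+ characteristic

  φ-cong : ∀ {a b} → a ≈ b → φ a ≈ φ b
  φ-cong e = ^-congˡ p e

  φ-0 : φ 0# ≈ 0#
  φ-0 = zeroˡ _

  φ-1 : φ 1# ≈ 1#
  φ-1 = one p
    where
    one : ∀ k → 1# ^ k ≈ 1#
    one zero    = refl
    one (suc k) = trans (*-identityˡ _) (one k)

  φ-neg : ∀ a → φ (- a) ≈ - φ a
  φ-neg a = inverseˡ-unique (φ (- a)) (φ a) (trans (sym (φ-+ (- a) a)) (trans (φ-cong (-‿inverseˡ a)) φ-0))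

  φ-injective : ∀ {a b} → φ a ≈ φ b → a ≈ b
  φ-injective {a} {b} e with ≈-decide a b
  ... | inj₁ a≈b = a≈b
  ... | inj₂ u   = contradiction (power-zero p (trans (φ-+ a (- b)) (trans (+-cong e (φ-neg b)) (-‿inverseʳ _)))) (unit≉0 u)

  φ-natural : ∀ n → φ (n · 1#) ≈ n · 1#
  φ-natural zero    = φ-0
  φ-natural (suc n) = trans (φ-+ 1# (n · 1#)) (+-cong φ-1 (φ-natural n))

  φ-ι : ∀ i → φ (ι i) ≈ ι i
  φ-ι i = let n , e = ι-prime i in trans (φ-cong e) (trans (φ-natural n) (sym e))

  -- The conjugates φⁿ a are roots of the same polynomial over 𝔽 p, so two of them agree.
  quotient : Poly → Carrier → Poly
  quotient []          r = []
  quotient (c ∷ [])    r = []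
  quotient (c ∷ d ∷ f) r = eval (d ∷ f) r ∷ quotient (d ∷ f) r

  -- This is f(x) - f(r) = (x - r) g(x) for the quotient g, arranged without subtraction so that it
  -- can be proved in the semiring.
  quotient-eval : ∀ f r x → eval f x + r * eval (quotient f r) x ≈ x * eval (quotient f r) x + eval f r
  quotient-eval []       r x = trans (+-congˡ (zeroʳ r)) (trans (+-identityʳ _) (sym (trans (+-congʳ (zeroʳ x)) (+-identityˡ _))))
  quotient-eval (c ∷ []) r x = S.solve 3 (λ c r x → (c S.:+ x S.:* S.con 0) S.:+ r S.:* S.con 0 S.:= x S.:* S.con 0 S.:+ (c S.:+ r S.:* S.con 0)) refl c r x
  quotient-eval (c ∷ f@(_ ∷ _)) r x = begin
    c + x * A + r * (B + x * Q)        ≈⟨ S.solve 6 (λ c x A r B Q → c S.:+ x S.:* A S.:+ r S.:* (B S.:+ x S.:* Q) S.:= (c S.:+ r S.:* B) S.:+ x S.:* (A S.:+ r S.:* Q)) refl c x A r B Q ⟩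
    c + r * B + x * (A + r * Q)        ≈⟨ +-congˡ (*-congˡ (quotient-eval f r x)) ⟩
    c + r * B + x * (x * Q + B)        ≈⟨ S.solve 5 (λ c x r B Q → (c S.:+ r S.:* B) S.:+ x S.:* (x S.:* Q S.:+ B) S.:= x S.:* (B S.:+ x S.:* Q) S.:+ (c S.:+ r S.:* B)) refl c x r B Q ⟩
    x * (B + x * Q) + (c + r * B)      ∎
    where
    A = eval f x
    B = eval f r
    Q = eval (quotient f r) x

  quotient-zero : ∀ f r → quotient f r ≋ [] → eval f r ≈ 0# → f ≋ []
  quotient-zero []       r q≈0 e = λ _ → refl
  quotient-zero (c ∷ []) r q≈0 e = λ { zero → trans (sym (trans (+-congˡ (zeroʳ r)) (+-identityʳ c))) e ; (suc n) → refl }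
  quotient-zero (c ∷ f@(_ ∷ _)) r q≈0 e = λ
    { zero    → trans (sym (trans (+-congˡ (trans (*-congˡ (q≈0 0)) (zeroʳ r))) (+-identityʳ c))) e
    ; (suc n) → quotient-zero f r (q≈0 ∘ suc) (q≈0 0) n }

  length-quotient : ∀ c f r → List.length (quotient (c ∷ f) r) ≡ List.length f
  length-quotient c []      r = ≡.refl
  length-quotient c (d ∷ f) r = ≡.cong suc (length-quotient d f r)

  -- Divide by x - r₀. If no later root equals r₀, the differences are units, so the later roots are
  -- roots of the quotient, which has one coefficient less; a vanishing quotient makes f vanish.
  roots : ∀ n (f : Poly) → List.length f ≡ n → (r : Fin n → Carrier) → (∀ i → eval f (r i) ≈ 0#) →
    f ≋ [] ⊎ (∃[ i ] ∃[ j ] toℕ i < toℕ j × r i ≈ r j)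
  roots zero    []      eq r zeros = inj₁ λ _ → refl
  roots (suc n) (c ∷ f) eq r zeros with roots n (quotient (c ∷ f) (r zero))
         (≡.trans (length-quotient c f (r zero)) (ℕ.suc-injective eq)) (r ∘ suc)
  ... | rec with first n (λ i → ≈-decide (r (suc i)) (r zero))
    where
    first : ∀ n {P : Fin n → Set ℓ₁} {Q : Fin n → Set (c₀ ⊔ ℓ₁)} → (∀ i → P i ⊎ Q i) → (∃ P) ⊎ (∀ i → Q i)
    first zero    f = inj₂ λ ()
    first (suc n) f with f zero | first n (f ∘ suc)
    ... | inj₁ x | _            = inj₁ (zero , x)
    ... | inj₂ _ | inj₁ (i , x) = inj₁ (suc i , x)
    ... | inj₂ y | inj₂ ys      = inj₂ λ { zero → y ; (suc i) → ys i }
  ...   | inj₁ (i , e)   = inj₂ (zero , suc i , s≤s z≤n , sym e)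
  ...   | inj₂ distinct with rec (λ i → unit-cancel (distinct i) (begin
            (r (suc i) + - r zero) * Q i                ≈⟨ distribʳ _ _ _ ⟩
            r (suc i) * Q i + - r zero * Q i            ≈⟨ +-cong (trans (sym (+-identityʳ _)) (trans (+-congˡ (sym (zeros zero)))
                                                              (trans (sym (quotient-eval (c ∷ f) (r zero) (r (suc i)))) (trans (+-congʳ (zeros (suc i))) (+-identityˡ _)))))
                                                            (sym (-‿distribˡ-* _ _)) ⟩
            r zero * Q i + - (r zero * Q i)             ≈⟨ -‿inverseʳ _ ⟩
            0#                                          ∎))
    where
    Q : Fin n → Carrier
    Q i = eval (quotient (c ∷ f) (r zero)) (r (suc i))
  ...     | inj₁ q≈0                 = inj₁ (quotient-zero (c ∷ f) (r zero) q≈0 (zeros zero))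
  ...     | inj₂ (i , j , i<j , e)   = inj₂ (suc i , suc j , s≤s i<j , e)

  φ-eval : ∀ (f : List ℤ.ℤ) a → φ (eval (List.map ι f) a) ≈ eval (List.map ι f) (φ a)
  φ-eval []      a = φ-0
  φ-eval (i ∷ f) a = trans (φ-+ _ _) (+-cong (φ-ι i) (trans (^-distrib-* a _ p) (*-congˡ (φ-eval f a))))

  conjugate : ℕ → Carrier → Carrier
  conjugate zero    a = a
  conjugate (suc n) a = φ (conjugate n a)

  conjugate-root : ∀ (f : List ℤ.ℤ) a → eval (List.map ι f) a ≈ 0# → ∀ n → eval (List.map ι f) (conjugate n a) ≈ 0#
  conjugate-root f a e zero    = e
  conjugate-root f a e (suc n) = trans (sym (φ-eval f (conjugate n a))) (trans (φ-cong (conjugate-root f a e n)) φ-0)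

  root : ∀ a → ∃[ b ] φ b ≈ a
  root a with alg a
  ... | f , f≉0 , fa≈0 with roots (List.length (List.map ι f)) (List.map ι f) ≡.refl (λ i → conjugate (toℕ i) a) (λ i → conjugate-root f a fa≈0 (toℕ i))
  ...   | inj₁ f≈0 = contradiction (reflects f f≈0) f≉0
    where
    reflects : ∀ f → List.map ι f ≋ [] → 𝔽[z]._≈_ p f []
    reflects []      e n       = divides 0 ≡.refl
    reflects (i ∷ f) e zero    with p ∣? ℤ.∣ i ℤ.- ℤ.0ℤ ∣
    ... | yes p∣i = p∣i
    ... | no  p∤i = contradiction (e 0) (unit≉0 (ι-nonzero i p∤i))
    reflects (i ∷ f) e (suc n) = reflects f (e ∘ suc) n
  ...   | inj₂ (i , j , i<j , e) = descend (toℕ i) (toℕ j) i<j e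
    where
    -- Injectivity of `φ` cancels m conjugations on both sides. Since n exceeds m, at least one `φ`
    -- is left on the right and exhibits a as a p-th power.
    descend : ∀ m n → m < n → conjugate m a ≈ conjugate n a → ∃[ b ] φ b ≈ a
    descend zero    (suc n) _         e = conjugate n a , sym e
    descend (suc m) (suc n) (s≤s m<n) e = descend m n m<n (φ-injective e)

  φ⁻¹ : Carrier → Carrier
  φ⁻¹ a = proj₁ (root a)

  φ-φ⁻¹ : ∀ a → φ (φ⁻¹ a) ≈ a
  φ-φ⁻¹ a = proj₂ (root a)

-- Polynomials over F

module PolynomialRing {c ℓ₁ ℓ₂} (F : HeytingField c ℓ₁ ℓ₂) where
  private
    module F = CommutativeRing (fieldRing F)
  open F[z] F hiding (_≈_; Irreducible; rawSemiring; eval)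

  -- A wrapper from which the two polynomials can be inferred.
  infix 4 _≋_
  record _≋_ (f g : Poly) : Set ℓ₁ where
    constructor coeffs
    field at : ∀ n → coeff f n F.≈ coeff g n
  open _≋_ public

  ≋-refl : ∀ {f} → f ≋ f
  ≋-refl = coeffs λ n → F.refl

  ≋-sym : ∀ {f g} → f ≋ g → g ≋ f
  ≋-sym e = coeffs λ n → F.sym (at e n)

  ≋-trans : ∀ {f g h} → f ≋ g → g ≋ h → f ≋ h
  ≋-trans e e′ = coeffs λ n → F.trans (at e n) (at e′ n)

  neg : Poly → Poly
  neg = List.map (λ a → F.- a)

  private
    -0≈0 = RingProperties.-0#≈0# F.ring

  coeff-neg : ∀ f n → coeff (neg f) n F.≈ F.- coeff f n
  coeff-neg []      n       = F.sym -0≈0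
  coeff-neg (a ∷ f) zero    = F.refl
  coeff-neg (a ∷ f) (suc n) = coeff-neg f n

  +-cong′ : ∀ {f f′ g g′} → f ≋ f′ → g ≋ g′ → f + g ≋ f′ + g′
  +-cong′ {f} {f′} {g} {g′} e e′ = coeffs λ n →
    F.trans (coeff-+ F f g n) (F.trans (F.+-cong (at e n) (at e′ n)) (F.sym (coeff-+ F f′ g′ n)))

  +-assoc′ : ∀ f g h → f + g + h ≋ f + (g + h)
  +-assoc′ f g h = coeffs λ n → F.trans (coeff-+ F (f + g) h n) (F.trans (F.+-congʳ (coeff-+ F f g n))
    (F.trans (F.+-assoc _ _ _) (F.sym (F.trans (coeff-+ F f (g + h) n) (F.+-congˡ (coeff-+ F g h n))))))

  +-comm′ : ∀ f g → f + g ≋ g + f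
  +-comm′ f g = coeffs λ n → F.trans (coeff-+ F f g n) (F.trans (F.+-comm _ _) (F.sym (coeff-+ F g f n)))

  +-identityʳ′ : ∀ f → f + [] ≋ f
  +-identityʳ′ []      = ≋-refl
  +-identityʳ′ (a ∷ f) = ≋-refl

  +-inverseˡ′ : ∀ f → neg f + f ≋ []
  +-inverseˡ′ f = coeffs λ n → F.trans (coeff-+ F (neg f) f n) (F.trans (F.+-congʳ (coeff-neg f n)) (F.-‿inverseˡ _))

  neg-cong : ∀ {f g} → f ≋ g → neg f ≋ neg g
  neg-cong {f} {g} e = coeffs λ n → F.trans (coeff-neg f n) (F.trans (F.-‿cong (at e n)) (F.sym (coeff-neg g n)))

  open import Algebra.Structures _≋_ using (IsAbelianGroup)

  +-isAbelianGroup : IsAbelianGroup _+_ [] neg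
  +-isAbelianGroup = record
    { isGroup = record
      { isMonoid = record
        { isSemigroup = record
          { isMagma = record
            { isEquivalence = record { refl = ≋-refl ; sym = ≋-sym ; trans = ≋-trans }
            ; ∙-cong = +-cong′ }
          ; assoc = +-assoc′ }
        ; identity = (λ f → ≋-refl) , +-identityʳ′ }
      ; inverse = +-inverseˡ′ , λ f → ≋-trans (+-comm′ f (neg f)) (+-inverseˡ′ f)
      ; ⁻¹-cong = neg-cong }
    ; comm = +-comm′ }

  private
    additive : CommutativeMonoid c ℓ₁
    additive = record { isCommutativeMonoid = IsAbelianGroup.isCommutativeMonoid +-isAbelianGroup }
    module S = CommutativeMonoidSolver additive

  ∷-cong : ∀ {a b f g} → a F.≈ b → f ≋ g → a ∷ f ≋ b ∷ g
  ∷-cong e e′ = coeffs λ { zero → e ; (suc n) → at e′ n }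

  shift-+ : ∀ f g → F.0# ∷ (f + g) ≋ (F.0# ∷ f) + (F.0# ∷ g)
  shift-+ f g = ∷-cong (F.sym (F.+-identityˡ F.0#)) ≋-refl

  0∷[] : F.0# ∷ [] ≋ []
  0∷[] = coeffs λ { zero → F.refl ; (suc n) → F.refl }

  scale-cong : ∀ {a b f g} → a F.≈ b → f ≋ g → scale a f ≋ scale b g
  scale-cong {a} {b} {f} {g} e e′ = coeffs λ n →
    F.trans (coeff-scale F a f n) (F.trans (F.*-cong e (at e′ n)) (F.sym (coeff-scale F b g n)))

  scale-+ : ∀ a f g → scale a (f + g) ≋ scale a f + scale a g
  scale-+ a f g = coeffs λ n → F.trans (coeff-scale F a (f + g) n) (F.trans (F.*-congˡ (coeff-+ F f g n)) (F.trans (F.distribˡ _ _ _)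
    (F.sym (F.trans (coeff-+ F (scale a f) (scale a g) n) (F.+-cong (coeff-scale F a f n) (coeff-scale F a g n))))))

  scale-scale : ∀ a b f → scale a (scale b f) ≋ scale (a F.* b) f
  scale-scale a b f = coeffs λ n → F.trans (coeff-scale F a (scale b f) n) (F.trans (F.*-congˡ (coeff-scale F b f n))
    (F.trans (F.sym (F.*-assoc _ _ _)) (F.sym (coeff-scale F (a F.* b) f n))))

  scale-1 : ∀ f → scale F.1# f ≋ f
  scale-1 f = coeffs λ n → F.trans (coeff-scale F F.1# f n) (F.*-identityˡ _)

  scale-0 : ∀ f → scale F.0# f ≋ []
  scale-0 f = coeffs λ n → F.trans (coeff-scale F F.0# f n) (F.zeroˡ _)

  scale-shift : ∀ a f → scale a (F.0# ∷ f) ≋ F.0# ∷ scale a f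
  scale-shift a f = ∷-cong (F.zeroʳ a) ≋-refl

  *-congˡ′ : ∀ f {g g′} → g ≋ g′ → f * g ≋ f * g′
  *-congˡ′ []      e = ≋-refl
  *-congˡ′ (a ∷ f) e = +-cong′ (scale-cong F.refl e) (∷-cong F.refl (*-congˡ′ f e))

  *-zeroʳ′ : ∀ f → f * [] ≋ []
  *-zeroʳ′ []      = ≋-refl
  *-zeroʳ′ (a ∷ f) = ≋-trans (∷-cong F.refl (*-zeroʳ′ f)) 0∷[]

  -- The product recurses on its left factor; this mirrored clause for the right factor is what
  -- commutativity rests on.
  *-∷ʳ : ∀ f b g → f * (b ∷ g) ≋ scale b f + (F.0# ∷ f * g)
  *-∷ʳ []      b g = ≋-sym 0∷[]
  *-∷ʳ (a ∷ f) b g = ∷-cong (F.trans (F.+-identityʳ _) (F.trans (F.*-comm a b) (F.sym (F.+-identityʳ _))))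
    (≋-trans (+-cong′ (≋-refl {scale a g}) (*-∷ʳ f b g))
      (S.solve 3 (λ x y z → x S.⊕ (y S.⊕ z) S.⊜ y S.⊕ (x S.⊕ z)) ≋-refl (scale a g) (scale b f) (F.0# ∷ f * g)))

  *-comm′ : ∀ f g → f * g ≋ g * f
  *-comm′ []      g = ≋-sym (*-zeroʳ′ g)
  *-comm′ (a ∷ f) g = ≋-trans (+-cong′ ≋-refl (∷-cong F.refl (*-comm′ f g))) (≋-sym (*-∷ʳ g a f))

  *-cong′ : ∀ {f f′ g g′} → f ≋ f′ → g ≋ g′ → f * g ≋ f′ * g′
  *-cong′ {f} {f′} {g} {g′} e e′ = ≋-trans (*-congˡ′ f e′) (≋-trans (*-comm′ f g′) (≋-trans (*-congˡ′ g′ e) (*-comm′ g′ f′)))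

  *-distribˡ′ : ∀ f g h → f * (g + h) ≋ f * g + f * h
  *-distribˡ′ []      g h = ≋-refl
  *-distribˡ′ (a ∷ f) g h = ≋-trans (+-cong′ (scale-+ a g h) (≋-trans (∷-cong F.refl (*-distribˡ′ f g h)) (shift-+ (f * g) (f * h))))
    (S.solve 4 (λ x y z w → (x S.⊕ y) S.⊕ (z S.⊕ w) S.⊜ (x S.⊕ z) S.⊕ (y S.⊕ w)) ≋-refl (scale a g) (scale a h) (F.0# ∷ f * g) (F.0# ∷ f * h))

  *-distribʳ′ : ∀ h f g → (f + g) * h ≋ f * h + g * h
  *-distribʳ′ h f g = ≋-trans (*-comm′ (f + g) h) (≋-trans (*-distribˡ′ h f g) (+-cong′ (*-comm′ h f) (*-comm′ h g)))

  scale-* : ∀ a f g → scale a f * g ≋ scale a (f * g)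
  scale-* a []      g = ≋-refl
  scale-* a (b ∷ f) g = ≋-trans (+-cong′ (≋-sym (scale-scale a b g)) (≋-trans (∷-cong F.refl (scale-* a f g)) (≋-sym (scale-shift a (f * g)))))
    (≋-sym (scale-+ a (scale b g) (F.0# ∷ f * g)))

  shift-* : ∀ f g → (F.0# ∷ f) * g ≋ F.0# ∷ f * g
  shift-* f g = +-cong′ (scale-0 g) ≋-refl

  *-assoc′ : ∀ f g h → f * g * h ≋ f * (g * h)
  *-assoc′ []      g h = ≋-refl
  *-assoc′ (a ∷ f) g h = ≋-trans (*-distribʳ′ h (scale a g) (F.0# ∷ f * g))
    (+-cong′ (scale-* a g h) (≋-trans (shift-* (f * g) h) (∷-cong F.refl (*-assoc′ f g h))))

  *-identityˡ′ : ∀ f → const F.1# * f ≋ f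
  *-identityˡ′ f = ≋-trans (+-cong′ (scale-1 f) 0∷[]) (+-identityʳ′ f)

  polyRing : CommutativeRing c ℓ₁
  polyRing = record
    { Carrier = Poly ; _≈_ = _≋_ ; _+_ = _+_ ; _*_ = _*_ ; -_ = neg ; 0# = [] ; 1# = const F.1#
    ; isCommutativeRing = record
      { isRing = record
        { +-isAbelianGroup = +-isAbelianGroup
        ; *-cong = *-cong′ ; *-assoc = *-assoc′
        ; *-identity = *-identityˡ′ , λ f → ≋-trans (*-comm′ f _) (*-identityˡ′ f)
        ; distrib = *-distribˡ′ , *-distribʳ′ }
      ; *-comm = *-comm′ } }

  const-* : ∀ a f → const a * f ≋ scale a f
  const-* a f = ≋-trans (+-cong′ (≋-refl {scale a f}) 0∷[]) (+-identityʳ′ _)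

  X-* : ∀ f → X * f ≋ F.0# ∷ f
  X-* f = ≋-trans (shift-* (const F.1#) f) (∷-cong F.refl (*-identityˡ′ f))

  ∷-split : ∀ a f → a ∷ f ≋ const a + X * f
  ∷-split a f = ≋-sym (≋-trans (+-cong′ (≋-refl {const a}) (X-* f)) (∷-cong (F.+-identityʳ a) ≋-refl))

  const-cong : ∀ {a b} → a F.≈ b → const a ≋ const b
  const-cong e = ∷-cong e ≋-refl

  const-homo-* : ∀ a b → const (a F.* b) ≋ const a * const b
  const-homo-* a b = ≋-sym (const-* a (const b))

  Bound : ℕ → Poly → Set ℓ₁
  Bound n f = ∀ m → n ≤ m → coeff f m F.≈ F.0#

  bound-mono : ∀ {m n f} → m ≤ n → Bound m f → Bound n f
  bound-mono m≤n b k n≤k = b k (ℕ.≤-trans m≤n n≤k)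

  bound-resp : ∀ {n f g} → f ≋ g → Bound n f → Bound n g
  bound-resp e b m n≤m = F.trans (F.sym (at e m)) (b m n≤m)

  bound-+ : ∀ {n} f g → Bound n f → Bound n g → Bound n (f + g)
  bound-+ f g b b′ m n≤m = F.trans (coeff-+ F f g m) (F.trans (F.+-cong (b m n≤m) (b′ m n≤m)) (F.+-identityˡ _))

  bound-scale : ∀ {n} a f → Bound n f → Bound n (scale a f)
  bound-scale a f b m n≤m = F.trans (coeff-scale F a f m) (F.trans (F.*-congˡ (b m n≤m)) (F.zeroʳ a))

  bound-neg : ∀ {n} f → Bound n f → Bound n (neg f)
  bound-neg f b m n≤m = F.trans (coeff-neg f m) (F.trans (F.-‿cong (b m n≤m)) -0≈0)

  bound-∷ : ∀ {n a} f → Bound n f → Bound (suc n) (a ∷ f)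
  bound-∷ f b (suc m) (s≤s n≤m) = b m n≤m

  bound-length : ∀ f → Bound (List.length f) f
  bound-length []      m       _         = F.refl
  bound-length (a ∷ f) (suc m) (s≤s l≤m) = bound-length f m l≤m

  bound-* : ∀ {n} f g → Bound n g → Bound (List.length f ℕ.+ n) (f * g)
  bound-* []          g b m _ = F.refl
  bound-* {n} (a ∷ f) g b = bound-+ (scale a g) (F.0# ∷ f * g)
    (bound-mono {f = scale a g} (ℕ.m≤n+m n _) (bound-scale a g b)) (bound-∷ (f * g) (bound-* f g b))

  bound-0 : ∀ {f} → Bound 0 f → f ≋ []
  bound-0 b = coeffs λ n → b n z≤n

  -- The numbers α and β merely bound the degrees; in degree α + β all contributions but one vanish.
  coeff-* : ∀ {α β} f g → Bound (suc α) f → Bound (suc β) g → coeff (f * g) (α ℕ.+ β) F.≈ coeff f α F.* coeff g β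
  coeff-* {zero}  {β} []      g b b′ = F.sym (F.zeroˡ _)
  coeff-* {suc α} {β} []      g b b′ = F.sym (F.zeroˡ _)
  coeff-* {zero}  {β} (a ∷ f) g b b′ = F.trans (coeff-∷* F a f g β) (F.trans (F.+-congˡ (zero-part β)) (F.+-identityʳ _))
    where
    f≋0 : f ≋ []
    f≋0 = bound-0 λ m _ → b (suc m) (s≤s z≤n)
    zero-part : ∀ β → coeff (F.0# ∷ f * g) β F.≈ F.0#
    zero-part zero    = F.refl
    zero-part (suc β) = at (*-cong′ f≋0 (≋-refl {g})) β
  coeff-* {suc α} {β} (a ∷ f) g b b′ = F.trans (coeff-∷* F a f g (suc α ℕ.+ β))
    (F.trans (F.+-cong (F.trans (F.*-congˡ (b′ _ (s≤s (ℕ.m≤n+m β α)))) (F.zeroʳ a)) (coeff-* f g (λ m h → b (suc m) (s≤s h)) b′)) (F.+-identityˡ _))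

-- Frobenius coordinates, division and greatest common divisors of polynomials

module FrobeniusPolynomials {c ℓ₁ ℓ₂} (F : HeytingField c ℓ₁ ℓ₂) {q} (pr : Prime (suc q)) (ι : ℤ.ℤ → HeytingField.Carrier F)
  (ext : IsExtension F (suc q) ι) (alg : IsAlgebraic F (suc q) ι) where

  open F[z] F hiding (_≈_; Irreducible; rawSemiring; eval)
  open PolynomialRing F
  open AlgebraicField F pr ι ext alg using (characteristic; Unit; unit-cong; unit≉0; zero?; φ; φ-+; φ-0; φ-injective; φ⁻¹; φ-φ⁻¹)
  private
    module F = CommutativeRing (fieldRing F)
    module P = CommutativeRing polyRing
    module S = SemiringSolver P.commutativeSemiring
    module Powers = Frobenius (F.commutativeSemiring) pr
    p = suc q
  open Frobenius P.commutativeSemiring pr public using (_^_; ^-distrib-*; ^-congˡ; ^-homo-*; ^-assocʳ)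
  open Mult P.semiring using () renaming (_×_ to _·_)
  open SetoidReasoning P.setoid

  φ⁻¹-cong : ∀ {a b} → a F.≈ b → φ⁻¹ a F.≈ φ⁻¹ b
  φ⁻¹-cong e = φ-injective (F.trans (φ-φ⁻¹ _) (F.trans e (F.sym (φ-φ⁻¹ _))))

  φ⁻¹-0 : φ⁻¹ F.0# F.≈ F.0#
  φ⁻¹-0 = φ-injective (F.trans (φ-φ⁻¹ _) (F.sym φ-0))

  φ⁻¹-+ : ∀ a b → φ⁻¹ (a F.+ b) F.≈ φ⁻¹ a F.+ φ⁻¹ b
  φ⁻¹-+ a b = φ-injective (F.trans (φ-φ⁻¹ _) (F.sym (F.trans (φ-+ _ _) (F.+-cong (φ-φ⁻¹ a) (φ-φ⁻¹ b)))))

  φ⁻¹-* : ∀ a b → φ⁻¹ (φ a F.* b) F.≈ a F.* φ⁻¹ b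
  φ⁻¹-* a b = φ-injective (F.trans (φ-φ⁻¹ _) (F.sym (F.trans (Powers.^-distrib-* a (φ⁻¹ b) p) (F.*-congˡ (φ-φ⁻¹ b)))))

  char-poly : p · const F.1# ≋ []
  char-poly = ≋-trans (natural p) (≋-trans (const-cong characteristic) 0∷[])
    where
    open Mult F.semiring using () renaming (_×_ to _·ᶠ_)
    natural : ∀ n → n · const F.1# ≋ const (n ·ᶠ F.1#)
    natural zero    = ≋-sym 0∷[]
    natural (suc n) = +-cong′ (≋-refl {const F.1#}) (natural n)

  pow-+ : ∀ f g → (f + g) ^ p ≋ f ^ p + g ^ p
  pow-+ = Frobenius.frobenius-+ P.commutativeSemiring pr char-poly

  const-^ : ∀ a k → const a ^ k ≋ const (a Powers.^ k)
  const-^ a zero    = ≋-refl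
  const-^ a (suc k) = ≋-trans (*-congˡ′ (const a) (const-^ a k)) (≋-sym (const-homo-* a _))

  ∷-pow : ∀ a f → (a ∷ f) ^ p ≋ const (φ a) + X ^ p * f ^ p
  ∷-pow a f = begin
    (a ∷ f) ^ p                        ≈⟨ ^-congˡ p (∷-split a f) ⟩
    (const a + X * f) ^ p              ≈⟨ pow-+ (const a) (X * f) ⟩
    const a ^ p + (X * f) ^ p          ≈⟨ +-cong′ (const-^ a p) (^-distrib-* X f p) ⟩
    const (φ a) + X ^ p * f ^ p        ∎

  coeff-X^ : ∀ k f m → coeff (X ^ k * f) (k ℕ.+ m) F.≈ coeff f m
  coeff-X^ zero    f m = at (*-identityˡ′ f) m
  coeff-X^ (suc k) f m = F.trans (at (≋-trans (P.*-assoc X (X ^ k) f) (X-* (X ^ k * f))) (suc (k ℕ.+ m))) (coeff-X^ k f m)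

  coeff-X^-low : ∀ k f m → m < k → coeff (X ^ k * f) m F.≈ F.0#
  coeff-X^-low (suc k) f zero    _         = at (≋-trans (P.*-assoc X (X ^ k) f) (X-* (X ^ k * f))) 0
  coeff-X^-low (suc k) f (suc m) (s≤s m<k) = F.trans (at (≋-trans (P.*-assoc X (X ^ k) f) (X-* (X ^ k * f))) (suc m)) (coeff-X^-low k f m m<k)

  -- f = Σ_{i ≤ q} X^i (θ i f)^p
  θ : Fin (suc q) → Poly → Poly
  θ i       []      = []
  θ zero    (a ∷ f) = φ⁻¹ a ∷ θ (fromℕ q) f
  θ (suc i) (a ∷ f) = θ (inject₁ i) f

  -- The recursion for `θ` rotates residue classes of exponents modulo p. This closed form makes
  -- congruence, additivity and degree bounds visible coefficient by coefficient.
  coeff-θ : ∀ i f l → coeff (θ i f) l F.≈ φ⁻¹ (coeff f (toℕ i ℕ.+ l ℕ.* p))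
  coeff-θ i       []      l       = F.sym φ⁻¹-0
  coeff-θ zero    (a ∷ f) zero    = F.refl
  coeff-θ zero    (a ∷ f) (suc l) = F.trans (coeff-θ (fromℕ q) f l)
    (F.reflexive (≡.cong (λ k → φ⁻¹ (coeff f (k ℕ.+ l ℕ.* p))) (Fin.toℕ-fromℕ q)))
  coeff-θ (suc i) (a ∷ f) l       = F.trans (coeff-θ (inject₁ i) f l)
    (F.reflexive (≡.cong (λ k → φ⁻¹ (coeff f (k ℕ.+ l ℕ.* p))) (Fin.toℕ-inject₁ i)))

  θ-cong : ∀ i {f g} → f ≋ g → θ i f ≋ θ i g
  θ-cong i {f} {g} e = coeffs λ l → F.trans (coeff-θ i f l) (F.trans (φ⁻¹-cong (at e _)) (F.sym (coeff-θ i g l)))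

  θ-+ : ∀ i f g → θ i (f + g) ≋ θ i f + θ i g
  θ-+ i f g = coeffs λ l → F.trans (coeff-θ i (f + g) l) (F.trans (φ⁻¹-cong (coeff-+ F f g _)) (F.trans (φ⁻¹-+ _ _)
    (F.sym (F.trans (coeff-+ F (θ i f) (θ i g) l) (F.+-cong (coeff-θ i f l) (coeff-θ i g l))))))

  θ-scale : ∀ i a f → θ i (scale (φ a) f) ≋ scale a (θ i f)
  θ-scale i a f = coeffs λ l → F.trans (coeff-θ i (scale (φ a) f) l) (F.trans (φ⁻¹-cong (coeff-scale F (φ a) f _)) (F.trans (φ⁻¹-* a _)
    (F.sym (F.trans (coeff-scale F a (θ i f) l) (F.*-congˡ (coeff-θ i f l))))))

  θ-X-zero : ∀ f → θ zero (X * f) ≋ X * θ (fromℕ q) f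
  θ-X-zero f = ≋-trans (θ-cong zero (X-* f)) (≋-trans (∷-cong φ⁻¹-0 ≋-refl) (≋-sym (X-* _)))

  θ-X-suc : ∀ i f → θ (suc i) (X * f) ≋ θ (inject₁ i) f
  θ-X-suc i f = θ-cong (suc i) (X-* f)

  θ-X^p : ∀ i f → θ i (X ^ p * f) ≋ X * θ i f
  θ-X^p i f = ≋-trans (coeffs go) (≋-sym (X-* (θ i f)))
    where
    go : ∀ l → coeff (θ i (X ^ p * f)) l F.≈ coeff (F.0# ∷ θ i f) l
    go zero    = F.trans (coeff-θ i (X ^ p * f) zero) (F.trans (φ⁻¹-cong (coeff-X^-low p f (toℕ i ℕ.+ 0) (≡.subst (_< p) (≡.sym (ℕ.+-identityʳ _)) (Fin.toℕ<n i)))) φ⁻¹-0)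
    go (suc l) = F.trans (coeff-θ i (X ^ p * f) (suc l)) (F.trans (φ⁻¹-cong (F.trans
        (F.reflexive (≡.cong (coeff (X ^ p * f)) (rearrange (toℕ i) p (l ℕ.* p)))) (coeff-X^ p f _))) (F.sym (coeff-θ i f l)))
      where
      rearrange : ∀ i p l → i ℕ.+ (p ℕ.+ l) ≡ p ℕ.+ (i ℕ.+ l)
      rearrange = solve-∀

  -- The operators `θ i` are of Cartier type: a p-th power leaves them as its root. Writing g as a
  -- constant plus X times its tail reduces the claim to p-th powers of constants and of X.
  θ-pow : ∀ i g h → θ i (g ^ p * h) ≋ g * θ i h
  θ-pow i []      h = ≋-refl
  θ-pow i (a ∷ g) h = begin
    θ i ((a ∷ g) ^ p * h)                                 ≈⟨ θ-cong i (*-cong′ (∷-pow a g) (≋-refl {h})) ⟩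
    θ i ((const (φ a) + X ^ p * g ^ p) * h)               ≈⟨ θ-cong i (*-distribʳ′ h (const (φ a)) (X ^ p * g ^ p)) ⟩
    θ i (const (φ a) * h + X ^ p * g ^ p * h)             ≈⟨ θ-cong i (+-cong′ (const-* (φ a) h) (P.*-assoc (X ^ p) (g ^ p) h)) ⟩
    θ i (scale (φ a) h + X ^ p * (g ^ p * h))             ≈⟨ θ-+ i (scale (φ a) h) (X ^ p * (g ^ p * h)) ⟩
    θ i (scale (φ a) h) + θ i (X ^ p * (g ^ p * h))       ≈⟨ +-cong′ (θ-scale i a h) (≋-trans (θ-X^p i (g ^ p * h)) (*-congˡ′ X (θ-pow i g h))) ⟩
    scale a (θ i h) + X * (g * θ i h)                     ≈⟨ +-cong′ (≋-sym (const-* a (θ i h))) (≋-sym (P.*-assoc X g (θ i h))) ⟩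
    const a * θ i h + X * g * θ i h                       ≈⟨ *-distribʳ′ (θ i h) (const a) (X * g) ⟨
    (const a + X * g) * θ i h                             ≈⟨ *-cong′ (≋-sym (∷-split a g)) ≋-refl ⟩
    (a ∷ g) * θ i h                                       ∎

  asm : ∀ {n} → (Fin n → Poly) → Poly
  asm {zero}  y = []
  asm {suc n} y = y zero ^ p + X * asm (y ∘ suc)

  -- Prepending a coefficient rotates the coordinates and brings the last one to the front, so
  -- `asm-θ` has to split the sum at its end.
  asm-last : ∀ n (y : Fin (suc n) → Poly) → asm y ≋ asm (y ∘ inject₁) + X ^ n * y (fromℕ n) ^ p
  asm-last zero    y = S.solve 2 (λ a x → a S.:+ x S.:* S.con 0 S.:= S.con 0 S.:+ S.con 1 S.:* a) P.refl (y zero ^ p) X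
  asm-last (suc n) y = ≋-trans (+-cong′ (≋-refl {y zero ^ p}) (*-congˡ′ X (asm-last n (y ∘ suc))))
    (S.solve 5 (λ a x b z w → a S.:+ x S.:* (b S.:+ z S.:* w) S.:= (a S.:+ x S.:* b) S.:+ (x S.:* z) S.:* w) P.refl
      (y zero ^ p) X (asm (y ∘ suc ∘ inject₁)) (X ^ n) (y (suc (fromℕ n)) ^ p))

  asm-θ : ∀ f → asm (λ i → θ i f) ≋ f
  asm-θ []      = zeros {suc q}
    where
    zeros : ∀ {n} → asm {n} (λ _ → []) ≋ []
    zeros {zero}  = ≋-refl
    zeros {suc n} = ≋-trans (*-congˡ′ X (zeros {n})) (*-zeroʳ′ X)
  asm-θ (a ∷ f) = begin
    (φ⁻¹ a ∷ θ (fromℕ q) f) ^ p + X * asm (λ i → θ (inject₁ i) f)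
      ≈⟨ +-cong′ (∷-pow (φ⁻¹ a) (θ (fromℕ q) f)) ≋-refl ⟩
    const (φ (φ⁻¹ a)) + X ^ p * θ (fromℕ q) f ^ p + X * asm (λ i → θ (inject₁ i) f)
      ≈⟨ S.solve 5 (λ u x y z w → (u S.:+ (x S.:* y) S.:* z) S.:+ x S.:* w S.:= u S.:+ x S.:* (w S.:+ y S.:* z)) P.refl
           (const (φ (φ⁻¹ a))) X (X ^ q) (θ (fromℕ q) f ^ p) (asm (λ i → θ (inject₁ i) f)) ⟩
    const (φ (φ⁻¹ a)) + X * (asm (λ i → θ (inject₁ i) f) + X ^ q * θ (fromℕ q) f ^ p)
      ≈⟨ +-cong′ (const-cong (φ-φ⁻¹ a)) (*-congˡ′ X (≋-trans (≋-sym (asm-last q (λ i → θ i f))) (asm-θ f))) ⟩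
    const a + X * f
      ≈⟨ ∷-split a f ⟨
    a ∷ f  ∎

  bound-pow : ∀ n f → Bound n f → Bound (p ℕ.* n) (f ^ p)
  bound-pow n       []      b m _ = F.refl
  bound-pow zero    (a ∷ f) b m _ = at (≋-trans (^-congˡ p (bound-0 {a ∷ f} b)) (≋-refl {[]})) m
  bound-pow (suc n) (a ∷ f) b m h = F.trans (at (∷-pow a f) m) (F.trans (coeff-+ F (const (φ a)) (X ^ p * f ^ p) m)
    (F.trans (F.+-cong (const-zero m (ℕ.≤-trans (s≤s z≤n) h′)) (high m h′)) (F.+-identityˡ _)))
    where
    h′ : p ℕ.+ p ℕ.* n ≤ m
    h′ = ≡.subst (_≤ m) (ℕ.*-suc p n) h
    const-zero : ∀ m → 1 ≤ m → coeff (const (φ a)) m F.≈ F.0#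
    const-zero (suc m) _ = F.refl
    high : ∀ m → p ℕ.+ p ℕ.* n ≤ m → coeff (X ^ p * f ^ p) m F.≈ F.0#
    high m h with ℕ.m≤n⇒∃[o]m+o≡n (ℕ.≤-trans (ℕ.m≤m+n p (p ℕ.* n)) h)
    ... | k , ≡.refl = F.trans (coeff-X^ p (f ^ p) k) (bound-pow n f (λ m h → b (suc m) (s≤s h)) k (ℕ.+-cancelˡ-≤ p _ _ h))

  bound-θ : ∀ n i f → Bound (p ℕ.* n) f → Bound n (θ i f)
  bound-θ n i f b m n≤m = F.trans (coeff-θ i f m) (F.trans (φ⁻¹-cong (b _
    (ℕ.≤-trans (ℕ.≤-reflexive (ℕ.*-comm p n)) (ℕ.≤-trans (ℕ.*-monoˡ-≤ p n≤m) (ℕ.m≤n+m _ (toℕ i)))))) φ⁻¹-0)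

  Top : Poly → ℕ → Set (c ⊔ ℓ₁)
  Top f α = Unit (coeff f α) × Bound (suc α) f

  top? : ∀ f → f ≋ [] ⊎ ∃ (Top f)
  top? []      = inj₁ ≋-refl
  top? (a ∷ f) with top? f
  ... | inj₂ (α , u , b) = inj₂ (suc α , u , bound-∷ f b)
  ... | inj₁ f≋0 with zero? a
  ...   | inj₁ a≈0 = inj₁ (coeffs λ { zero → a≈0 ; (suc n) → at f≋0 n })
  ...   | inj₂ u   = inj₂ (0 , u , λ { (suc m) _ → at f≋0 m })

  top-bound : ∀ {f α n} → Top f α → Bound n f → α < n
  top-bound {α = α} {n} (u , _) b with ℕ.<-≤-connex α n
  ... | inj₁ α<n = α<n
  ... | inj₂ n≤α = contradiction (b α n≤α) (unit≉0 u)

  top-resp : ∀ {f g α} → f ≋ g → Top f α → Top g α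
  top-resp e (u , b) = unit-cong (at e _) u , bound-resp e b

  unit-* : ∀ {a b} → Unit a → Unit b → Unit (a F.* b)
  unit-* {a} {b} (u , e) (v , e′) = v F.* u , F.trans (F.*-assoc v u (a F.* b)) (F.trans (F.*-congˡ (F.trans (F.sym (F.*-assoc u a b))
    (F.trans (F.*-congʳ e) (F.*-identityˡ b)))) e′)

  bound-cancel : ∀ {α n} a g → Top a α → Bound n (a * g) → Bound n g
  bound-cancel {α} {n} a g (u , ba) b with top? g
  ... | inj₁ g≋0          = λ m _ → at g≋0 m
  ... | inj₂ (β , v , bg) = bound-mono {f = g} β<n bg
    where
    β<n : β < n
    β<n with ℕ.<-≤-connex (α ℕ.+ β) n
    ... | inj₁ h = ℕ.≤-<-trans (ℕ.m≤n+m β α) h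
    ... | inj₂ h = contradiction (F.trans (F.sym (coeff-* a g ba bg)) (b _ h)) (unit≉0 (unit-* u v))

  *-cancel-zero : ∀ {α} a g → Top a α → a * g ≋ [] → g ≋ []
  *-cancel-zero a g t e = bound-0 {g} (bound-cancel a g t λ m _ → at e m)

  *-cancelˡ : ∀ {α} a {g h} → Top a α → a * g ≋ a * h → g ≋ h
  *-cancelˡ a {g} {h} t e = x∙y⁻¹≈ε⇒x≈y g h (*-cancel-zero a (g + neg h) t
    (≋-trans (*-distribˡ′ a g (neg h)) (≋-trans (+-cong′ e (≋-sym (-‿distribʳ-* a h))) (P.-‿inverseʳ (a * h)))))
    where
    open AbelianGroupProperties P.+-abelianGroup using (x∙y⁻¹≈ε⇒x≈y)
    open RingProperties P.ring using (-‿distribʳ-*)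

  top-factor : ∀ {α} a b → Top (a * b) α → ∃ (Top a) × ∃ (Top b)
  top-factor a b t with top? a | top? b
  ... | inj₂ ta | inj₂ tb = ta , tb
  ... | inj₁ a0 | _       = contradiction (at (*-cong′ a0 (≋-refl {b})) _) (unit≉0 (proj₁ t))
  ... | inj₂ _  | inj₁ b0 = contradiction (at (≋-trans (*-congˡ′ a b0) (*-zeroʳ′ a)) _) (unit≉0 (proj₁ t))

  top-* : ∀ {α β} a b → Top a α → Top b β → ∃ (Top (a * b))
  top-* a b ta tb with top? (a * b)
  ... | inj₂ t = t
  ... | inj₁ e = contradiction (F.trans (F.sym (coeff-* a b (proj₂ ta) (proj₂ tb))) (at e _)) (unit≉0 (unit-* (proj₁ ta) (proj₁ tb)))

  top-1 : Top (const F.1#) 0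
  top-1 = (F.1# , F.*-identityˡ F.1#) , λ { (suc m) _ → F.refl }

  top-^ : ∀ {α} f → Top f α → ∀ n → ∃ (Top (f ^ n))
  top-^ f t zero    = 0 , top-1
  top-^ f t (suc n) = top-* f (f ^ n) t (proj₂ (top-^ f t n))

  divide : ∀ {α} a → Top a α → ∀ g → ∃[ d ] ∃[ r ] g ≋ a * d + r × Bound α r
  divide a t []      = [] , [] , ≋-sym (≋-trans (+-identityʳ′ _) (*-zeroʳ′ a)) , λ m _ → F.refl
  divide {α} a t@((u , ua) , ba) (x ∷ g) =
    let d , r , e , br = divide a t g
        -- The remainder of the tail, shifted by one degree, has degree at most α; subtracting s a
        -- removes the coefficient in degree α.
        s = coeff (x ∷ r) α F.* u
    in s ∷ d , (x ∷ r) + neg (scale s a) , (begin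
        x ∷ g                                                         ≈⟨ ∷-cong (F.sym (F.+-identityˡ x)) e ⟩
        (F.0# ∷ a * d) + (x ∷ r)                                      ≈⟨ P.+-identityˡ _ ⟨
        [] + ((F.0# ∷ a * d) + (x ∷ r))                               ≈⟨ +-cong′ (≋-sym (P.-‿inverseʳ (scale s a))) ≋-refl ⟩
        (scale s a + neg (scale s a)) + ((F.0# ∷ a * d) + (x ∷ r))    ≈⟨ S.solve 4 (λ x y z w → (x S.:+ y) S.:+ (z S.:+ w) S.:= (x S.:+ z) S.:+ (w S.:+ y)) P.refl
                                                                           (scale s a) (neg (scale s a)) (F.0# ∷ a * d) (x ∷ r) ⟩
        (scale s a + (F.0# ∷ a * d)) + ((x ∷ r) + neg (scale s a))    ≈⟨ +-cong′ (≋-sym (*-∷ʳ a s d)) ≋-refl ⟩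
        a * (s ∷ d) + ((x ∷ r) + neg (scale s a))                     ∎)
      , remainder r br
    where
    remainder : ∀ r → Bound α r → Bound α ((x ∷ r) + neg (scale (coeff (x ∷ r) α F.* u) a))
    remainder r br m α≤m with ℕ.m≤n⇒m<n∨m≡n α≤m
    ... | inj₁ α<m = bound-+ (x ∷ r) (neg (scale s a)) (bound-∷ r br) (bound-neg (scale s a) (bound-scale s a ba)) m α<m
      where s = coeff (x ∷ r) α F.* u
    ... | inj₂ ≡.refl = F.trans (coeff-+ F (x ∷ r) (neg (scale s a)) α) (F.trans (F.+-congˡ (F.trans (coeff-neg (scale s a) α)
          (F.-‿cong (F.trans (coeff-scale F s a α) (F.trans (F.*-assoc _ u _) (F.trans (F.*-congˡ ua) (F.*-identityʳ _))))))) (F.-‿inverseʳ _))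
      where s = coeff (x ∷ r) α F.* u

  record GCD (a b : Poly) : Set (c ⊔ ℓ₁) where
    field
      d u v a′ b′ : Poly
      bézout : u * a + v * b ≋ d
      a≋ : a ≋ d * a′
      b≋ : b ≋ d * b′

  gcd : ∀ n a b → Bound n b → GCD a b
  gcd n a b bb with top? b
  ... | inj₁ b≋0 = record
    { d = a ; u = const F.1# ; v = [] ; a′ = const F.1# ; b′ = []
    ; bézout = ≋-trans (+-identityʳ′ _) (*-identityˡ′ a)
    ; a≋ = ≋-sym (P.*-identityʳ a) ; b≋ = ≋-trans b≋0 (≋-sym (*-zeroʳ′ a)) }
  ... | inj₂ (β , t) with n | top-bound {b} t bb
  ...   | suc n | s≤s β≤n with divide b t a
  ...     | e , r , a≋be+r , br = record
    { d = d ; u = v ; v = u + neg (v * e) ; a′ = a′ * e + b′ ; b′ = a′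
    ; bézout = begin
        v * a + (u + neg (v * e)) * b                   ≈⟨ +-cong′ (*-congˡ′ v a≋be+r) ≋-refl ⟩
        v * (b * e + r) + (u + neg (v * e)) * b         ≈⟨ S.solve 6 (λ v b e r u n → v S.:* (b S.:* e S.:+ r) S.:+ (u S.:+ n) S.:* b
                                                              S.:= (u S.:* b S.:+ v S.:* r) S.:+ (v S.:* e S.:+ n) S.:* b) P.refl v b e r u (neg (v * e)) ⟩
        u * b + v * r + (v * e + neg (v * e)) * b       ≈⟨ +-cong′ bézout (≋-trans (*-cong′ (P.-‿inverseʳ (v * e)) (≋-refl {b})) (≋-refl {[]})) ⟩
        d + []                                          ≈⟨ +-identityʳ′ d ⟩
        d                                               ∎
    ; a≋ = begin
        a                            ≈⟨ a≋be+r ⟩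
        b * e + r                    ≈⟨ +-cong′ (*-cong′ a≋ (≋-refl {e})) b≋ ⟩
        d * a′ * e + d * b′          ≈⟨ S.solve 4 (λ d a e b → (d S.:* a) S.:* e S.:+ d S.:* b S.:= d S.:* (a S.:* e S.:+ b)) P.refl d a′ e b′ ⟩
        d * (a′ * e + b′)            ∎
    ; b≋ = a≋ }
    where open GCD (gcd n b r (bound-mono {f = r} β≤n br))

-- The ring R as a filtered module

module RationalFunctions {c ℓ₁ ℓ₂} (F : HeytingField c ℓ₁ ℓ₂) {q} (pr : Prime (suc q)) (ι : ℤ.ℤ → HeytingField.Carrier F)
  (ext : IsExtension F (suc q) ι) (alg : IsAlgebraic F (suc q) ι) (S : List (𝔽[z].Poly (suc q)))
  (irreducible : All (λ s → F[z].Irreducible F (extend F (suc q) ι s)) S) where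

  open F[z] F hiding (_≈_; Irreducible; rawSemiring; eval)
  open PolynomialRing F
  open AlgebraicField F pr ι ext alg using (unit≉0)
  open FrobeniusPolynomials F pr ι ext alg
  module Q = F⟨z⟩ F
  open Q using (Frac; frac; num; den; den≉0)
  private
    module F = CommutativeRing (fieldRing F)
    module P = CommutativeRing polyRing
    module Solver = SemiringSolver P.commutativeSemiring
    p = suc q
  open Solver using (solve; _:*_; _:+_; _:=_; con)

  ≋-stable : ∀ {g h} → ¬ ¬ g ≋ h → g ≋ h
  ≋-stable ¬¬e = coeffs λ n → AlgebraicField.≈ᶠ-stable′ F pr ι ext alg λ k → ¬¬e λ e → k (at e n)

  open RawMagmaDefs (RawSemiring.*-rawMagma (F[z].rawSemiring F)) using () renaming (_∣ʳ_ to _∣′_; module _∣ʳ_ to _∣′_)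

  product : List (𝔽[z].Poly p) → Poly
  product []      = const F.1#
  product (s ∷ T) = extend F p ι s * product T

  f : Poly
  f = product S

  -- If s were zero it would be the product of two zeros, so zero, and with it s, would divide 1.
  irreducible-top : ∀ s → F[z].Irreducible F (extend F p ι s) → ∃ (Top (extend F p ι s))
  irreducible-top s irr with top? (extend F p ι s)
  ... | inj₂ t = t
  ... | inj₁ e = contradiction ([ divides-one , divides-one ] (split-∣1 (at (≋-trans e (≋-refl {[]}))))) p∤1
    where
    open RawSemiringDefs.Irreducible irr
    divides-one : [] ∣′ const F.1# → extend F p ι s ∣′ const F.1#
    divides-one d = record { quotient = _∣′_.quotient d ; equality = λ n → F.trans (at (*-congˡ′ (_∣′_.quotient d) e) n) (_∣′_.equality d n) }

  product-top : ∀ {T} → All (λ s → F[z].Irreducible F (extend F p ι s)) T → ∃ (Top (product T))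
  product-top []                     = 0 , top-1
  product-top {s ∷ T} (irr ∷ irrs) = top-* (extend F p ι s) (product T) (proj₂ (irreducible-top s irr)) (proj₂ (product-top irrs))

  f-top : ∃ (Top f)
  f-top = product-top irreducible

  f^-top : ∀ K → ∃ (Top (f ^ K))
  f^-top = top-^ f (proj₂ f-top)

  top≉0 : ∀ {g} → ∃ (Top g) → ¬ F[z]._≈_ F g []
  top≉0 (α , u , _) e = unit≉0 u (e α)

  ≉0-top : ∀ {g} → ¬ F[z]._≈_ F g [] → ∃ (Top g)
  ≉0-top {g} g≉0 with top? g
  ... | inj₂ t = t
  ... | inj₁ e = contradiction (at e) g≉0

  den-top : ∀ x → ∃ (Top (den x))
  den-top x = ≉0-top {den x} (den≉0 x)

  -- x = h / f ^ K
  record Rep (x : Frac) (K : ℕ) (h : Poly) : Set ℓ₁ where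
    constructor rep
    field cross : num x * f ^ K ≋ h * den x
  open Rep

  rep-resp : ∀ {x K g h} → g ≋ h → Rep x K g → Rep x K h
  rep-resp {x} e (rep r) = rep (≋-trans r (*-cong′ e (≋-refl {den x})))

  rep-≈ : ∀ {x y K h} → Rep x K h → Rep y K h → x Q.≈ y
  rep-≈ {x} {y} {K} {h} (rep r) (rep s) = at (*-cancelˡ (f ^ K) (proj₂ (f^-top K)) (begin
    f ^ K * (num x * den y)      ≈⟨ solve 3 (λ a b c → a :* (b :* c) := (b :* a) :* c) P.refl (f ^ K) (num x) (den y) ⟩
    num x * f ^ K * den y        ≈⟨ *-cong′ r ≋-refl ⟩
    h * den x * den y            ≈⟨ solve 3 (λ a b c → (a :* b) :* c := (a :* c) :* b) P.refl h (den x) (den y) ⟩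
    h * den y * den x            ≈⟨ *-cong′ s ≋-refl ⟨
    num y * f ^ K * den x        ≈⟨ solve 3 (λ a b c → (b :* a) :* c := a :* (b :* c)) P.refl (f ^ K) (num y) (den x) ⟩
    f ^ K * (num y * den x)      ∎))
    where open SetoidReasoning P.setoid

  ≈-rep : ∀ {x y K h} → x Q.≈ y → Rep x K h → Rep y K h
  ≈-rep {x} {y} {K} {h} e (rep r) = rep (*-cancelˡ (den x) (proj₂ (den-top x)) (begin
    den x * (num y * f ^ K)      ≈⟨ solve 3 (λ a b c → a :* (b :* c) := (b :* a) :* c) P.refl (den x) (num y) (f ^ K) ⟩
    num y * den x * f ^ K        ≈⟨ *-cong′ {num x * den y} {num y * den x} (coeffs e) (≋-refl {f ^ K}) ⟨
    num x * den y * f ^ K        ≈⟨ solve 3 (λ a b c → (a :* b) :* c := (a :* c) :* b) P.refl (num x) (den y) (f ^ K) ⟩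
    num x * f ^ K * den y        ≈⟨ *-cong′ r ≋-refl ⟩
    h * den x * den y            ≈⟨ solve 3 (λ a b c → (a :* b) :* c := b :* (a :* c)) P.refl h (den x) (den y) ⟩
    den x * (h * den y)          ∎))
    where open SetoidReasoning P.setoid

  rep-unique : ∀ {x K K′ h h′} → Rep x K h → Rep x K′ h′ → f ^ K′ * h ≋ f ^ K * h′
  rep-unique {x} {K} {K′} {h} {h′} (rep r) (rep s) = *-cancelˡ (den x) (proj₂ (den-top x)) (begin
    den x * (f ^ K′ * h)        ≈⟨ solve 3 (λ a b c → a :* (b :* c) := (c :* a) :* b) P.refl (den x) (f ^ K′) h ⟩
    h * den x * f ^ K′          ≈⟨ *-cong′ r ≋-refl ⟨
    num x * f ^ K * f ^ K′      ≈⟨ solve 3 (λ a b c → (a :* b) :* c := (a :* c) :* b) P.refl (num x) (f ^ K) (f ^ K′) ⟩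
    num x * f ^ K′ * f ^ K      ≈⟨ *-cong′ s ≋-refl ⟩
    h′ * den x * f ^ K          ≈⟨ solve 3 (λ a b c → (c :* a) :* b := a :* (b :* c)) P.refl (den x) (f ^ K) h′ ⟩
    den x * (f ^ K * h′)        ∎)
    where open SetoidReasoning P.setoid

  rep-raise : ∀ {x K h} j → Rep x K h → Rep x (j ℕ.+ K) (f ^ j * h)
  rep-raise {x} {K} {h} j (rep r) = rep (begin
    num x * f ^ (j ℕ.+ K)       ≈⟨ *-congˡ′ (num x) (^-homo-* f j K) ⟩
    num x * (f ^ j * f ^ K)     ≈⟨ solve 3 (λ a b c → a :* (b :* c) := b :* (a :* c)) P.refl (num x) (f ^ j) (f ^ K) ⟩
    f ^ j * (num x * f ^ K)     ≈⟨ *-congˡ′ (f ^ j) r ⟩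
    f ^ j * (h * den x)         ≈⟨ P.*-assoc (f ^ j) h (den x) ⟨
    f ^ j * h * den x           ∎)
    where open SetoidReasoning P.setoid

  rep-lower : ∀ {x K h} j → Rep x (j ℕ.+ K) (f ^ j * h) → Rep x K h
  rep-lower {x} {K} {h} j (rep r) = rep (*-cancelˡ (f ^ j) (proj₂ (f^-top j)) (begin
    f ^ j * (num x * f ^ K)     ≈⟨ solve 3 (λ a b c → a :* (b :* c) := b :* (a :* c)) P.refl (f ^ j) (num x) (f ^ K) ⟩
    num x * (f ^ j * f ^ K)     ≈⟨ *-congˡ′ (num x) (^-homo-* f j K) ⟨
    num x * f ^ (j ℕ.+ K)       ≈⟨ r ⟩
    f ^ j * h * den x           ≈⟨ P.*-assoc (f ^ j) h (den x) ⟩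
    f ^ j * (h * den x)         ∎))
    where open SetoidReasoning P.setoid

  rep-+ : ∀ x y {K g h} → Rep x K g → Rep y K h → Rep (x Q.+ y) K (g + h)
  rep-+ x y {K} {g} {h} (rep r) (rep s) = rep (begin
    (num x * den y + num y * den x) * f ^ K
      ≈⟨ solve 5 (λ a b c d e → (a :* b :+ c :* d) :* e := (a :* e) :* b :+ (c :* e) :* d) P.refl (num x) (den y) (num y) (den x) (f ^ K) ⟩
    num x * f ^ K * den y + num y * f ^ K * den x
      ≈⟨ +-cong′ (*-cong′ r (≋-refl {den y})) (*-cong′ s ≋-refl) ⟩
    g * den x * den y + h * den y * den x
      ≈⟨ solve 4 (λ a b c d → (a :* c) :* d :+ (b :* d) :* c := (a :+ b) :* (c :* d)) P.refl g h (den x) (den y) ⟩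
    (g + h) * (den x * den y)  ∎)
    where open SetoidReasoning P.setoid

  rep-* : ∀ x y {K L g h} → Rep x K g → Rep y L h → Rep (x Q.* y) (K ℕ.+ L) (g * h)
  rep-* x y {K} {L} {g} {h} (rep r) (rep s) = rep (begin
    num x * num y * f ^ (K ℕ.+ L)            ≈⟨ *-congˡ′ (num x * num y) (^-homo-* f K L) ⟩
    num x * num y * (f ^ K * f ^ L)          ≈⟨ solve 4 (λ a b c d → (a :* b) :* (c :* d) := (a :* c) :* (b :* d)) P.refl (num x) (num y) (f ^ K) (f ^ L) ⟩
    (num x * f ^ K) * (num y * f ^ L)        ≈⟨ *-cong′ r s ⟩
    (g * den x) * (h * den y)                ≈⟨ solve 4 (λ a b c d → (a :* c) :* (b :* d) := (a :* b) :* (c :* d)) P.refl g h (den x) (den y) ⟩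
    g * h * (den x * den y)                  ∎)
    where open SetoidReasoning P.setoid

  rep-poly : ∀ g → Rep (Q.poly g) 0 g
  rep-poly g = rep ≋-refl

  rep-pow : ∀ x {K h} n → Rep x K h → Rep (x Q.^ n) (n ℕ.* K) (h ^ n)
  rep-pow x zero    r = rep-poly (const F.1#)
  rep-pow x (suc n) r = rep-* x (x Q.^ n) r (rep-pow x n r)

  inR : Frac → Set (c ⊔ ℓ₁)
  inR = _∈R F p ι S

  factor : ∀ {s T} → s ∈ T → Poly
  factor {T = s ∷ T} (here _)  = product T
  factor {T = t ∷ T} (there i) = extend F p ι t * factor i

  factor-* : ∀ {s T} (i : s ∈ T) → extend F p ι s * factor i ≋ product T
  factor-* (here ≡.refl) = ≋-refl
  factor-* {s} {t ∷ T} (there i) = ≋-trans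
    (solve 3 (λ a b c → a :* (b :* c) := b :* (a :* c)) P.refl (extend F p ι s) (extend F p ι t) (factor i))
    (*-congˡ′ (extend F p ι t) (factor-* i))

  represent : ∀ {x} → inR x → ∃[ K ] ∃[ h ] Rep x K h
  represent (const∈ a)     = 0 , const a , rep-poly (const a)
  represent z∈             = 0 , X , rep-poly X
  -- Here 1 / s is rewritten as (f / s) / f.
  represent (inv∈ {s} {x} i e) = 1 , factor i , rep (begin
    num x * (f * const F.1#)                             ≈⟨ *-congˡ′ (num x) (P.*-identityʳ f) ⟩
    num x * f                                            ≈⟨ *-congˡ′ (num x) (factor-* i) ⟨
    num x * (extend F p ι s * factor i)                  ≈⟨ solve 3 (λ a b c → a :* (b :* c) := c :* ((b :* a) :* con 1)) P.refl (num x) (extend F p ι s) (factor i) ⟩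
    factor i * (extend F p ι s * num x * const F.1#)     ≈⟨ *-congˡ′ (factor i) (coeffs e) ⟩
    factor i * (const F.1# * (const F.1# * den x))       ≈⟨ *-congˡ′ (factor i) (≋-trans (*-identityˡ′ _) (*-identityˡ′ _)) ⟩
    factor i * den x                                     ∎)
    where open SetoidReasoning P.setoid
  represent (+∈ {x} {y} x∈ y∈)   =
    let K , g , r = represent x∈ ; L , h , s = represent y∈
    in L ℕ.+ K , _ , rep-+ x y (rep-raise L r) (≡.subst (λ n → Rep y n (f ^ K * h)) (ℕ.+-comm K L) (rep-raise K s))
  represent (*∈ {x} {y} x∈ y∈)   = let K , g , r = represent x∈ ; L , h , s = represent y∈ in K ℕ.+ L , g * h , rep-* x y r s
  represent (resp∈ e x∈)   = let K , h , r = represent x∈ in K , h , ≈-rep e r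

  poly∈ : ∀ g → inR (Q.poly g)
  poly∈ []      = resp∈ (rep-≈ (rep-resp 0∷[] (rep-poly (const F.0#))) (rep-poly [])) (const∈ F.0#)
  poly∈ (a ∷ g) = resp∈ (rep-≈ (rep-resp (≋-sym (∷-split a g)) (rep-+ (Q.const a) (Q.z Q.* Q.poly g) (rep-poly (const a)) (rep-* Q.z (Q.poly g) (rep-poly X) (rep-poly g)))) (rep-poly (a ∷ g)))
    (+∈ (const∈ a) (*∈ z∈ (poly∈ g)))

  inverse : ∀ g → ∃ (Top g) → Frac
  inverse g t = frac (const F.1#) g (top≉0 {g} t)

  inverse∈ : ∀ {T} (irrs : All (λ s → F[z].Irreducible F (extend F p ι s)) T) → (∀ {s} → s ∈ T → s ∈ S) →
    inR (inverse (product T) (product-top irrs))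
  inverse∈ []                   sub = resp∈ (at (≋-refl {const F.1# * const F.1#})) (const∈ F.1#)
  inverse∈ {s ∷ T} (irr ∷ irrs) sub = resp∈
    (at (*-cong′ (*-identityˡ′ (const F.1#)) (≋-refl {product (s ∷ T)})))
    (*∈ (inv∈ {x = inverse (extend F p ι s) (irreducible-top s irr)} (sub (here ≡.refl))
           (at (solve 2 (λ a b → (a :* b) :* b := b :* (b :* a)) P.refl (extend F p ι s) (const F.1#))))
        (inverse∈ irrs (sub ∘ there)))

  mk : ℕ → Poly → Frac
  mk K h = frac h (f ^ K) (top≉0 {f ^ K} (f^-top K))

  rep-mk : ∀ K h → Rep (mk K h) K h
  rep-mk K h = rep ≋-refl

  mk∈ : ∀ K h → inR (mk K h)
  mk∈ zero    h = resp∈ (at (≋-refl {h * const F.1#})) (poly∈ h)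
  mk∈ (suc K) h = resp∈ (at (solve 3 (λ a c d → (a :* con 1) :* (c :* d) := a :* (d :* c)) P.refl h f (f ^ K)))
    (*∈ (mk∈ K h) (inverse∈ irreducible λ i → i))

  Elt : Set (c ⊔ ℓ₁)
  Elt = Σ Frac inR

  _≈ᴿ_ : Elt → Elt → Set ℓ₁
  x ≈ᴿ y = proj₁ x Q.≈ proj₁ y

  Rᴱ : Elt → ℕ → Poly → Set ℓ₁
  Rᴱ x = Rep (proj₁ x)

  raise : ∀ {x K h} L → K ≤ L → Rep x K h → ∃[ h′ ] Rep x L h′
  raise {x} {K} {h} L K≤L r = f ^ (L ℕ.∸ K) * h , ≡.subst (λ n → Rep x n (f ^ (L ℕ.∸ K) * h)) (ℕ.m∸n+n≡m K≤L) (rep-raise (L ℕ.∸ K) r)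

  rep₂ : ∀ (x y : Elt) → ∃[ K ] (∃[ g ] Rᴱ x K g) × (∃[ h ] Rᴱ y K h)
  rep₂ (x , x∈) (y , y∈) =
    let K , g , r = represent x∈ ; L , h , s = represent y∈
    in K ℕ.+ L , raise _ (ℕ.m≤m+n K L) r , raise _ (ℕ.m≤n+m L K) s

  rep₃ : ∀ (x y w : Elt) → ∃[ K ] (∃[ g ] Rᴱ x K g) × (∃[ h ] Rᴱ y K h) × (∃[ k ] Rᴱ w K k)
  rep₃ x y w@(_ , w∈) =
    let K , (g , r) , (h , s) = rep₂ x y ; L , k , t = represent w∈
    in K ℕ.+ L , raise _ (ℕ.m≤m+n K L) r , raise _ (ℕ.m≤m+n K L) s , raise _ (ℕ.m≤n+m L K) t

  infixl 6 _+ᴿ_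
  _+ᴿ_ : Elt → Elt → Elt
  (x , x∈) +ᴿ (y , y∈) = x Q.+ y , +∈ x∈ y∈

  0ᴿ : Elt
  0ᴿ = Q.const F.0# , const∈ F.0#

  minus : Poly
  minus = const (F.- F.1#)

  -- Negation is not among the generating operations of R, so it is multiplication by the constant
  -- -1.
  negᴿ : Elt → Elt
  negᴿ (x , x∈) = Q.const (F.- F.1#) Q.* x , *∈ (const∈ (F.- F.1#)) x∈

  rep-neg : ∀ x {K h} → Rᴱ x K h → Rᴱ (negᴿ x) K (minus * h)
  rep-neg x r = rep-* (Q.poly minus) (proj₁ x) (rep-poly minus) r

  rep-0 : ∀ K → Rᴱ 0ᴿ K []
  rep-0 K = rep (*-cong′ 0∷[] (≋-refl {f ^ K}))

  ≈ᴿ-refl : ∀ {x} → x ≈ᴿ x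
  ≈ᴿ-refl n = F.refl

  ≈ᴿ-sym : ∀ {x y} → x ≈ᴿ y → y ≈ᴿ x
  ≈ᴿ-sym e n = F.sym (e n)

  ≈ᴿ-trans : ∀ {x y w} → x ≈ᴿ y → y ≈ᴿ w → x ≈ᴿ w
  ≈ᴿ-trans {x} {y} {w} e e′ = let K , h , r = represent (proj₂ x) in rep-≈ r (≈-rep {proj₁ y} {proj₁ w} e′ (≈-rep {proj₁ x} {proj₁ y} e r))

  minus-inverse : ∀ h → minus * h + h ≋ []
  minus-inverse h = ≋-trans (+-cong′ (const-* (F.- F.1#) h) (≋-refl {h})) (coeffs λ n →
    F.trans (coeff-+ F (scale (F.- F.1#) h) h n) (F.trans (F.+-congʳ (F.trans (coeff-scale F (F.- F.1#) h n)
      (F.trans (F.sym (RingProperties.-‿distribˡ-* F.ring F.1# _)) (F.-‿cong (F.*-identityˡ _))))) (F.-‿inverseˡ _)))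

  rep-+ᴿ : ∀ (x y : Elt) {K g h} → Rᴱ x K g → Rᴱ y K h → Rᴱ (x +ᴿ y) K (g + h)
  rep-+ᴿ (x , _) (y , _) = rep-+ x y

  group : AbelianGroup (c ⊔ ℓ₁) ℓ₁
  group = record
    { Carrier = Elt ; _≈_ = _≈ᴿ_ ; _∙_ = _+ᴿ_ ; ε = 0ᴿ ; _⁻¹ = negᴿ
    ; isAbelianGroup = record
      { isGroup = record
        { isMonoid = record
          { isSemigroup = record
            { isMagma = record
              { isEquivalence = record { refl = λ {x} → ≈ᴿ-refl {x} ; sym = λ {x} {y} → ≈ᴿ-sym {x} {y} ; trans = λ {x} {y} {w} → ≈ᴿ-trans {x} {y} {w} }
              ; ∙-cong = λ {x} {y} {u} {v} e e′ → let K , (g , r) , (h , s) = rep₂ x u in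
                  rep-≈ (rep-+ (proj₁ x) (proj₁ u) r s) (rep-+ (proj₁ y) (proj₁ v) (≈-rep {proj₁ x} {proj₁ y} e r) (≈-rep {proj₁ u} {proj₁ v} e′ s)) }
            ; assoc = λ x y w → let K , (g , r) , (h , s) , (k , t) = rep₃ x y w in
                rep-≈ (rep-resp (P.+-assoc g h k) (rep-+ᴿ (x +ᴿ y) w (rep-+ᴿ x y r s) t)) (rep-+ᴿ x (y +ᴿ w) r (rep-+ᴿ y w s t)) }
          ; identity = (λ x → let K , h , r = represent (proj₂ x) in rep-≈ (rep-+ᴿ 0ᴿ x (rep-0 K) r) r)
                     , (λ x → let K , h , r = represent (proj₂ x) in rep-≈ (rep-resp (+-identityʳ′ h) (rep-+ᴿ x 0ᴿ r (rep-0 K))) r) }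
        ; inverse = (λ x → let K , h , r = represent (proj₂ x) in rep-≈ (rep-resp (minus-inverse h) (rep-+ᴿ (negᴿ x) x (rep-neg x r) r)) (rep-0 K))
                  , (λ x → let K , h , r = represent (proj₂ x) in rep-≈ (rep-resp (≋-trans (P.+-comm h (minus * h)) (minus-inverse h)) (rep-+ᴿ x (negᴿ x) r (rep-neg x r))) (rep-0 K))
        ; ⁻¹-cong = λ {x} {y} e → let K , h , r = represent (proj₂ x) in rep-≈ (rep-neg x r) (rep-neg y (≈-rep {proj₁ x} {proj₁ y} e r)) }
      ; comm = λ x y → let K , (g , r) , (h , s) = rep₂ x y in rep-≈ (rep-resp (P.+-comm g h) (rep-+ᴿ x y r s)) (rep-+ᴿ y x s r) } }

module RationalModule {c ℓ₁ ℓ₂} (F : HeytingField c ℓ₁ ℓ₂) {q} (pr : Prime (suc q)) (ι : ℤ.ℤ → HeytingField.Carrier F)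
  (ext : IsExtension F (suc q) ι) (alg : IsAlgebraic F (suc q) ι) (S : List (𝔽[z].Poly (suc q)))
  (irreducible : All (λ s → F[z].Irreducible F (extend F (suc q) ι s)) S) where

  open F[z] F hiding (_≈_; Irreducible; rawSemiring; eval)
  open PolynomialRing F
  open AlgebraicField F pr ι ext alg using (Unit; unit≉0; unit-cong; φ⁻¹; φ-φ⁻¹; φ-1; φ-injective)
  open FrobeniusPolynomials F pr ι ext alg
  open RationalFunctions F pr ι ext alg S irreducible
  open Operators group
  private
    module F = CommutativeRing (fieldRing F)
    module P = CommutativeRing polyRing
    module Solver = SemiringSolver P.commutativeSemiring
    p = suc q
  open Solver using (solve; _:*_; _:=_)
  open SetoidReasoning P.setoid

  zᴿ τᴿ : Elt → Elt
  zᴿ (x , x∈) = Q.z Q.* x , *∈ z∈ x∈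
  τᴿ (x , x∈) = x Q.^ p , ^∈ F p ι S p x∈

  θᴿ : Fin (suc q) → Elt → Elt
  -- The denominator must be a p-th power before `θ` can be applied: h / f^K = f^(qK) h / (f^K)^p.
  θᴿ i (x , x∈) = let K , h , r = represent x∈ in mk K (θ i (f ^ (q ℕ.* K) * h)) , mk∈ K _

  rep-z : ∀ x {K h} → Rᴱ x K h → Rᴱ (zᴿ x) K (X * h)
  rep-z (x , _) r = rep-* Q.z x (rep-poly X) r

  rep-τ : ∀ x {K h} → Rᴱ x K h → Rᴱ (τᴿ x) (p ℕ.* K) (h ^ p)
  rep-τ (x , _) r = rep-pow x p r

  -- The operator was defined through one chosen representation; cross-multiplying with p-th powers
  -- and using `θ-pow` shows that any other with a suitable exponent gives the same element.
  rep-θ : ∀ i x {K h} → Rᴱ x (p ℕ.* K) h → Rᴱ (θᴿ i x) K (θ i h)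
  rep-θ i (x , x∈) {K} {h} r with represent x∈
  ... | K₀ , h₀ , r₀ = rep (begin
    θ i (f ^ (q ℕ.* K₀) * h₀) * f ^ K                  ≈⟨ P.*-comm (θ i (f ^ (q ℕ.* K₀) * h₀)) (f ^ K) ⟩
    f ^ K * θ i (f ^ (q ℕ.* K₀) * h₀)                  ≈⟨ θ-pow i (f ^ K) (f ^ (q ℕ.* K₀) * h₀) ⟨
    θ i ((f ^ K) ^ p * (f ^ (q ℕ.* K₀) * h₀))          ≈⟨ θ-cong i (begin
      (f ^ K) ^ p * (f ^ (q ℕ.* K₀) * h₀)                ≈⟨ *-cong′ (p-th K) (≋-refl {f ^ (q ℕ.* K₀) * h₀}) ⟩
      f ^ (p ℕ.* K) * (f ^ (q ℕ.* K₀) * h₀)              ≈⟨ solve 3 (λ a b c → a :* (b :* c) := b :* (a :* c)) P.refl (f ^ (p ℕ.* K)) (f ^ (q ℕ.* K₀)) h₀ ⟩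
      f ^ (q ℕ.* K₀) * (f ^ (p ℕ.* K) * h₀)              ≈⟨ *-congˡ′ (f ^ (q ℕ.* K₀)) (rep-unique r₀ r) ⟩
      f ^ (q ℕ.* K₀) * (f ^ K₀ * h)                      ≈⟨ solve 3 (λ a b c → a :* (b :* c) := (b :* a) :* c) P.refl (f ^ (q ℕ.* K₀)) (f ^ K₀) h ⟩
      f ^ K₀ * f ^ (q ℕ.* K₀) * h                        ≈⟨ *-cong′ (≋-trans (≋-sym (^-homo-* f K₀ (q ℕ.* K₀))) (≋-sym (p-th K₀))) (≋-refl {h}) ⟩
      (f ^ K₀) ^ p * h                                   ∎) ⟩
    θ i ((f ^ K₀) ^ p * h)                             ≈⟨ θ-pow i (f ^ K₀) h ⟩
    f ^ K₀ * θ i h                                     ≈⟨ P.*-comm (f ^ K₀) (θ i h) ⟩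
    θ i h * f ^ K₀                                     ∎)
    where
    p-th : ∀ K → (f ^ K) ^ p ≋ f ^ (p ℕ.* K)
    p-th K = ≋-trans (^-assocʳ f K p) (P.reflexive (≡.cong (f ^_) (ℕ.*-comm K p)))

  K≤pK : ∀ K → K ≤ p ℕ.* K
  K≤pK K = ℕ.m≤m+n K (q ℕ.* K)

  -- The functions `k` and `l` give the exponent of f before and after `g`: it is kept by z,
  -- multiplied by p by `τᴿ` and divided by p by `θᴿ`. Since representations can be raised to
  -- exponent `k K`, congruence and additivity are inherited from the numerators.
  module _ (g : Elt → Elt) (g′ : Poly → Poly) (k l : ℕ → ℕ) (inflates : ∀ K → K ≤ k K)
           (rep-g : ∀ x {K h} → Rᴱ x (k K) h → Rᴱ (g x) (l K) (g′ h)) (homo : ∀ a b → g′ (a + b) ≋ g′ a + g′ b) where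
    represented-cong : ∀ {x y} → x ≈ᴿ y → g x ≈ᴿ g y
    represented-cong {x} {y} e =
      let K , _ , r = represent (proj₂ x) ; h , s = raise (k K) (inflates K) r
      in rep-≈ (rep-g x s) (rep-g y (≈-rep {proj₁ x} {proj₁ y} e s))

    represented-homo : ∀ x y → g (x +ᴿ y) ≈ᴿ (g x +ᴿ g y)
    represented-homo x y =
      let K , (_ , r) , (_ , s) = rep₂ x y
          a , r′ = raise (k K) (inflates K) r
          b , s′ = raise (k K) (inflates K) s
      in rep-≈ (rep-resp (homo a b) (rep-g (x +ᴿ y) (rep-+ᴿ x y r′ s′))) (rep-+ᴿ (g x) (g y) (rep-g x r′) (rep-g y s′))

    represented-additive : Additive g
    represented-additive = record { cong = λ {x} {y} → represented-cong {x} {y} ; homo = represented-homo }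

  zᴿ-additive : Additive zᴿ
  zᴿ-additive = represented-additive zᴿ (X *_) (λ K → K) (λ K → K) (λ K → ℕ.≤-refl) rep-z (*-distribˡ′ X)

  τᴿ-additive : Additive τᴿ
  τᴿ-additive = represented-additive τᴿ (_^ p) (λ K → K) (p ℕ.*_) (λ K → ℕ.≤-refl) rep-τ pow-+

  θᴿ-additive : ∀ i → Additive (θᴿ i)
  θᴿ-additive i = represented-additive (θᴿ i) (θ i) (p ℕ.*_) (λ K → K) K≤pK (rep-θ i) (θ-+ i)

  rep-p : ∀ x → ∃[ K ] ∃[ h ] Rᴱ x (p ℕ.* K) h
  rep-p x = let K , _ , r = represent (proj₂ x) in K , raise (p ℕ.* K) (K≤pK K) r

  θᴿ-z-zero : ∀ x → θᴿ zero (zᴿ x) ≈ᴿ zᴿ (θᴿ (fromℕ q) x)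
  θᴿ-z-zero x = let K , h , r = rep-p x in
    rep-≈ (rep-resp (θ-X-zero h) (rep-θ zero (zᴿ x) (rep-z x r))) (rep-z (θᴿ (fromℕ q) x) (rep-θ (fromℕ q) x r))

  θᴿ-z-suc : ∀ i x → θᴿ (suc i) (zᴿ x) ≈ᴿ θᴿ (inject₁ i) x
  θᴿ-z-suc i x = let K , h , r = rep-p x in
    rep-≈ (rep-resp (θ-X-suc i h) (rep-θ (suc i) (zᴿ x) (rep-z x r))) (rep-θ (inject₁ i) x r)

  rep-assemble : ∀ {n} (y : Fin n → Elt) K {h : Fin n → Poly} → (∀ i → Rᴱ (y i) K (h i)) → Rᴱ (assembleBy zᴿ τᴿ y) (p ℕ.* K) (asm h)
  rep-assemble {zero}  y K r = rep-0 (p ℕ.* K)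
  rep-assemble {suc n} y K {h} r = rep-+ᴿ (τᴿ (y zero)) (zᴿ (assembleBy zᴿ τᴿ (y ∘ suc))) (rep-τ (y zero) (r zero))
    (rep-z (assembleBy zᴿ τᴿ (y ∘ suc)) (rep-assemble (y ∘ suc) K {h ∘ suc} (r ∘ suc)))

  rep-family : ∀ {n} (y : Fin n → Elt) → ∃[ K ] Σ (Fin n → Poly) λ h → ∀ i → Rᴱ (y i) K (h i)
  rep-family {zero}  y = 0 , (λ ()) , λ ()
  rep-family {suc n} y =
    let K , g , r = represent (proj₂ (y zero)) ; L , h , s = rep-family (y ∘ suc)
        g′ , r′ = raise (K ℕ.+ L) (ℕ.m≤m+n K L) r
        hs = λ i → raise (K ℕ.+ L) (ℕ.m≤n+m L K) (s i)
    in K ℕ.+ L , (λ { zero → g′ ; (suc i) → proj₁ (hs i) }) , λ { zero → r′ ; (suc i) → proj₂ (hs i) }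

  assembleᴿ-θ : ∀ x → assembleBy zᴿ τᴿ (λ i → θᴿ i x) ≈ᴿ x
  assembleᴿ-θ x = let K , h , r = rep-p x in
    rep-≈ (rep-resp (asm-θ h) (rep-assemble (λ i → θᴿ i x) K {λ i → θ i h} λ i → rep-θ i x r)) r

  pad : ∀ {n} → (Fin n → Poly) → ℕ → Poly
  pad {zero}  y j       = []
  pad {suc n} y zero    = y zero
  pad {suc n} y (suc j) = pad (y ∘ suc) j

  pad-high : ∀ {n} (y : Fin n → Poly) {j} → n ≤ j → pad y j ≡ []
  pad-high {zero}  y _         = ≡.refl
  pad-high {suc n} y (s≤s n≤j) = pad-high (y ∘ suc) n≤j

  pad-toℕ : ∀ {n} (y : Fin n → Poly) i → pad y (toℕ i) ≡ y i
  pad-toℕ y zero    = ≡.refl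
  pad-toℕ y (suc i) = pad-toℕ (y ∘ suc) i

  θ-p-th : ∀ i g → θ i (g ^ p) ≋ g * θ i (const F.1#)
  θ-p-th i g = ≋-trans (θ-cong i (≋-sym (P.*-identityʳ (g ^ p)))) (θ-pow i g (const F.1#))

  φ⁻¹-1 : φ⁻¹ F.1# F.≈ F.1#
  φ⁻¹-1 = φ-injective (F.trans (φ-φ⁻¹ F.1#) (F.sym φ-1))

  -- The induction peels off summands, so fewer than p of them are allowed and absent ones count as
  -- zero. When θ at 0 wraps around to θ at q on a tail of at most q summands, it meets an absent
  -- one.
  θ-asm : ∀ {n} (y : Fin n → Poly) → n ≤ p → ∀ i → θ i (asm y) ≋ pad y (toℕ i)
  θ-asm {zero}  y _         i    = ≋-refl
  θ-asm {suc n} y (s≤s n≤q) zero = begin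
    θ zero (y zero ^ p + X * asm (y ∘ suc))                ≈⟨ θ-+ zero (y zero ^ p) (X * asm (y ∘ suc)) ⟩
    θ zero (y zero ^ p) + θ zero (X * asm (y ∘ suc))       ≈⟨ +-cong′ (θ-p-th zero (y zero)) (θ-X-zero (asm (y ∘ suc))) ⟩
    y zero * const (φ⁻¹ F.1#) + X * θ (fromℕ q) (asm (y ∘ suc))
      ≈⟨ +-cong′ (*-congˡ′ (y zero) (const-cong φ⁻¹-1)) (*-congˡ′ X (≋-trans (θ-asm (y ∘ suc) (ℕ.m≤n⇒m≤1+n n≤q) (fromℕ q))
           (P.reflexive (pad-high (y ∘ suc) (≡.subst (n ≤_) (≡.sym (Fin.toℕ-fromℕ q)) n≤q))))) ⟩
    y zero * const F.1# + X * []                           ≈⟨ +-cong′ (P.*-identityʳ (y zero)) (*-zeroʳ′ X) ⟩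
    y zero + []                                            ≈⟨ +-identityʳ′ (y zero) ⟩
    y zero                                                 ∎
  θ-asm {suc n} y (s≤s n≤q) (suc i) = begin
    θ (suc i) (y zero ^ p + X * asm (y ∘ suc))             ≈⟨ θ-+ (suc i) (y zero ^ p) (X * asm (y ∘ suc)) ⟩
    θ (suc i) (y zero ^ p) + θ (suc i) (X * asm (y ∘ suc)) ≈⟨ +-cong′ (≋-trans (θ-p-th (suc i) (y zero)) (*-zeroʳ′ (y zero))) (θ-X-suc i (asm (y ∘ suc))) ⟩
    θ (inject₁ i) (asm (y ∘ suc))                          ≈⟨ θ-asm (y ∘ suc) (ℕ.m≤n⇒m≤1+n n≤q) (inject₁ i) ⟩
    pad (y ∘ suc) (toℕ (inject₁ i))                        ≡⟨ ≡.cong (pad (y ∘ suc)) (Fin.toℕ-inject₁ i) ⟩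
    pad (y ∘ suc) (toℕ i)                                  ∎

  θᴿ-assemble : ∀ (y : Fin (suc q) → Elt) i → θᴿ i (assembleBy zᴿ τᴿ y) ≈ᴿ y i
  θᴿ-assemble y i = let K , h , r = rep-family y in
    rep-≈ (rep-resp (≋-trans (θ-asm h ℕ.≤-refl i) (P.reflexive (pad-toℕ h i))) (rep-θ i (assembleBy zᴿ τᴿ y) (rep-assemble y K {h} r))) (r i)

  -- C exceeds deg f, so that V (1 + N) has room for z times f h / f ^ (1 + N)
  -- whenever V N contains h / f ^ N.
  C : ℕ
  C = suc (List.length f)

  V : ℕ → Elt → Set (c ⊔ ℓ₁)
  V N x = ∃[ h ] Rᴱ x N h × Bound (C ℕ.* N) h

  bound-f^ : ∀ {n} e h → Bound n h → Bound (List.length f ℕ.* e ℕ.+ n) (f ^ e * h)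
  bound-f^ {n} zero    h b = bound-resp (≋-sym (*-identityˡ′ h)) (≡.subst (λ m → Bound (m ℕ.+ n) h) (≡.sym (ℕ.*-zeroʳ (List.length f))) b)
  bound-f^ {n} (suc e) h b = bound-resp (≋-sym (P.*-assoc f (f ^ e) h))
    (≡.subst (λ m → Bound m (f * (f ^ e * h))) (rearrange (List.length f) e n) (bound-* f (f ^ e * h) (bound-f^ e h b)))
    where
    rearrange : ∀ l e n → l ℕ.+ (l ℕ.* e ℕ.+ n) ≡ l ℕ.* suc e ℕ.+ n
    rearrange = solve-∀

  V-bound : ∀ x {K h} e → Rᴱ x K h → Bound (C ℕ.* K ℕ.+ e) h → V (e ℕ.+ K) x
  V-bound x {K} {h} e r b = f ^ e * h , rep-raise e r ,
    ≡.subst (λ m → Bound m (f ^ e * h)) (rearrange (List.length f) K e) (bound-f^ e h b)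
    where
    rearrange : ∀ l K e → l ℕ.* e ℕ.+ (suc l ℕ.* K ℕ.+ e) ≡ suc l ℕ.* (e ℕ.+ K)
    rearrange = solve-∀

  V-resp : ∀ {N x y} → x ≈ᴿ y → V N x → V N y
  V-resp {x = x} {y} e (h , r , b) = h , ≈-rep {proj₁ x} {proj₁ y} e r , b

  V-mono : ∀ {N N′ x} → N ≤ N′ → V N x → V N′ x
  V-mono {N} {N′} {x} N≤N′ (h , r , b) = ≡.subst (λ m → V m x) (ℕ.m∸n+n≡m N≤N′)
    (V-bound x (N′ ℕ.∸ N) r (bound-mono {f = h} (ℕ.m≤m+n _ _) b))

  V-all : ∀ x → ∃[ N ] V N x
  V-all x = let K , h , r = represent (proj₂ x) in
    List.length h ℕ.+ K , V-bound x (List.length h) r (bound-mono {f = h} (ℕ.m≤n+m _ (C ℕ.* K)) (bound-length h))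

  V-0 : ∀ {N} → V N 0ᴿ
  V-0 {N} = [] , rep-0 N , λ _ _ → F.refl

  V-+ : ∀ {N x y} → V N x → V N y → V N (x +ᴿ y)
  V-+ {x = x} {y} (g , r , b) (h , s , b′) = g + h , rep-+ᴿ x y r s , bound-+ g h b b′

  V-neg : ∀ {N x} → V N x → V N (negᴿ x)
  V-neg {x = x} (h , r , b) = minus * h , rep-neg x r , bound-resp (≋-sym (const-* (F.- F.1#) h)) (bound-scale (F.- F.1#) h b)

  V-z : ∀ {N x} → V N x → V (suc N) (zᴿ x)
  V-z {N} {x} (h , r , b) = V-bound (zᴿ x) 1 (rep-z x r)
    (≡.subst (λ m → Bound m (X * h)) (ℕ.+-comm 1 (C ℕ.* N)) (bound-resp (≋-sym (X-* h)) (bound-∷ h b)))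

  CpN : ∀ N → p ℕ.* (C ℕ.* N) ≡ C ℕ.* (p ℕ.* N)
  CpN N = rearrange p C N
    where
    rearrange : ∀ a b c → a ℕ.* (b ℕ.* c) ≡ b ℕ.* (a ℕ.* c)
    rearrange = solve-∀

  V-τ : ∀ {N x} → V N x → V (p ℕ.* N) (τᴿ x)
  V-τ {N} {x} (h , r , b) = h ^ p , rep-τ x r , ≡.subst (λ m → Bound m (h ^ p)) (CpN N) (bound-pow (C ℕ.* N) h b)

  2≤p : 2 ≤ p
  2≤p = ℕ.nonTrivial⇒n>1 p {{prime⇒nonTrivial pr}}

  V-θ′ : ∀ {N x} i → V (p ℕ.* N) x → V N (θᴿ i x)
  V-θ′ {N} {x} i (h , r , b) = θ i h , rep-θ i x r , bound-θ (C ℕ.* N) i h (≡.subst (λ m → Bound m h) (≡.sym (CpN N)) b)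

  2N≤pN : ∀ N → N ℕ.+ N ≤ p ℕ.* N
  2N≤pN N = ≡.subst (_≤ p ℕ.* N) (≡.cong (N ℕ.+_) (ℕ.+-identityʳ N)) (ℕ.*-monoˡ-≤ N 2≤p)

  -- Orders are even divided by p, and p ≥ 2; halving is what the contraction argument asks for.
  V-θ : ∀ {N x} i → V (N ℕ.+ N) x → V N (θᴿ i x)
  V-θ {N} {x} i v = V-θ′ {N} {x} i (V-mono {N ℕ.+ N} {p ℕ.* N} {x} (2N≤pN N) v)

  unit-X^ : ∀ n → Unit (coeff (X ^ n) n)
  unit-X^ n = unit-cong (F.trans (F.sym (coeff-X^ n (const F.1#) 0))
    (F.trans (F.reflexive (≡.cong (coeff (X ^ n * const F.1#)) (ℕ.+-identityʳ n))) (at (P.*-identityʳ (X ^ n)) n))) (proj₁ top-1)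

  ¬bound-X^ : ∀ N n → ¬ (Bound n (f ^ N * X ^ n))
  ¬bound-X^ N n b = unit≉0 (unit-X^ n) (bound-cancel (f ^ N) (X ^ n) (proj₂ (f^-top N)) b n ℕ.≤-refl)

  V-large : ∀ N → ∃[ x ] ¬ V N x
  -- Written over f^N, the element z^(C N) has a numerator of degree at least C N, which V N
  -- excludes.
  V-large N = (Q.poly (X ^ (C ℕ.* N)) , poly∈ (X ^ (C ℕ.* N))) , λ (h , r , b) →
    ¬bound-X^ N (C ℕ.* N) (bound-resp (≋-sym (≋-trans (rep-unique (rep-poly (X ^ (C ℕ.* N))) r) (*-identityˡ′ h))) b)

-- Division by polynomials up to bounded errors

module Division {c ℓ₁ ℓ₂} (F : HeytingField c ℓ₁ ℓ₂) {q} (pr : Prime (suc q)) (ι : ℤ.ℤ → HeytingField.Carrier F)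
  (ext : IsExtension F (suc q) ι) (alg : IsAlgebraic F (suc q) ι) (S : List (𝔽[z].Poly (suc q)))
  (irreducible : All (λ s → F[z].Irreducible F (extend F (suc q) ι s)) S) where

  open F[z] F hiding (_≈_; Irreducible; rawSemiring; eval)
  open PolynomialRing F
  open AlgebraicField F pr ι ext alg using (unit≉0)
  open FrobeniusPolynomials F pr ι ext alg
  open RationalFunctions F pr ι ext alg S irreducible
  open RationalModule F pr ι ext alg S irreducible
  open Operators group
  private
    module F = CommutativeRing (fieldRing F)
    module P = CommutativeRing polyRing
    module Solver = SemiringSolver P.commutativeSemiring
    p = suc q
  open Solver using (solve; _:*_; _:+_; _:=_)
  open SetoidReasoning P.setoid

  times : Poly → Elt → Elt
  times a (x , x∈) = Q.poly a Q.* x , *∈ (poly∈ a) x∈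

  rep-times : ∀ a x {K h} → Rᴱ x K h → Rᴱ (times a x) K (a * h)
  rep-times a (x , _) r = rep-* (Q.poly a) x (rep-poly a) r

  V-times : ∀ {N} a x → V N x → V (List.length a ℕ.+ N) (times a x)
  V-times {N} a x (h , r , b) = V-bound (times a x) (List.length a) (rep-times a x r)
    (≡.subst (λ m → Bound m (a * h)) (ℕ.+-comm (List.length a) (C ℕ.* N)) (bound-* a h b))

  infixl 6 _-ᴿ_
  _-ᴿ_ : Elt → Elt → Elt
  x -ᴿ y = x +ᴿ negᴿ y

  rep-- : ∀ x y {K g h} → Rᴱ x K g → Rᴱ y K h → Rᴱ (x -ᴿ y) K (g + minus * h)
  rep-- x y r s = rep-+ᴿ x (negᴿ y) r (rep-neg y s)

  record Divides (a : Poly) : Set (c ⊔ ℓ₁) where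
    field
      excess    : ℕ
      reflects  : ∀ {N} x → V N (times a x) → V (N ℕ.+ excess) x
      quotient  : Elt → Elt
      remainder : ∀ x → V excess (x -ᴿ times a (quotient x))
  open Divides

  divides-resp : ∀ {a b} → a ≋ b → Divides a → Divides b
  divides-resp {a} {b} e D = record
    { excess    = excess D
    ; reflects  = λ {N} x v → reflects D x (V-resp {N} {times b x} {times a x} (≈ᴿ-sym {times a x} {times b x} (same x)) v)
    ; quotient  = quotient D
    ; remainder = λ x → V-resp {excess D} {x -ᴿ times a (quotient D x)} {x -ᴿ times b (quotient D x)}
        (Gr.∙-cong {x} {x} {negᴿ (times a (quotient D x))} {negᴿ (times b (quotient D x))} (≈ᴿ-refl {x})
          (Gr.⁻¹-cong {times a (quotient D x)} {times b (quotient D x)} (same (quotient D x)))) (remainder D x) }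
    where
    module Gr = AbelianGroup group
    same : ∀ x → times a x ≈ᴿ times b x
    same x = let K , h , r = represent (proj₂ x) in rep-≈ (rep-resp (*-cong′ e (≋-refl {h})) (rep-times a x r)) (rep-times b x r)

  divides-* : ∀ {a b} → Divides a → Divides b → Divides (a * b)
  divides-* {a} {b} D E = record
    { excess    = n
    ; reflects  = λ {N} x v → V-mono {x = x} (bound₁ N) (reflects E x (reflects D (times b x)
        (V-resp {N} {times (a * b) x} {times a (times b x)} (split x) v)))
    ; quotient  = λ x → quotient E (quotient D x)
    ; remainder = λ x → V-resp {n} {(x -ᴿ times a (quotient D x)) +ᴿ times a (quotient D x -ᴿ times b (quotient E (quotient D x)))}
        {x -ᴿ times (a * b) (quotient E (quotient D x))} (combine x (quotient D x) (quotient E (quotient D x)))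
        (V-+ {n} {x -ᴿ times a (quotient D x)} {times a (quotient D x -ᴿ times b (quotient E (quotient D x)))}
          (V-mono {x = x -ᴿ times a (quotient D x)} bound₂ (remainder D x))
          (V-mono {x = times a (quotient D x -ᴿ times b (quotient E (quotient D x)))} bound₃
            (V-times a (quotient D x -ᴿ times b (quotient E (quotient D x))) (remainder E (quotient D x))))) }
    where
    -- Since x - a b w = (x - a y) + a (y - b w), the remainder of the division by b is multiplied
    -- by a, which costs at most the length of a.
    n = List.length a ℕ.+ (excess D ℕ.+ excess E)
    bound₁ : ∀ N → (N ℕ.+ excess D) ℕ.+ excess E ≤ N ℕ.+ n
    bound₁ N = ≡.subst (_≤ N ℕ.+ n) (≡.sym (ℕ.+-assoc N (excess D) (excess E))) (ℕ.+-monoʳ-≤ N (ℕ.m≤n+m _ (List.length a)))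
    bound₂ : excess D ≤ n
    bound₂ = ℕ.≤-trans (ℕ.m≤m+n _ (excess E)) (ℕ.m≤n+m _ (List.length a))
    bound₃ : List.length a ℕ.+ excess E ≤ n
    bound₃ = ℕ.+-monoʳ-≤ (List.length a) (ℕ.m≤n+m _ (excess D))
    split : ∀ x → times (a * b) x ≈ᴿ times a (times b x)
    split x = let K , h , r = represent (proj₂ x) in
      rep-≈ (rep-resp (P.*-assoc a b h) (rep-times (a * b) x r)) (rep-times a (times b x) (rep-times b x r))
    combine : ∀ x y w → ((x -ᴿ times a y) +ᴿ times a (y -ᴿ times b w)) ≈ᴿ (x -ᴿ times (a * b) w)
    combine x y w = let K , (g , r) , (h , s) , (k , t) = rep₃ x y w in
      rep-≈ (rep-resp (collect g h k)
          (rep-+ᴿ (x -ᴿ times a y) (times a (y -ᴿ times b w)) (rep-- x (times a y) r (rep-times a y s))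
            (rep-times a (y -ᴿ times b w) (rep-- y (times b w) s (rep-times b w t)))))
        (rep-- x (times (a * b) w) r (rep-times (a * b) w t))
      where
      collect : ∀ g h k → (g + minus * (a * h)) + a * (h + minus * (b * k)) ≋ g + minus * (a * b * k)
      collect g h k = begin
        (g + minus * (a * h)) + a * (h + minus * (b * k))
          ≈⟨ solve 6 (λ g m a h b k → (g :+ m :* (a :* h)) :+ a :* (h :+ m :* (b :* k)) := (m :* (a :* h) :+ a :* h) :+ (g :+ m :* ((a :* b) :* k))) P.refl g minus a h b k ⟩
        (minus * (a * h) + a * h) + (g + minus * (a * b * k))   ≈⟨ +-cong′ (minus-inverse (a * h)) (≋-refl {g + minus * (a * b * k)}) ⟩
        g + minus * (a * b * k)                                 ∎

  -- A divisor d of f is invertible in R with inverse f′ / f, so the division is exact. The excess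
  -- pays for one more factor f in the denominator and for the degree of f′.
  divides-denominator : ∀ {d f′} → f ≋ d * f′ → Divides d
  divides-denominator {d} {f′} f≋ = record
    { excess    = suc (List.length f′)
    ; reflects  = λ {N} x (h , r , b) → ≡.subst (λ m → V m x) (rearrange (List.length f′) N)
        (V-bound x (List.length f′) (reflect x r) (≡.subst (λ m → Bound m (f′ * h)) (ℕ.+-comm (List.length f′) (C ℕ.* suc N))
          (bound-mono {f = f′ * h} (ℕ.+-monoʳ-≤ (List.length f′) (ℕ.*-monoʳ-≤ C (ℕ.n≤1+n N))) (bound-* f′ h b))))
    ; quotient  = times-f′/f
    ; remainder = λ x → V-resp {suc (List.length f′)} {0ᴿ} {x -ᴿ times d (times-f′/f x)} (≈ᴿ-sym {x -ᴿ times d (times-f′/f x)} {0ᴿ} (exact x)) V-0 }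
    where
    rearrange : ∀ l N → l ℕ.+ suc N ≡ N ℕ.+ suc l
    rearrange = solve-∀
    times-f′/f : Elt → Elt
    times-f′/f (x , x∈) = mk 1 f′ Q.* x , *∈ (mk∈ 1 f′) x∈
    rep-f′/f : ∀ x {K h} → Rᴱ x K h → Rᴱ (times-f′/f x) (suc K) (f′ * h)
    rep-f′/f (x , _) r = rep-* (mk 1 f′) x (rep-mk 1 f′) r
    absorb : ∀ h → d * (f′ * h) ≋ f ^ 1 * h
    absorb h = ≋-trans (≋-sym (P.*-assoc d f′ h)) (*-cong′ (≋-trans (≋-sym f≋) (≋-sym (P.*-identityʳ f))) (≋-refl {h}))
    reflect : ∀ x {N h} → Rᴱ (times d x) N h → Rᴱ x (suc N) (f′ * h)
    reflect x {N} {h} r = let K , g , s = represent (proj₂ x) in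
      ≈-rep {proj₁ (times-f′/f (times d x))} {proj₁ x}
        (rep-≈ (rep-resp (≋-trans (solve 3 (λ a b c → a :* (b :* c) := b :* (a :* c)) P.refl f′ d g) (absorb g))
          (rep-f′/f (times d x) (rep-times d x s))) (rep-raise 1 s)) (rep-f′/f (times d x) r)
    exact : ∀ x → (x -ᴿ times d (times-f′/f x)) ≈ᴿ 0ᴿ
    exact x = let K , g , s = represent (proj₂ x) in
      rep-≈ (rep-resp (≋-trans (+-cong′ (≋-refl {f ^ 1 * g}) (*-congˡ′ minus (absorb g))) (≋-trans (P.+-comm (f ^ 1 * g) (minus * (f ^ 1 * g))) (minus-inverse (f ^ 1 * g))))
        (rep-- x (times d (times-f′/f x)) (rep-raise 1 s) (rep-times d (times-f′/f x) (rep-f′/f x s)))) (rep-0 (suc K))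

  -- As f is invertible modulo a, every h is a g + f^K r with r of degree below α. Dividing by f^K
  -- leaves the polynomial r as remainder, which lies in V α. Conversely a cannot cancel against the
  -- denominator, so orders are reflected.
  divides-coprime : ∀ {α} a → Top a α → ∀ u v → u * a + v * f ≋ const F.1# → Divides a
  divides-coprime {α} a t u v bézout = record
    { excess    = α
    ; reflects  = λ {N} x (g , s , b) → reflect {N} x g s b (represent (proj₂ x))
    ; quotient  = λ x → let K , h , _ = represent (proj₂ x) in mk K (proj₁ (modulo K h)) , mk∈ K _
    ; remainder = λ x → remains x (represent (proj₂ x)) }
    where
    modulo : ∀ K h → ∃[ g ] ∃[ r ] h ≋ a * g + f ^ K * r × Bound α r
    modulo zero    h = let g , r , e , b = divide a t h in g , r , ≋-trans e (+-cong′ (≋-refl {a * g}) (≋-sym (*-identityˡ′ r))) , b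
    modulo (suc K) h = let g , r , e , b = modulo K (v * h) in u * h + f * g , r , (begin
      h                                            ≈⟨ *-identityˡ′ h ⟨
      const F.1# * h                               ≈⟨ *-cong′ bézout (≋-refl {h}) ⟨
      (u * a + v * f) * h                          ≈⟨ solve 5 (λ u a v f h → (u :* a :+ v :* f) :* h := u :* a :* h :+ f :* (v :* h)) P.refl u a v f h ⟩
      u * a * h + f * (v * h)                      ≈⟨ +-cong′ (≋-refl {u * a * h}) (*-congˡ′ f e) ⟩
      u * a * h + f * (a * g + f ^ K * r)          ≈⟨ solve 7 (λ u a h f g k r → u :* a :* h :+ f :* (a :* g :+ k :* r) := a :* (u :* h :+ f :* g) :+ f :* k :* r) P.refl u a h f g (f ^ K) r ⟩
      a * (u * h + f * g) + f * f ^ K * r          ∎) , b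
    remains : ∀ x (X : ∃[ K ] ∃[ h ] Rᴱ x K h) → V α (x -ᴿ times a (mk (proj₁ X) (proj₁ (modulo (proj₁ X) (proj₁ (proj₂ X)))) , mk∈ (proj₁ X) _))
    remains x (K , h , s) = remains′ (modulo K h)
      where
      remains′ : (Y : ∃[ g ] ∃[ r ] h ≋ a * g + f ^ K * r × Bound α r) → V α (x -ᴿ times a (mk K (proj₁ Y) , mk∈ K _))
      remains′ (g , r , e , b) = ≡.subst (λ m → V m (x -ᴿ times a y)) (ℕ.+-identityʳ α)
        (V-bound (x -ᴿ times a y) α (rep-lower K (≡.subst (λ m → Rᴱ (x -ᴿ times a y) m (f ^ K * r)) (≡.sym (ℕ.+-identityʳ K))
          (rep-resp cancel (rep-- x (times a y) s (rep-times a y (rep-mk K g))))))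
          (bound-mono {f = r} (ℕ.m≤n+m α (C ℕ.* 0)) b))
        where
        y : Elt
        y = mk K g , mk∈ K g
        cancel : h + minus * (a * g) ≋ f ^ K * r
        cancel = begin
          h + minus * (a * g)                       ≈⟨ +-cong′ e (≋-refl {minus * (a * g)}) ⟩
          a * g + f ^ K * r + minus * (a * g)       ≈⟨ solve 3 (λ x y z → (x :+ y) :+ z := (z :+ x) :+ y) P.refl (a * g) (f ^ K * r) (minus * (a * g)) ⟩
          minus * (a * g) + a * g + f ^ K * r       ≈⟨ +-cong′ (minus-inverse (a * g)) (≋-refl {f ^ K * r}) ⟩
          f ^ K * r                                 ∎
    -- Bézout's identity removes one factor f at a time.
    gauss : ∀ K g m → f ^ K * g ≋ a * m → ∃[ k ] g ≋ a * k
    gauss zero    g m e = m , ≋-trans (≋-sym (*-identityˡ′ g)) e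
    gauss (suc K) g m e = gauss K g (u * (f ^ K * g) + v * m) (begin
      f ^ K * g                                          ≈⟨ *-identityˡ′ (f ^ K * g) ⟨
      const F.1# * (f ^ K * g)                           ≈⟨ *-cong′ bézout (≋-refl {f ^ K * g}) ⟨
      (u * a + v * f) * (f ^ K * g)                      ≈⟨ solve 6 (λ u a v f k g → (u :* a :+ v :* f) :* (k :* g) := a :* (u :* (k :* g)) :+ v :* (f :* k :* g)) P.refl u a v f (f ^ K) g ⟩
      a * (u * (f ^ K * g)) + v * (f * f ^ K * g)        ≈⟨ +-cong′ (≋-refl {a * (u * (f ^ K * g))}) (*-congˡ′ v e) ⟩
      a * (u * (f ^ K * g)) + v * (a * m)                ≈⟨ solve 4 (λ a x v m → a :* x :+ v :* (a :* m) := a :* (x :+ v :* m)) P.refl a (u * (f ^ K * g)) v m ⟩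
      a * (u * (f ^ K * g) + v * m)                      ∎)
    reflect : ∀ {N} x g → Rᴱ (times a x) N g → Bound (C ℕ.* N) g → ∃[ K ] ∃[ h ] Rᴱ x K h → V (N ℕ.+ α) x
    reflect {N} x g s b (K , h , r) = found (gauss K g (f ^ N * h) (≋-trans (rep-unique s (rep-times a x r))
        (solve 3 (λ x y z → x :* (y :* z) := y :* (x :* z)) P.refl (f ^ N) a h)))
      where
      found : ∃[ k ] g ≋ a * k → V (N ℕ.+ α) x
      found (k , e) = V-mono {x = x} (ℕ.m≤m+n N α) (k , rep-lower K (≡.subst (λ m → Rᴱ x m (f ^ K * k)) (ℕ.+-comm N K)
          (rep-resp (*-cancelˡ a t (begin
            a * (f ^ N * h)        ≈⟨ solve 3 (λ x y z → x :* (y :* z) := y :* (x :* z)) P.refl a (f ^ N) h ⟩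
            f ^ N * (a * h)        ≈⟨ rep-unique s (rep-times a x r) ⟨
            f ^ K * g              ≈⟨ *-congˡ′ (f ^ K) e ⟩
            f ^ K * (a * k)        ≈⟨ solve 3 (λ x y z → x :* (y :* z) := y :* (x :* z)) P.refl (f ^ K) a k ⟩
            a * (f ^ K * k)        ∎)) (rep-raise N r)))
        , bound-cancel a k t (bound-resp e b))

  bound-quotient : ∀ {δ n} a b → Top a (suc δ) → Bound (suc n) (a * b) → Bound n b
  bound-quotient {δ} {n} a b (u , ba) bab with top? b
  ... | inj₁ b≋0          = λ m _ → at b≋0 m
  ... | inj₂ (β , v , bb) = bound-mono {f = b} β<n bb
    where
    β<n : β < n
    β<n with ℕ.<-≤-connex (suc δ ℕ.+ β) (suc n)
    ... | inj₁ (s≤s h) = ℕ.≤-<-trans (ℕ.m≤n+m β δ) h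
    ... | inj₂ h       = contradiction (F.trans (F.sym (coeff-* a b ba bb)) (bab _ h)) (unit≉0 (unit-* u v))

  -- A common divisor of a and f of positive degree is split off as an invertible factor, which
  -- lowers the degree of a; when only constants are left in common, a is coprime to f.
  divides-nonzero : ∀ n {α} a → Top a α → Bound n a → Divides a
  divides-nonzero zero    a t b = contradiction (b _ z≤n) (unit≉0 (proj₁ t))
  divides-nonzero (suc n) {α} a t b with gcd (List.length f) a f (bound-length f)
  ... | record { d = d ; u = u ; v = v ; a′ = a′ ; b′ = f′ ; bézout = bézout ; a≋ = a≋ ; b≋ = f≋ } = by-degree (proj₁ tops)
    where
    tops : ∃ (Top d) × ∃ (Top a′)
    tops = top-factor d a′ (top-resp {a} {d * a′} a≋ t)
    by-degree : ∃ (Top d) → Divides a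
    by-degree (suc δ , td) = divides-resp (≋-sym a≋) (divides-* {d} {a′} (divides-denominator f≋)
      (divides-nonzero n a′ (proj₂ (proj₂ tops)) (bound-quotient d a′ td (bound-resp a≋ b))))
    -- The greatest common divisor d is a nonzero constant here, and its inverse w normalises
    -- Bézout's identity.
    by-degree (zero , (w , wd≈1) , bd) = divides-coprime a t (const w * u) (const w * v) (begin
      const w * u * a + const w * v * f       ≈⟨ solve 5 (λ w u a v f → w :* u :* a :+ w :* v :* f := w :* (u :* a :+ v :* f)) P.refl (const w) u a v f ⟩
      const w * (u * a + v * f)               ≈⟨ *-congˡ′ (const w) bézout ⟩
      const w * d                             ≈⟨ const-* w d ⟩
      scale w d                               ≈⟨ coeffs (λ n → F.trans (coeff-scale F w d n) (constant n)) ⟩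
      const F.1#                              ∎)
      where
      constant : ∀ n → w F.* coeff d n F.≈ coeff (const F.1#) n
      constant zero    = wd≈1
      constant (suc n) = F.trans (F.*-congˡ (bd (suc n) (s≤s z≤n))) (F.zeroʳ w)

  scalarPoly : Scalar → Poly
  scalarPoly 𝟘       = []
  scalarPoly 𝟙       = const F.1#
  scalarPoly 𝕫       = X
  scalarPoly (s ⊞ t) = scalarPoly s + scalarPoly t
  scalarPoly (s ⊡ t) = scalarPoly s * scalarPoly t
  scalarPoly (⊟ s)   = minus * scalarPoly s

  rep-act : ∀ s x {K h} → Rᴱ x K h → Rᴱ (actBy zᴿ s x) K (scalarPoly s * h)
  rep-act 𝟘       x {K} r = rep-0 K
  rep-act 𝟙       x {h = h} r = rep-resp (≋-sym (*-identityˡ′ h)) r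
  rep-act 𝕫       x r = rep-z x r
  rep-act (s ⊞ t) x {h = h} r = rep-resp (≋-sym (*-distribʳ′ h (scalarPoly s) (scalarPoly t)))
    (rep-+ᴿ (actBy zᴿ s x) (actBy zᴿ t x) (rep-act s x r) (rep-act t x r))
  rep-act (s ⊡ t) x {h = h} r = rep-resp (≋-sym (P.*-assoc (scalarPoly s) (scalarPoly t) h)) (rep-act s (actBy zᴿ t x) (rep-act t x r))
  rep-act (⊟ s)   x {h = h} r = rep-resp (≋-sym (P.*-assoc minus (scalarPoly s) h)) (rep-neg (actBy zᴿ s x) (rep-act s x r))

  act-times : ∀ s x → actBy zᴿ s x ≈ᴿ times (scalarPoly s) x
  act-times s x = let K , h , r = represent (proj₂ x) in rep-≈ (rep-act s x r) (rep-times (scalarPoly s) x r)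

  divisorᴿ? : ∀ s → (∀ x → actBy zᴿ s x ≈ᴿ 0ᴿ) ⊎
    (∃[ D ] (∀ {N x} → V N (actBy zᴿ s x) → V (N ℕ.+ D) x) × (∀ x → ∃[ y ] V D (x +ᴿ negᴿ (actBy zᴿ s y))))
  divisorᴿ? s with top? (scalarPoly s)
  ... | inj₁ e = inj₁ λ x → let K , h , r = represent (proj₂ x) in rep-≈ (rep-resp (*-cong′ e (≋-refl {h})) (rep-act s x r)) (rep-0 K)
  ... | inj₂ (α , t) = inj₂ (excess D
      , (λ {N} {x} v → reflects D x (V-resp {N} {actBy zᴿ s x} {times (scalarPoly s) x} (act-times s x) v))
      , λ x → quotient D x , V-resp {excess D} {x -ᴿ times (scalarPoly s) (quotient D x)} {x +ᴿ negᴿ (actBy zᴿ s (quotient D x))} (same x) (remainder D x))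
    where
    D = divides-nonzero (List.length (scalarPoly s)) (scalarPoly s) t (bound-length (scalarPoly s))
    same : ∀ x → (x -ᴿ times (scalarPoly s) (quotient D x)) ≈ᴿ (x +ᴿ negᴿ (actBy zᴿ s (quotient D x)))
    same x = AbelianGroup.∙-cong group {x} {x} {negᴿ (times (scalarPoly s) (quotient D x))} {negᴿ (actBy zᴿ s (quotient D x))} (≈ᴿ-refl {x})
      (AbelianGroup.⁻¹-cong group {times (scalarPoly s) (quotient D x)} {actBy zᴿ s (quotient D x)}
        (≈ᴿ-sym {actBy zᴿ s (quotient D x)} {times (scalarPoly s) (quotient D x)} (act-times s (quotient D x))))

  filteredModule : FilteredModule q (c ⊔ ℓ₁) ℓ₁ (c ⊔ ℓ₁)
  filteredModule = record
    { group = group ; z = zᴿ ; τ = τᴿ ; θ = θᴿ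
    ; z-add = zᴿ-additive ; τ-add = τᴿ-additive ; θ-add = θᴿ-additive
    ; θ-assemble = θᴿ-assemble ; assemble-θ = assembleᴿ-θ
    ; θ-z-zero = θᴿ-z-zero ; θ-z-suc = θᴿ-z-suc
    ; V = V
    ; V-resp = λ {N} {x} {y} → V-resp {N} {x} {y} ; V-0 = V-0 ; V-+ = λ {N} {x} {y} → V-+ {N} {x} {y}
    ; V-neg = λ {N} {x} → V-neg {N} {x} ; V-mono = λ {N} {N′} {x} → V-mono {N} {N′} {x} ; V-all = V-all
    ; V-z = λ {N} {x} → V-z {N} {x} ; V-τ = λ {N} {x} → V-τ {N} {x} ; V-θ = λ {N} {x} → V-θ {N} {x}
    ; V-large = V-large ; divisor? = divisorᴿ? }

-- Coordinates over F and definability of linear equations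

module CoordinateSystem {c ℓ₁ ℓ₂} (F : HeytingField c ℓ₁ ℓ₂) {q} (pr : Prime (suc q)) (ι : ℤ.ℤ → HeytingField.Carrier F)
  (ext : IsExtension F (suc q) ι) (alg : IsAlgebraic F (suc q) ι) (S : List (𝔽[z].Poly (suc q)))
  (irreducible : All (λ s → F[z].Irreducible F (extend F (suc q) ι s)) S) where

  open F[z] F hiding (_≈_; Irreducible; rawSemiring; eval)
  open PolynomialRing F
  open AlgebraicField F pr ι ext alg using (ι-prime; φ; φ-0; φ-+; φ-cong; φ-injective; φ⁻¹; φ-φ⁻¹; conjugate)
  open FrobeniusPolynomials F pr ι ext alg
  open RationalFunctions F pr ι ext alg S irreducible
  open RationalModule F pr ι ext alg S irreducible
  open Division F pr ι ext alg S irreducible using (filteredModule)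
  open Forms filteredModule using (eval; eval-cong)
  open Horner filteredModule
  private
    module F = CommutativeRing (fieldRing F)
    module P = CommutativeRing polyRing
    p = suc q
    Fₚ = Fₚ-structure F p
  open Definability Fₚ using (Definable)

  bnd : ℕ → F.Carrier → Elt
  bnd N a = mk N (const a) , mk∈ N (const a)

  bnd-V : ∀ N a → V (suc N) (bnd N a)
  bnd-V N a = V-bound (bnd N a) 1 (rep-mk N (const a)) (bound-mono {f = const a} (ℕ.m≤n+m 1 (C ℕ.* N)) (bound-length (const a)))

  bnd-cong : ∀ N {a b} → a F.≈ b → bnd N a ≈ᴿ bnd N b
  bnd-cong N {a} {b} e = rep-≈ (rep-resp (const-cong e) (rep-mk N (const a))) (rep-mk N (const b))

  rep-vec : ∀ N {n} (x : Fin n → F.Carrier) → Rᴱ (horner (λ i → bnd N (x i))) N (List.tabulate x)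
  rep-vec N {zero}  x = rep-0 N
  rep-vec N {suc n} x = rep-resp (≋-sym (∷-split (x zero) (List.tabulate (x ∘ suc))))
    (rep-+ᴿ (bnd N (x zero)) (zᴿ (horner (λ i → bnd N (x (suc i))))) (rep-mk N (const (x zero)))
      (rep-z (horner (λ i → bnd N (x (suc i)))) (rep-vec N (x ∘ suc))))

  coeff-tabulate : ∀ n (g : ℕ → F.Carrier) → (∀ m → n ≤ m → g m F.≈ F.0#) → ∀ m → coeff (List.tabulate {n = n} (g ∘ toℕ)) m F.≈ g m
  coeff-tabulate zero    g e m       = F.sym (e m z≤n)
  coeff-tabulate (suc n) g e zero    = F.refl
  coeff-tabulate (suc n) g e (suc m) = coeff-tabulate n (g ∘ suc) (λ m n≤m → e (suc m) (s≤s n≤m)) m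

  vec-V : ∀ N (x : Fin (C ℕ.* N) → F.Carrier) → V N (horner (λ i → bnd N (x i)))
  vec-V N x = List.tabulate x , rep-vec N x ,
    ≡.subst (λ n → Bound n (List.tabulate x)) (List.length-tabulate x) (bound-length (List.tabulate x))

  V-coord : ∀ {N x} → V N x → Σ (Fin (C ℕ.* N) → F.Carrier) λ y → x ≈ᴿ horner (λ i → bnd N (y i))
  V-coord {N} {x} (h , r , b) = coeff h ∘ toℕ , rep-≈ r
    (rep-resp (coeffs (coeff-tabulate (C ℕ.* N) (coeff h) b)) (rep-vec N {C ℕ.* N} (coeff h ∘ toℕ)))

  conjugate-φ : ∀ n a → conjugate n (φ a) ≡ φ (conjugate n a)
  conjugate-φ zero    a = ≡.refl
  conjugate-φ (suc n) a = ≡.cong φ (conjugate-φ n a)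

  conjugate-cong : ∀ n {a b} → a F.≈ b → conjugate n a F.≈ conjugate n b
  conjugate-cong zero    e = e
  conjugate-cong (suc n) e = φ-cong (conjugate-cong n e)

  conjugate-homo : ∀ n a b → conjugate n (a F.+ b) F.≈ conjugate n a F.+ conjugate n b
  conjugate-homo zero    a b = F.refl
  conjugate-homo (suc n) a b = F.trans (φ-cong (conjugate-homo n a b)) (φ-+ _ _)

  conjugate-∘ : ∀ m n a → conjugate (m ℕ.+ n) a ≡ conjugate m (conjugate n a)
  conjugate-∘ zero    n a = ≡.refl
  conjugate-∘ (suc m) n a = ≡.cong φ (conjugate-∘ m n a)

  conjugate-0 : ∀ n → conjugate n F.0# F.≈ F.0#
  conjugate-0 zero    = F.refl
  conjugate-0 (suc n) = F.trans (φ-cong (conjugate-0 n)) φ-0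

  conjugate-injective : ∀ n {a b} → conjugate n a F.≈ conjugate n b → a F.≈ b
  conjugate-injective zero    e = e
  conjugate-injective (suc n) e = conjugate-injective n (φ-injective e)

  frobenius : ∀ {n} → ℕ → Term ℒₚ n → Term ℒₚ n
  frobenius zero    t = t
  frobenius (suc k) t = app frobₚ (frobenius k t ∷ [])

  eval-frobenius : ∀ {n} k (v : Vec F.Carrier n) t → evalTerm Fₚ v (frobenius k t) ≡ conjugate k (evalTerm Fₚ v t)
  eval-frobenius zero    v t = ≡.refl
  eval-frobenius (suc k) v t = ≡.cong φ (eval-frobenius k v t)

  -- The additive functions generated by the variables, φ and φ⁻¹; a power of φ
  -- clears the inverses, which the language lacks.
  record Functional (A : Set) : Set (c ⊔ ℓ₁) where
    field
      fun     : (A → F.Carrier) → F.Carrier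
      depth   : ℕ
      term    : ∀ {n} → (A → Fin n) → Term ℒₚ n
      correct : ∀ {n} (g : A → Fin n) v → conjugate depth (fun (Vec.lookup v ∘ g)) F.≈ evalTerm Fₚ v (term g)
  open Functional

  module _ {A : Set} where
    varᶠ : A → Functional A
    varᶠ a = record { fun = λ x → x a ; depth = 0 ; term = λ g → var (g a) ; correct = λ g v → F.refl }

    0ᶠ : Functional A
    0ᶠ = record { fun = λ x → F.0# ; depth = 0 ; term = λ g → app zeroₚ [] ; correct = λ g v → F.refl }

    infixl 6 _+ᶠ_
    _+ᶠ_ : Functional A → Functional A → Functional A
    g +ᶠ h = record
      { fun = λ x → fun g x F.+ fun h x
      ; depth = depth h ℕ.+ depth g
      ; term = λ i → app plusₚ (frobenius (depth h) (term g i) ∷ frobenius (depth g) (term h i) ∷ [])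
      ; correct = λ i v → F.trans (conjugate-homo (depth h ℕ.+ depth g) _ _) (F.+-cong
          (lifted (depth h) (depth g) (correct g i v))
          (F.trans (F.reflexive (≡.cong (λ n → conjugate n (fun h (Vec.lookup v ∘ i))) (ℕ.+-comm (depth h) (depth g))))
                   (lifted (depth g) (depth h) (correct h i v)))) }
      where
      lifted : ∀ m n {a k} {v : Vec F.Carrier k} {t} → conjugate n a F.≈ evalTerm Fₚ v t → conjugate (m ℕ.+ n) a F.≈ evalTerm Fₚ v (frobenius m t)
      lifted m n {a} {v = v} {t} e = F.trans (F.reflexive (conjugate-∘ m n a)) (F.trans (conjugate-cong m e) (F.reflexive (≡.sym (eval-frobenius m v t))))

    φᶠ φ⁻¹ᶠ : Functional A → Functional A
    φᶠ g = record
      { fun = λ x → φ (fun g x) ; depth = depth g ; term = λ i → app frobₚ (term g i ∷ [])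
      ; correct = λ i v → F.trans (F.reflexive (conjugate-φ (depth g) _)) (φ-cong (correct g i v)) }
    φ⁻¹ᶠ g = record
      { fun = λ x → φ⁻¹ (fun g x) ; depth = suc (depth g) ; term = term g
      ; correct = λ i v → F.trans (F.reflexive (≡.sym (conjugate-φ (depth g) _))) (F.trans (conjugate-cong (depth g) (φ-φ⁻¹ _)) (correct g i v)) }

    open Mult F.semiring using (×-assoc-*; ×-congʳ) renaming (_×_ to _·_)

    _·ᶠ_ : ℕ → Functional A → Functional A
    zero  ·ᶠ g = 0ᶠ
    suc n ·ᶠ g = g +ᶠ n ·ᶠ g

    fun-· : ∀ n g x → fun (n ·ᶠ g) x ≡ n · fun g x
    fun-· zero    g x = ≡.refl
    fun-· (suc n) g x = ≡.cong (fun g x F.+_) (fun-· n g x)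

    Generic : Set (c ⊔ ℓ₁)
    Generic = List (Functional A)

    value : (A → F.Carrier) → Generic → Poly
    value x = List.map λ g → fun g x

    infixl 6 _+ᴳ_
    _+ᴳ_ : Generic → Generic → Generic
    []      +ᴳ H       = H
    (g ∷ G) +ᴳ []      = g ∷ G
    (g ∷ G) +ᴳ (h ∷ H) = (g +ᶠ h) ∷ (G +ᴳ H)

    value-+ : ∀ x G H → value x (G +ᴳ H) ≡ value x G + value x H
    value-+ x []      H       = ≡.refl
    value-+ x (g ∷ G) []      = ≡.refl
    value-+ x (g ∷ G) (h ∷ H) = ≡.cong (_ ∷_) (value-+ x G H)

    -- Without multiplication in the language, scaling has to be iterated addition. This suffices
    -- for multiplying by f because the coefficients of the elements of S come from the prime field.
    scaleᴳ : ℤ.ℤ → Generic → Generic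
    scaleᴳ i = List.map (proj₁ (ι-prime i) ·ᶠ_)

    value-scale : ∀ x i G → value x (scaleᴳ i G) ≋ scale (ι i) (value x G)
    value-scale x i []      = ≋-refl
    value-scale x i (g ∷ G) = ∷-cong (begin
        fun (n ·ᶠ g) x          ≡⟨ fun-· n g x ⟩
        n · fun g x             ≈⟨ ×-congʳ n (F.*-identityˡ (fun g x)) ⟨
        n · (F.1# F.* fun g x)  ≈⟨ ×-assoc-* n F.1# (fun g x) ⟨
        (n · F.1#) F.* fun g x  ≈⟨ F.*-congʳ (proj₂ (ι-prime i)) ⟨
        ι i F.* fun g x         ∎) (value-scale x i G)
      where
      open SetoidReasoning F.setoid
      n = proj₁ (ι-prime i)

    multiplyᴳ : 𝔽[z].Poly p → Generic → Generic
    multiplyᴳ []      G = []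
    multiplyᴳ (i ∷ s) G = scaleᴳ i G +ᴳ (0ᶠ ∷ multiplyᴳ s G)

    value-multiply : ∀ x s G → value x (multiplyᴳ s G) ≋ extend F p ι s * value x G
    value-multiply x []      G = ≋-refl
    value-multiply x (i ∷ s) G = ≋-trans (P.reflexive (value-+ x (scaleᴳ i G) (0ᶠ ∷ multiplyᴳ s G)))
      (+-cong′ (value-scale x i G) (∷-cong F.refl (value-multiply x s G)))

    productᴳ : List (𝔽[z].Poly p) → Generic → Generic
    productᴳ []      G = G
    productᴳ (s ∷ T) G = multiplyᴳ s (productᴳ T G)

    value-product : ∀ x T G → value x (productᴳ T G) ≋ product T * value x G
    value-product x []      G = ≋-sym (*-identityˡ′ (value x G))
    value-product x (s ∷ T) G = ≋-trans (value-multiply x s (productᴳ T G)) (≋-trans (*-congˡ′ (extend F p ι s) (value-product x T G))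
      (≋-sym (P.*-assoc (extend F p ι s) (product T) (value x G))))

    raiseᴳ : ℕ → Generic → Generic
    raiseᴳ zero    G = G
    raiseᴳ (suc k) G = productᴳ S (raiseᴳ k G)

    value-raise : ∀ x k G → value x (raiseᴳ k G) ≋ f ^ k * value x G
    value-raise x zero    G = ≋-sym (*-identityˡ′ (value x G))
    value-raise x (suc k) G = ≋-trans (value-product x S (raiseᴳ k G)) (≋-trans (*-congˡ′ f (value-raise x k G)) (≋-sym (P.*-assoc f (f ^ k) (value x G))))

    negᴳ : Generic → Generic
    negᴳ = scaleᴳ (ℤ.- ℤ.1ℤ)

    value-neg : ∀ x G → value x (negᴳ G) ≋ minus * value x G
    value-neg x G = ≋-trans (value-scale x (ℤ.- ℤ.1ℤ) G) (≋-trans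
      (scale-cong {f = value x G} (F.trans (ι.-‿homo ℤ.1ℤ) (F.-‿cong ι.1#-homo)) ≋-refl) (≋-sym (const-* (F.- F.1#) (value x G))))
      where module ι = RingMorphisms.IsRingHomomorphism ext

    shiftᴳ : ℕ → Generic → Generic
    shiftᴳ zero    G = G
    shiftᴳ (suc k) G = 0ᶠ ∷ shiftᴳ k G

    value-shift : ∀ x k G → value x (shiftᴳ k G) ≋ X ^ k * value x G
    value-shift x zero    G = ≋-sym (*-identityˡ′ (value x G))
    value-shift x (suc k) G = ≋-trans (≋-sym (X-* (value x (shiftᴳ k G)))) (≋-trans (*-congˡ′ X (value-shift x k G)) (≋-sym (P.*-assoc X (X ^ k) (value x G))))

    powerᴳ : Generic → Generic
    powerᴳ []      = []
    powerᴳ (g ∷ G) = (φᶠ g ∷ []) +ᴳ shiftᴳ p (powerᴳ G)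

    value-power : ∀ x G → value x (powerᴳ G) ≋ value x G ^ p
    value-power x []      = ≋-refl
    value-power x (g ∷ G) = ≋-trans (P.reflexive (value-+ x (φᶠ g ∷ []) (shiftᴳ p (powerᴳ G))))
      (≋-trans (+-cong′ (≋-refl {const (φ (fun g x))}) (≋-trans (value-shift x p (powerᴳ G)) (*-congˡ′ (X ^ p) (value-power x G))))
        (≋-sym (∷-pow (fun g x) (value x G))))

    θᴳ : Fin (suc q) → Generic → Generic
    θᴳ i       []      = []
    θᴳ zero    (g ∷ G) = φ⁻¹ᶠ g ∷ θᴳ (fromℕ q) G
    θᴳ (suc i) (g ∷ G) = θᴳ (inject₁ i) G

    value-θ : ∀ x i G → value x (θᴳ i G) ≡ θ i (value x G)
    value-θ x i       []      = ≡.refl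
    value-θ x zero    (g ∷ G) = ≡.cong (φ⁻¹ (fun g x) ∷_) (value-θ x (fromℕ q) G)
    value-θ x (suc i) (g ∷ G) = value-θ x (inject₁ i) G

    module _ (e : A → ℕ) where
      at-bnd : (A → F.Carrier) → A → Elt
      at-bnd x a = bnd (e a) (x a)

      -- The exponent of the denominator and the functionals in the numerator depend on t but not on
      -- x, so the vanishing of t amounts to finitely many equations over F, uniformly in x.
      record Numerator (t : LinTerm q A) : Set (c ⊔ ℓ₁) where
        field
          level     : ℕ
          generic   : Generic
          represents : ∀ x → Rᴱ (eval (at-bnd x) t) level (value x generic)
      open Numerator

      raiseᴺ : ∀ {t} k → Numerator t → Numerator t
      raiseᴺ {t} k N = record
        { level = k ℕ.+ level N ; generic = raiseᴳ k (generic N)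
        ; represents = λ x → rep-resp (≋-sym (value-raise x k (generic N))) (rep-raise {proj₁ (eval (at-bnd x) t)} k (represents N x)) }

      relevel : ∀ {t} (N : Numerator t) {m} → level N ≡ m → ∀ x → Rᴱ (eval (at-bnd x) t) m (value x (generic N))
      relevel N ≡.refl = represents N

      numerator : ∀ t → Numerator t
      numerator (var a)  = record { level = e a ; generic = varᶠ a ∷ [] ; represents = λ x → rep-mk (e a) (const (x a)) }
      numerator 0ᴸ       = record { level = 0 ; generic = [] ; represents = λ x → rep-0 0 }
      numerator (t +ᴸ u) = record
        { level = level M′ ; generic = generic M′ +ᴳ generic N′
        ; represents = λ x → rep-resp (P.reflexive (≡.sym (value-+ x (generic M′) (generic N′))))
            (rep-+ᴿ (eval (at-bnd x) t) (eval (at-bnd x) u) (represents M′ x) (relevel N′ (ℕ.+-comm (level M) (level N)) x)) }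
        where
        M = numerator t
        N = numerator u
        M′ = raiseᴺ (level N) M
        N′ = raiseᴺ (level M) N
      numerator (-ᴸ t) = record
        { level = level N ; generic = negᴳ (generic N)
        ; represents = λ x → rep-resp (≋-sym (value-neg x (generic N))) (rep-neg (eval (at-bnd x) t) (represents N x)) }
        where N = numerator t
      numerator (zᴸ t) = record
        { level = level N ; generic = 0ᶠ ∷ generic N
        ; represents = λ x → rep-resp (X-* (value x (generic N))) (rep-z (eval (at-bnd x) t) (represents N x)) }
        where N = numerator t
      numerator (τᴸ t) = record
        { level = p ℕ.* level N ; generic = powerᴳ (generic N)
        ; represents = λ x → rep-resp (≋-sym (value-power x (generic N))) (rep-τ (eval (at-bnd x) t) (represents N x)) }
        where N = numerator t
      numerator (θᴸ i t) = record
        { level = level N ; generic = θᴳ i (generic N′)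
        ; represents = λ x → rep-resp (P.reflexive (≡.sym (value-θ x i (generic N′))))
            (rep-θ i (eval (at-bnd x) t) (relevel N′ (ℕ.+-comm (q ℕ.* level N) (level N)) x)) }
        where
        N = numerator t
        -- For `θ` the exponent must be a multiple of p; adding q times the level to the level gives
        -- p times the level.
        N′ = raiseᴺ (q ℕ.* level N) N

    zeros : ∀ {n} → (A → Fin n) → Generic → Formula ℒₚ n
    zeros i []      = bot ⇒ bot
    zeros i (g ∷ G) = (term g i ≐ app zeroₚ []) and zeros i G

    zeros⁻ : ∀ {n} (i : A → Fin n) v G → Satisfies Fₚ (zeros i G) v → value (Vec.lookup v ∘ i) G ≋ []
    zeros⁻ i v []      h = ≋-refl
    -- The abbreviation `and` hides its components under a double negation, which the stability of
    -- polynomial equality removes.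
    zeros⁻ i v (g ∷ G) h = ≋-stable λ k → lower (h λ e h′ → lift (k (coeffs λ
      { zero    → conjugate-injective (depth g) (F.trans (correct g i v) (F.trans (lower e) (F.sym (conjugate-0 (depth g)))))
      ; (suc n) → at (zeros⁻ i v G h′) n })))

    zeros⁺ : ∀ {n} (i : A → Fin n) v G → value (Vec.lookup v ∘ i) G ≋ [] → Satisfies Fₚ (zeros i G) v
    zeros⁺ i v []      e = λ x → x
    zeros⁺ i v (g ∷ G) e k = k
      (lift (F.trans (F.sym (correct g i v)) (F.trans (conjugate-cong (depth g) (at e 0)) (conjugate-0 (depth g)))))
      (zeros⁺ i v G (coeffs λ n → at e (suc n)))

    definable-zero : ∀ (e : A → ℕ) t → Definable (λ x → Level.Lift c (eval (at-bnd e x) t ≈ᴿ 0ᴿ))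
    definable-zero e t = record
      { form = λ i → zeros i (generic N)
      ; to   = λ i v h → lift (rep-≈ (rep-resp (zeros⁻ i v (generic N) h) (represents N (Vec.lookup v ∘ i))) (rep-0 (level N)))
      ; from = λ i v h → zeros⁺ i v (generic N)
          (vanishes {eval (at-bnd e (Vec.lookup v ∘ i)) t} (represents N (Vec.lookup v ∘ i)) (lower h))
      ; resp = λ {x} {y} x≡y h → lift (≈ᴿ-trans {eval (at-bnd e y) t} {eval (at-bnd e x) t} {0ᴿ}
          (eval-cong {ρ = at-bnd e y} {ρ′ = at-bnd e x} (λ a → bnd-cong (e a) (F.reflexive (≡.sym (x≡y a)))) t) (lower h)) }
      where
      open Numerator
      N = numerator e t
      vanishes : ∀ {y K h} → Rᴱ y K h → y ≈ᴿ 0ᴿ → h ≋ []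
      vanishes {y} {K} {h} r y≈0 = *-cancelˡ (f ^ K) (proj₂ (f^-top K))
        (rep-unique (≈-rep {proj₁ y} {proj₁ 0ᴿ} y≈0 r) (rep-0 K))

  coordinates : Coordinates F p filteredModule
  coordinates = record
    { bnd = bnd ; len = C ℕ.*_ ; bnd-V = bnd-V ; bnd-cong = bnd-cong
    ; vec-V = vec-V ; V-coord = λ {N} {x} → V-coord {N} {x} ; definable-zero = definable-zero }

-- The interpretation of the language in R

module Standard {c ℓ₁ ℓ₂} (F : HeytingField c ℓ₁ ℓ₂) {q} (pr : Prime (suc q)) (ι : ℤ.ℤ → HeytingField.Carrier F)
  (ext : IsExtension F (suc q) ι) (alg : IsAlgebraic F (suc q) ι) (S : List (𝔽[z].Poly (suc q)))
  (irreducible : All (λ s → F[z].Irreducible F (extend F (suc q) ι s)) S) where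

  open F[z] F using (coeff; const; _*_)
  open PolynomialRing F
  open AlgebraicField F pr ι ext alg using (≈ᶠ-stable′)
  open FrobeniusPolynomials F pr ι ext alg using (Top)
  open RationalFunctions F pr ι ext alg S irreducible
  open Division F pr ι ext alg S irreducible using (filteredModule)
  open CoordinateSystem F pr ι ext alg S irreducible using (bnd; coordinates)
  private
    module F = CommutativeRing (fieldRing F)
    module P = CommutativeRing polyRing
    module R = Structure (R-structure F (suc q) ι S)

  ≈ᴿ-stable : ∀ {x y : Elt} → ¬ ¬ x ≈ᴿ y → x ≈ᴿ y
  ≈ᴿ-stable {x , _} {y , _} h = at (≋-stable {Q.num x * Q.den y} {Q.num y * Q.den x} λ k → h λ e → k (coeffs e))

  -- The constant can be computed without knowing that it exists: it must be the coefficient of the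
  -- numerator in the degree of the denominator, divided by the leading coefficient of the
  -- denominator. Only the equality with x is then taken from the double negation.
  constant-stable : ∀ {x : Elt} → ¬ ¬ (∃[ a ] x ≈ᴿ bnd 0 a) → ∃[ a ] x ≈ᴿ bnd 0 a
  constant-stable {x} h = named (den-top (proj₁ x))
    where
    named : ∃ (Top (Q.den (proj₁ x))) → ∃[ a ] x ≈ᴿ bnd 0 a
    named (δ , (u , eq) , _) = coeff n δ F.* u , ≈ᴿ-stable {x} {bnd 0 (coeff n δ F.* u)} λ k → h λ (a , e) →
      k (≈ᴿ-trans {x} {bnd 0 a} {bnd 0 (coeff n δ F.* u)} e (at (*-cong′ (const-cong (F.sym (leading a e))) (≋-refl {const F.1#}))))
      where
      n = Q.num (proj₁ x)
      d = Q.den (proj₁ x)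
      leading : ∀ a → x ≈ᴿ bnd 0 a → coeff n δ F.* u F.≈ a
      leading a e = begin
        coeff n δ F.* u                    ≈⟨ F.*-congʳ (at (P.*-identityʳ n) δ) ⟨
        coeff (n * const F.1#) δ F.* u     ≈⟨ F.*-congʳ (e δ) ⟩
        coeff (const a * d) δ F.* u        ≈⟨ F.*-congʳ (F.trans (at (const-* a d) δ) (coeff-scale F a d δ)) ⟩
        a F.* coeff d δ F.* u              ≈⟨ F.*-assoc a _ u ⟩
        a F.* (coeff d δ F.* u)            ≈⟨ F.*-congˡ (F.trans (F.*-comm _ u) eq) ⟩
        a F.* F.1#                         ≈⟨ F.*-identityʳ a ⟩
        a                                  ∎
        where open SetoidReasoning F.setoid

  bnd-injective : ∀ {a b} → bnd 0 a ≈ᴿ bnd 0 b → a F.≈ b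
  bnd-injective {a} {b} e = F.trans (F.sym (at (P.*-identityʳ (const a)) 0)) (F.trans (e 0) (at (P.*-identityʳ (const b)) 0))

  interpretation : Interpretation F (suc q) filteredModule coordinates
  interpretation = record
    { fun = R.⟦_⟧ᶠ ; rel = R.⟦_⟧ᵖ
    ; fun-zero = ≈ᴿ-refl {0ᴿ} ; fun-one = ≈ᴿ-refl {bnd 0 F.1#}
    ; fun-plus = λ x y → ≈ᴿ-refl {x +ᴿ y}
    ; fun-frob = λ x _ → F.refl
    ; fun-z    = λ x _ → F.refl
    ; rel-inF⁺ = λ h → h ; rel-inF⁻ = λ {_} {a} e → a , e
    ; rel-P⁺   = λ h → h ; rel-P⁻ = λ {_} {_} {_} {as} e s → as , e , s
    ; ≈-stable = λ {x} {y} → ≈ᴿ-stable {x} {y} ; F-stable = λ {x} → constant-stable {x}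
    ; bnd-injective = bnd-injective ; ≈ᶠ-stable = ≈ᶠ-stable′ }

corollary1p2 :
  ∀ {c ℓ₁ ℓ₂ : Level}
  (p : ℕ) → Prime p →
  (F : HeytingField c ℓ₁ ℓ₂) (ι : ℤ → HeytingField.Carrier F) →
  IsExtension F p ι → IsAlgebraic F p ι →
  (S : List (𝔽[z].Poly p)) →
  All (𝔽[z].Irreducible p) S →
  All (λ s → F[z].Irreducible F (extend F p ι s)) S →
  DecidableTheory (Fₚ-structure F p) →
  DecidableTheory (R-structure F p ι S)
corollary1p2 zero    pr F ι ext alg S _ irr = contradiction pr ¬prime[0]
corollary1p2 (suc q) pr F ι ext alg S _ irr = Translation.decidable-theory F (suc q)
  (Division.filteredModule F pr ι ext alg S irr) (CoordinateSystem.coordinates F pr ι ext alg S irr)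
  (Standard.interpretation F pr ι ext alg S irr)
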